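{- Let $q\ge5$ be a prime power with $\operatorname{char}\mathbb F_q\notin\{2,3\}$, let $R\in\mathbb F_q^\times$, and let $(P_{\mathrm{tc}},\mathcal S_{\mathrm{tc}})$ be the system constructed in the context. Put $N=|P_{\mathrm{tc}}|$ and $\Sigma=\sigma(P_{\mathrm{tc}},\mathcal S_{\mathrm{tc}})$. Then: (1) Every sphere has the prescribed radius $R\ne0$, the lifted parameters $\Phi(S_t)$ are pairwise distinct, and no affine line contains three of them. Hence no coaxal pencil contains three members of $\mathcal S_{\mathrm{tc}}$. (2) One has $$N=\frac{(q-1)^2(q-2)}6,\qquad p_A\in S_t\iff t\in A.$$ Consequently every point has degree three and $$I(P_{\mathrm{tc}},\mathcal S_{\mathrm{tc}})=3N,\qquad\Sigma=2N,\qquad K_q=\frac{2\sqrt N}{q^{3/2}}\longrightarrow\sqrt{\frac23}\quad(q\to\infty),$$ where $K_q$ is defined by $\Sigma=K_qq\sqrt{|P_{\mathrm{tc}}||\mathcal S_{\mathrm{tc}}|}$. In particular, $K_q^2q^2|\mathcal S_{\mathrm{tc}}|=4|P_{\mathrm{tc}}|$. (3) For distinct $a,b\in\mathbb F_q$, $$q-3\le|P_{\mathrm{tc}}\cap S_a\cap S_b|\le q-2.$$ The system lies in the moderate window $\frac{4|P_{\mathrm{tc}}|}{K_q^2q^2}\le|\mathcal S_{\mathrm{tc}}|\le C_1K_qq$ with $C_1=2$, and its rich-pair graph is complete: every two distinct $S,S'\in\mathcal S_{\mathrm{tc}}$ satisfy $|P_{\mathrm{tc}}\cap S\cap S'|\ge\frac{K_qq}{4C_1}$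 with $C_1=2$. (4) Every $B\subseteq P_{\mathrm{tc}}$ satisfies $\sigma(B,\mathcal S_{\mathrm{tc}})=2|B|$, and every distinct sphere pair obeys $$\frac{\sigma(P_{\mathrm{tc}}\cap S_a\cap S_b,\mathcal S_{\mathrm{tc}})}\Sigma\le\frac6{(q-1)^2}.$$ (5) The incidence system is $\mathcal D_{3,0}$ (via $p_A\leftrightarrow A$, $S_t\leftrightarrow t$). Hence, for every $0<\tau\le1$, whenever $q\ge96/\tau$, it has no $(\tau,\varepsilon)$-centered block decomposition with $\varepsilon\le\tau^2/144$. Moreover, every nondegenerate ternary quadratic form over $\mathbb F_q$, in characteristic different from two and three, admits an incidence-isomorphic example whose spheres have one fixed nonzero radius.
   Context: For a nondegenerate quadratic form $Q$ on $\mathbb F_q^3$, $S_Q(c,r)=\{x:Q(x-c)=r\}$ and the lift is $\Phi(S_Q(c,r))=(2c,r-Q(c))\in\mathbb F_q^4$; a coaxal pencil is the family of $q$ spheres whose lifts form an affine line. $I(P,\mathcal S)=|\{(p,S)\in P\times\mathcal S:p\in S\}|$, $\sigma(P,\mathcal S)=I(P,\mathcal S)-|P||\mathcal S|/q$; degree of a point means the number of spheres of the family containing it. Construction. Let $Q_0(x,y,z)=xy+z^2$ on $\mathbb F_q^3$, $c_t=(0,t^3,t)$, $S_t=S_{Q_0}(c_t,R)$ for $t\in\mathbb F_q$, and $\mathcal S_{\mathrm{tc}}=\{S_t:t\in\mathbb F_q\}$. The map $$\Psi(x,y,z)(T)=T^3-\frac1xT^2+\frac{2z}xT-\frac{xy+z^2-R}x$$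 is a bijection from $\{(x,y,z)\in\mathbb F_q^3:x\ne0\}$ onto the monic cubics $T^3-s_1T^2+s_2T-s_3$ with $s_1\ne0$. Let $\mathfrak T=\{A\subseteq\mathbb F_q:|A|=3,\ \sum_{a\in A}a\ne0\}$; for $A\in\mathfrak T$ let $p_A$ be the point with $\Psi(p_A)=\prod_{a\in A}(T-a)$, and put $P_{\mathrm{tc}}=\{p_A:A\in\mathfrak T\}$. $\mathcal D_{3,0}$ is the bipartite incidence system with object set $\mathbb F_q$, point set $\{A\subseteq\mathbb F_q:|A|=3,\ -\sum_{a\in A}a\ne0\}$, and $A$ incident to $t$ iff $t\in A$. With $\Sigma=\sigma(P,\mathcal S)>0$, $0<\tau\le1$, $\varepsilon\ge0$, a $(\tau,\varepsilon)$-centered block decomposition of $(P,\mathcal S)$ consists of an integer $m\ge2$ and partitions $\mathcal S=\mathcal S_1\sqcup\cdots\sqcup\mathcal S_m$, $P=A_1\sqcup\cdots\sqcup A_m\sqcup R'$ such that $\sigma(A_i,\mathcal S_i)\ge\tau\Sigma$ for all $i$, $\sigma(R',\mathcal S)\le\varepsilon\Sigma$, and $\sum_{i\ne j}\max\{\sigma(A_i,\mathcal S_j),0\}\le\varepsilon\Sigma$. -}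

module Defs where

open import Algebra.Bundles.Raw using (RawMonoid)
open import Algebra.Core using (Op₁; Op₂)
import Algebra.Definitions.RawMonoid as RawMonoidDefinitions
open import Algebra.Structures using (IsCommutativeRing)
open import Data.Bool.Base using (Bool; T; not; _∧_)
open import Data.Bool.ListAction using (any)
open import Data.Fin.Base using (Fin)
import Data.Fin.Properties as Finₚ
import Data.Fin.Subset as Subset
open Subset using (Subset)
open import Data.Fin.Subset.Properties using (anySubset?)
open import Data.Integer.Base as ℤ using (ℤ; +_; +[1+_]; -[1+_])
import Data.Integer.Properties as ℤₚ
open import Data.List.Base as List using (List; []; _∷_)
import Data.List.Properties as Listₚ
open import Data.Nat.Base as ℕ using (ℕ; zero; suc)
import Data.Nat.Coprimality as Coprime
open import Data.Nat.Divisibility using (_∣_)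
import Data.Nat.Properties as ℕₚ
open import Data.Product using (∃-syntax; ∃!; _×_; _,_; proj₁; proj₂)
import Data.Product.Properties as Productₚ
import Data.Rational.Base as Q
open Q using (ℚ; 0ℚ; 1ℚ; ½; *≤*; *<*)
import Data.Rational.Properties as ℚₚ
open import Data.Rational.Solver using (module +-*-Solver)
open import Data.Refinement using (Refinement-syntax; value)
open import Data.Sum.Base using (inj₁; inj₂)
open import Data.Vec.Base as Vec using (Vec; []; _∷_)
import Data.Vec.Functional as Vector
import Data.Vec.Properties as Vecₚ
open import Function.Bundles using (_↔_; _⇔_; module Inverse)
open import Function.Properties.Inverse using (↔⇒↣)
open import Level using (0ℓ)
open import Relation.Binary.Definitions using (DecidableEquality)
open import Relation.Binary.PropositionalEquality
  using (_≡_; _≢_; refl; sym; trans; cong; cong₂; subst; subst₂)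
open import Relation.Nullary.Decidable using (Dec; yes; no; does; ¬?; _×-dec_)
open import Relation.Nullary.Negation using (¬_; contradiction)

ℕ→ℚ : ℕ → ℚ
ℕ→ℚ n = (+ n) Q./ 1

-- Division on ℚ, made total by x ÷₀ 0 = 0.

recip₀ : ℚ → ℚ
recip₀ p with p ℚₚ.≟ 0ℚ
... | yes _  = 0ℚ
... | no p≢0 = (Q.1/ p) {{Q.≢-nonZero p≢0}}

infixl 7 _÷₀_

_÷₀_ : ℚ → ℚ → ℚ
p ÷₀ q = p Q.* recip₀ q

module Rational where

  open Q using (_+_; _*_; -_; _-_; _<_; _≤_; ∣_∣; _⊔_)
  open ℚₚ

  +-posʳ : ∀ p {q} → 0ℚ < q → p < p + q
  +-posʳ p 0<q = subst (_< p + _) (+-identityʳ p) (+-monoʳ-< p 0<q)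

  *-pos : ∀ {p q} → 0ℚ < p → 0ℚ < q → 0ℚ < p * q
  *-pos {p} {q} 0<p 0<q = positive⁻¹ (p * q) {{pos*pos⇒pos p {{Q.positive 0<p}} q {{Q.positive 0<q}}}}

  half-pos : ∀ {p} → 0ℚ < p → 0ℚ < p * ½
  half-pos 0<p = *-pos 0<p (positive⁻¹ ½)

  halves : ∀ p → p * ½ + p * ½ ≡ p
  halves p = trans (sym (*-distribˡ-+ p ½ ½)) (*-identityʳ p)

  mono-* : ∀ {a b c d} → 0ℚ ≤ c → 0ℚ ≤ b → a ≤ b → c ≤ d → a * c ≤ b * d
  mono-* {a} {b} {c} {d} 0≤c 0≤b a≤b c≤d = ≤-trans
    (*-monoʳ-≤-nonNeg c {{Q.nonNegative 0≤c}} a≤b)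
    (*-monoˡ-≤-nonNeg b {{Q.nonNegative 0≤b}} c≤d)

  p≤∣p∣ : ∀ p → p ≤ ∣ p ∣
  p≤∣p∣ p with ≤-total 0ℚ p
  ... | inj₁ 0≤p = ≤-reflexive (sym (0≤p⇒∣p∣≡p 0≤p))
  ... | inj₂ p≤0 = ≤-trans p≤0 (0≤∣p∣ p)

  ∣-∣-sym : ∀ p q → ∣ p - q ∣ ≡ ∣ q - p ∣
  ∣-∣-sym p q = trans (sym (∣-p∣≡∣p∣ (p - q)))
    (cong ∣_∣ (solve 2 (λ x y → :- (x :- y) := y :- x) refl p q))
    where open +-*-Solver

  add-back : ∀ p q → q + (p - q) ≡ p
  add-back = solve 2 (λ p q → q :+ (p :- q) := p) refl
    where open +-*-Solver

  -- |p − q| < ε is the conjunction of p < q + ε and q < p + ε.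

  ∣-∣⇒< : ∀ {p q ε} → ∣ p - q ∣ < ε → p < q + ε
  ∣-∣⇒< {p} {q} {ε} h = subst (_< q + ε) (add-back p q)
    (+-monoʳ-< q (≤-<-trans (p≤∣p∣ (p - q)) h))

  -cancel : ∀ p q → q + p - q ≡ p
  -cancel = solve 2 (λ p q → q :+ p :- q := p) refl
    where open +-*-Solver

  sub-< : ∀ {p q ε} → p < q + ε → p - q < ε
  sub-< {p} {q} {ε} h = subst (p - q <_) (-cancel ε q) (+-monoˡ-< (- q) h)

  sub-≤ : ∀ {p q ε} → p ≤ q + ε → p - q ≤ ε
  sub-≤ {p} {q} {ε} h = subst (p - q ≤_) (-cancel ε q) (+-monoˡ-≤ (- q) h)

  <⇒∣-∣ : ∀ {p q ε} → p < q + ε → q < p + ε → ∣ p - q ∣ < ε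
  <⇒∣-∣ {p} {q} h k with ≤-total 0ℚ (p - q)
  ... | inj₁ 0≤ = subst (_< _) (sym (0≤p⇒∣p∣≡p 0≤)) (sub-< h)
  ... | inj₂ ≤0 = subst (_< _)
    (trans (sym (0≤p⇒∣p∣≡p 0≤q-p)) (∣-∣-sym q p)) (sub-< k)
    where
    0≤q-p : 0ℚ ≤ q - p
    0≤q-p = subst (0ℚ ≤_) (solve 2 (λ x y → :- (x :- y) := y :- x) refl p q) (neg-antimono-≤ ≤0)
      where open +-*-Solver

  ≮-∣-∣ : ∀ {p q ε} → ∣ p - q ∣ < ε → q + ε ≤ p → ∀ {A : Set} → A
  ≮-∣-∣ h k = contradiction (<-≤-trans (∣-∣⇒< h) k) (<-irrefl refl)

  ∣∣-∣∣-≤ : ∀ p q → ∣ ∣ p ∣ - ∣ q ∣ ∣ ≤ ∣ p - q ∣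
  ∣∣-∣∣-≤ p q with ≤-total 0ℚ (∣ p ∣ - ∣ q ∣)
  ... | inj₁ 0≤ = subst (_≤ ∣ p - q ∣) (sym (0≤p⇒∣p∣≡p 0≤)) (one p q)
    where
    one : ∀ p q → ∣ p ∣ - ∣ q ∣ ≤ ∣ p - q ∣
    one p q = sub-≤ (subst (λ z → ∣ z ∣ ≤ ∣ q ∣ + ∣ p - q ∣) (add-back p q)
      (∣p+q∣≤∣p∣+∣q∣ q (p - q)))
  ... | inj₂ ≤0 = subst (_≤ ∣ p - q ∣)
    (trans (sym (0≤p⇒∣p∣≡p 0≤)) (∣-∣-sym ∣ q ∣ ∣ p ∣))
    (sub-≤ (subst (λ z → ∣ z ∣ ≤ ∣ p ∣ + ∣ p - q ∣) (add-back q p)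
      (subst (λ z → ∣ p + (q - p) ∣ ≤ ∣ p ∣ + z) (∣-∣-sym q p) (∣p+q∣≤∣p∣+∣q∣ p (q - p)))))
    where
    0≤ : 0ℚ ≤ ∣ q ∣ - ∣ p ∣
    0≤ = subst (0ℚ ≤_) (solve 2 (λ x y → :- (x :- y) := y :- x) refl ∣ p ∣ ∣ q ∣) (neg-antimono-≤ ≤0)
      where open +-*-Solver

  ℕ→ℚ-mk : ∀ n → ℕ→ℚ n ≡ Q.mkℚ (+ n) 0 (Coprime.sym (Coprime.1-coprimeTo n))
  ℕ→ℚ-mk n = normalize-coprime (Coprime.sym (Coprime.1-coprimeTo n))

  ℕ→ℚ-suc : ∀ n → ℕ→ℚ (suc n) ≡ 1ℚ + ℕ→ℚ n
  ℕ→ℚ-suc n rewrite ℕ→ℚ-mk n =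
    cong (λ z → (+ 1 ℤ.+ z) Q./ 1) (sym (ℤₚ.*-identityʳ (+ n)))

  ℕ→ℚ-nonNeg : ∀ n → 0ℚ ≤ ℕ→ℚ n
  ℕ→ℚ-nonNeg n = nonNegative⁻¹ (ℕ→ℚ n) {{normalize-nonNeg n 1}}


  ℕ→ℚ-pos : ∀ n .{{_ : ℕ.NonZero n}} → 0ℚ < ℕ→ℚ n
  ℕ→ℚ-pos n = positive⁻¹ (ℕ→ℚ n) {{normalize-pos n 1}}

  unit : ℕ → ℚ
  unit n = (+ 1) Q./ suc n

  unit-mk : ∀ n → unit n ≡ Q.mkℚ (+ 1) n (Coprime.1-coprimeTo (suc n))
  unit-mk n = normalize-coprime (Coprime.1-coprimeTo (suc n))

  unit-pos : ∀ n → 0ℚ < unit n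
  unit-pos n = positive⁻¹ (unit n) {{normalize-pos 1 (suc n)}}

  archimedes : ∀ ε → 0ℚ < ε → ∃[ N ] ∀ n → N ℕ.≤ n → unit n < ε
  archimedes (Q.mkℚ -[1+ _ ] _ _) (*<* ())
  archimedes (Q.mkℚ (+ zero) _ _) (*<* (ℤ.+<+ ()))
  archimedes (Q.mkℚ +[1+ p ] d c) _ = suc d , λ n d<n →
    subst (_< Q.mkℚ +[1+ p ] d c) (sym (unit-mk n))
      (*<* (subst₂ ℤ._<_ (sym (ℤₚ.*-identityˡ (+ suc d))) (ℤₚ.pos-* (suc p) (suc n))
        (ℤ.+<+ (ℕₚ.<-≤-trans (ℕ.s≤s d<n) (ℕₚ.m≤m+n (suc n) (p ℕ.* suc n))))))

  recip₀-inverse : ∀ {p} → 0ℚ < p → p * recip₀ p ≡ 1ℚ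
  recip₀-inverse {p} 0<p with p ≟ 0ℚ
  ... | yes p≡0 = contradiction (sym p≡0) (<⇒≢ 0<p)
  ... | no  p≢0 = *-inverseʳ p {{Q.≢-nonZero p≢0}}

  recip₀-pos : ∀ {p} → 0ℚ < p → 0ℚ < recip₀ p
  recip₀-pos {p} 0<p = ≰⇒> λ r≤0 → <-irrefl refl (<-≤-trans (positive⁻¹ 1ℚ)
    (subst₂ _≤_ (recip₀-inverse 0<p) (*-zeroʳ p)
      (*-monoˡ-≤-nonNeg p {{Q.nonNegative (<⇒≤ 0<p)}} r≤0)))

  search : (ℕ → ℚ) → ℚ → ℕ → ℕ
  search f x zero    = zero
  search f x (suc b) with f (suc b) ≤? x
  ... | yes _ = suc b
  ... | no  _ = search f x b

  search-lower : ∀ (f : ℕ → ℚ) x b → f 0 ≤ x → f (search f x b) ≤ x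
  search-lower f x zero    h = h
  search-lower f x (suc b) h with f (suc b) ≤? x
  ... | yes p = p
  ... | no  _ = search-lower f x b h

  search-upper : ∀ (f : ℕ → ℚ) x b → x < f (suc b) → x < f (suc (search f x b))
  search-upper f x zero    h = h
  search-upper f x (suc b) h with f (suc b) ≤? x
  ... | yes _ = h
  ... | no  p = search-upper f x b (≰⇒> p)

  -- Upper bound: x ≤ M with M = |numerator|, and (M(n+1)+1)/(n+1) > M, 1/(n+1).

  x≤num : ∀ x → x ≤ ℕ→ℚ ℤ.∣ Q.↥ x ∣
  x≤num x@(Q.mkℚ i d _) = subst (x ≤_) (sym (ℕ→ℚ-mk ℤ.∣ i ∣)) (*≤* (go i))
    where
    go : ∀ i → i ℤ.* (+ 1) ℤ.≤ (+ ℤ.∣ i ∣) ℤ.* (+ suc d)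
    go (+ m) = ℤₚ.*-monoˡ-≤-nonNeg (+ m) {+ 1} {+ suc d} (ℤ.+≤+ (ℕ.s≤s ℕ.z≤n))
    go -[1+ m ] = ℤₚ.≤-trans (ℤₚ.≤-reflexive (ℤₚ.*-identityʳ -[1+ m ])) (ℤ.-≤+)

  ℕ→ℚ-* : ∀ m n → ℕ→ℚ (m ℕ.* n) ≡ ℕ→ℚ m * ℕ→ℚ n
  ℕ→ℚ-* m n rewrite ℕ→ℚ-mk m | ℕ→ℚ-mk n = cong (Q._/ 1) (ℤₚ.pos-* m n)

  suc*unit : ∀ n → ℕ→ℚ (suc n) * unit n ≡ 1ℚ
  suc*unit n = trans (cong₂ _*_ (ℕ→ℚ-mk (suc n)) (unit-mk n))
    (*-inverseʳ (Q.mkℚ +[1+ n ] 0 (Coprime.sym (Coprime.1-coprimeTo (suc n)))))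

  grid : ℕ → ℕ → ℚ
  grid n k = (ℕ→ℚ k * unit n) * (ℕ→ℚ k * unit n)

  -- √↓ n x = k/(n+1), for the largest k with (k/(n+1))² ≤ x  (x ≥ 0).  The
  -- search starts from a k with k/(n+1) = 1 + |numerator of x| > √x.

  √↓ : ℕ → ℚ → ℚ
  √↓ n x = ℕ→ℚ (search (grid n) x (suc ℤ.∣ Q.↥ x ∣ ℕ.* suc n)) * unit n

  √↓-nonNeg : ∀ n x → 0ℚ ≤ √↓ n x
  √↓-nonNeg n x = subst (_≤ √↓ n x) (*-zeroˡ (unit n))
    (*-monoʳ-≤-nonNeg (unit n) {{Q.nonNegative (<⇒≤ (unit-pos n))}} (ℕ→ℚ-nonNeg k))
    where k = search (grid n) x (suc ℤ.∣ Q.↥ x ∣ ℕ.* suc n)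

  √↓-lower : ∀ n x → 0ℚ ≤ x → √↓ n x * √↓ n x ≤ x
  √↓-lower n x 0≤x = search-lower (grid n) x (suc ℤ.∣ Q.↥ x ∣ ℕ.* suc n) (subst (_≤ x)
    (sym (trans (cong (_* (0ℚ * unit n)) (*-zeroˡ (unit n))) (*-zeroˡ (0ℚ * unit n)))) 0≤x)

  suc-step : ∀ n k → ℕ→ℚ (suc k) * unit n ≡ ℕ→ℚ k * unit n + unit n
  suc-step n k = trans (cong (_* unit n) (ℕ→ℚ-suc k))
    (trans (*-distribʳ-+ (unit n) 1ℚ (ℕ→ℚ k))
    (trans (cong (_+ ℕ→ℚ k * unit n) (*-identityˡ (unit n)))
    (+-comm (unit n) (ℕ→ℚ k * unit n))))

  start : ∀ n m → ℕ→ℚ (m ℕ.* suc n) * unit n ≡ ℕ→ℚ m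
  start n m = trans (cong (_* unit n) (ℕ→ℚ-* m (suc n)))
    (trans (*-assoc (ℕ→ℚ m) (ℕ→ℚ (suc n)) (unit n))
    (trans (cong (ℕ→ℚ m *_) (suc*unit n)) (*-identityʳ (ℕ→ℚ m))))

  start-above : ∀ n x → x < grid n (suc (suc ℤ.∣ Q.↥ x ∣ ℕ.* suc n))
  start-above n x = ≤-<-trans (x≤num x) (<-≤-trans M<1+M
    (subst (_≤ grid n (suc (suc M ℕ.* suc n))) (*-identityˡ (ℕ→ℚ (suc M)))
      (mono-* {1ℚ} {top} {ℕ→ℚ (suc M)} {top}
        (ℕ→ℚ-nonNeg (suc M)) (≤-trans (ℕ→ℚ-nonNeg (suc M)) 1+M≤top)
        (≤-trans 1≤1+M 1+M≤top) 1+M≤top)))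
    where
    M = ℤ.∣ Q.↥ x ∣
    top = ℕ→ℚ (suc (suc M ℕ.* suc n)) * unit n
    M<1+M : ℕ→ℚ M < ℕ→ℚ (suc M)
    M<1+M = subst (ℕ→ℚ M <_) (trans (+-comm (ℕ→ℚ M) 1ℚ) (sym (ℕ→ℚ-suc M)))
      (+-posʳ (ℕ→ℚ M) (positive⁻¹ 1ℚ))
    1≤1+M : 1ℚ ≤ ℕ→ℚ (suc M)
    1≤1+M = subst₂ _≤_ (+-identityʳ 1ℚ) (sym (ℕ→ℚ-suc M)) (+-monoʳ-≤ 1ℚ (ℕ→ℚ-nonNeg M))
    1+M≤top : ℕ→ℚ (suc M) ≤ top
    1+M≤top = subst (ℕ→ℚ (suc M) ≤_)
      (sym (trans (suc-step n (suc M ℕ.* suc n)) (cong (_+ unit n) (start n (suc M)))))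
      (<⇒≤ (+-posʳ (ℕ→ℚ (suc M)) (unit-pos n)))

  √↓-upper : ∀ n x → x < (√↓ n x + unit n) * (√↓ n x + unit n)
  √↓-upper n x = subst (λ z → x < z * z) (suc-step n k)
    (search-upper (grid n) x (suc ℤ.∣ Q.↥ x ∣ ℕ.* suc n) (start-above n x))
    where k = search (grid n) x (suc ℤ.∣ Q.↥ x ∣ ℕ.* suc n)

  square-≤ : ∀ a b → 0ℚ ≤ a → 0ℚ ≤ b → a * a + b * b ≤ (a + b) * (a + b)
  square-≤ a b 0≤a 0≤b = subst₂ _≤_ (+-identityʳ (a * a + b * b))
    (solve 2 (λ a b → (a :* a :+ b :* b) :+ (a :* b :+ a :* b) := (a :+ b) :* (a :+ b)) refl a b)
    (+-monoʳ-≤ (a * a + b * b) (subst (_≤ a * b + a * b) (+-identityʳ 0ℚ) (+-mono-≤ 0≤ab 0≤ab)))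
    where
    open +-*-Solver
    0≤ab : 0ℚ ≤ a * b
    0≤ab = subst (_≤ a * b) (*-zeroˡ b) (*-monoʳ-≤-nonNeg b {{Q.nonNegative 0≤b}} 0≤a)

  √↓-close : ∀ {m n x y h} → 0ℚ ≤ x → 0ℚ ≤ y → 0ℚ < h → unit n < h →
             ∣ x - y ∣ < h * h → √↓ m x < √↓ n y + (h + h)
  √↓-close {m} {n} {x} {y} {h} 0≤x 0≤y 0<h u<h x~y = ≰⇒> λ far →
    ≮-∣-∣ x~y (≤-trans (<⇒≤ (+-monoˡ-< (h * h) (√↓-upper n y)))
      (≤-trans (square-≤ t h 0≤t (<⇒≤ 0<h))
      (≤-trans (mono-* 0≤t+h 0≤s (t+h≤s far) (t+h≤s far)) (√↓-lower m x 0≤x))))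
    where
    s = √↓ m x
    t = √↓ n y + unit n
    0≤s = √↓-nonNeg m x
    0≤t : 0ℚ ≤ t
    0≤t = ≤-trans (√↓-nonNeg n y) (<⇒≤ (+-posʳ (√↓ n y) (unit-pos n)))
    0≤t+h : 0ℚ ≤ t + h
    0≤t+h = ≤-trans 0≤t (<⇒≤ (+-posʳ t 0<h))
    t+h≤s : √↓ n y + (h + h) ≤ s → t + h ≤ s
    t+h≤s far = ≤-trans (+-monoˡ-≤ h (+-monoʳ-≤ (√↓ n y) (<⇒≤ u<h)))
      (subst (_≤ s) (sym (+-assoc (√↓ n y) h h)) far)

  ⊔0-close : ∀ x y {ε} → 0ℚ < ε → ∣ x - y ∣ < ε → ∣ (x ⊔ 0ℚ) - (y ⊔ 0ℚ) ∣ < ε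
  ⊔0-close x y {ε} 0<ε x~y = <⇒∣-∣ (side x y (∣-∣⇒< x~y))
    (side y x (∣-∣⇒< (subst (_< ε) (∣-∣-sym x y) x~y)))
    where
    side : ∀ x y → x < y + ε → x ⊔ 0ℚ < (y ⊔ 0ℚ) + ε
    side x y h with ⊔-sel x 0ℚ
    ... | inj₁ e = subst (_< (y ⊔ 0ℚ) + ε) (sym e) (<-≤-trans h (+-monoˡ-≤ ε (p≤p⊔q y 0ℚ)))
    ... | inj₂ e = subst (_< (y ⊔ 0ℚ) + ε) (sym e) (≤-<-trans (p≤q⊔p y 0ℚ) (+-posʳ (y ⊔ 0ℚ) 0<ε))

  +-close : ∀ x x₁ y y₁ {ε} → ∣ x - x₁ ∣ < ε * ½ → ∣ y - y₁ ∣ < ε * ½ →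
            ∣ (x + y) - (x₁ + y₁) ∣ < ε
  +-close x x₁ y y₁ {ε} h k = ≤-<-trans
    (subst (λ z → ∣ z ∣ ≤ ∣ x - x₁ ∣ + ∣ y - y₁ ∣)
      (solve 4 (λ x x₁ y y₁ → (x :- x₁) :+ (y :- y₁) := (x :+ y) :- (x₁ :+ y₁)) refl x x₁ y y₁)
      (∣p+q∣≤∣p∣+∣q∣ (x - x₁) (y - y₁)))
    (subst (∣ x - x₁ ∣ + ∣ y - y₁ ∣ <_) (halves ε) (+-mono-< h k))
    where open +-*-Solver

  neg-close : ∀ x x₁ {ε} → ∣ x - x₁ ∣ < ε → ∣ (- x) - (- x₁) ∣ < ε
  neg-close x x₁ {ε} = subst (_< ε) (trans (∣-∣-sym x x₁)
    (cong ∣_∣ (solve 2 (λ x x₁ → x₁ :- x := (:- x) :- (:- x₁)) refl x x₁)))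
    where open +-*-Solver

  -- With B > 0 bounding |y| and |x₁|, and δ = (ε/2)/B.

  *-close : ∀ x x₁ y y₁ {ε B} → 0ℚ < B → ∣ y ∣ < B → ∣ x₁ ∣ < B →
            ∣ x - x₁ ∣ < ε * ½ * recip₀ B → ∣ y - y₁ ∣ < ε * ½ * recip₀ B →
            ∣ x * y - x₁ * y₁ ∣ < ε
  *-close x x₁ y y₁ {ε} {B} 0<B y<B x<B h k = ≤-<-trans
    (subst (λ z → ∣ z ∣ ≤ ∣ (x - x₁) * y ∣ + ∣ (y - y₁) * x₁ ∣)
      (solve 4 (λ x x₁ y y₁ → (x :- x₁) :* y :+ (y :- y₁) :* x₁ := x :* y :- x₁ :* y₁) refl x x₁ y y₁)
      (∣p+q∣≤∣p∣+∣q∣ ((x - x₁) * y) ((y - y₁) * x₁)))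
    (subst (∣ (x - x₁) * y ∣ + ∣ (y - y₁) * x₁ ∣ <_) (halves ε)
      (+-mono-< (part (x - x₁) y h y<B) (part (y - y₁) x₁ k x<B)))
    where
    open +-*-Solver
    part : ∀ d z → ∣ d ∣ < ε * ½ * recip₀ B → ∣ z ∣ < B → ∣ d * z ∣ < ε * ½
    part d z d< z< = subst₂ _<_ (sym (∣p*q∣≡∣p∣*∣q∣ d z))
      (trans (*-assoc (ε * ½) (recip₀ B) B)
        (trans (cong (ε * ½ *_) (trans (*-comm (recip₀ B) B) (recip₀-inverse 0<B)))
          (*-identityʳ (ε * ½))))
      (≤-<-trans (*-monoˡ-≤-nonNeg ∣ d ∣ {{∣-∣-nonNeg d}} (<⇒≤ z<))
        (*-monoˡ-<-pos B {{Q.positive 0<B}} d<))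

  bound : ∀ x c → ∣ x - c ∣ < 1ℚ → ∣ x ∣ < ∣ c ∣ + 1ℚ
  bound x c h = ≤-<-trans
    (subst (λ z → ∣ z ∣ ≤ ∣ c ∣ + ∣ x - c ∣) (add-back x c) (∣p+q∣≤∣p∣+∣q∣ c (x - c)))
    (+-monoʳ-< ∣ c ∣ h)

  recip₀-close : ∀ x y {δ ε} → 0ℚ < δ → 0ℚ < ε → δ < x → δ < y → ∣ x - y ∣ < ε * (δ * δ) →
                 ∣ recip₀ x - recip₀ y ∣ < ε
  recip₀-close x y {δ} {ε} 0<δ 0<ε δ<x δ<y h =
    subst (_< ε) (cong ∣_∣ (sym difference))
      (subst (_< ε) (sym (trans (∣p*q∣≡∣p∣*∣q∣ (y - x) (u * v))
          (cong (∣ y - x ∣ *_) (0≤p⇒∣p∣≡p (<⇒≤ 0<uv)))))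
        (<-≤-trans
          (*-monoˡ-<-pos (u * v) {{Q.positive 0<uv}} (subst (_< ε * (δ * δ)) (∣-∣-sym x y) h))
          (subst₂ _≤_
            (solve 4 (λ e d u v → e :* ((d :* u) :* (d :* v)) := e :* (d :* d) :* (u :* v)) refl ε δ u v)
            (trans (cong (ε *_) (*-identityʳ 1ℚ)) (*-identityʳ ε))
            (*-monoˡ-≤-nonNeg ε {{Q.nonNegative (<⇒≤ 0<ε)}}
              (mono-* {δ * u} {1ℚ} {δ * v} {1ℚ} (<⇒≤ (*-pos 0<δ 0<v)) (<⇒≤ (positive⁻¹ 1ℚ))
                (small 0<x δ<x) (small 0<y δ<y))))))
    where
    open +-*-Solver
    u = recip₀ x
    v = recip₀ y
    0<x = <-trans 0<δ δ<x
    0<y = <-trans 0<δ δ<y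
    0<u = recip₀-pos 0<x
    0<v = recip₀-pos 0<y
    0<uv = *-pos 0<u 0<v
    small : ∀ {z} → 0ℚ < z → δ < z → δ * recip₀ z ≤ 1ℚ
    small {z} 0<z δ<z = subst (δ * recip₀ z ≤_) (recip₀-inverse 0<z)
      (*-monoʳ-≤-nonNeg (recip₀ z) {{Q.nonNegative (<⇒≤ (recip₀-pos 0<z))}} (<⇒≤ δ<z))
    difference : u - v ≡ (y - x) * (u * v)
    difference = trans
      (sym (trans (cong₂ (λ a b → u * a - v * b) (recip₀-inverse 0<y) (recip₀-inverse 0<x))
        (cong₂ _-_ (*-identityʳ u) (*-identityʳ v))))
      (solve 4 (λ x y u v → u :* (y :* v) :- v :* (x :* u) := (y :- x) :* (u :* v)) refl x y u v)

  ⊓1-pos : ∀ {δ} → 0ℚ < δ → 0ℚ < δ Q.⊓ 1ℚ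
  ⊓1-pos {δ} 0<δ with ⊓-sel δ 1ℚ
  ... | inj₁ e = subst (0ℚ <_) (sym e) 0<δ
  ... | inj₂ e = subst (0ℚ <_) (sym e) (positive⁻¹ 1ℚ)

  -- If m ≤ δ and m ≤ 1 then m² ≤ δ.

  √↓-pos : ∀ {n x δ} → 0ℚ < δ → unit n < (δ Q.⊓ 1ℚ) * ½ → δ < x → (δ Q.⊓ 1ℚ) * ½ < √↓ n x
  √↓-pos {n} {x} {δ} 0<δ u< δ<x = ≰⇒> λ s≤ → <-irrefl refl (<-trans δ<x
    (<-≤-trans (√↓-upper n x) (≤-trans
      (mono-* (0≤s+u) (<⇒≤ 0<m) (s+u≤m s≤) (s+u≤m s≤))
      (subst (m * m ≤_) (*-identityʳ δ)
        (mono-* {m} {δ} {m} {1ℚ} (<⇒≤ 0<m) (<⇒≤ 0<δ) (p⊓q≤p δ 1ℚ) (p⊓q≤q δ 1ℚ))))))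
    where
    m = δ Q.⊓ 1ℚ
    0<m : 0ℚ < m
    0<m = ⊓1-pos 0<δ
    0≤s+u : 0ℚ ≤ √↓ n x + unit n
    0≤s+u = ≤-trans (√↓-nonNeg n x) (<⇒≤ (+-posʳ (√↓ n x) (unit-pos n)))
    s+u≤m : √↓ n x ≤ m * ½ → √↓ n x + unit n ≤ m
    s+u≤m h = subst (√↓ n x + unit n ≤_) (halves m) (+-mono-≤ h (<⇒≤ u<))

-- The real numbers as Cauchy sequences of rationals, with _≃_ as equality.

module ℝ where

  open Rational using (unit; archimedes; √↓; halves; half-pos; *-pos)

  IsCauchy : (ℕ → ℚ) → Set
  IsCauchy s = ∀ ε → 0ℚ Q.< ε →
    ∃[ N ] ∀ m n → N ℕ.≤ m → N ℕ.≤ n → Q.∣ s m Q.- s n ∣ Q.< ε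

  record CauchySequence : Set where
    no-eta-equality
    field
      seq    : ℕ → ℚ
      cauchy : IsCauchy seq

  open CauchySequence public

  ℝ : Set
  ℝ = CauchySequence

  infix 4 _≤_ _<_ _≃_

  _≤_ : ℝ → ℝ → Set
  x ≤ y = ∀ ε → 0ℚ Q.< ε → ∃[ N ] ∀ n → N ℕ.≤ n → seq x n Q.< seq y n Q.+ ε

  _<_ : ℝ → ℝ → Set
  x < y = ∃[ ε ] 0ℚ Q.< ε × ∃[ N ] ∀ n → N ℕ.≤ n → seq x n Q.+ ε Q.< seq y n

  _≃_ : ℝ → ℝ → Set
  x ≃ y = x ≤ y × y ≤ x

  constant : ∀ p → IsCauchy (λ _ → p)
  constant p ε 0<ε = 0 , λ _ _ _ _ →
    subst (λ z → Q.∣ z ∣ Q.< ε) (sym (ℚₚ.+-inverseʳ p)) 0<ε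

  fromℚ : ℚ → ℝ
  fromℚ p .seq _  = p
  fromℚ p .cauchy = constant p

  fromℕ : ℕ → ℝ
  fromℕ n .seq _  = ℕ→ℚ n
  fromℕ n .cauchy = constant (ℕ→ℚ n)

  0ℝ 1ℝ : ℝ
  0ℝ = fromℚ 0ℚ
  1ℝ = fromℚ 1ℚ

  ≤⊔ˡ : ∀ m n {o} → m ℕ.⊔ n ℕ.≤ o → m ℕ.≤ o
  ≤⊔ˡ m n = ℕₚ.≤-trans (ℕₚ.m≤m⊔n m n)

  ≤⊔ʳ : ∀ m n {o} → m ℕ.⊔ n ℕ.≤ o → n ℕ.≤ o
  ≤⊔ʳ m n = ℕₚ.≤-trans (ℕₚ.m≤n⊔m m n)

  infixl 6 _+_ _-_
  infixl 7 _*_ _/_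
  infix  8 -_

  _+_ : ℝ → ℝ → ℝ
  (x + y) .seq n = seq x n Q.+ seq y n
  (x + y) .cauchy ε 0<ε with cauchy x (ε Q.* ½) (half-pos 0<ε) | cauchy y (ε Q.* ½) (half-pos 0<ε)
  ... | M , h | N , k = M ℕ.⊔ N , λ m n p q →
    Rational.+-close (seq x m) (seq x n) (seq y m) (seq y n)
      (h m n (≤⊔ˡ M N p) (≤⊔ˡ M N q)) (k m n (≤⊔ʳ M N p) (≤⊔ʳ M N q))

  -_ : ℝ → ℝ
  (- x) .seq n = Q.- seq x n
  (- x) .cauchy ε 0<ε with cauchy x ε 0<ε
  ... | N , h = N , λ m n p q → Rational.neg-close (seq x m) (seq x n) (h m n p q)

  _-_ : ℝ → ℝ → ℝ
  x - y = x + - y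

  ∣_∣ : ℝ → ℝ
  ∣ x ∣ .seq n = Q.∣ seq x n ∣
  ∣ x ∣ .cauchy ε 0<ε with cauchy x ε 0<ε
  ... | N , h = N , λ m n p q →
    ℚₚ.≤-<-trans (Rational.∣∣-∣∣-≤ (seq x m) (seq x n)) (h m n p q)

  _*_ : ℝ → ℝ → ℝ
  (x * y) .seq n = seq x n Q.* seq y n
  (x * y) .cauchy ε 0<ε
    with cauchy x 1ℚ (ℚₚ.positive⁻¹ 1ℚ) | cauchy y 1ℚ (ℚₚ.positive⁻¹ 1ℚ)
  ... | K , f | L , g = (K ℕ.⊔ L) ℕ.⊔ N , λ m n p q →
      Rational.*-close (seq x m) (seq x n) (seq y m) (seq y n) 0<B
        (<Bʳ (Rational.bound (seq y m) (seq y L) (g m L (≤⊔ʳ K L (≤⊔ˡ (K ℕ.⊔ L) N p)) ℕₚ.≤-refl)))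
        (<Bˡ (Rational.bound (seq x n) (seq x K) (f n K (≤⊔ˡ K L (≤⊔ˡ (K ℕ.⊔ L) N q)) ℕₚ.≤-refl)))
        (proj₂ h m n (≤⊔ˡ H I (≤⊔ʳ (K ℕ.⊔ L) N p)) (≤⊔ˡ H I (≤⊔ʳ (K ℕ.⊔ L) N q)))
        (proj₂ k m n (≤⊔ʳ H I (≤⊔ʳ (K ℕ.⊔ L) N p)) (≤⊔ʳ H I (≤⊔ʳ (K ℕ.⊔ L) N q)))
    where
    bx = Q.∣ seq x K ∣ Q.+ 1ℚ
    by = Q.∣ seq y L ∣ Q.+ 1ℚ
    B  = bx Q.⊔ by
    <Bˡ : ∀ {z} → z Q.< bx → z Q.< B
    <Bˡ z< = ℚₚ.<-≤-trans z< (ℚₚ.p≤p⊔q bx by)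
    <Bʳ : ∀ {z} → z Q.< by → z Q.< B
    <Bʳ z< = ℚₚ.<-≤-trans z< (ℚₚ.p≤q⊔p bx by)
    0<B : 0ℚ Q.< B
    0<B = <Bˡ (ℚₚ.≤-<-trans (ℚₚ.0≤∣p∣ (seq x K)) (Rational.+-posʳ Q.∣ seq x K ∣ (ℚₚ.positive⁻¹ 1ℚ)))
    δ = ε Q.* ½ Q.* recip₀ B
    0<δ : 0ℚ Q.< δ
    0<δ = *-pos (half-pos 0<ε) (Rational.recip₀-pos 0<B)
    h = cauchy x δ 0<δ
    k = cauchy y δ 0<δ
    H = proj₁ h
    I = proj₁ k
    N = H ℕ.⊔ I

  -- √ x is the nonnegative square root of max(x, 0).

  √ : ℝ → ℝ
  √ x .seq n = √↓ n (seq x n Q.⊔ 0ℚ)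
  √ x .cauchy = √-cauchy
    where
    side : ∀ m n h → 0ℚ Q.< h → unit n Q.< h → Q.∣ seq x m Q.- seq x n ∣ Q.< h Q.* h →
           √↓ m (seq x m Q.⊔ 0ℚ) Q.< √↓ n (seq x n Q.⊔ 0ℚ) Q.+ (h Q.+ h)
    side m n h 0<h u d = Rational.√↓-close {m} {n} {seq x m Q.⊔ 0ℚ} {seq x n Q.⊔ 0ℚ} {h}
      (ℚₚ.p≤q⊔p (seq x m) 0ℚ) (ℚₚ.p≤q⊔p (seq x n) 0ℚ) 0<h u (Rational.⊔0-close (seq x m) (seq x n) (*-pos 0<h 0<h) d)

    M L N : ∀ h → 0ℚ Q.< h → ℕ
    M h 0<h = proj₁ (archimedes h 0<h)
    L h 0<h = proj₁ (cauchy x (h Q.* h) (*-pos 0<h 0<h))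
    N h 0<h = M h 0<h ℕ.⊔ L h 0<h

    close : ∀ h (0<h : 0ℚ Q.< h) m n → N h 0<h ℕ.≤ m → N h 0<h ℕ.≤ n →
            √↓ m (seq x m Q.⊔ 0ℚ) Q.< √↓ n (seq x n Q.⊔ 0ℚ) Q.+ (h Q.+ h)
    close h 0<h m n p q = side m n h 0<h (proj₂ (archimedes h 0<h) n (≤⊔ˡ (M h 0<h) (L h 0<h) q))
      (proj₂ (cauchy x (h Q.* h) (*-pos 0<h 0<h)) m n (≤⊔ʳ (M h 0<h) (L h 0<h) p) (≤⊔ʳ (M h 0<h) (L h 0<h) q))

    √-cauchy : IsCauchy (λ n → √↓ n (seq x n Q.⊔ 0ℚ))
    √-cauchy ε 0<ε = N (ε Q.* ½) (half-pos 0<ε) , λ m n p q → Rational.<⇒∣-∣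
      (at-ε m n (close (ε Q.* ½) (half-pos 0<ε) m n p q))
      (at-ε n m (close (ε Q.* ½) (half-pos 0<ε) n m q p))
      where
      at-ε : ∀ m n → √↓ m (seq x m Q.⊔ 0ℚ) Q.< √↓ n (seq x n Q.⊔ 0ℚ) Q.+ (ε Q.* ½ Q.+ ε Q.* ½) →
             √↓ m (seq x m Q.⊔ 0ℚ) Q.< √↓ n (seq x n Q.⊔ 0ℚ) Q.+ ε
      at-ε m n = subst (λ z → √↓ m (seq x m Q.⊔ 0ℚ) Q.< √↓ n (seq x n Q.⊔ 0ℚ) Q.+ z) (halves ε)

  record Positive (x : ℝ) : Set where
    constructor positive
    field 0< : 0ℝ < x

  open Positive public

  eventually : ∀ {x} → Positive x →
    ∃[ δ ] 0ℚ Q.< δ × ∃[ N ] ∀ n → N ℕ.≤ n → δ Q.< seq x n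
  eventually {x} (positive (δ , 0<δ , N , h)) = δ , 0<δ , N , λ n p →
    subst (Q._< seq x n) (ℚₚ.+-identityˡ δ) (h n p)

  eventually⁻¹ : ∀ {x} → (∃[ δ ] 0ℚ Q.< δ × ∃[ N ] ∀ n → N ℕ.≤ n → δ Q.< seq x n) → Positive x
  eventually⁻¹ {x} (δ , 0<δ , N , h) = positive (δ , 0<δ , N , λ n p →
    subst (Q._< seq x n) (sym (ℚₚ.+-identityˡ δ)) (h n p))

  instance
    fromℕ-positive : ∀ {n} .{{_ : ℕ.NonZero n}} → Positive (fromℕ n)
    fromℕ-positive {n} = eventually⁻¹ (ℕ→ℚ n Q.* ½ , half-pos (Rational.ℕ→ℚ-pos n) , 0 , λ _ _ →
      subst (ℕ→ℚ n Q.* ½ Q.<_) (halves (ℕ→ℚ n))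
        (Rational.+-posʳ (ℕ→ℚ n Q.* ½) (half-pos (Rational.ℕ→ℚ-pos n))))

    *-positive : ∀ {x y} {{_ : Positive x}} {{_ : Positive y}} → Positive (x * y)
    *-positive {x} {y} {{p}} {{q}} with eventually p | eventually q
    ... | δ , 0<δ , M , h | η , 0<η , N , k = eventually⁻¹ (δ Q.* η , *-pos 0<δ 0<η , M ℕ.⊔ N ,
      λ n r → ℚₚ.<-≤-trans
        (ℚₚ.*-monoˡ-<-pos η {{Q.positive 0<η}} (h n (≤⊔ˡ M N r)))
        (ℚₚ.*-monoˡ-≤-nonNeg (seq x n) {{Q.nonNegative (ℚₚ.<⇒≤ (ℚₚ.<-trans 0<δ (h n (≤⊔ˡ M N r))))}}
          (ℚₚ.<⇒≤ (k n (≤⊔ʳ M N r)))))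

    √-positive : ∀ {x} {{_ : Positive x}} → Positive (√ x)
    √-positive {x} {{p}} with eventually p
    ... | δ , 0<δ , N , h with archimedes ((δ Q.⊓ 1ℚ) Q.* ½) (half-pos (Rational.⊓1-pos 0<δ))
    ... | M , u = eventually⁻¹ ((δ Q.⊓ 1ℚ) Q.* ½ , half-pos (Rational.⊓1-pos 0<δ) , M ℕ.⊔ N ,
      λ n r → Rational.√↓-pos {n} {seq x n Q.⊔ 0ℚ} 0<δ (u n (≤⊔ˡ M N r))
        (ℚₚ.<-≤-trans (h n (≤⊔ʳ M N r)) (ℚₚ.p≤p⊔q (seq x n) 0ℚ)))

  _⁻¹ : (x : ℝ) {{_ : Positive x}} → ℝ
  (x ⁻¹) .seq n = recip₀ (seq x n)
  (x ⁻¹) {{p}} .cauchy ε 0<ε with eventually p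
  ... | δ , 0<δ , M , h with cauchy x (ε Q.* (δ Q.* δ)) (*-pos 0<ε (*-pos 0<δ 0<δ))
  ... | N , k = M ℕ.⊔ N , λ m n r s → Rational.recip₀-close (seq x m) (seq x n) 0<δ 0<ε
      (h m (≤⊔ˡ M N r)) (h n (≤⊔ˡ M N s)) (k m n (≤⊔ʳ M N r) (≤⊔ʳ M N s))

  _/_ : ℝ → (y : ℝ) {{_ : Positive y}} → ℝ
  x / y = x * y ⁻¹

open ℝ using (ℝ)

-- Decidable subsets, represented by their characteristic functions.

Sub : Set → Set
Sub A = A → Bool

infix  4 _∈_ _⊆_
infixr 7 _∩_

_∈_ : {A : Set} → A → Sub A → Set
x ∈ X = T (X x)

_⊆_ : {A : Set} → Sub A → Sub A → Set
X ⊆ Y = ∀ x → x ∈ X → x ∈ Y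

_∩_ : {A : Set} → Sub A → Sub A → Sub A
(X ∩ Y) x = X x ∧ Y x

-- Only applied to a list containing every element of A exactly once.

count : {A : Set} → List A → Sub A → ℕ
count universe X = List.length (List.filterᵇ X universe)

IsPartition : {A : Set} {n : ℕ} → Sub A → (Fin n → Sub A) → Set
IsPartition X Xs =
  (∀ i → Xs i ⊆ X) × (∀ x → x ∈ X → ∃! _≡_ λ i → x ∈ Xs i)

record IncidenceSystem : Set₁ where
  field
    Point Object : Set
    Incident     : Point → Object → Set

record _≅_ (X Y : IncidenceSystem) : Set where
  private
    module X = IncidenceSystem X
    module Y = IncidenceSystem Y
  field
    points   : X.Point ↔ Y.Point
    objects  : X.Object ↔ Y.Object
    incident : ∀ p s → X.Incident p s ⇔ Y.Incident (Inverse.to points p) (Inverse.to objects s)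

-- The value of 0# ⁻¹ is unspecified.

record FiniteField (q : ℕ) : Set₁ where
  infixl 6 _+_ _-_
  infixl 7 _*_
  infix  8 -_
  infix  9 _⁻¹
  field
    Carrier           : Set
    _+_ _*_           : Op₂ Carrier
    -_ _⁻¹            : Op₁ Carrier
    0# 1#             : Carrier
    isCommutativeRing : IsCommutativeRing _≡_ _+_ _*_ -_ 0# 1#
    0≢1               : 0# ≢ 1#
    *-inverseʳ        : ∀ x → x ≢ 0# → x * x ⁻¹ ≡ 1#
    enumeration       : Carrier ↔ Fin q

  _-_ : Op₂ Carrier
  x - y = x + - y

  +-rawMonoid : RawMonoid 0ℓ 0ℓ
  +-rawMonoid = record { Carrier = Carrier ; _≈_ = _≡_ ; _∙_ = _+_ ; ε = 0# }

  open RawMonoidDefinitions +-rawMonoid public using () renaming (_×_ to _·_)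

  HasCharacteristic : ℕ → Set
  HasCharacteristic p = ∀ m → (m · 1# ≡ 0#) ⇔ (p ∣ m)

  _≟_ : DecidableEquality Carrier
  _≟_ = Finₚ.inj⇒≟ (↔⇒↣ enumeration)

  index : Carrier → Fin q
  index = Inverse.to enumeration

  element : Fin q → Carrier
  element = Inverse.from enumeration

  elements : List Carrier
  elements = List.map element (List.allFin q)

  instance
    order-nonZero : ℕ.NonZero q
    order-nonZero = Finₚ.nonZeroIndex (index 0#)

module Geometry {q : ℕ} (F : FiniteField q) where

  open FiniteField F

  Space : ℕ → Set
  Space = Vec Carrier

  Point : Set
  Point = Space 3

  infixl 6 _⊕_ _⊖_
  infixl 7 _•_

  _⊕_ _⊖_ : ∀ {n} → Space n → Space n → Space n
  _⊕_ = Vec.zipWith _+_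
  _⊖_ = Vec.zipWith _-_

  _•_ : ∀ {n} → Carrier → Space n → Space n
  a • v = Vec.map (a *_) v

  0ᵛ : ∀ {n} → Space n
  0ᵛ = Vec.replicate _ 0#

  record QuadraticForm : Set where
    field xx yy zz xy xz yz : Carrier

  eval : QuadraticForm → Point → Carrier
  eval Q (x ∷ y ∷ z ∷ []) =
    xx * (x * x) + yy * (y * y) + zz * (z * z) + xy * (x * y) + xz * (x * z) + yz * (y * z)
    where open QuadraticForm Q

  polar : QuadraticForm → Point → Point → Carrier
  polar Q u v = eval Q (u ⊕ v) - eval Q u - eval Q v

  Nondegenerate : QuadraticForm → Set
  Nondegenerate Q = ∀ u → (∀ v → polar Q u v ≡ 0#) → u ≡ 0ᵛ

  -- A sphere S_Q(c, r) is recorded by its parameters (c, r).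

  Sphere : Set
  Sphere = Point × Carrier

  centre : Sphere → Point
  centre = proj₁

  radius : Sphere → Carrier
  radius = proj₂

  _≟ˢ_ : DecidableEquality Sphere
  _≟ˢ_ = Productₚ.≡-dec (Vecₚ.≡-dec _≟_) _≟_

  Lies : QuadraticForm → Point → Sphere → Set
  Lies Q p S = eval Q (p ⊖ centre S) ≡ radius S

  pointsOf : QuadraticForm → Sphere → Sub Point
  pointsOf Q S p = does (eval Q (p ⊖ centre S) ≟ radius S)

  Φ : QuadraticForm → Sphere → Space 4
  Φ Q (c , r) = ((1# + 1#) • c) Vec.++ (r - eval Q c ∷ [])

  record AffineLine (n : ℕ) : Set where
    field
      base direction : Space n
      direction≢0    : direction ≢ 0ᵛ

  _onLine_ : ∀ {n} → Space n → AffineLine n → Set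
  v onLine L = ∃[ s ] v ≡ AffineLine.base L ⊕ s • AffineLine.direction L

  vectors : ∀ n → List (Space n)
  vectors zero    = List.[ [] ]
  vectors (suc n) = List.cartesianProductWith _∷_ elements (vectors n)

  allPoints : List Point
  allPoints = vectors 3

  allSpheres : List Sphere
  allSpheres = List.cartesianProduct allPoints elements

  ∣_∣ₚ : Sub Point → ℕ
  ∣ P ∣ₚ = count allPoints P

  ∣_∣ₛ : Sub Sphere → ℕ
  ∣ 𝒮 ∣ₛ = count allSpheres 𝒮

  record IsCoaxalPencil (Q : QuadraticForm) (𝒫 : Sub Sphere) : Set where
    field
      size : ∣ 𝒫 ∣ₛ ≡ q
      line : AffineLine 4
      into : ∀ S → S ∈ 𝒫 → Φ Q S onLine line
      onto : ∀ v → v onLine line → ∃[ S ] S ∈ 𝒫 × Φ Q S ≡ v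

  I : QuadraticForm → Sub Point → Sub Sphere → ℕ
  I Q P 𝒮 = count (List.cartesianProduct allPoints allSpheres)
                  (λ (p , S) → P p ∧ 𝒮 S ∧ pointsOf Q S p)

  degree : QuadraticForm → Sub Sphere → Point → ℕ
  degree Q 𝒮 p = count allSpheres (λ S → 𝒮 S ∧ pointsOf Q S p)

  σ : QuadraticForm → Sub Point → Sub Sphere → ℚ
  σ Q P 𝒮 = ℕ→ℚ (I Q P 𝒮) Q.- (+ (∣ P ∣ₚ ℕ.* ∣ 𝒮 ∣ₛ)) Q./ q

  -- The equation σ = K q √(|P||𝒮|) defining K.

  IsDensity : QuadraticForm → Sub Point → Sub Sphere → ℝ → Set
  IsDensity Q P 𝒮 K =
    ℝ.fromℚ (σ Q P 𝒮) ℝ.≃ K ℝ.* ℝ.fromℕ q ℝ.* ℝ.√ (ℝ.fromℕ (∣ P ∣ₚ ℕ.* ∣ 𝒮 ∣ₛ))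

  system : QuadraticForm → Sub Point → Sub Sphere → IncidenceSystem
  system Q P 𝒮 = record
    { Point    = [ p ∈ Point ∣ p ∈ P ]
    ; Object   = [ S ∈ Sphere ∣ S ∈ 𝒮 ]
    ; Incident = λ p S → Lies Q (value p) (value S)
    }

  -- Σ > 0, 0 < τ ≤ 1 and ε ≥ 0 are not part of the record.

  record CenteredBlockDecomposition
    (Q : QuadraticForm) (P : Sub Point) (𝒮 : Sub Sphere) (τ ε : ℝ) : Set where
    field
      m    : ℕ
      2≤m  : 2 ℕ.≤ m
      𝒮s   : Fin m → Sub Sphere
      As   : Fin m → Sub Point
      R′   : Sub Point
      sphere-partition : IsPartition 𝒮 𝒮s
      point-partition  : IsPartition P (R′ Vector.∷ As)

    offDiagonal : ℚ
    offDiagonal = List.foldr Q._+_ 0ℚ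
      (List.map (λ (i , j) → σ Q (As i) (𝒮s j) Q.⊔ 0ℚ)
        (List.filterᵇ (λ (i , j) → not (does (i Finₚ.≟ j)))
          (List.cartesianProduct (List.allFin m) (List.allFin m))))

    field
      diagonal  : ∀ i → τ ℝ.* ℝ.fromℚ (σ Q P 𝒮) ℝ.≤ ℝ.fromℚ (σ Q (As i) (𝒮s i))
      remainder : ℝ.fromℚ (σ Q R′ 𝒮) ℝ.≤ ε ℝ.* ℝ.fromℚ (σ Q P 𝒮)
      cross     : ℝ.fromℚ offDiagonal ℝ.≤ ε ℝ.* ℝ.fromℚ (σ Q P 𝒮)

  -- Coefficient lists, constant term first.

  Polynomial : Set
  Polynomial = List Carrier

  _+ᴾ_ : Polynomial → Polynomial → Polynomial
  []      +ᴾ g       = g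
  (a ∷ f) +ᴾ []      = a ∷ f
  (a ∷ f) +ᴾ (b ∷ g) = a + b ∷ f +ᴾ g

  -- (T - a) f = T f - a f

  timesLinear : Carrier → Polynomial → Polynomial
  timesLinear a f = (0# ∷ f) +ᴾ List.map (- a *_) f

  -- Subsets of the field are subsets of Fin q, through the enumeration.

  _∈ᶠ_ : Carrier → Subset q → Set
  t ∈ᶠ A = index t Subset.∈ A

  members : Subset q → List Carrier
  members A = List.filterᵇ (λ t → Vec.lookup A (index t)) elements

  sumOf : Subset q → Carrier
  sumOf A = List.foldr _+_ 0# (members A)

  rootPolynomial : Subset q → Polynomial
  rootPolynomial A = List.foldr timesLinear (1# ∷ []) (members A)

  𝒟₃₀ : IncidenceSystem
  𝒟₃₀ = record
    { Point    = [ A ∈ Subset q ∣ Subset.∣ A ∣ ≡ 3 × - sumOf A ≢ 0# ]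
    ; Object   = Carrier
    ; Incident = λ A t → t ∈ᶠ value A
    }

module TwistedCubic {q : ℕ} (F : FiniteField q) (R : FiniteField.Carrier F) where

  open FiniteField F
  open Geometry F

  Q₀ : QuadraticForm
  Q₀ = record { xx = 0# ; yy = 0# ; zz = 1# ; xy = 1# ; xz = 0# ; yz = 0# }

  S : Carrier → Sphere
  S t = (0# ∷ t * t * t ∷ t ∷ []) , R

  𝒮tc : Sub Sphere
  𝒮tc S′ = any (λ t → does (S′ ≟ˢ S t)) elements

  Ψ : Point → Polynomial
  Ψ (x ∷ y ∷ z ∷ []) =
      - ((x * y + z * z - R) * x ⁻¹)
    ∷ (1# + 1#) * z * x ⁻¹
    ∷ - (x ⁻¹)
    ∷ 1#
    ∷ []

  _∈𝔗 : Subset q → Set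
  A ∈𝔗 = Subset.∣ A ∣ ≡ 3 × sumOf A ≢ 0#

  -- p is the point p_A: Ψ is only defined where x ≠ 0.

  IsPointOf : Subset q → Point → Set
  IsPointOf A p = Vec.head p ≢ 0# × Ψ p ≡ rootPolynomial A

  ∈𝔗? : ∀ A → Dec (A ∈𝔗)
  ∈𝔗? A = (Subset.∣ A ∣ ℕₚ.≟ 3) ×-dec ¬? (sumOf A ≟ 0#)

  isPointOf? : ∀ A p → Dec (IsPointOf A p)
  isPointOf? A p = ¬? (Vec.head p ≟ 0#) ×-dec Listₚ.≡-dec _≟_ (Ψ p) (rootPolynomial A)

  Ptc : Sub Point
  Ptc p = does (anySubset? (λ A → ∈𝔗? A ×-dec isPointOf? A p))

-- By Vieta's formulas a point p with x ≠ 0 lies on S_t exactly when t is a root of Ψ(p), and a triple of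
-- distinct parameters with nonzero sum determines p.  All incidence numbers are therefore numbers of triples
-- of distinct field elements with nonzero sum, which are obtained by summing indicator functions.
--
-- Given a block decomposition, let U be the set of parameters of one block and V its complement.  The excess
-- of a triple over the class to which its point does not belong is bounded below by a cubic polynomial in
-- |A ∩ U|, whose sum over all triples is a count of mixed triples of order q |U| |V|.  The diagonal condition
-- forces U and V to be large, so the off-diagonal excess cannot be small.
--
-- A nondegenerate ternary form is isotropic because a x² and - c - b y² each take more than half of the
-- values; splitting off a hyperbolic plane makes it similar to Q₀, and a similitude maps spheres to spheres.

module Submission where

open import Algebra.Bundles using (CommutativeRing)
import Algebra.Properties.Ring as RingProperties
open import Algebra.Solver.Ring.AlmostCommutativeRing
  using (AlmostCommutativeRing; fromCommutativeRing; _-Raw-AlmostCommutative⟶_)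
import Algebra.Solver.Ring as RingSolver
open import Data.Bool.Base using (Bool; true; false; T; not; _∧_; if_then_else_)
import Data.Bool.Properties as Boolₚ
open import Data.Empty using (⊥; ⊥-elim)
open import Data.Fin.Base using (Fin; zero; suc)
import Data.Fin.Properties as Finₚ
import Data.Fin.Subset as Subset
open Subset using (Subset)
open import Data.Fin.Subset.Properties using (anySubset?)
open import Data.Integer.Base as ℤ using (ℤ; -[1+_])
import Data.Integer.Properties as ℤₚ
open import Data.Irrelevant using ([_])
open import Data.List.Base as List using (List; []; _∷_)
import Data.List.Properties as Listₚ
open import Data.List.Relation.Unary.All as All using (All; []; _∷_)
open import Data.List.Relation.Unary.Any as Any using (here; there)
import Data.List.Relation.Unary.Any.Properties as Anyₚ
open import Data.List.Relation.Unary.AllPairs using ([]; _∷_)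
open import Data.List.Relation.Unary.Unique.Propositional using (Unique)
import Data.List.Relation.Unary.Unique.Propositional.Properties as Uniqueₚ
import Data.List.Membership.Propositional as Membership
import Data.List.Membership.Propositional.Properties as Membershipₚ
open import Data.Maybe.Base using (Maybe; just; nothing)
open import Data.Nat.Base as ℕ using (ℕ; zero; suc)
open import Data.Nat.Divisibility using (_∣_; divides)
import Data.Nat.Properties as ℕₚ
open import Data.Product using (∃-syntax; Σ-syntax; ∃!; _×_; _,_; proj₁; proj₂)
import Data.Rational.Base as Q
open Q using (ℚ; 0ℚ; 1ℚ; ½)
import Data.Rational.Properties as ℚₚ
import Data.Rational.Solver as ℚSolver
import Data.Rational.Unnormalised.Base as ℚᵘ
import Data.Rational.Unnormalised.Properties as ℚᵘₚ
open import Data.Refinement using (Refinement; value; _,_)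
open import Data.Refinement.Properties using (value-injective)
open import Data.Sum.Base using (_⊎_; inj₁; inj₂)
open import Data.Unit.Base using (tt)
open import Data.Vec.Base as Vec using (Vec; []; _∷_)
import Data.Vec.Functional as Vector
import Data.Vec.Properties as Vecₚ
open import Function.Base using (_∘_; id)
open import Function.Bundles using (_⇔_; mk⇔; mk↔ₛ′; module Inverse; module Equivalence)
open import Relation.Binary.PropositionalEquality
  using (_≡_; _≢_; refl; sym; trans; cong; cong₂; subst; subst₂; module ≡-Reasoning)
open import Relation.Binary.Bundles using (Setoid)
import Relation.Binary.Reasoning.Setoid as SetoidReasoning
open import Relation.Nullary.Decidable using (Dec; yes; no; does; ¬?; _×-dec_; dec-true; dec-false; recompute)
open import Relation.Nullary.Negation using (¬_; contradiction)
open import Defs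
open ℝ using (ℝ; fromℕ; fromℚ; √)

-- The cubic cost is the Lagrange interpolant of the smaller of the two excesses at 0, 1, 2, 3: each
-- of its four terms is a product of binomials that picks out the triples of one type. Inserting the
-- counts, with u = |U| and v = |V|, gives at least (u² + v²)(2uv - 3q + 3)/(6q). Triples of sum
-- zero and coinciding parameters cost only the part linear in q, so it is enough that uv exceeds a
-- multiple of q.
--
-- This is where the constants come from. Let D be a common lower bound of two diagonal excesses,
-- and X the sum of the cross terms and the size of the remainder. A sphere contains at most (q -
-- 1)(q - 2)/2 points, whence D ≤ q u v. The condition q ≥ 96/τ yields D ≥ 12q², and ε ≤ τ²/144
-- yields X ≤ D/48. The cost bound becomes 2D - 3q² ≤ 12X, which is then impossible.
--
-- All counting takes place in ℚ, where indicators, averages and ring identities can be treated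
-- uniformly; statements about natural numbers are pulled back along `ℕ→ℚ`.

-- Finite sums of rational indicator functions.

module Sums where

  open Q using (_+_; _*_; _-_; -_; _≤_)
  open ℚₚ
  open ℚSolver.+-*-Solver using (solve; _:+_; _:*_; _:-_; :-_; _:=_; con)

  -- Polynomial inequalities are brought to this form: a visibly nonnegative slack `d` and an
  -- identity for the ring solver.
  ≤-by : ∀ {p q d} → 0ℚ ≤ d → q ≡ p + d → p ≤ q
  ≤-by {p} {q} {d} 0≤d eq = subst₂ _≤_ (+-identityʳ p) (sym eq) (+-monoʳ-≤ p 0≤d)

  ≤⇒0≤- : ∀ {p q} → p ≤ q → 0ℚ ≤ q - p
  ≤⇒0≤- {p} {q} p≤q = subst (_≤ q - p) (+-inverseʳ p) (+-monoˡ-≤ (- p) p≤q)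

  0≤+ : ∀ {p q} → 0ℚ ≤ p → 0ℚ ≤ q → 0ℚ ≤ p + q
  0≤+ {p} {q} 0≤p 0≤q = subst (_≤ p + q) (+-identityʳ 0ℚ) (+-mono-≤ 0≤p 0≤q)

  0≤* : ∀ {p q} → 0ℚ ≤ p → 0ℚ ≤ q → 0ℚ ≤ p * q
  0≤* {p} {q} 0≤p 0≤q = subst (_≤ p * q) (*-zeroˡ q) (*-monoʳ-≤-nonNeg q {{Q.nonNegative 0≤q}} 0≤p)

  0≤1 : 0ℚ ≤ 1ℚ
  0≤1 = nonNegative⁻¹ 1ℚ

  *-cancelˡ : ∀ r {p q} → r ≢ 0ℚ → r * p ≡ r * q → p ≡ q
  *-cancelˡ r {p} {q} r≢0 eq = begin
    p                ≡⟨ *-identityˡ p ⟨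
    1ℚ * p           ≡⟨ cong (_* p) (*-inverseˡ r {{Q.≢-nonZero r≢0}}) ⟨
    r⁻¹ * r * p      ≡⟨ *-assoc r⁻¹ r p ⟩
    r⁻¹ * (r * p)    ≡⟨ cong (r⁻¹ *_) eq ⟩
    r⁻¹ * (r * q)    ≡⟨ *-assoc r⁻¹ r q ⟨
    r⁻¹ * r * q      ≡⟨ cong (_* q) (*-inverseˡ r {{Q.≢-nonZero r≢0}}) ⟩
    1ℚ * q           ≡⟨ *-identityˡ q ⟩
    q                ∎
    where
    open ≡-Reasoning
    r⁻¹ = (Q.1/ r) {{Q.≢-nonZero r≢0}}

  ℕ→ℚ-+ : ∀ m n → ℕ→ℚ (m ℕ.+ n) ≡ ℕ→ℚ m + ℕ→ℚ n
  ℕ→ℚ-+ zero    n = sym (+-identityˡ (ℕ→ℚ n))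
  ℕ→ℚ-+ (suc m) n = begin
    ℕ→ℚ (suc m ℕ.+ n)         ≡⟨ Rational.ℕ→ℚ-suc (m ℕ.+ n) ⟩
    1ℚ + ℕ→ℚ (m ℕ.+ n)        ≡⟨ cong (λ z → 1ℚ + z) (ℕ→ℚ-+ m n) ⟩
    1ℚ + (ℕ→ℚ m + ℕ→ℚ n)      ≡⟨ +-assoc 1ℚ (ℕ→ℚ m) (ℕ→ℚ n) ⟨
    1ℚ + ℕ→ℚ m + ℕ→ℚ n        ≡⟨ cong (_+ ℕ→ℚ n) (Rational.ℕ→ℚ-suc m) ⟨
    ℕ→ℚ (suc m) + ℕ→ℚ n       ∎
    where open ≡-Reasoning

  ℕ→ℚ-mono : ∀ {m n} → m ℕ.≤ n → ℕ→ℚ m ≤ ℕ→ℚ n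
  ℕ→ℚ-mono {m} m≤n with k , refl ← ℕₚ.m≤n⇒∃[o]m+o≡n m≤n =
    ≤-by (Rational.ℕ→ℚ-nonNeg k) (ℕ→ℚ-+ m k)

  ℕ→ℚ-cancel-≤ : ∀ {m n} → ℕ→ℚ m ≤ ℕ→ℚ n → m ℕ.≤ n
  ℕ→ℚ-cancel-≤ {m} {n} h with m ℕₚ.≤? n
  ... | yes m≤n = m≤n
  ... | no  m≰n with k , refl ← ℕₚ.m≤n⇒∃[o]m+o≡n (ℕₚ.≰⇒> m≰n) =
    contradiction (≤-trans (≤-reflexive (sym (ℕ→ℚ-+ (suc n) k))) h)
      (<⇒≱ (<-≤-trans (subst (ℕ→ℚ n Q.<_) (trans (+-comm (ℕ→ℚ n) 1ℚ) (sym (Rational.ℕ→ℚ-suc n)))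
                         (Rational.+-posʳ (ℕ→ℚ n) (positive⁻¹ 1ℚ)))
                       (≤-by (Rational.ℕ→ℚ-nonNeg k) refl)))
    where
    <⇒≱ : ∀ {p q} → p Q.< q → ¬ q ≤ p
    <⇒≱ p<q q≤p = <-irrefl refl (<-≤-trans p<q q≤p)

  ℕ→ℚ-injective : ∀ {m n} → ℕ→ℚ m ≡ ℕ→ℚ n → m ≡ n
  ℕ→ℚ-injective eq = ℕₚ.≤-antisym (ℕ→ℚ-cancel-≤ (≤-reflexive eq)) (ℕ→ℚ-cancel-≤ (≤-reflexive (sym eq)))

  ℕ→ℚ-∸ : ∀ {m n} → n ℕ.≤ m → ℕ→ℚ (m ℕ.∸ n) ≡ ℕ→ℚ m - ℕ→ℚ n
  ℕ→ℚ-∸ {m} {n} n≤m = begin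
    ℕ→ℚ (m ℕ.∸ n)                      ≡⟨ solve 2 (λ x y → x := x :+ y :- y) refl (ℕ→ℚ (m ℕ.∸ n)) (ℕ→ℚ n) ⟩
    ℕ→ℚ (m ℕ.∸ n) + ℕ→ℚ n - ℕ→ℚ n      ≡⟨ cong (_- ℕ→ℚ n) (ℕ→ℚ-+ (m ℕ.∸ n) n) ⟨
    ℕ→ℚ (m ℕ.∸ n ℕ.+ n) - ℕ→ℚ n        ≡⟨ cong (λ z → ℕ→ℚ z - ℕ→ℚ n) (ℕₚ.m∸n+n≡m n≤m) ⟩
    ℕ→ℚ m - ℕ→ℚ n                      ∎
    where open ≡-Reasoning

  𝟙 : Bool → ℚ
  𝟙 true  = 1ℚ
  𝟙 false = 0ℚ

  0≤𝟙 : ∀ b → 0ℚ ≤ 𝟙 b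
  0≤𝟙 true  = 0≤1
  0≤𝟙 false = ≤-refl

  𝟙≤1 : ∀ b → 𝟙 b ≤ 1ℚ
  𝟙≤1 true  = ≤-refl
  𝟙≤1 false = 0≤1

  𝟙-∧ : ∀ a b → 𝟙 (a ∧ b) ≡ 𝟙 a * 𝟙 b
  𝟙-∧ true  b = sym (*-identityˡ (𝟙 b))
  𝟙-∧ false b = sym (*-zeroˡ (𝟙 b))

  𝟙-not : ∀ b → 𝟙 (not b) ≡ 1ℚ - 𝟙 b
  𝟙-not true  = refl
  𝟙-not false = refl

  𝟙-idem : ∀ b → 𝟙 b * 𝟙 b ≡ 𝟙 b
  𝟙-idem true  = refl
  𝟙-idem false = refl

  𝟙-T : ∀ {b} → T b → 𝟙 b ≡ 1ℚ
  𝟙-T {true} _ = refl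

  𝟙-¬T : ∀ {b} → ¬ T b → 𝟙 b ≡ 0ℚ
  𝟙-¬T {false} _ = refl
  𝟙-¬T {true}  h = ⊥-elim (h tt)

  -- An identity multiplied by an indicator has to be checked only where the indicator is 1. This
  -- brings facts about points of the system into sums over all points.
  𝟙-guard : ∀ b {x y} → (T b → x ≡ y) → 𝟙 b * x ≡ 𝟙 b * y
  𝟙-guard true  h = cong (λ z → 1ℚ * z) (h tt)
  𝟙-guard false {x} {y} h = trans (*-zeroˡ x) (sym (*-zeroˡ y))

  T-ext : ∀ {a b} → (T a → T b) → (T b → T a) → a ≡ b
  T-ext {true}  {true}  f g = refl
  T-ext {true}  {false} f g = ⊥-elim (f tt)
  T-ext {false} {true}  f g = ⊥-elim (g tt)
  T-ext {false} {false} f g = refl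

  T-does : ∀ {P : Set} (P? : Dec P) → P → T (does P?)
  T-does (yes _) _ = tt
  T-does (no ¬p) p = ⊥-elim (¬p p)

  does-T : ∀ {P : Set} (P? : Dec P) → T (does P?) → P
  does-T (yes p) _ = p

  ∧-T : ∀ {a b} → T a → T b → T (a ∧ b)
  ∧-T {true} _ b = b

  T-∧₁ : ∀ {a b} → T (a ∧ b) → T a
  T-∧₁ {true} _ = tt

  T-∧₂ : ∀ {a b} → T (a ∧ b) → T b
  T-∧₂ {true} b = b

  private variable A B : Set

  Σ : List A → (A → ℚ) → ℚ
  Σ []       f = 0ℚ
  Σ (x ∷ xs) f = f x + Σ xs f

  infixr 5 Σ
  syntax Σ xs (λ x → e) = ∑[ x ← xs ] e

  Σ-cong : ∀ (xs : List A) {f g : A → ℚ} → (∀ x → f x ≡ g x) → Σ xs f ≡ Σ xs g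
  Σ-cong []       h = refl
  Σ-cong (x ∷ xs) h = cong₂ _+_ (h x) (Σ-cong xs h)

  Σ-mono : ∀ (xs : List A) {f g : A → ℚ} → (∀ x → f x ≤ g x) → Σ xs f ≤ Σ xs g
  Σ-mono []       h = ≤-refl
  Σ-mono (x ∷ xs) h = +-mono-≤ (h x) (Σ-mono xs h)

  Σ-zero : ∀ (xs : List A) → Σ xs (λ _ → 0ℚ) ≡ 0ℚ
  Σ-zero []       = refl
  Σ-zero (x ∷ xs) = trans (+-identityˡ _) (Σ-zero xs)

  Σ-+ : ∀ (xs : List A) (f g : A → ℚ) → Σ xs (λ x → f x + g x) ≡ Σ xs f + Σ xs g
  Σ-+ []       f g = refl
  Σ-+ (x ∷ xs) f g = trans (cong (λ z → f x + g x + z) (Σ-+ xs f g))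
    (solve 4 (λ a b c d → a :+ b :+ (c :+ d) := a :+ c :+ (b :+ d)) refl (f x) (g x) (Σ xs f) (Σ xs g))

  Σ-neg : ∀ (xs : List A) (f : A → ℚ) → Σ xs (λ x → - f x) ≡ - Σ xs f
  Σ-neg []       f = refl
  Σ-neg (x ∷ xs) f = trans (cong (- f x +_) (Σ-neg xs f)) (sym (neg-distrib-+ (f x) (Σ xs f)))

  Σ-- : ∀ (xs : List A) (f g : A → ℚ) → Σ xs (λ x → f x - g x) ≡ Σ xs f - Σ xs g
  Σ-- xs f g = trans (Σ-+ xs f (λ x → - g x)) (cong (Σ xs f +_) (Σ-neg xs g))

  Σ-*ˡ : ∀ (xs : List A) c (f : A → ℚ) → Σ xs (λ x → c * f x) ≡ c * Σ xs f
  Σ-*ˡ []       c f = sym (*-zeroʳ c)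
  Σ-*ˡ (x ∷ xs) c f = trans (cong (c * f x +_) (Σ-*ˡ xs c f)) (sym (*-distribˡ-+ c (f x) (Σ xs f)))

  Σ-*ʳ : ∀ (xs : List A) (f : A → ℚ) c → Σ xs (λ x → f x * c) ≡ Σ xs f * c
  Σ-*ʳ xs f c = trans (Σ-cong xs (λ x → *-comm (f x) c)) (trans (Σ-*ˡ xs c f) (*-comm c (Σ xs f)))

  Σ-const : ∀ (xs : List A) c → Σ xs (λ _ → c) ≡ ℕ→ℚ (List.length xs) * c
  Σ-const []       c = sym (*-zeroˡ c)
  Σ-const (x ∷ xs) c = begin
    c + Σ xs (λ _ → c)             ≡⟨ cong (c +_) (Σ-const xs c) ⟩
    c + ℕ→ℚ n * c                  ≡⟨ solve 2 (λ c n → c :+ n :* c := (con 1ℚ :+ n) :* c) refl c (ℕ→ℚ n) ⟩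
    (1ℚ + ℕ→ℚ n) * c               ≡⟨ cong (_* c) (Rational.ℕ→ℚ-suc n) ⟨
    ℕ→ℚ (suc n) * c                ∎
    where
    open ≡-Reasoning
    n = List.length xs

  Σ-swap : ∀ (xs : List A) (ys : List B) (f : A → B → ℚ) →
           ∑[ x ← xs ] ∑[ y ← ys ] f x y ≡ ∑[ y ← ys ] ∑[ x ← xs ] f x y
  Σ-swap []       ys f = sym (Σ-zero ys)
  Σ-swap (x ∷ xs) ys f = trans (cong (Σ ys (f x) +_) (Σ-swap xs ys f))
    (sym (Σ-+ ys (f x) (λ y → ∑[ x ← xs ] f x y)))

  Σ-++ : ∀ (xs ys : List A) (f : A → ℚ) → Σ (xs List.++ ys) f ≡ Σ xs f + Σ ys f
  Σ-++ []       ys f = sym (+-identityˡ (Σ ys f))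
  Σ-++ (x ∷ xs) ys f = trans (cong (f x +_) (Σ-++ xs ys f)) (sym (+-assoc (f x) (Σ xs f) (Σ ys f)))

  Σ-map : ∀ (g : A → B) (xs : List A) (f : B → ℚ) → Σ (List.map g xs) f ≡ Σ xs (f ∘ g)
  Σ-map g []       f = refl
  Σ-map g (x ∷ xs) f = cong (f (g x) +_) (Σ-map g xs f)

  Σ-cartesianProduct : ∀ (xs : List A) (ys : List B) (f : A × B → ℚ) →
    Σ (List.cartesianProduct xs ys) f ≡ ∑[ x ← xs ] ∑[ y ← ys ] f (x , y)
  Σ-cartesianProduct []       ys f = refl
  Σ-cartesianProduct (x ∷ xs) ys f = trans
    (Σ-++ (List.map (x ,_) ys) (List.cartesianProduct xs ys) f)
    (cong₂ _+_ (Σ-map (x ,_) ys f) (Σ-cartesianProduct xs ys f))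

  count≡Σ : ∀ (xs : List A) (X : Sub A) → ℕ→ℚ (count xs X) ≡ ∑[ x ← xs ] 𝟙 (X x)
  count≡Σ []       X = refl
  count≡Σ (x ∷ xs) X with X x
  ... | true  = trans (Rational.ℕ→ℚ-suc (count xs X)) (cong (λ z → 1ℚ + z) (count≡Σ xs X))
  ... | false = trans (count≡Σ xs X) (sym (+-identityˡ _))

  -- With these two properties a sum over the list is a sum over the type, each element being taken
  -- once.
  record Listing (xs : List A) : Set where
    field
      unique   : Unique xs
      complete : ∀ x → x Membership.∈ xs

  open Listing public

  δ-list : ∀ {xs : List A} (_≟_ : (x y : A) → Dec (x ≡ y)) a (f : A → ℚ) → Unique xs → a Membership.∈ xs →
           ∑[ x ← xs ] 𝟙 (does (a ≟ x)) * f x ≡ f a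
  δ-list {xs = x ∷ xs} _≟_ a f (x∉ ∷ u) (here refl) with a ≟ a
  ... | no a≢a = ⊥-elim (a≢a refl)
  ... | yes _  = trans (cong₂ _+_ (*-identityˡ (f a)) (rest xs x∉)) (+-identityʳ (f a))
    where
    rest : ∀ ys → All (a ≢_) ys → ∑[ x ← ys ] 𝟙 (does (a ≟ x)) * f x ≡ 0ℚ
    rest []       _ = refl
    rest (y ∷ ys) (a≢y ∷ h) with a ≟ y
    ... | yes a≡y = ⊥-elim (a≢y a≡y)
    ... | no _    = trans (cong₂ _+_ (*-zeroˡ (f y)) (rest ys h)) (+-identityʳ 0ℚ)
  δ-list {xs = x ∷ xs} _≟_ a f (x∉ ∷ u) (there a∈) with a ≟ x
  ... | yes refl = ⊥-elim (All.lookup x∉ a∈ refl)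
  ... | no _     = trans (cong₂ _+_ (*-zeroˡ (f x)) (δ-list _≟_ a f u a∈)) (+-identityˡ (f a))

  Σ-δ : ∀ {xs : List A} → Listing xs → (_≟_ : (x y : A) → Dec (x ≡ y)) → ∀ a (f : A → ℚ) →
        ∑[ x ← xs ] 𝟙 (does (a ≟ x)) * f x ≡ f a
  Σ-δ l _≟_ a f = δ-list _≟_ a f (unique l) (complete l a)

  Σ-single : ∀ {xs : List A} → Listing xs → (_≟_ : (x y : A) → Dec (x ≡ y)) → ∀ a (f : A → ℚ) →
             (∀ x → x ≢ a → f x ≡ 0ℚ) → Σ xs f ≡ f a
  Σ-single {xs = xs} l _≟_ a f h = trans (Σ-cong xs only) (Σ-δ l _≟_ a f)
    where
    only : ∀ x → f x ≡ 𝟙 (does (a ≟ x)) * f x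
    only x with a ≟ x
    ... | yes _   = sym (*-identityˡ (f x))
    ... | no  a≢x = trans (h x (a≢x ∘ sym)) (sym (*-zeroˡ (f x)))

  module Finite {xs : List A} {ys : List B} (l : Listing xs) (m : Listing ys)
                (_≟A_ : (x y : A) → Dec (x ≡ y)) (_≟B_ : (x y : B) → Dec (x ≡ y)) where

    -- For x in the image, 1 is the sum over y of the indicator of f y = x. Inserting it and
    -- interchanging the sums gives the claim, since `h` vanishes off the image.
    Σ-reindex : (f : B → A) → (∀ {x y} → f x ≡ f y → x ≡ y) → (h : A → ℚ) →
                (∀ x → (∀ y → f y ≢ x) → h x ≡ 0ℚ) → Σ xs h ≡ Σ ys (h ∘ f)
    Σ-reindex f inj h outside = begin
      Σ xs h                                                ≡⟨ Σ-cong xs hits ⟩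
      ∑[ x ← xs ] ∑[ y ← ys ] 𝟙 (does (f y ≟A x)) * h x     ≡⟨ Σ-swap xs ys _ ⟩
      ∑[ y ← ys ] ∑[ x ← xs ] 𝟙 (does (f y ≟A x)) * h x     ≡⟨ Σ-cong ys (λ y → Σ-δ l _≟A_ (f y) h) ⟩
      Σ ys (h ∘ f)                                          ∎
      where
      open ≡-Reasoning
      hits : ∀ x → h x ≡ ∑[ y ← ys ] 𝟙 (does (f y ≟A x)) * h x
      hits x with Any.any? (λ y → f y ≟A x) ys
      ... | yes p with y₀ , refl ← Any.satisfied p = sym (trans
        (Σ-single m _≟B_ y₀ _ (λ y y≢ → trans (cong (λ b → 𝟙 b * h x)
          (dec-false (f y ≟A x) (λ e → y≢ (inj e)))) (*-zeroˡ (h x))))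
        (trans (cong (λ b → 𝟙 b * h x) (dec-true (f y₀ ≟A x) refl)) (*-identityˡ (h x))))
      ... | no ¬p = trans (outside x miss) (sym (trans (Σ-cong ys (λ y →
        trans (cong (λ b → 𝟙 b * h x) (dec-false (f y ≟A x) (miss y))) (*-zeroˡ (h x)))) (Σ-zero ys)))
        where
        miss : ∀ y → f y ≢ x
        miss y e = ¬p (Membership.lose (complete m y) e)

    fibre : (A → B) → B → ℚ
    fibre f y = ∑[ x ← xs ] 𝟙 (does (f x ≟B y))

    Σ-fibre : (f : A → B) → ∑[ y ← ys ] fibre f y ≡ ℕ→ℚ (List.length xs)
    Σ-fibre f = begin
      ∑[ y ← ys ] fibre f y                                ≡⟨ Σ-swap xs ys _ ⟨
      ∑[ x ← xs ] ∑[ y ← ys ] 𝟙 (does (f x ≟B y))          ≡⟨ Σ-cong xs one ⟩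
      ∑[ x ← xs ] 1ℚ                                       ≡⟨ Σ-const xs 1ℚ ⟩
      ℕ→ℚ (List.length xs) * 1ℚ                            ≡⟨ *-identityʳ _ ⟩
      ℕ→ℚ (List.length xs)                                 ∎
      where
      open ≡-Reasoning
      one : ∀ x → ∑[ y ← ys ] 𝟙 (does (f x ≟B y)) ≡ 1ℚ
      one x = trans (Σ-cong ys (λ y → sym (*-identityʳ _))) (Σ-δ m _≟B_ (f x) (λ _ → 1ℚ))

    fibre-empty : (f : A → B) → ∀ y → (∀ x → f x ≢ y) → fibre f y ≡ 0ℚ
    fibre-empty f y h = trans (Σ-cong xs (λ x → cong 𝟙 (dec-false (f x ≟B y) (h x)))) (Σ-zero xs)

    fibre-injective : (f : A → B) → (∀ {x y} → f x ≡ f y → x ≡ y) → ∀ y → fibre f y ≤ 1ℚ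
    fibre-injective f inj y with Any.any? (λ x → f x ≟B y) xs
    ... | no ¬p = ≤-trans (≤-reflexive (fibre-empty f y λ x e → ¬p (Membership.lose (complete l x) e))) 0≤1
    ... | yes p with x₀ , refl ← Any.satisfied p = ≤-trans (≤-reflexive
      (Σ-single l _≟A_ x₀ _ (λ x x≢ → cong 𝟙 (dec-false (f x ≟B y) (λ e → x≢ (inj e)))))) (𝟙≤1 (does (f x₀ ≟B f x₀)))

    -- The fibre sizes add up to the length of `xs`, and each of them is at most 1.
    injective⇒length≤ : (f : A → B) → (∀ {x y} → f x ≡ f y → x ≡ y) → List.length xs ℕ.≤ List.length ys
    injective⇒length≤ f inj = ℕ→ℚ-cancel-≤ (subst₂ _≤_ (Σ-fibre f)
      (trans (Σ-const ys 1ℚ) (*-identityʳ _)) (Σ-mono ys (fibre-injective f inj)))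

    -- A missed value `y₀` has an empty fibre, so the fibre sizes would add up to at most one less
    -- than the length of `ys`.
    injective⇒surjective : (f : A → B) → (∀ {x y} → f x ≡ f y → x ≡ y) →
                           List.length ys ℕ.≤ List.length xs → ∀ y → ∃[ x ] f x ≡ y
    injective⇒surjective f inj ys≤xs y₀ with Any.any? (λ x → f x ≟B y₀) xs
    ... | yes p = Any.satisfied p
    ... | no ¬p = ⊥-elim (<-irrefl refl (<-≤-trans
      (subst₂ Q._<_ (+-identityʳ _) refl (+-monoʳ-< (ℕ→ℚ (List.length ys)) (positive⁻¹ 1ℚ)))
      (≤-trans (+-monoˡ-≤ 1ℚ (≤-trans (ℕ→ℚ-mono ys≤xs)
        (≤-trans (≤-reflexive (sym (Σ-fibre f))) (Σ-mono ys bound))))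
        (≤-reflexive total))))
      where
      d : B → ℚ
      d y = 𝟙 (does (y₀ ≟B y)) * 1ℚ
      bound : ∀ y → fibre f y ≤ 1ℚ - d y
      bound y with y₀ ≟B y
      ... | yes refl = ≤-reflexive (fibre-empty f y λ x e → ¬p (Membership.lose (complete l x) e))
      ... | no _     = fibre-injective f inj y
      total : Σ ys (λ y → 1ℚ - d y) + 1ℚ ≡ ℕ→ℚ (List.length ys)
      total = begin
        Σ ys (λ y → 1ℚ - d y) + 1ℚ     ≡⟨ cong (_+ 1ℚ) (Σ-- ys (λ _ → 1ℚ) d) ⟩
        Σ ys (λ _ → 1ℚ) - Σ ys d + 1ℚ  ≡⟨ cong (λ z → Σ ys (λ _ → 1ℚ) - z + 1ℚ) (Σ-δ m _≟B_ y₀ (λ _ → 1ℚ)) ⟩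
        Σ ys (λ _ → 1ℚ) - 1ℚ + 1ℚ      ≡⟨ solve 1 (λ a → a :- con 1ℚ :+ con 1ℚ := a) refl (Σ ys (λ _ → 1ℚ)) ⟩
        Σ ys (λ _ → 1ℚ)                ≡⟨ Σ-const ys 1ℚ ⟩
        ℕ→ℚ (List.length ys) * 1ℚ      ≡⟨ *-identityʳ _ ⟩
        ℕ→ℚ (List.length ys)           ∎
        where open ≡-Reasoning

open Sums

-- Arithmetic in a finite field, with a ring solver over integer coefficients.

module FieldTheory where

  module FieldAlgebra {q : ℕ} (F : FiniteField q) where

    open FiniteField F
    open Listing

    commutativeRing : CommutativeRing _ _
    commutativeRing = record { isCommutativeRing = isCommutativeRing }

    almostCommutativeRing : AlmostCommutativeRing _ _
    almostCommutativeRing = fromCommutativeRing commutativeRing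

    open CommutativeRing commutativeRing public
      using (+-assoc; +-comm; +-identityˡ; +-identityʳ; *-assoc; *-comm; *-identityˡ; *-identityʳ;
             zeroˡ; zeroʳ; distribˡ; distribʳ; -‿inverseˡ; -‿inverseʳ; ring)
    open RingProperties ring public using (-‿distribˡ-*; -‿distribʳ-*; -‿involutive; -0#≈0#)

    -- The separate clause for 1 lets the integer constants 1 and 2 reduce to `1#` and `1# + 1#`, so
    -- that solved identities agree by conversion with the expressions in the definitions.
    multiple : ℕ → Carrier
    multiple 0             = 0#
    multiple 1             = 1#
    multiple (suc (suc n)) = 1# + multiple (suc n)

    fromℤ : ℤ → Carrier
    fromℤ (ℤ.+ n)  = multiple n
    fromℤ -[1+ n ] = - multiple (suc n)

    private
      multiple-suc : ∀ n → multiple (suc n) ≡ 1# + multiple n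
      multiple-suc zero    = sym (+-identityʳ 1#)
      multiple-suc (suc n) = refl

      multiple-+ : ∀ m n → multiple (m ℕ.+ n) ≡ multiple m + multiple n
      multiple-+ zero    n = sym (+-identityˡ (multiple n))
      multiple-+ (suc m) n = begin
        multiple (suc (m ℕ.+ n))          ≡⟨ multiple-suc (m ℕ.+ n) ⟩
        1# + multiple (m ℕ.+ n)           ≡⟨ cong (λ z → 1# + z) (multiple-+ m n) ⟩
        1# + (multiple m + multiple n)    ≡⟨ +-assoc 1# (multiple m) (multiple n) ⟨
        1# + multiple m + multiple n      ≡⟨ cong (_+ multiple n) (multiple-suc m) ⟨
        multiple (suc m) + multiple n     ∎
        where open ≡-Reasoning

      multiple-* : ∀ m n → multiple (m ℕ.* n) ≡ multiple m * multiple n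
      multiple-* zero    n = sym (zeroˡ (multiple n))
      multiple-* (suc m) n = begin
        multiple (n ℕ.+ m ℕ.* n)                    ≡⟨ multiple-+ n (m ℕ.* n) ⟩
        multiple n + multiple (m ℕ.* n)             ≡⟨ cong₂ _+_ (sym (*-identityˡ (multiple n))) (multiple-* m n) ⟩
        1# * multiple n + multiple m * multiple n   ≡⟨ distribʳ (multiple n) 1# (multiple m) ⟨
        (1# + multiple m) * multiple n              ≡⟨ cong (_* multiple n) (multiple-suc m) ⟨
        multiple (suc m) * multiple n               ∎
        where open ≡-Reasoning

      -‿+ : ∀ x y → - (x + y) ≡ - x + - y
      -‿+ x y = sym (AlmostCommutativeRing.-‿+-comm almostCommutativeRing x y)

      cancel : ∀ a x y → (a + x) + - (a + y) ≡ x + - y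
      cancel a x y = begin
        (a + x) + - (a + y)     ≡⟨ cong ((a + x) +_) (-‿+ a y) ⟩
        (a + x) + (- a + - y)   ≡⟨ cong (_+ (- a + - y)) (+-comm a x) ⟩
        (x + a) + (- a + - y)   ≡⟨ +-assoc x a (- a + - y) ⟩
        x + (a + (- a + - y))   ≡⟨ cong (x +_) (+-assoc a (- a) (- y)) ⟨
        x + ((a + - a) + - y)   ≡⟨ cong (λ z → x + (z + - y)) (-‿inverseʳ a) ⟩
        x + (0# + - y)          ≡⟨ cong (x +_) (+-identityˡ (- y)) ⟩
        x + - y                 ∎
        where open ≡-Reasoning

      fromℤ-⊖ : ∀ m n → fromℤ (m ℤ.⊖ n) ≡ multiple m + - multiple n
      fromℤ-⊖ m       zero    = sym (trans (cong (multiple m +_) -0#≈0#) (+-identityʳ (multiple m)))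
      fromℤ-⊖ zero    (suc n) = sym (+-identityˡ _)
      fromℤ-⊖ (suc m) (suc n) = trans (cong fromℤ (ℤₚ.[1+m]⊖[1+n]≡m⊖n m n))
        (trans (fromℤ-⊖ m n) (sym (trans (cong₂ (λ a b → a + - b) (multiple-suc m) (multiple-suc n))
          (cancel 1# (multiple m) (multiple n)))))

      fromℤ-+ : ∀ i j → fromℤ (i ℤ.+ j) ≡ fromℤ i + fromℤ j
      fromℤ-+ (ℤ.+ m)  (ℤ.+ n)  = multiple-+ m n
      fromℤ-+ (ℤ.+ m)  -[1+ n ] = fromℤ-⊖ m (suc n)
      fromℤ-+ -[1+ m ] (ℤ.+ n)  = trans (fromℤ-⊖ n (suc m)) (+-comm (multiple n) _)
      fromℤ-+ -[1+ m ] -[1+ n ] = trans (cong (λ k → - multiple k) (sym (ℕₚ.+-suc (suc m) n)))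
        (trans (cong -_ (multiple-+ (suc m) (suc n))) (-‿+ (multiple (suc m)) (multiple (suc n))))

      fromℤ-neg : ∀ i → fromℤ (ℤ.- i) ≡ - fromℤ i
      fromℤ-neg (ℤ.+ zero)  = sym -0#≈0#
      fromℤ-neg (ℤ.+ suc n) = refl
      fromℤ-neg -[1+ n ]    = sym (-‿involutive _)

      fromℤ-*-+ : ∀ m j → fromℤ (ℤ.+ m ℤ.* j) ≡ multiple m * fromℤ j
      fromℤ-*-+ m (ℤ.+ n)  = trans (cong fromℤ (sym (ℤₚ.pos-* m n))) (multiple-* m n)
      fromℤ-*-+ m -[1+ n ] = begin
        fromℤ (ℤ.+ m ℤ.* ℤ.- (ℤ.+ suc n))     ≡⟨ cong fromℤ (ℤₚ.neg-distribʳ-* (ℤ.+ m) (ℤ.+ suc n)) ⟨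
        fromℤ (ℤ.- (ℤ.+ m ℤ.* ℤ.+ suc n))     ≡⟨ fromℤ-neg (ℤ.+ m ℤ.* ℤ.+ suc n) ⟩
        - fromℤ (ℤ.+ m ℤ.* ℤ.+ suc n)         ≡⟨ cong -_ (fromℤ-*-+ m (ℤ.+ suc n)) ⟩
        - (multiple m * multiple (suc n))           ≡⟨ -‿distribʳ-* (multiple m) (multiple (suc n)) ⟩
        multiple m * - multiple (suc n)             ∎
        where open ≡-Reasoning

      fromℤ-* : ∀ i j → fromℤ (i ℤ.* j) ≡ fromℤ i * fromℤ j
      fromℤ-* (ℤ.+ m)  j = fromℤ-*-+ m j
      fromℤ-* -[1+ m ] j = begin
        fromℤ (ℤ.- (ℤ.+ suc m) ℤ.* j)     ≡⟨ cong fromℤ (ℤₚ.neg-distribˡ-* (ℤ.+ suc m) j) ⟨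
        fromℤ (ℤ.- (ℤ.+ suc m ℤ.* j))     ≡⟨ fromℤ-neg (ℤ.+ suc m ℤ.* j) ⟩
        - fromℤ (ℤ.+ suc m ℤ.* j)         ≡⟨ cong -_ (fromℤ-*-+ (suc m) j) ⟩
        - (multiple (suc m) * fromℤ j)        ≡⟨ -‿distribˡ-* (multiple (suc m)) (fromℤ j) ⟩
        (- multiple (suc m)) * fromℤ j          ∎
        where open ≡-Reasoning

    morphism : CommutativeRing.rawRing ℤₚ.+-*-commutativeRing -Raw-AlmostCommutative⟶ almostCommutativeRing
    morphism = record
      { ⟦_⟧ = fromℤ ; +-homo = fromℤ-+ ; *-homo = fromℤ-* ; -‿homo = fromℤ-neg
      ; 0-homo = refl ; 1-homo = refl }

    -- A semidecision: different integers may still have the same image in the field, and `nothing`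
    -- claims no inequality.
    equal? : ∀ i j → Maybe (fromℤ i ≡ fromℤ j)
    equal? i j with i ℤₚ.≟ j
    ... | yes refl = just refl
    ... | no _     = nothing

    open RingSolver (CommutativeRing.rawRing ℤₚ.+-*-commutativeRing) almostCommutativeRing morphism equal? public
      using (solve; _:+_; _:*_; _:-_; :-_; _:=_; con) renaming (Polynomial to Expression)

    :0 :1 :2 : ∀ {n} → Expression n
    :0 = con (ℤ.+ 0)
    :1 = con (ℤ.+ 1)
    :2 = con (ℤ.+ 2)

    2# : Carrier
    2# = 1# + 1#

    -‿≡0 : ∀ {a b} → a - b ≡ 0# → a ≡ b
    -‿≡0 {a} {b} h = trans (solve 2 (λ a b → a := (a :- b) :+ b) refl a b)
      (trans (cong (_+ b) h) (+-identityˡ b))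

    ≡⇒-‿≡0 : ∀ {a b} → a ≡ b → a - b ≡ 0#
    ≡⇒-‿≡0 {a} refl = -‿inverseʳ a

    -- The goal is certified as a multiple of the hypothesis with an explicit coefficient, leaving
    -- one ring identity. The two lemmas below do the same with linear combinations.
    combine₁ : ∀ {a b l r} c → l ≡ r → a - b ≡ c * (l - r) → a ≡ b
    combine₁ c h eq = -‿≡0 (trans eq (trans (cong (c *_) (≡⇒-‿≡0 h)) (zeroʳ c)))

    combine₂ : ∀ {a b l r l′ r′} c c′ → l ≡ r → l′ ≡ r′ → a - b ≡ c * (l - r) + c′ * (l′ - r′) → a ≡ b
    combine₂ c c′ h h′ eq = -‿≡0 (trans eq (trans
      (cong₂ (λ u v → c * u + c′ * v) (≡⇒-‿≡0 h) (≡⇒-‿≡0 h′))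
      (solve 2 (λ c c′ → c :* :0 :+ c′ :* :0 := :0) refl c c′)))

    combine₃ : ∀ {a b l r l′ r′ l″ r″} c c′ c″ → l ≡ r → l′ ≡ r′ → l″ ≡ r″ →
               a - b ≡ c * (l - r) + c′ * (l′ - r′) + c″ * (l″ - r″) → a ≡ b
    combine₃ c c′ c″ h h′ h″ eq = -‿≡0 (trans eq (trans
      (cong₂ _+_ (cong₂ (λ u v → c * u + c′ * v) (≡⇒-‿≡0 h) (≡⇒-‿≡0 h′)) (cong (c″ *_) (≡⇒-‿≡0 h″)))
      (solve 3 (λ c c′ c″ → c :* :0 :+ c′ :* :0 :+ c″ :* :0 := :0) refl c c′ c″)))

    *-cancelˡ-≡ : ∀ {a b c} → c ≢ 0# → c * a ≡ c * b → a ≡ b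
    *-cancelˡ-≡ {a} {b} {c} c≢0 h = begin
      a                  ≡⟨ *-identityʳ a ⟨
      a * 1#             ≡⟨ cong (a *_) (*-inverseʳ c c≢0) ⟨
      a * (c * c ⁻¹)     ≡⟨ solve 3 (λ a c d → a :* (c :* d) := c :* a :* d) refl a c (c ⁻¹) ⟩
      c * a * c ⁻¹       ≡⟨ cong (_* c ⁻¹) h ⟩
      c * b * c ⁻¹       ≡⟨ solve 3 (λ a c d → a :* (c :* d) := c :* a :* d) refl b c (c ⁻¹) ⟨
      b * (c * c ⁻¹)     ≡⟨ cong (b *_) (*-inverseʳ c c≢0) ⟩
      b * 1#             ≡⟨ *-identityʳ b ⟩
      b                  ∎
      where open ≡-Reasoning

    *-cancelˡ-≡0 : ∀ {a c} → c ≢ 0# → c * a ≡ 0# → a ≡ 0#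
    *-cancelˡ-≡0 {a} {c} c≢0 h = *-cancelˡ-≡ c≢0 (trans h (sym (zeroʳ c)))

    *-cancel-- : ∀ {a b c} → a ≢ b → (a - b) * c ≡ 0# → c ≡ 0#
    *-cancel-- a≢b = *-cancelˡ-≡0 (λ e → a≢b (-‿≡0 e))

    *-≢0 : ∀ {a b} → a ≢ 0# → b ≢ 0# → a * b ≢ 0#
    *-≢0 a≢0 b≢0 e = b≢0 (*-cancelˡ-≡0 a≢0 e)

    *-≡1⇒≢0 : ∀ {a b} → a * b ≡ 1# → a ≢ 0#
    *-≡1⇒≢0 {b = b} e refl = 0≢1 (trans (sym (zeroˡ b)) e)

    ⁻¹-≢0 : ∀ {a} → a ≢ 0# → a ⁻¹ ≢ 0#
    ⁻¹-≢0 {a} a≢0 e = 0≢1 (trans (sym (zeroʳ a)) (trans (cong (a *_) (sym e)) (*-inverseʳ a a≢0)))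

    elements-listing : Listing elements
    elements-listing .unique = Uniqueₚ.map⁺ (λ {i} {j} e → trans (sym (Inverse.strictlyInverseˡ enumeration i))
      (trans (cong index e) (Inverse.strictlyInverseˡ enumeration j))) (Uniqueₚ.allFin⁺ q)
    elements-listing .complete x = subst (Membership._∈ elements) (Inverse.strictlyInverseʳ enumeration x)
      (Membershipₚ.∈-map⁺ element (Membershipₚ.∈-allFin (index x)))

    length-elements : List.length elements ≡ q
    length-elements = trans (Listₚ.length-map element (List.allFin q)) (Listₚ.length-tabulate id)

    private
      ·-additive : ∀ m n → (m ℕ.+ n) · 1# ≡ m · 1# + n · 1#
      ·-additive zero    n = sym (+-identityˡ (n · 1#))
      ·-additive (suc m) n = trans (cong (λ z → 1# + z) (·-additive m n)) (sym (+-assoc 1# (m · 1#) (n · 1#)))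

      ·-multiple : ∀ k {p} → p · 1# ≡ 0# → (k ℕ.* p) · 1# ≡ 0#
      ·-multiple zero    h = refl
      ·-multiple (suc k) {p} h = trans (·-additive p (k ℕ.* p))
        (trans (cong₂ _+_ h (·-multiple k h)) (+-identityˡ 0#))

    -- An integer 1 < p ≤ 3 vanishing in F is the characteristic: the remainders 1 and 2 of m modulo p
    -- satisfy 1 ≠ 0 and, when 3 = 0, also 2 = - 1 ≠ 0.

    two≢0 : ¬ HasCharacteristic 2 → 2# ≢ 0#
    two≢0 ¬2 two≡0 = ¬2 λ m → mk⇔ (to m) λ { (divides k refl) → ·-multiple k two }
      where
      two : 2 · 1# ≡ 0#
      two = trans (solve 0 (:1 :+ (:1 :+ :0) := :2) refl) two≡0
      step : ∀ {m} → (2 ℕ.+ m) · 1# ≡ 0# → m · 1# ≡ 0#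
      step {m} h = trans (sym (+-identityˡ _)) (trans (cong (_+ m · 1#) (sym two)) (trans (sym (·-additive 2 m)) h))
      to : ∀ m → m · 1# ≡ 0# → 2 ∣ m
      to 0 h = divides 0 refl
      to 1 h = ⊥-elim (0≢1 (trans (sym h) (+-identityʳ 1#)))
      to (suc (suc m)) h with divides k refl ← to m (step {m} h) = divides (suc k) refl

    three≢0 : ¬ HasCharacteristic 3 → 2# + 1# ≢ 0#
    three≢0 ¬3 three≡0 = ¬3 λ m → mk⇔ (to m) λ { (divides k refl) → ·-multiple k three }
      where
      three : 3 · 1# ≡ 0#
      three = trans (solve 0 (:1 :+ (:1 :+ (:1 :+ :0)) := :2 :+ :1) refl) three≡0
      step : ∀ {m} → (3 ℕ.+ m) · 1# ≡ 0# → m · 1# ≡ 0#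
      step {m} h = trans (sym (+-identityˡ _)) (trans (cong (_+ m · 1#) (sym three)) (trans (sym (·-additive 3 m)) h))
      to : ∀ m → m · 1# ≡ 0# → 3 ∣ m
      to 0 h = divides 0 refl
      to 1 h = ⊥-elim (0≢1 (trans (sym h) (+-identityʳ 1#)))
      to 2 h = ⊥-elim (0≢1 (combine₂ 1# (- 1#) h three≡0
        (solve 0 (:0 :- :1 := :1 :* ((:1 :+ (:1 :+ :0)) :- :0) :+ (:- :1) :* ((:2 :+ :1) :- :0)) refl)))
      to (suc (suc (suc m))) h with divides k refl ← to m (step {m} h) = divides (suc k) refl

open FieldTheory

-- Vieta's formulas for the spheres through a point, and the curve of lifts.

module Cubic where

  module CubicAlgebra {q : ℕ} (F : FiniteField q) (R : FiniteField.Carrier F) where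

    open FiniteField F
    open FieldAlgebra F
    open Geometry F
    open TwistedCubic F R

    -- Vieta's formulas for x T³ - T² + 2 z T - (x y + z² - R) = x (T - a) (T - b) (T - c).

    Vieta : Point → Carrier → Carrier → Carrier → Set
    Vieta (x ∷ y ∷ z ∷ []) a b c =
        x * (a + b + c) ≡ 1#
      × x * (a * b + a * c + b * c) ≡ 2# * z
      × x * (a * b * c) ≡ x * y + z * z - R

    -- Here Q₀(p - c_t) = x (y - t³) + (z - t)². The coefficient of t² does not depend on the point,
    -- which is why the roots have sum 1/x and why exactly the triples of nonzero sum occur.
    Lies-cubic : ∀ x y z t → eval Q₀ ((x ∷ y ∷ z ∷ []) ⊖ centre (S t)) - R ≡
                 - (x * (t * t * t) - t * t + 2# * z * t - (x * y + z * z - R))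
    Lies-cubic = solve 5 (λ R x y z t →
        let x′ = x :- :0 ; y′ = y :- t :* t :* t ; z′ = z :- t in
        :0 :* (x′ :* x′) :+ :0 :* (y′ :* y′) :+ :1 :* (z′ :* z′) :+ :1 :* (x′ :* y′) :+ :0 :* (x′ :* z′) :+ :0 :* (y′ :* z′) :- R
        := :- (x :* (t :* t :* t) :- t :* t :+ :2 :* z :* t :- (x :* y :+ z :* z :- R))) refl R

    Lies⇒cubic : ∀ {x y z} t → Lies Q₀ (x ∷ y ∷ z ∷ []) (S t) →
                 x * (t * t * t) - t * t + 2# * z * t ≡ x * y + z * z - R
    Lies⇒cubic {x} {y} {z} t h = combine₁ (- 1#) h
      (trans (solve 1 (λ e → e := (:- :1) :* (:- e)) refl _) (cong (- 1# *_) (sym (Lies-cubic x y z t))))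

    cubic⇒Lies : ∀ {x y z} t → x * (t * t * t) - t * t + 2# * z * t ≡ x * y + z * z - R →
                 Lies Q₀ (x ∷ y ∷ z ∷ []) (S t)
    cubic⇒Lies {x} {y} {z} t h = combine₁ (- 1#) h
      (trans (Lies-cubic x y z t) (solve 1 (λ e → :- e := (:- :1) :* e) refl _))

    -- Divided differences: two distinct roots annihilate the first difference of the cubic, and a
    -- second difference gives the formula for the sum. The other two formulas follow by back
    -- substitution, so only differences of distinct roots are ever cancelled.
    Lies⇒Vieta : ∀ p {a b c} → a ≢ b → a ≢ c → b ≢ c →
                 Lies Q₀ p (S a) → Lies Q₀ p (S b) → Lies Q₀ p (S c) → Vieta p a b c
    Lies⇒Vieta (x ∷ y ∷ z ∷ []) {a} {b} {c} a≢b a≢c b≢c la lb lc = e₁ , e₂ , e₃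
      where
      k = x * y + z * z - R
      quotient : ∀ {u v} → u ≢ v → Lies Q₀ (x ∷ y ∷ z ∷ []) (S u) → Lies Q₀ (x ∷ y ∷ z ∷ []) (S v) →
                 x * (u * u + u * v + v * v) - (u + v) + 2# * z ≡ 0#
      quotient {u} {v} u≢v lu lv = *-cancel-- u≢v (combine₂ 1# (- 1#) (Lies⇒cubic u lu) (Lies⇒cubic v lv)
        (solve 5 (λ x z k u v → (u :- v) :* (x :* (u :* u :+ u :* v :+ v :* v) :- (u :+ v) :+ :2 :* z) :- :0
          := :1 :* ((x :* (u :* u :* u) :- u :* u :+ :2 :* z :* u) :- k) :+
             (:- :1) :* ((x :* (v :* v :* v) :- v :* v :+ :2 :* z :* v) :- k)) refl x z k u v))
      e₁ : x * (a + b + c) ≡ 1#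
      e₁ = -‿≡0 (*-cancel-- b≢c (combine₂ 1# (- 1#) (quotient a≢b la lb) (quotient a≢c la lc)
        (solve 5 (λ x z a b c → (b :- c) :* (x :* (a :+ b :+ c) :- :1) :- :0
          := :1 :* ((x :* (a :* a :+ a :* b :+ b :* b) :- (a :+ b) :+ :2 :* z) :- :0) :+
             (:- :1) :* ((x :* (a :* a :+ a :* c :+ c :* c) :- (a :+ c) :+ :2 :* z) :- :0)) refl x z a b c)))
      e₂ : x * (a * b + a * c + b * c) ≡ 2# * z
      e₂ = combine₂ (a + b) (- 1#) e₁ (quotient a≢b la lb)
        (solve 5 (λ x z a b c → x :* (a :* b :+ a :* c :+ b :* c) :- :2 :* z
          := (a :+ b) :* (x :* (a :+ b :+ c) :- :1) :+
             (:- :1) :* ((x :* (a :* a :+ a :* b :+ b :* b) :- (a :+ b) :+ :2 :* z) :- :0)) refl x z a b c)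
      e₃ : x * (a * b * c) ≡ k
      e₃ = combine₃ 1# (- (a * a)) a (Lies⇒cubic a la) e₁ e₂
        (solve 6 (λ x z a b c k → x :* (a :* b :* c) :- k
          := :1 :* ((x :* (a :* a :* a) :- a :* a :+ :2 :* z :* a) :- k) :+ (:- (a :* a)) :* (x :* (a :+ b :+ c) :- :1) :+
             a :* (x :* (a :* b :+ a :* c :+ b :* c) :- :2 :* z)) refl x z a b c k)

    Vieta⇒≢0 : ∀ p {a b c} → Vieta p a b c → Vec.head p ≢ 0#
    Vieta⇒≢0 (x ∷ y ∷ z ∷ []) (e₁ , _) = *-≡1⇒≢0 e₁

    Vieta⇒factor : ∀ x y z {a b c} → Vieta (x ∷ y ∷ z ∷ []) a b c → ∀ t →
                   x * (t * t * t) - t * t + 2# * z * t - (x * y + z * z - R) ≡ (t - a) * ((t - b) * ((t - c) * x))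
    Vieta⇒factor x y z {a} {b} {c} (e₁ , e₂ , e₃) t = combine₃ (t * t) (- t) 1# e₁ e₂ e₃
      (solve 7 (λ x z a b c t k →
        (x :* (t :* t :* t) :- t :* t :+ :2 :* z :* t :- k) :- (t :- a) :* ((t :- b) :* ((t :- c) :* x))
        := t :* t :* (x :* (a :+ b :+ c) :- :1) :+ (:- t) :* (x :* (a :* b :+ a :* c :+ b :* c) :- :2 :* z) :+
           :1 :* (x :* (a :* b :* c) :- k)) refl x z a b c t (x * y + z * z - R))

    Vieta⇒Lies : ∀ p {a b c} → Vieta p a b c → ∀ {t} → t ≡ a ⊎ t ≡ b ⊎ t ≡ c → Lies Q₀ p (S t)
    Vieta⇒Lies (x ∷ y ∷ z ∷ []) v {t} root = cubic⇒Lies t (-‿≡0 (trans (Vieta⇒factor x y z v t) (vanish root)))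
      where
      vanish : ∀ {a b c} → t ≡ a ⊎ t ≡ b ⊎ t ≡ c → (t - a) * ((t - b) * ((t - c) * x)) ≡ 0#
      vanish {b = b} {c} (inj₁ refl)        = solve 4 (λ t b c x → (t :- t) :* ((t :- b) :* ((t :- c) :* x)) := :0) refl t b c x
      vanish {a} {c = c} (inj₂ (inj₁ refl)) = solve 4 (λ t a c x → (t :- a) :* ((t :- t) :* ((t :- c) :* x)) := :0) refl t a c x
      vanish {a} {b}     (inj₂ (inj₂ refl)) = solve 4 (λ t a b x → (t :- a) :* ((t :- b) :* ((t :- t) :* x)) := :0) refl t a b x

    Vieta⇒roots : ∀ p {a b c} → Vieta p a b c → ∀ {t} → Lies Q₀ p (S t) → t ≡ a ⊎ t ≡ b ⊎ t ≡ c
    Vieta⇒roots p@(x ∷ y ∷ z ∷ []) {a} {b} {c} v {t} l with t ≟ a | t ≟ b | t ≟ c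
    ... | yes e | _     | _     = inj₁ e
    ... | no _  | yes e | _     = inj₂ (inj₁ e)
    ... | no _  | no _  | yes e = inj₂ (inj₂ e)
    ... | no t≢a | no t≢b | no t≢c = ⊥-elim (Vieta⇒≢0 p v (*-cancel-- t≢c (*-cancel-- t≢b (*-cancel-- t≢a
      (trans (sym (Vieta⇒factor x y z v t)) (≡⇒-‿≡0 (Lies⇒cubic t l)))))))

    Vieta-exists : 2# ≢ 0# → ∀ a b c → a + b + c ≢ 0# → ∃[ p ] Vieta p a b c
    Vieta-exists 2≢0 a b c s≢0 = (x ∷ y ∷ z ∷ []) , x*s , e₂ , e₃
      where
      s = a + b + c
      x = s ⁻¹
      z = x * (a * b + a * c + b * c) * 2# ⁻¹
      -- The third formula is linear in y with coefficient x; as x s = 1, multiplying by s solves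
      -- for y.
      y = s * (x * (a * b * c) - z * z + R)
      x*s : x * s ≡ 1#
      x*s = trans (*-comm x s) (*-inverseʳ s s≢0)
      e₂ : x * (a * b + a * c + b * c) ≡ 2# * z
      e₂ = combine₁ (- (x * (a * b + a * c + b * c))) (*-inverseʳ 2# 2≢0)
        (solve 2 (λ e h → e :- :2 :* (e :* h) := (:- e) :* (:2 :* h :- :1)) refl _ (2# ⁻¹))
      e₃ : x * (a * b * c) ≡ x * y + z * z - R
      e₃ = combine₁ (- (x * (a * b * c) - z * z + R)) x*s
        (solve 5 (λ x s e z R → e :- (x :* (s :* (e :- z :* z :+ R)) :+ z :* z :- R) := (:- (e :- z :* z :+ R)) :* (x :* s :- :1))
          refl x s (x * (a * b * c)) z R)

    Vieta-unique : 2# ≢ 0# → ∀ p p′ {a b c} → Vieta p a b c → Vieta p′ a b c → p ≡ p′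
    Vieta-unique 2≢0 (x ∷ y ∷ z ∷ []) (x′ ∷ y′ ∷ z′ ∷ []) {a} {b} {c} v@(e₁ , e₂ , e₃) (e₁′ , e₂′ , e₃′) with x≡x′
      where
      x≡x′ : x ≡ x′
      x≡x′ = *-cancelˡ-≡ {c = a + b + c} (*-≡1⇒≢0 (trans (*-comm _ x) e₁))
        (trans (*-comm _ x) (trans e₁ (trans (sym e₁′) (*-comm x′ _))))
    ... | refl with *-cancelˡ-≡ 2≢0 (trans (sym e₂) e₂′)
    ... | refl with *-cancelˡ-≡ {y} {y′} (*-≡1⇒≢0 e₁) (combine₂ (- 1#) 1# e₃ e₃′
        (solve 6 (λ e x y y′ z R → x :* y :- x :* y′ :=
          (:- :1) :* (e :- (x :* y :+ z :* z :- R)) :+ :1 :* (e :- (x :* y′ :+ z :* z :- R))) refl _ x y y′ z R))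
    ... | refl = refl

    -- The lifts are (0, 2 t³, 2 t, R - t²); the coordinates (2 t, R - t²) already lie on a parabola.

    lifts-distinct : 2# ≢ 0# → ∀ t u → t ≢ u → Φ Q₀ (S t) ≢ Φ Q₀ (S u)
    lifts-distinct 2≢0 t u t≢u e = t≢u (*-cancelˡ-≡ 2≢0 (cong (λ v → Vec.lookup v (suc (suc zero))) e))

    -- Comparing the last two coordinates of the lifts of t and u gives - (t + u) d₃ = 2 d₄ for the
    -- direction of a common line. Doing this for t, u and for t, v leaves (u - v) d₃ = 0, whereas
    -- d₃ = 0 would make 2 t equal to 2 u.
    no-three-on-line : 2# ≢ 0# → ∀ (L : AffineLine 4) t u v → t ≢ u → t ≢ v → u ≢ v →
      ¬ (Φ Q₀ (S t) onLine L × Φ Q₀ (S u) onLine L × Φ Q₀ (S v) onLine L)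
    no-three-on-line 2≢0 record { base = b₁ ∷ b₂ ∷ b₃ ∷ b₄ ∷ [] ; direction = d₁ ∷ d₂ ∷ d₃ ∷ d₄ ∷ [] } t u v t≢u t≢v u≢v
      ((s , hs) , (s′ , hs′) , (s″ , hs″)) = u≢v (-‿≡0 (*-cancelˡ-≡0 d₃≢0 (combine₂ 1# (- 1#) slope-v slope-u
        (solve 5 (λ t u v d₃ d₄ → d₃ :* (u :- v) :- :0 :=
          :1 :* (:- ((t :+ v) :* d₃) :- :2 :* d₄) :+ (:- :1) :* (:- ((t :+ u) :* d₃) :- :2 :* d₄)) refl t u v d₃ d₄))))
      where
      third : ∀ {t s} → Φ Q₀ (S t) ≡ (b₁ ∷ b₂ ∷ b₃ ∷ b₄ ∷ []) ⊕ s • (d₁ ∷ d₂ ∷ d₃ ∷ d₄ ∷ []) → 2# * t ≡ b₃ + s * d₃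
      third = cong (λ w → Vec.lookup w (suc (suc zero)))
      fourth : ∀ {t s} → Φ Q₀ (S t) ≡ (b₁ ∷ b₂ ∷ b₃ ∷ b₄ ∷ []) ⊕ s • (d₁ ∷ d₂ ∷ d₃ ∷ d₄ ∷ []) → R - t * t ≡ b₄ + s * d₄
      fourth {t} h = trans (solve 2 (λ R t → let y = t :* t :* t in R :- t :* t :=
        R :- (:0 :* (:0 :* :0) :+ :0 :* (y :* y) :+ :1 :* (t :* t) :+ :1 :* (:0 :* y) :+ :0 :* (:0 :* t) :+ :0 :* (y :* t))) refl R t)
        (cong (λ w → Vec.lookup w (suc (suc (suc zero)))) h)
      slope : ∀ {u s′} → t ≢ u → Φ Q₀ (S u) ≡ (b₁ ∷ b₂ ∷ b₃ ∷ b₄ ∷ []) ⊕ s′ • (d₁ ∷ d₂ ∷ d₃ ∷ d₄ ∷ []) →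
              - ((t + u) * d₃) ≡ 2# * d₄
      slope {u} {s′} t≢u h = -‿≡0 (*-cancel-- t≢u (combine₂ d₃ (- d₄)
        (cong₂ _-_ (fourth {t} {s} hs) (fourth {u} {s′} h)) (cong₂ _-_ (third {t} {s} hs) (third {u} {s′} h))
        (solve 9 (λ R t u s s′ b₃ b₄ d₃ d₄ → (t :- u) :* (:- ((t :+ u) :* d₃) :- :2 :* d₄) :- :0 :=
          d₃ :* ((R :- t :* t) :- (R :- u :* u) :- ((b₄ :+ s :* d₄) :- (b₄ :+ s′ :* d₄))) :+
          (:- d₄) :* ((:2 :* t :- :2 :* u) :- ((b₃ :+ s :* d₃) :- (b₃ :+ s′ :* d₃)))) refl R t u s s′ b₃ b₄ d₃ d₄)))
      slope-u = slope {u} {s′} t≢u hs′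
      slope-v = slope {v} {s″} t≢v hs″
      d₃≢0 : d₃ ≢ 0#
      d₃≢0 e = t≢u (*-cancelˡ-≡ 2≢0 (trans (third {t} {s} hs) (trans (trans (cong (λ d → b₃ + s * d) e)
        (trans (solve 3 (λ b s s′ → b :+ s :* :0 := b :+ s′ :* :0) refl b₃ s s′) (cong (λ d → b₃ + s′ * d) (sym e)))) (sym (third {u} {s′} hs′)))))

open Cubic

-- The points of the system and their triples of parameters.

module PointTheory where

  open Listing

  length-filterᵇ-tabulate : ∀ {n} {B : Set} (A : Subset n) (f : Fin n → B) (P : B → Bool) →
    (∀ i → P (f i) ≡ Vec.lookup A i) → List.length (List.filterᵇ P (List.tabulate f)) ≡ Subset.∣ A ∣
  length-filterᵇ-tabulate []      f P h = refl
  length-filterᵇ-tabulate (a ∷ A) f P h with P (f zero) | h zero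
  length-filterᵇ-tabulate (true  ∷ A) f P h | _ | refl = cong suc (length-filterᵇ-tabulate A (f ∘ suc) P (h ∘ suc))
  length-filterᵇ-tabulate (false ∷ A) f P h | _ | refl = length-filterᵇ-tabulate A (f ∘ suc) P (h ∘ suc)

  module Points {q : ℕ} (F : FiniteField q) (R : FiniteField.Carrier F)
                (2≢0 : FieldAlgebra.2# F ≢ FiniteField.0# F) where

    open FiniteField F
    open FieldAlgebra F
    open Geometry F
    open TwistedCubic F R
    open CubicAlgebra F R

    on : Point → Carrier → Bool
    on p t = pointsOf Q₀ (S t) p

    on⇒Lies : ∀ p t → T (on p t) → Lies Q₀ p (S t)
    on⇒Lies p t = does-T (eval Q₀ (p ⊖ centre (S t)) ≟ R)

    Lies⇒on : ∀ p t → Lies Q₀ p (S t) → T (on p t)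
    Lies⇒on p t = T-does (eval Q₀ (p ⊖ centre (S t)) ≟ R)

    index-element : ∀ i → index (element i) ≡ i
    index-element = Inverse.strictlyInverseˡ enumeration

    element-index : ∀ x → element (index x) ≡ x
    element-index = Inverse.strictlyInverseʳ enumeration

    ∈ᶠ⇒T : ∀ {t A} → t ∈ᶠ A → T (Vec.lookup A (index t))
    ∈ᶠ⇒T h = subst T (sym (Vecₚ.[]=⇒lookup h)) tt

    T⇒∈ᶠ : ∀ {t A} → T (Vec.lookup A (index t)) → t ∈ᶠ A
    T⇒∈ᶠ {t} {A} h = Vecₚ.lookup⇒[]= (index t) A (T-ext (λ _ → tt) (λ _ → h))

    length-members : ∀ A → List.length (members A) ≡ Subset.∣ A ∣
    length-members A = trans (cong (List.length ∘ List.filterᵇ _) (Listₚ.map-tabulate id element))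
      (length-filterᵇ-tabulate A element (λ t → Vec.lookup A (index t)) (λ i → cong (Vec.lookup A) (index-element i)))

    record Elements (A : Subset q) : Set where
      field
        a b c     : Carrier
        a≢b       : a ≢ b
        a≢c       : a ≢ c
        b≢c       : b ≢ c
        members≡  : members A ≡ a ∷ b ∷ c ∷ []
        ∈ᶠ⇒root   : ∀ {t} → t ∈ᶠ A → t ≡ a ⊎ t ≡ b ⊎ t ≡ c
        root⇒∈ᶠ   : ∀ {t} → t ≡ a ⊎ t ≡ b ⊎ t ≡ c → t ∈ᶠ A

    elements-of : ∀ A → Subset.∣ A ∣ ≡ 3 → Elements A
    elements-of A size = go (members A) refl (trans (length-members A) size)
      where
      P : Carrier → Bool
      P t = Vec.lookup A (index t)
      go : ∀ xs → members A ≡ xs → List.length xs ≡ 3 → Elements A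
      go (a ∷ b ∷ c ∷ []) eq refl
        with (a≢b ∷ a≢c ∷ []) ∷ (b≢c ∷ []) ∷ _ ← subst Unique eq (Uniqueₚ.filter⁺ (Boolₚ.T? ∘ P) (elements-listing .unique))
        = record { a≢b = a≢b ; a≢c = a≢c ; b≢c = b≢c ; members≡ = eq ; ∈ᶠ⇒root = to ; root⇒∈ᶠ = from }
        where
        to : ∀ {t} → t ∈ᶠ A → t ≡ a ⊎ t ≡ b ⊎ t ≡ c
        to {t} h with subst (t Membership.∈_) eq (Membershipₚ.∈-filter⁺ (Boolₚ.T? ∘ P) (elements-listing .complete t) (∈ᶠ⇒T h))
        ... | here e                 = inj₁ e
        ... | there (here e)         = inj₂ (inj₁ e)
        ... | there (there (here e)) = inj₂ (inj₂ e)
        back : ∀ {t} → t Membership.∈ (a ∷ b ∷ c ∷ []) → t ∈ᶠ A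
        back {t} h = T⇒∈ᶠ (proj₂ (Membershipₚ.∈-filter⁻ (Boolₚ.T? ∘ P) {xs = elements} (subst (t Membership.∈_) (sym eq) h)))
        from : ∀ {t} → t ≡ a ⊎ t ≡ b ⊎ t ≡ c → t ∈ᶠ A
        from (inj₁ e)        = back (here e)
        from (inj₂ (inj₁ e)) = back (there (here e))
        from (inj₂ (inj₂ e)) = back (there (there (here e)))

    module _ {A : Subset q} (E : Elements A) where

      open Elements E

      sumOf≡ : sumOf A ≡ a + b + c
      sumOf≡ = trans (cong (List.foldr _+_ 0#) members≡) (solve 3 (λ a b c → a :+ (b :+ (c :+ :0)) := a :+ b :+ c) refl a b c)

      expanded : Polynomial
      expanded = - (a * b * c) ∷ a * b + a * c + b * c ∷ - (a + b + c) ∷ 1# ∷ []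

      rootPolynomial≡ : rootPolynomial A ≡ expanded
      rootPolynomial≡ = trans (cong (List.foldr timesLinear (1# ∷ [])) members≡) (cong₂ _∷_
        (solve 3 (λ a b c → :0 :+ (:- a) :* (:0 :+ (:- b) :* (:0 :+ (:- c) :* :1)) := :- (a :* b :* c)) refl a b c) (cong₂ _∷_
        (solve 3 (λ a b c → (:0 :+ (:- b) :* (:0 :+ (:- c) :* :1)) :+ (:- a) :* ((:0 :+ (:- c) :* :1) :+ (:- b) :* :1)
          := a :* b :+ a :* c :+ b :* c) refl a b c) (cong (_∷ 1# ∷ [])
        (solve 3 (λ a b c → ((:0 :+ (:- c) :* :1) :+ (:- b) :* :1) :+ (:- a) :* :1 := :- (a :+ b :+ c)) refl a b c))))

      IsPointOf⇒Vieta : ∀ p → IsPointOf A p → Vieta p a b c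
      IsPointOf⇒Vieta (x ∷ y ∷ z ∷ []) (x≢0 , Ψ≡) =
          -‿≡0 (*-cancelˡ-≡0 (⁻¹-≢0 x≢0) (combine₂ 1# (a + b + c) (Listₚ.∷-injectiveˡ t₂) x*x⁻¹
            (solve 3 (λ x x⁻¹ s → x⁻¹ :* (x :* s :- :1) :- :0 := :1 :* ((:- x⁻¹) :- (:- s)) :+ s :* (x :* x⁻¹ :- :1)) refl x (x ⁻¹) (a + b + c))))
        , combine₂ (- x) (2# * z) (Listₚ.∷-injectiveˡ t₁) x*x⁻¹
            (solve 4 (λ x x⁻¹ z e → x :* e :- :2 :* z := (:- x) :* (:2 :* z :* x⁻¹ :- e) :+ :2 :* z :* (x :* x⁻¹ :- :1)) refl x (x ⁻¹) z _)
        , combine₂ x k (Listₚ.∷-injectiveˡ t₀) x*x⁻¹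
            (solve 4 (λ x x⁻¹ k e → x :* e :- k := x :* ((:- (k :* x⁻¹)) :- (:- e)) :+ k :* (x :* x⁻¹ :- :1)) refl x (x ⁻¹) k _)
        where
        k = x * y + z * z - R
        x*x⁻¹ = *-inverseʳ x x≢0
        t₀ = trans Ψ≡ rootPolynomial≡
        t₁ = Listₚ.∷-injectiveʳ t₀
        t₂ = Listₚ.∷-injectiveʳ t₁

      Vieta⇒IsPointOf : ∀ p → Vieta p a b c → IsPointOf A p
      Vieta⇒IsPointOf p@(x ∷ y ∷ z ∷ []) v@(e₁ , e₂ , e₃) = x≢0 , trans (cong₂ _∷_
          (combine₂ (x ⁻¹) (- (a * b * c)) e₃ x*x⁻¹
            (solve 4 (λ x x⁻¹ k e → (:- (k :* x⁻¹)) :- (:- e) := x⁻¹ :* (x :* e :- k) :+ (:- e) :* (x :* x⁻¹ :- :1)) refl x (x ⁻¹) _ _)) (cong₂ _∷_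
          (combine₂ (- (x ⁻¹)) (a * b + a * c + b * c) e₂ x*x⁻¹
            (solve 4 (λ x x⁻¹ z e → :2 :* z :* x⁻¹ :- e := (:- x⁻¹) :* (x :* e :- :2 :* z) :+ e :* (x :* x⁻¹ :- :1)) refl x (x ⁻¹) z _)) (cong (_∷ 1# ∷ [])
          (combine₂ (x ⁻¹) (- (a + b + c)) e₁ x*x⁻¹
            (solve 3 (λ x x⁻¹ s → (:- x⁻¹) :- (:- s) := x⁻¹ :* (x :* s :- :1) :+ (:- s) :* (x :* x⁻¹ :- :1)) refl x (x ⁻¹) _)))))
        (sym rootPolynomial≡)
        where
        x≢0 = Vieta⇒≢0 p v
        x*x⁻¹ = *-inverseʳ x x≢0

    -- A form of membership in `Ptc` that exposes three roots; `Ptc` itself is decided by a search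
    -- over all subsets.
    record Roots (p : Point) : Set where
      constructor roots
      field
        {a b c}     : Carrier
        a≢b         : a ≢ b
        a≢c         : a ≢ c
        b≢c         : b ≢ c
        vieta       : Vieta p a b c

    ∈Ptc⇒A : ∀ p → p ∈ Ptc → ∃[ A ] A ∈𝔗 × IsPointOf A p
    ∈Ptc⇒A p = does-T (anySubset? (λ A → ∈𝔗? A ×-dec isPointOf? A p))

    A⇒∈Ptc : ∀ p A → A ∈𝔗 → IsPointOf A p → p ∈ Ptc
    A⇒∈Ptc p A A∈ h = T-does (anySubset? (λ A → ∈𝔗? A ×-dec isPointOf? A p)) (A , A∈ , h)

    ∈Ptc⇒Roots : ∀ p → p ∈ Ptc → Roots p
    ∈Ptc⇒Roots p p∈ with A , (size , _) , h ← ∈Ptc⇒A p p∈ = roots a≢b a≢c b≢c (IsPointOf⇒Vieta (elements-of A size) p h)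
      where open Elements (elements-of A size)

    open Q using () renaming (_+_ to _+ℚ_; _*_ to _*ℚ_)

    𝟙-on : ∀ p → (r : Roots p) → let open Roots r in
           ∀ t → 𝟙 (on p t) ≡ 𝟙 (does (a ≟ t)) +ℚ 𝟙 (does (b ≟ t)) +ℚ 𝟙 (does (c ≟ t))
    𝟙-on p (roots {a} {b} {c} a≢b a≢c b≢c v) t = case (a ≟ t) (b ≟ t) (c ≟ t)
      where
      hit : t ≡ a ⊎ t ≡ b ⊎ t ≡ c → 𝟙 (on p t) ≡ 1ℚ
      hit h = 𝟙-T (Lies⇒on p t (Vieta⇒Lies p v h))
      case : (a? : Dec (a ≡ t)) (b? : Dec (b ≡ t)) (c? : Dec (c ≡ t)) →
             𝟙 (on p t) ≡ 𝟙 (does a?) +ℚ 𝟙 (does b?) +ℚ 𝟙 (does c?)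
      case (yes e) (yes f) _       = ⊥-elim (a≢b (trans e (sym f)))
      case (yes e) (no _)  (yes f) = ⊥-elim (a≢c (trans e (sym f)))
      case (yes e) (no _)  (no _)  = hit (inj₁ (sym e))
      case (no _)  (yes e) (yes f) = ⊥-elim (b≢c (trans e (sym f)))
      case (no _)  (yes e) (no _)  = hit (inj₂ (inj₁ (sym e)))
      case (no _)  (no _)  (yes e) = hit (inj₂ (inj₂ (sym e)))
      case (no a≢t) (no b≢t) (no c≢t) = 𝟙-¬T λ h → none (Vieta⇒roots p v (on⇒Lies p t h))
        where
        none : ¬ (t ≡ a ⊎ t ≡ b ⊎ t ≡ c)
        none (inj₁ e)        = a≢t (sym e)
        none (inj₂ (inj₁ e)) = b≢t (sym e)
        none (inj₂ (inj₂ e)) = c≢t (sym e)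

    Σ-on : ∀ p → (r : Roots p) → let open Roots r in
           ∀ f → ∑[ t ← elements ] 𝟙 (on p t) *ℚ f t ≡ f a +ℚ f b +ℚ f c
    Σ-on p r f = begin
      (∑[ t ← elements ] 𝟙 (on p t) *ℚ f t)
        ≡⟨ Σ-cong elements (λ t → trans (cong (_*ℚ f t) (𝟙-on p r t))
             (trans (ℚₚ.*-distribʳ-+ (f t) (δ a t +ℚ δ b t) (δ c t))
               (cong (_+ℚ δ c t *ℚ f t) (ℚₚ.*-distribʳ-+ (f t) (δ a t) (δ b t))))) ⟩
      (∑[ t ← elements ] (δ a t *ℚ f t +ℚ δ b t *ℚ f t +ℚ δ c t *ℚ f t))
        ≡⟨ trans (Σ-+ elements _ _) (cong (_+ℚ (∑[ t ← elements ] δ c t *ℚ f t)) (Σ-+ elements _ _)) ⟩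
      (∑[ t ← elements ] δ a t *ℚ f t) +ℚ (∑[ t ← elements ] δ b t *ℚ f t) +ℚ (∑[ t ← elements ] δ c t *ℚ f t)
        ≡⟨ cong₂ _+ℚ_ (cong₂ _+ℚ_ (pick a) (pick b)) (pick c) ⟩
      f a +ℚ f b +ℚ f c ∎
      where
      open ≡-Reasoning
      open Roots r
      δ : Carrier → Carrier → ℚ
      δ a t = 𝟙 (does (a ≟ t))
      pick : ∀ a → (∑[ t ← elements ] δ a t *ℚ f t) ≡ f a
      pick a = Σ-δ elements-listing _≟_ a f

    degree-3 : ∀ p → Roots p → ∑[ t ← elements ] 𝟙 (on p t) ≡ ℕ→ℚ 3
    degree-3 p r = trans (Σ-cong elements (λ t → sym (ℚₚ.*-identityʳ (𝟙 (on p t))))) (Σ-on p r (λ _ → 1ℚ))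

    rootSet : Point → Subset q
    rootSet p = Vec.tabulate (λ i → on p (element i))

    lookup-rootSet : ∀ p t → Vec.lookup (rootSet p) (index t) ≡ on p t
    lookup-rootSet p t = trans (Vecₚ.lookup∘tabulate (λ i → on p (element i)) (index t)) (cong (on p) (element-index t))

    rootSet-size : ∀ p → Roots p → Subset.∣ rootSet p ∣ ≡ 3
    rootSet-size p r = ℕ→ℚ-injective (begin
      ℕ→ℚ Subset.∣ rootSet p ∣                                          ≡⟨ cong ℕ→ℚ (length-members (rootSet p)) ⟨
      ℕ→ℚ (count elements (λ t → Vec.lookup (rootSet p) (index t)))     ≡⟨ count≡Σ elements _ ⟩
      (∑[ t ← elements ] 𝟙 (Vec.lookup (rootSet p) (index t)))          ≡⟨ Σ-cong elements (λ t → cong 𝟙 (lookup-rootSet p t)) ⟩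
      (∑[ t ← elements ] 𝟙 (on p t))                                    ≡⟨ degree-3 p r ⟩
      ℕ→ℚ 3                                                             ∎)
      where open ≡-Reasoning

    -- Vieta's formulas are derived afresh for the enumeration of `rootSet p`, whose elements are
    -- distinct parameters of spheres through `p`; this avoids matching them with the given roots up
    -- to order.
    rootSet-correct : ∀ p → Roots p → rootSet p ∈𝔗 × IsPointOf (rootSet p) p
    rootSet-correct p r = (rootSet-size p r , sum≢0 p v) , Vieta⇒IsPointOf E p v
      where
      E = elements-of (rootSet p) (rootSet-size p r)
      open Elements E
      lies : ∀ {t} → t ≡ a ⊎ t ≡ b ⊎ t ≡ c → Lies Q₀ p (S t)
      lies {t} h = on⇒Lies p t (subst T (lookup-rootSet p t) (∈ᶠ⇒T (root⇒∈ᶠ h)))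
      v : Vieta p a b c
      v = Lies⇒Vieta p a≢b a≢c b≢c (lies (inj₁ refl)) (lies (inj₂ (inj₁ refl))) (lies (inj₂ (inj₂ refl)))
      sum≢0 : ∀ p′ → Vieta p′ a b c → sumOf (rootSet p) ≢ 0#
      sum≢0 (x ∷ y ∷ z ∷ []) (e₁ , _) e = *-≡1⇒≢0 (trans (*-comm _ x) e₁) (trans (sym (sumOf≡ E)) e)

    Roots⇒∈Ptc : ∀ p → Roots p → p ∈ Ptc
    Roots⇒∈Ptc p r = A⇒∈Ptc p (rootSet p) (proj₁ (rootSet-correct p r)) (proj₂ (rootSet-correct p r))

    point-of : ∀ A → A ∈𝔗 → ∃! _≡_ (IsPointOf A) × (∀ p → IsPointOf A p → ∀ t → Lies Q₀ p (S t) ⇔ t ∈ᶠ A)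
    point-of A (size , sum≢0) =
        (p , Vieta⇒IsPointOf E p v , λ {p′} h → Vieta-unique 2≢0 p p′ v (IsPointOf⇒Vieta E p′ h))
      , λ p′ h t → let v′ = IsPointOf⇒Vieta E p′ h in
          mk⇔ (λ l → root⇒∈ᶠ (Vieta⇒roots p′ v′ l)) (λ m → Vieta⇒Lies p′ v′ (∈ᶠ⇒root m))
      where
      E = elements-of A size
      open Elements E
      exists = Vieta-exists 2≢0 a b c (λ e → sum≢0 (trans (sumOf≡ E) e))
      p = proj₁ exists
      v = proj₂ exists

open PointTheory

-- Sums over distinct pairs and triples.

module Counting where

  open Q using (_+_; _*_; _-_; -_; _≤_)
  open ℚₚ using (≤-reflexive; *-identityˡ; *-identityʳ; *-zeroˡ)
  open ℚSolver.+-*-Solver using (solve; _:+_; _:*_; _:-_; :-_; _:=_; con)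
  open ≡-Reasoning

  module Weights {A : Set} {xs : List A} (l : Listing xs) (_≟_ : (x y : A) → Dec (x ≡ y)) where

    δ ν : A → A → ℚ
    δ a b = 𝟙 (does (a ≟ b))
    ν a b = 1ℚ - δ a b

    -- The indicator of pairwise distinctness. Sums weighted by it count ordered triples, six for
    -- each set of three elements.
    Δ : A → A → A → ℚ
    Δ a b c = ν a b * (ν a c * ν b c)

    δ-≢ : ∀ {a b} → a ≢ b → δ a b ≡ 0ℚ
    δ-≢ {a} {b} a≢b = 𝟙-¬T (a≢b ∘ does-T (a ≟ b))

    ν-≢ : ∀ {a b} → a ≢ b → ν a b ≡ 1ℚ
    ν-≢ a≢b = cong (λ d → 1ℚ - d) (δ-≢ a≢b)

    δ-cong : ∀ {a b c d} → (a ≡ b → c ≡ d) → (c ≡ d → a ≡ b) → δ a b ≡ δ c d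
    δ-cong {a} {b} {c} {d} f g = cong 𝟙 (T-ext (λ t → T-does (c ≟ d) (f (does-T (a ≟ b) t)))
                                               (λ t → T-does (a ≟ b) (g (does-T (c ≟ d) t))))

    0≤ν : ∀ a b → 0ℚ ≤ ν a b
    0≤ν a b = ≤⇒0≤- (𝟙≤1 (does (a ≟ b)))

    ν≤1 : ∀ a b → ν a b ≤ 1ℚ
    ν≤1 a b = ≤-by (0≤𝟙 (does (a ≟ b))) (solve 1 (λ d → con 1ℚ := con 1ℚ :- d :+ d) refl (δ a b))

    ν-guard : ∀ a b {x y} → (a ≢ b → x ≡ y) → ν a b * x ≡ ν a b * y
    ν-guard a b {x} {y} h = go (a ≟ b)
      where
      go : (d : Dec (a ≡ b)) → (1ℚ - 𝟙 (does d)) * x ≡ (1ℚ - 𝟙 (does d)) * y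
      go (yes _)  = trans (*-zeroˡ x) (sym (*-zeroˡ y))
      go (no a≢b) = cong (λ z → 1ℚ * z) (h a≢b)

    ν-guard-≤ : ∀ a b {x y} → (a ≢ b → x ≤ y) → ν a b * x ≤ ν a b * y
    ν-guard-≤ a b {x} {y} h = go (a ≟ b)
      where
      go : (d : Dec (a ≡ b)) → (1ℚ - 𝟙 (does d)) * x ≤ (1ℚ - 𝟙 (does d)) * y
      go (yes _)  = ≤-reflexive (trans (*-zeroˡ x) (sym (*-zeroˡ y)))
      go (no a≢b) = subst₂ _≤_ (sym (*-identityˡ x)) (sym (*-identityˡ y)) (h a≢b)

    Δ-guard : ∀ a b c {x y} → (a ≢ b → a ≢ c → b ≢ c → x ≡ y) → Δ a b c * x ≡ Δ a b c * y
    Δ-guard a b c {x} {y} h = trans (assoc x) (trans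
      (ν-guard a b (λ a≢b → ν-guard a c (λ a≢c → ν-guard b c (h a≢b a≢c)))) (sym (assoc y)))
      where
      assoc : ∀ z → Δ a b c * z ≡ ν a b * (ν a c * (ν b c * z))
      assoc z = solve 4 (λ u v w z → (u :* (v :* w)) :* z := u :* (v :* (w :* z))) refl (ν a b) (ν a c) (ν b c) z

    Σ-ν : ∀ a (f : A → ℚ) → ∑[ b ← xs ] ν a b * f b ≡ Σ xs f - f a
    Σ-ν a f = begin
      (∑[ b ← xs ] ν a b * f b)               ≡⟨ Σ-cong xs (λ b → solve 2 (λ d f → (con 1ℚ :- d) :* f := f :- d :* f) refl (δ a b) (f b)) ⟩
      (∑[ b ← xs ] (f b - δ a b * f b))       ≡⟨ Σ-- xs f _ ⟩
      Σ xs f - (∑[ b ← xs ] δ a b * f b)      ≡⟨ cong (λ z → Σ xs f - z) (Σ-δ l _≟_ a f) ⟩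
      Σ xs f - f a                            ∎

    -- As a and b differ, the two exclusions remove two different terms.
    Σ-νν : ∀ {a b} → a ≢ b → (f : A → ℚ) → ∑[ c ← xs ] (ν a c * ν b c) * f c ≡ Σ xs f - f a - f b
    Σ-νν {a} {b} a≢b f = begin
      (∑[ c ← xs ] (ν a c * ν b c) * f c)       ≡⟨ Σ-cong xs (λ c → solve 3 (λ x y f → x :* y :* f := x :* (y :* f)) refl (ν a c) (ν b c) (f c)) ⟩
      (∑[ c ← xs ] ν a c * (ν b c * f c))       ≡⟨ Σ-ν a (λ c → ν b c * f c) ⟩
      (∑[ c ← xs ] ν b c * f c) - ν b a * f a   ≡⟨ cong₂ (λ x y → x - y * f a) (Σ-ν b f) (ν-≢ (a≢b ∘ sym)) ⟩
      Σ xs f - f b - 1ℚ * f a                   ≡⟨ solve 3 (λ s x y → s :- y :- con 1ℚ :* x := s :- x :- y) refl (Σ xs f) (f a) (f b) ⟩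
      Σ xs f - f a - f b                        ∎

    Σ₃-cong : {f g : A → A → A → ℚ} → (∀ a b c → f a b c ≡ g a b c) →
              ∑[ a ← xs ] ∑[ b ← xs ] ∑[ c ← xs ] f a b c ≡ ∑[ a ← xs ] ∑[ b ← xs ] ∑[ c ← xs ] g a b c
    Σ₃-cong h = Σ-cong xs λ a → Σ-cong xs λ b → Σ-cong xs λ c → h a b c

    Σ₃-mono : {f g : A → A → A → ℚ} → (∀ a b c → f a b c ≤ g a b c) →
              ∑[ a ← xs ] ∑[ b ← xs ] ∑[ c ← xs ] f a b c ≤ ∑[ a ← xs ] ∑[ b ← xs ] ∑[ c ← xs ] g a b c
    Σ₃-mono h = Σ-mono xs λ a → Σ-mono xs λ b → Σ-mono xs λ c → h a b c

    Σ₃-product : ∀ (u v w : A → ℚ) → ∑[ a ← xs ] ∑[ b ← xs ] ∑[ c ← xs ] u a * v b * w c ≡ Σ xs u * Σ xs v * Σ xs w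
    Σ₃-product u v w = begin
      (∑[ a ← xs ] ∑[ b ← xs ] ∑[ c ← xs ] u a * v b * w c)  ≡⟨ Σ-cong xs (λ a → Σ-cong xs λ b → Σ-*ˡ xs (u a * v b) w) ⟩
      (∑[ a ← xs ] ∑[ b ← xs ] u a * v b * Σ xs w)           ≡⟨ Σ-cong xs (λ a → trans (Σ-*ʳ xs (λ b → u a * v b) (Σ xs w)) (cong (_* Σ xs w) (Σ-*ˡ xs (u a) v))) ⟩
      (∑[ a ← xs ] u a * Σ xs v * Σ xs w)                    ≡⟨ trans (Σ-*ʳ xs (λ a → u a * Σ xs v) (Σ xs w)) (cong (_* Σ xs w) (Σ-*ʳ xs u (Σ xs v))) ⟩
      Σ xs u * Σ xs v * Σ xs w                               ∎

    Σ₃-Δ : ∀ (u v w : A → ℚ) → ∑[ a ← xs ] ∑[ b ← xs ] ∑[ c ← xs ] Δ a b c * (u a * v b * w c) ≡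
           ∑[ a ← xs ] u a * (∑[ b ← xs ] ν a b * (v b * (Σ xs w - w a - w b)))
    Σ₃-Δ u v w = Σ-cong xs λ a → trans (Σ-cong xs λ b → inner a b) (Σ-*ˡ xs (u a) _)
      where
      inner : ∀ a b → (∑[ c ← xs ] Δ a b c * (u a * v b * w c)) ≡ u a * (ν a b * (v b * (Σ xs w - w a - w b)))
      inner a b = begin
        (∑[ c ← xs ] Δ a b c * (u a * v b * w c))
          ≡⟨ Σ-cong xs (λ c → solve 5 (λ n k u v w → (n :* k) :* (u :* v :* w) := (u :* n :* v) :* (k :* w)) refl (ν a b) (ν a c * ν b c) (u a) (v b) (w c)) ⟩
        (∑[ c ← xs ] (u a * ν a b * v b) * ((ν a c * ν b c) * w c))
          ≡⟨ Σ-*ˡ xs (u a * ν a b * v b) _ ⟩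
        (u a * ν a b * v b) * (∑[ c ← xs ] (ν a c * ν b c) * w c)
          ≡⟨ solve 4 (λ u n v s → (u :* n :* v) :* s := (u :* v) :* (n :* s)) refl (u a) (ν a b) (v b) _ ⟩
        (u a * v b) * (ν a b * (∑[ c ← xs ] (ν a c * ν b c) * w c))
          ≡⟨ cong (λ z → u a * v b * z) (ν-guard a b (λ a≢b → Σ-νν a≢b w)) ⟩
        (u a * v b) * (ν a b * (Σ xs w - w a - w b))
          ≡⟨ solve 4 (λ u n v s → (u :* v) :* (n :* s) := u :* (n :* (v :* s))) refl (u a) (ν a b) (v b) _ ⟩
        u a * (ν a b * (v b * (Σ xs w - w a - w b))) ∎

    module _ (w : A → ℚ) (idem : ∀ a → w a * w a ≡ w a) where

      private
        s = Σ xs w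

        idem-expand : ∀ a k m → w a * (k - w a * m) ≡ w a * (k - m)
        idem-expand a k m = trans (solve 3 (λ w k m → w :* (k :- w :* m) := w :* k :- (w :* w) :* m) refl (w a) k m)
          (trans (cong (λ z → w a * k - z * m) (idem a)) (solve 3 (λ w k m → w :* k :- w :* m := w :* (k :- m)) refl (w a) k m))

      Σ-pairs : ∑[ a ← xs ] w a * (∑[ b ← xs ] ν a b * w b) ≡ s * s - s
      Σ-pairs = begin
        (∑[ a ← xs ] w a * (∑[ b ← xs ] ν a b * w b))  ≡⟨ Σ-cong xs (λ a → trans (cong (w a *_) (trans (Σ-ν a w) (cong (λ z → s - z) (sym (*-identityʳ (w a))))))
                                                            (trans (idem-expand a s 1ℚ) (*-distribˡ-- (w a) s))) ⟩
        (∑[ a ← xs ] (w a * s - w a))                  ≡⟨ Σ-- xs _ w ⟩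
        (∑[ a ← xs ] w a * s) - s                      ≡⟨ cong (_- s) (Σ-*ʳ xs w s) ⟩
        s * s - s                                      ∎
        where
        *-distribˡ-- : ∀ w s → w * (s - 1ℚ) ≡ w * s - w
        *-distribˡ-- = solve 2 (λ w s → w :* (s :- con 1ℚ) := w :* s :- w) refl

      -- An idempotent weight is the indicator of a set with s elements. Once c and b have been
      -- summed out, powers of `w a` appear, and idempotence reduces them to `w a`.
      Σ-triples : ∑[ a ← xs ] ∑[ b ← xs ] ∑[ c ← xs ] Δ a b c * (w a * w b * w c) ≡ s * (s - 1ℚ) * (s - ℕ→ℚ 2)
      Σ-triples = begin
        (∑[ a ← xs ] ∑[ b ← xs ] ∑[ c ← xs ] Δ a b c * (w a * w b * w c))        ≡⟨ Σ₃-Δ w w w ⟩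
        (∑[ a ← xs ] w a * (∑[ b ← xs ] ν a b * (w b * (s - w a - w b))))        ≡⟨ Σ-cong xs outer ⟩
        (∑[ a ← xs ] w a * ((s - 1ℚ) * (s - ℕ→ℚ 2)))                             ≡⟨ Σ-*ʳ xs w _ ⟩
        s * ((s - 1ℚ) * (s - ℕ→ℚ 2))                                             ≡⟨ ℚₚ.*-assoc s _ _ ⟨
        s * (s - 1ℚ) * (s - ℕ→ℚ 2)                                               ∎
        where
        simplify : ∀ a b → w b * (s - w a - w b) ≡ w b * (s - w a - 1ℚ)
        simplify a b = trans (cong (λ z → w b * (s - w a - z)) (sym (*-identityʳ (w b)))) (idem-expand b (s - w a) 1ℚ)
        outer : ∀ a → w a * (∑[ b ← xs ] ν a b * (w b * (s - w a - w b))) ≡ w a * ((s - 1ℚ) * (s - ℕ→ℚ 2))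
        outer a = begin
          w a * (∑[ b ← xs ] ν a b * (w b * (s - w a - w b)))
            ≡⟨ cong (w a *_) (trans (Σ-cong xs (λ b → cong (ν a b *_) (simplify a b))) (Σ-ν a _)) ⟩
          w a * ((∑[ b ← xs ] w b * (s - w a - 1ℚ)) - w a * (s - w a - 1ℚ))
            ≡⟨ cong (λ z → w a * (z - w a * (s - w a - 1ℚ))) (Σ-*ʳ xs w _) ⟩
          w a * (s * (s - w a - 1ℚ) - w a * (s - w a - 1ℚ))
            ≡⟨ solve 2 (λ w s → w :* (s :* (s :- w :- con 1ℚ) :- w :* (s :- w :- con 1ℚ)) :=
                              s :* (s :- con 1ℚ) :* w :- (con (ℕ→ℚ 2) :* s :- con 1ℚ) :* (w :* w) :+ w :* (w :* w)) refl (w a) s ⟩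
          s * (s - 1ℚ) * w a - (ℕ→ℚ 2 * s - 1ℚ) * (w a * w a) + w a * (w a * w a)
            ≡⟨ cong₂ (λ y z → s * (s - 1ℚ) * w a - (ℕ→ℚ 2 * s - 1ℚ) * y + z) (idem a) (trans (cong (w a *_) (idem a)) (idem a)) ⟩
          s * (s - 1ℚ) * w a - (ℕ→ℚ 2 * s - 1ℚ) * w a + w a
            ≡⟨ solve 2 (λ w s → s :* (s :- con 1ℚ) :* w :- (con (ℕ→ℚ 2) :* s :- con 1ℚ) :* w :+ w :=
                              w :* ((s :- con 1ℚ) :* (s :- con (ℕ→ℚ 2)))) refl (w a) s ⟩
          w a * ((s - 1ℚ) * (s - ℕ→ℚ 2)) ∎

      module _ (v : A → ℚ) (disjoint : ∀ a → w a * v a ≡ 0ℚ) where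

        -- On disjoint supports c differs from a and b automatically, so c runs over the full
        -- support of `v` and only a ≠ b remains.
        Σ-mixed : ∑[ a ← xs ] ∑[ b ← xs ] ∑[ c ← xs ] Δ a b c * (w a * w b * v c) ≡ (s * s - s) * Σ xs v
        Σ-mixed = begin
          (∑[ a ← xs ] ∑[ b ← xs ] ∑[ c ← xs ] Δ a b c * (w a * w b * v c))       ≡⟨ Σ₃-Δ w w v ⟩
          (∑[ a ← xs ] w a * (∑[ b ← xs ] ν a b * (w b * (Σ xs v - v a - v b))))  ≡⟨ Σ-cong xs outer ⟩
          (∑[ a ← xs ] w a * (∑[ b ← xs ] ν a b * w b) * Σ xs v)                  ≡⟨ Σ-*ʳ xs _ (Σ xs v) ⟩
          (∑[ a ← xs ] w a * (∑[ b ← xs ] ν a b * w b)) * Σ xs v                  ≡⟨ cong (_* Σ xs v) Σ-pairs ⟩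
          (s * s - s) * Σ xs v                                                    ∎
          where
          t = Σ xs v
          kill : ∀ a b → w a * (ν a b * (w b * (t - v a - v b))) ≡ w a * (ν a b * w b * t)
          kill a b = begin
            w a * (ν a b * (w b * (t - v a - v b)))
              ≡⟨ solve 6 (λ wa n wb t va vb → wa :* (n :* (wb :* (t :- va :- vb))) :=
                   wa :* (n :* wb :* t) :- (wa :* va) :* (n :* wb) :- (wb :* vb) :* (wa :* n)) refl (w a) (ν a b) (w b) t (v a) (v b) ⟩
            w a * (ν a b * w b * t) - (w a * v a) * (ν a b * w b) - (w b * v b) * (w a * ν a b)
              ≡⟨ cong₂ (λ y z → w a * (ν a b * w b * t) - y * (ν a b * w b) - z * (w a * ν a b)) (disjoint a) (disjoint b) ⟩
            w a * (ν a b * w b * t) - 0ℚ * (ν a b * w b) - 0ℚ * (w a * ν a b)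
              ≡⟨ solve 3 (λ x y z → x :- con 0ℚ :* y :- con 0ℚ :* z := x) refl _ (ν a b * w b) (w a * ν a b) ⟩
            w a * (ν a b * w b * t) ∎
          outer : ∀ a → w a * (∑[ b ← xs ] ν a b * (w b * (t - v a - v b))) ≡ w a * (∑[ b ← xs ] ν a b * w b) * t
          outer a = begin
            w a * (∑[ b ← xs ] ν a b * (w b * (t - v a - v b)))     ≡⟨ Σ-*ˡ xs (w a) _ ⟨
            (∑[ b ← xs ] w a * (ν a b * (w b * (t - v a - v b))))   ≡⟨ Σ-cong xs (kill a) ⟩
            (∑[ b ← xs ] w a * (ν a b * w b * t))                   ≡⟨ Σ-*ˡ xs (w a) _ ⟩
            w a * (∑[ b ← xs ] ν a b * w b * t)                     ≡⟨ cong (w a *_) (Σ-*ʳ xs _ t) ⟩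
            w a * ((∑[ b ← xs ] ν a b * w b) * t)                   ≡⟨ ℚₚ.*-assoc (w a) _ t ⟨
            w a * (∑[ b ← xs ] ν a b * w b) * t                     ∎

open Counting

-- The number of points on three spheres, on two spheres, and in the whole system.

module CountTheory where

  open Q using (_*_; _≤_) renaming (_+_ to _+ℚ_; _-_ to _-ℚ_)
  open ℚₚ using (≤-trans; ≤-reflexive; *-identityˡ; *-identityʳ; *-zeroˡ; *-zeroʳ)
  open ℚSolver.+-*-Solver using (solve; _:+_; _:*_; _:-_; :-_; _:=_; con)
  open ≡-Reasoning
  open Listing

  vectors-listing : ∀ {q} (F : FiniteField q) n → Listing (Geometry.vectors F n)
  vectors-listing F zero .unique        = [] ∷ []
  vectors-listing F zero .complete []   = here refl
  vectors-listing F (suc n) .unique     = Uniqueₚ.cartesianProductWith⁺ _∷_ Vecₚ.∷-injective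
    (FieldAlgebra.elements-listing F .unique) (vectors-listing F n .unique)
  vectors-listing F (suc n) .complete (x ∷ v) = Membershipₚ.∈-cartesianProductWith⁺ _∷_
    (FieldAlgebra.elements-listing F .complete x) (vectors-listing F n .complete v)

  module Counts {q : ℕ} (F : FiniteField q) (R : FiniteField.Carrier F)
                (2≢0 : FieldAlgebra.2# F ≢ FiniteField.0# F)
                (3≢0 : FiniteField._+_ F (FieldAlgebra.2# F) (FiniteField.1# F) ≢ FiniteField.0# F) where

    open FiniteField F hiding (_*_)
    open FiniteField F using () renaming (_*_ to _*ᶠ_)
    module K = FieldAlgebra F
    open K using (elements-listing; length-elements; 2#; combine₁; *-cancelˡ-≡0)
    open Geometry F
    open TwistedCubic F R
    open CubicAlgebra F R
    open Points F R 2≢0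
    open Weights elements-listing _≟_

    E = elements
    qℚ = ℕ→ℚ q

    points-listing : Listing allPoints
    points-listing = vectors-listing F 3

    _≟ᵖ_ : (x y : Point) → Dec (x ≡ y)
    _≟ᵖ_ = Vecₚ.≡-dec _≟_

    Σ-1 : ∑[ t ← E ] 1ℚ ≡ qℚ
    Σ-1 = trans (Σ-const E 1ℚ) (trans (*-identityʳ _) (cong ℕ→ℚ length-elements))

    third : Carrier → Carrier → Carrier
    third a b = - (a + b)

    third≡⇒sum≡0 : ∀ {a b c} → third a b ≡ c → a + b + c ≡ 0#
    third≡⇒sum≡0 {a} {b} refl = K.-‿inverseʳ (a + b)

    sum≡0⇒third≡ : ∀ {a b c} → a + b + c ≡ 0# → third a b ≡ c
    sum≡0⇒third≡ {a} {b} {c} h = combine₁ (- 1#) h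
      (K.solve 3 (λ a b c → K.:- (a K.:+ b) K.:- c K.:= (K.:- K.:1) K.:* (a K.:+ b K.:+ c K.:- K.:0)) refl a b c)

    tc : Point → ℚ
    tc p = 𝟙 (Ptc p)

    on³ : Point → Carrier → Carrier → Carrier → ℚ
    on³ p a b c = 𝟙 (on p a) * 𝟙 (on p b) * 𝟙 (on p c)

    -- Three distinct parameters determine at most one point by Vieta's formulas, and the point
    -- exists exactly when they have nonzero sum, that is, when c is not `third a b`.
    points-through-three : ∀ a b c → Δ a b c * (∑[ p ← allPoints ] tc p * on³ p a b c) ≡ Δ a b c * ν (third a b) c
    points-through-three a b c = Δ-guard a b c λ a≢b a≢c b≢c → go a≢b a≢c b≢c (third a b ≟ c)
      where
      on³-T : ∀ p → T (on p a) → T (on p b) → T (on p c) → on³ p a b c ≡ 1ℚ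
      on³-T p ta tb tc = cong₂ _*_ (cong₂ _*_ (𝟙-T ta) (𝟙-T tb)) (𝟙-T tc)
      on³-0 : ∀ p → (T (on p a) → T (on p b) → T (on p c) → ⊥) → tc p * on³ p a b c ≡ 0ℚ
      on³-0 p h with on p a | on p b | on p c
      ... | false | x     | y     = trans (cong (tc p *_) (trans (cong (_* 𝟙 y) (*-zeroˡ (𝟙 x))) (*-zeroˡ (𝟙 y)))) (*-zeroʳ (tc p))
      ... | true  | false | y     = trans (cong (tc p *_) (*-zeroˡ (𝟙 y))) (*-zeroʳ (tc p))
      ... | true  | true  | false = *-zeroʳ (tc p)
      ... | true  | true  | true  = ⊥-elim (h tt tt tt)
      go : a ≢ b → a ≢ c → b ≢ c → (d : Dec (third a b ≡ c)) → (∑[ p ← allPoints ] tc p * on³ p a b c) ≡ 1ℚ -ℚ 𝟙 (does d)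
      go a≢b a≢c b≢c (yes e) = trans (Σ-cong allPoints (λ p → on³-0 p λ ta tb tc →
          sum≢0 p (Lies⇒Vieta p a≢b a≢c b≢c (on⇒Lies p a ta) (on⇒Lies p b tb) (on⇒Lies p c tc)))) (Σ-zero allPoints)
        where
        sum≢0 : ∀ p → ¬ Vieta p a b c
        sum≢0 (x ∷ y ∷ z ∷ []) (e₁ , _) = K.*-≡1⇒≢0 (trans (K.*-comm _ x) e₁) (third≡⇒sum≡0 e)
      go a≢b a≢c b≢c (no n) with p₀ , v ← Vieta-exists 2≢0 a b c (n ∘ sum≡0⇒third≡) = trans
        (Σ-single points-listing _≟ᵖ_ p₀ _ λ p p≢ → on³-0 p λ ta tb tc →
          p≢ (Vieta-unique 2≢0 p p₀ (Lies⇒Vieta p a≢b a≢c b≢c (on⇒Lies p a ta) (on⇒Lies p b tb) (on⇒Lies p c tc)) v))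
        (cong₂ _*_ (𝟙-T (Roots⇒∈Ptc p₀ (roots a≢b a≢c b≢c v)))
          (on³-T p₀ (lies (inj₁ refl)) (lies (inj₂ (inj₁ refl))) (lies (inj₂ (inj₂ refl)))))
        where
        lies : ∀ {t} → t ≡ a ⊎ t ≡ b ⊎ t ≡ c → T (on p₀ t)
        lies {t} h = Lies⇒on p₀ t (Vieta⇒Lies p₀ v h)

    -- Interchanging the sums over points and over triples turns products of incidence counts at a
    -- point into weighted counts of distinct triples with nonzero sum.
    triple-count : ∀ (X Y Z : Carrier → ℚ) →
      ∑[ p ← allPoints ] tc p * (∑[ a ← E ] ∑[ b ← E ] ∑[ c ← E ] Δ a b c * ((𝟙 (on p a) * X a) * (𝟙 (on p b) * Y b) * (𝟙 (on p c) * Z c)))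
      ≡ ∑[ a ← E ] ∑[ b ← E ] ∑[ c ← E ] X a * Y b * Z c * (Δ a b c * ν (third a b) c)
    triple-count X Y Z = begin
      (∑[ p ← allPoints ] tc p * (∑[ a ← E ] ∑[ b ← E ] ∑[ c ← E ] f p a b c))
        ≡⟨ Σ-cong allPoints (λ p → trans (sym (Σ-*ˡ E (tc p) _)) (Σ-cong E λ a → trans (sym (Σ-*ˡ E (tc p) _)) (Σ-cong E λ b → trans (sym (Σ-*ˡ E (tc p) _)) (Σ-cong E λ c → arrange p a b c)))) ⟩
      (∑[ p ← allPoints ] ∑[ a ← E ] ∑[ b ← E ] ∑[ c ← E ] X a * Y b * Z c * (Δ a b c * (tc p * on³ p a b c)))
        ≡⟨ trans (Σ-swap allPoints E _) (Σ-cong E λ a → trans (Σ-swap allPoints E _) (Σ-cong E λ b → Σ-swap allPoints E _)) ⟩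
      (∑[ a ← E ] ∑[ b ← E ] ∑[ c ← E ] ∑[ p ← allPoints ] X a * Y b * Z c * (Δ a b c * (tc p * on³ p a b c)))
        ≡⟨ Σ₃-cong (λ a b c → trans (Σ-*ˡ allPoints (X a * Y b * Z c) _) (cong (X a * Y b * Z c *_)
             (trans (Σ-*ˡ allPoints (Δ a b c) _) (points-through-three a b c)))) ⟩
      (∑[ a ← E ] ∑[ b ← E ] ∑[ c ← E ] X a * Y b * Z c * (Δ a b c * ν (third a b) c)) ∎
      where
      f : Point → Carrier → Carrier → Carrier → ℚ
      f p a b c = Δ a b c * ((𝟙 (on p a) * X a) * (𝟙 (on p b) * Y b) * (𝟙 (on p c) * Z c))
      arrange : ∀ p a b c → tc p * f p a b c ≡ X a * Y b * Z c * (Δ a b c * (tc p * on³ p a b c))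
      arrange p a b c = solve 8 (λ t d x y z i j k → t :* (d :* ((i :* x) :* (j :* y) :* (k :* z))) := x :* y :* z :* (d :* (t :* (i :* j :* k))))
        refl (tc p) (Δ a b c) (X a) (Y b) (Z c) (𝟙 (on p a)) (𝟙 (on p b)) (𝟙 (on p c))

    pairs : Carrier → Carrier → ℚ
    pairs a b = ∑[ p ← allPoints ] tc p * (𝟙 (on p a) * 𝟙 (on p b))

    -- A point on both spheres is given by its third root, which avoids a, b and `third a b`. The
    -- two deltas correct for the case in which `third a b` is already among a and b.
    pairs-formula : ∀ {a b} → a ≢ b → pairs a b ≡ qℚ -ℚ ℕ→ℚ 3 +ℚ (δ (third a b) a +ℚ δ (third a b) b)
    pairs-formula {a} {b} a≢b = begin
      (∑[ p ← allPoints ] tc p * (𝟙 (on p a) * 𝟙 (on p b)))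
        ≡⟨ Σ-cong allPoints extend ⟩
      (∑[ p ← allPoints ] ∑[ c ← E ] ν a c * ν b c * (tc p * on³ p a b c))
        ≡⟨ Σ-swap allPoints E _ ⟩
      (∑[ c ← E ] ∑[ p ← allPoints ] ν a c * ν b c * (tc p * on³ p a b c))
        ≡⟨ Σ-cong E (λ c → trans (Σ-*ˡ allPoints (ν a c * ν b c) _) (through c)) ⟩
      (∑[ c ← E ] ν a c * ν b c * ν (third a b) c)
        ≡⟨ Σ-νν a≢b (ν (third a b)) ⟩
      Σ E (ν (third a b)) -ℚ ν (third a b) a -ℚ ν (third a b) b
        ≡⟨ cong (λ s → s -ℚ ν (third a b) a -ℚ ν (third a b) b) (trans (Σ-cong E (λ c → sym (*-identityʳ (ν (third a b) c))))
             (trans (Σ-ν (third a b) (λ _ → 1ℚ)) (cong (_-ℚ 1ℚ) Σ-1))) ⟩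
      qℚ -ℚ 1ℚ -ℚ ν (third a b) a -ℚ ν (third a b) b
        ≡⟨ solve 3 (λ q x y → q :- con 1ℚ :- (con 1ℚ :- x) :- (con 1ℚ :- y) := q :- con (ℕ→ℚ 3) :+ (x :+ y)) refl qℚ (δ (third a b) a) (δ (third a b) b) ⟩
      qℚ -ℚ ℕ→ℚ 3 +ℚ (δ (third a b) a +ℚ δ (third a b) b) ∎
      where
      through : ∀ c → ν a c * ν b c * (∑[ p ← allPoints ] tc p * on³ p a b c) ≡ ν a c * ν b c * ν (third a b) c
      through c = subst (λ n → n * (∑[ p ← allPoints ] tc p * on³ p a b c) ≡ n * ν (third a b) c)
        (trans (cong (_* (ν a c * ν b c)) (ν-≢ a≢b)) (*-identityˡ (ν a c * ν b c))) (points-through-three a b c)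
      extend : ∀ p → tc p * (𝟙 (on p a) * 𝟙 (on p b)) ≡ ∑[ c ← E ] ν a c * ν b c * (tc p * on³ p a b c)
      extend p = sym (begin
        (∑[ c ← E ] ν a c * ν b c * (tc p * on³ p a b c))
          ≡⟨ Σ-cong E (λ c → solve 5 (λ n t i j k → n :* (t :* (i :* j :* k)) := (t :* (i :* j)) :* (n :* k)) refl (ν a c * ν b c) (tc p) (𝟙 (on p a)) (𝟙 (on p b)) (𝟙 (on p c))) ⟩
        (∑[ c ← E ] tc p * (𝟙 (on p a) * 𝟙 (on p b)) * (ν a c * ν b c * 𝟙 (on p c)))
          ≡⟨ trans (Σ-*ˡ E (tc p * (𝟙 (on p a) * 𝟙 (on p b))) (λ c → ν a c * ν b c * 𝟙 (on p c)))
               (cong (tc p * (𝟙 (on p a) * 𝟙 (on p b)) *_) (Σ-νν a≢b (λ c → 𝟙 (on p c)))) ⟩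
        tc p * (𝟙 (on p a) * 𝟙 (on p b)) * (Σ E (λ c → 𝟙 (on p c)) -ℚ 𝟙 (on p a) -ℚ 𝟙 (on p b))
          ≡⟨ trans (ℚₚ.*-assoc (tc p) _ _) (𝟙-guard (Ptc p) (λ p∈ → trans (ℚₚ.*-assoc (𝟙 (on p a)) _ _) (𝟙-guard (on p a) (λ pa → 𝟙-guard (on p b) (λ pb → one p∈ pa pb))))) ⟩
        tc p * (𝟙 (on p a) * (𝟙 (on p b) * 1ℚ))
          ≡⟨ cong (λ z → tc p * (𝟙 (on p a) * z)) (*-identityʳ _) ⟩
        tc p * (𝟙 (on p a) * 𝟙 (on p b)) ∎)
        where
        one : p ∈ Ptc → T (on p a) → T (on p b) → Σ E (λ c → 𝟙 (on p c)) -ℚ 𝟙 (on p a) -ℚ 𝟙 (on p b) ≡ 1ℚ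
        one p∈ pa pb = trans (cong₂ (λ s x → s -ℚ x -ℚ 𝟙 (on p b)) (degree-3 p (∈Ptc⇒Roots p p∈)) (𝟙-T pa)) (cong (λ x → ℕ→ℚ 3 -ℚ 1ℚ -ℚ x) (𝟙-T pb))

    q-3≤pairs : ∀ {a b} → a ≢ b → qℚ -ℚ ℕ→ℚ 3 ≤ pairs a b
    q-3≤pairs {a} {b} a≢b = ≤-by (0≤+ (0≤𝟙 (does (third a b ≟ a))) (0≤𝟙 (does (third a b ≟ b)))) (pairs-formula a≢b)

    pairs≤q-2 : ∀ {a b} → a ≢ b → pairs a b ≤ qℚ -ℚ ℕ→ℚ 2
    pairs≤q-2 {a} {b} a≢b = ≤-trans (≤-reflexive (pairs-formula a≢b)) (≤-trans
      (ℚₚ.+-monoʳ-≤ (qℚ -ℚ ℕ→ℚ 3) (at-most-one (third a b ≟ a) (third a b ≟ b)))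
      (≤-reflexive (solve 1 (λ q → q :- con (ℕ→ℚ 3) :+ con 1ℚ := q :- con (ℕ→ℚ 2)) refl qℚ)))
      where
      at-most-one : (x : Dec (third a b ≡ a)) (y : Dec (third a b ≡ b)) → 𝟙 (does x) +ℚ 𝟙 (does y) ≤ 1ℚ
      at-most-one (yes e) (yes f) = ⊥-elim (a≢b (trans (sym e) f))
      at-most-one (yes e) (no _)  = ℚₚ.≤-refl
      at-most-one (no _)  (yes e) = ℚₚ.≤-refl
      at-most-one (no _)  (no _)  = 0≤1

    -- The condition on `f` forces b = - 2 a, and this differs from a unless 3 a = 0. Characteristic
    -- different from 3 leaves exactly the nonzero a.
    Σ-νδ : (f : Carrier → Carrier) → (∀ {a b} → third a b ≡ a → f a ≡ b) → (∀ {a b} → f a ≡ b → third a b ≡ a) →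
           ∑[ a ← E ] ∑[ b ← E ] ν a b * δ (third a b) a ≡ qℚ -ℚ 1ℚ
    Σ-νδ f to from = begin
      (∑[ a ← E ] ∑[ b ← E ] ν a b * δ (third a b) a)   ≡⟨ Σ-cong E inner ⟩
      (∑[ a ← E ] ν 0# a * 1ℚ)                          ≡⟨ Σ-ν 0# (λ _ → 1ℚ) ⟩
      (∑[ a ← E ] 1ℚ) -ℚ 1ℚ                             ≡⟨ cong (_-ℚ 1ℚ) Σ-1 ⟩
      qℚ -ℚ 1ℚ                                          ∎
      where
      zero⇔ : ∀ {a} → third a a ≡ a → 0# ≡ a
      zero⇔ {a} h = sym (*-cancelˡ-≡0 3≢0 (trans
        (K.solve 1 (λ a → (K.:2 K.:+ K.:1) K.:* a K.:= a K.:+ a K.:+ a) refl a) (third≡⇒sum≡0 h)))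
      inner : ∀ a → (∑[ b ← E ] ν a b * δ (third a b) a) ≡ ν 0# a * 1ℚ
      inner a = begin
        (∑[ b ← E ] ν a b * δ (third a b) a)  ≡⟨ Σ-cong E (λ b → trans (ℚₚ.*-comm (ν a b) _) (cong (_* ν a b) (δ-cong to from))) ⟩
        (∑[ b ← E ] δ (f a) b * ν a b)        ≡⟨ Σ-δ elements-listing _≟_ (f a) (ν a) ⟩
        ν a (f a)                             ≡⟨ cong (λ d → 1ℚ -ℚ d) (δ-cong (λ e → zero⇔ (from (sym e)))
                                                   (λ { refl → sym (to (trans (cong (-_) (K.+-identityˡ 0#)) K.-0#≈0#)) })) ⟩
        ν 0# a                                ≡⟨ *-identityʳ _ ⟨
        ν 0# a * 1ℚ                           ∎

    Σ-pairs-tc : ∑[ a ← E ] ∑[ b ← E ] ν a b * pairs a b ≡ (qℚ -ℚ 1ℚ) * (qℚ -ℚ 1ℚ) * (qℚ -ℚ ℕ→ℚ 2)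
    Σ-pairs-tc = begin
      (∑[ a ← E ] ∑[ b ← E ] ν a b * pairs a b)
        ≡⟨ Σ-cong E (λ a → trans (Σ-cong E (λ b → trans (ν-guard a b pairs-formula) (expand a b)))
             (trans (Σ-+ E _ _) (cong (_+ℚ (∑[ b ← E ] ν a b * δ (third a b) b)) (Σ-+ E _ _)))) ⟩
      (∑[ a ← E ] ((∑[ b ← E ] ν a b * (qℚ -ℚ ℕ→ℚ 3)) +ℚ (∑[ b ← E ] ν a b * δ (third a b) a) +ℚ (∑[ b ← E ] ν a b * δ (third a b) b)))
        ≡⟨ trans (Σ-+ E _ _) (cong₂ _+ℚ_ (Σ-+ E _ _) refl) ⟩
      (∑[ a ← E ] ∑[ b ← E ] ν a b * (qℚ -ℚ ℕ→ℚ 3)) +ℚ (∑[ a ← E ] ∑[ b ← E ] ν a b * δ (third a b) a) +ℚ (∑[ a ← E ] ∑[ b ← E ] ν a b * δ (third a b) b)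
        ≡⟨ cong₂ _+ℚ_ (cong₂ _+ℚ_ generic (Σ-νδ f to from)) flipped ⟩
      qℚ * (qℚ * (qℚ -ℚ ℕ→ℚ 3) -ℚ (qℚ -ℚ ℕ→ℚ 3)) +ℚ (qℚ -ℚ 1ℚ) +ℚ (qℚ -ℚ 1ℚ)
        ≡⟨ solve 1 (λ q → q :* (q :* (q :- con (ℕ→ℚ 3)) :- (q :- con (ℕ→ℚ 3))) :+ (q :- con 1ℚ) :+ (q :- con 1ℚ)
                         := (q :- con 1ℚ) :* (q :- con 1ℚ) :* (q :- con (ℕ→ℚ 2))) refl qℚ ⟩
      (qℚ -ℚ 1ℚ) * (qℚ -ℚ 1ℚ) * (qℚ -ℚ ℕ→ℚ 2) ∎
      where
      f : Carrier → Carrier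
      f a = - (a + a)
      to : ∀ {a b} → third a b ≡ a → f a ≡ b
      to {a} {b} h = combine₁ 1# h (K.solve 2 (λ a b → K.:- (a K.:+ a) K.:- b K.:= K.:1 K.:* (K.:- (a K.:+ b) K.:- a)) refl a b)
      from : ∀ {a b} → f a ≡ b → third a b ≡ a
      from {a} {b} h = combine₁ 1# h (K.solve 2 (λ a b → K.:- (a K.:+ b) K.:- a K.:= K.:1 K.:* (K.:- (a K.:+ a) K.:- b)) refl a b)
      expand : ∀ a b → ν a b * (qℚ -ℚ ℕ→ℚ 3 +ℚ (δ (third a b) a +ℚ δ (third a b) b)) ≡
               ν a b * (qℚ -ℚ ℕ→ℚ 3) +ℚ ν a b * δ (third a b) a +ℚ ν a b * δ (third a b) b
      expand a b = solve 4 (λ n k x y → n :* (k :+ (x :+ y)) := n :* k :+ n :* x :+ n :* y) refl (ν a b) (qℚ -ℚ ℕ→ℚ 3) (δ (third a b) a) (δ (third a b) b)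
      Σ-q : ∀ c → Σ E (λ _ → c) ≡ qℚ * c
      Σ-q c = trans (Σ-const E c) (cong (λ n → ℕ→ℚ n * c) length-elements)
      generic : (∑[ a ← E ] ∑[ b ← E ] ν a b * (qℚ -ℚ ℕ→ℚ 3)) ≡ qℚ * (qℚ * (qℚ -ℚ ℕ→ℚ 3) -ℚ (qℚ -ℚ ℕ→ℚ 3))
      generic = trans (Σ-cong E (λ a → trans (Σ-ν a (λ _ → qℚ -ℚ ℕ→ℚ 3)) (cong (_-ℚ (qℚ -ℚ ℕ→ℚ 3)) (Σ-q _)))) (Σ-q _)
      flipped : (∑[ a ← E ] ∑[ b ← E ] ν a b * δ (third a b) b) ≡ qℚ -ℚ 1ℚ
      flipped = begin
        (∑[ a ← E ] ∑[ b ← E ] ν a b * δ (third a b) b)   ≡⟨ Σ-swap E E _ ⟩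
        (∑[ b ← E ] ∑[ a ← E ] ν a b * δ (third a b) b)   ≡⟨ Σ-cong E (λ b → Σ-cong E (λ a → cong₂ _*_
                                                               (cong (λ d → 1ℚ -ℚ d) (δ-cong {a} {b} sym sym)) (cong (λ c → δ (- c) b) (K.+-comm a b)))) ⟩
        (∑[ b ← E ] ∑[ a ← E ] ν b a * δ (third b a) b)   ≡⟨ Σ-νδ f to from ⟩
        qℚ -ℚ 1ℚ ∎

    -- Double counting of the pairs (t, b) of distinct roots of p, weighted by t.

    Σ-double : ∀ (X : Carrier → ℚ) → ∑[ p ← allPoints ] tc p * (ℕ→ℚ 2 * (∑[ t ← E ] 𝟙 (on p t) * X t)) ≡
               ∑[ a ← E ] X a * (∑[ b ← E ] ν a b * pairs a b)
    Σ-double X = begin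
      (∑[ p ← allPoints ] tc p * (ℕ→ℚ 2 * (∑[ t ← E ] 𝟙 (on p t) * X t)))
        ≡⟨ Σ-cong allPoints (λ p → trans (𝟙-guard (Ptc p) (λ p∈ → per-point p p∈)) (distribute p)) ⟩
      (∑[ p ← allPoints ] ∑[ a ← E ] ∑[ b ← E ] X a * (ν a b * (tc p * (𝟙 (on p a) * 𝟙 (on p b)))))
        ≡⟨ trans (Σ-swap allPoints E _) (Σ-cong E (λ a → Σ-swap allPoints E _)) ⟩
      (∑[ a ← E ] ∑[ b ← E ] ∑[ p ← allPoints ] X a * (ν a b * (tc p * (𝟙 (on p a) * 𝟙 (on p b)))))
        ≡⟨ Σ-cong E (λ a → trans (Σ-cong E (λ b → trans (Σ-*ˡ allPoints (X a) _) (cong (X a *_) (Σ-*ˡ allPoints (ν a b) _)))) (Σ-*ˡ E (X a) _)) ⟩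
      (∑[ a ← E ] X a * (∑[ b ← E ] ν a b * pairs a b)) ∎
      where
      per-point : ∀ p → p ∈ Ptc → ℕ→ℚ 2 * (∑[ t ← E ] 𝟙 (on p t) * X t) ≡
                  ∑[ a ← E ] 𝟙 (on p a) * X a * (∑[ b ← E ] ν a b * 𝟙 (on p b))
      per-point p p∈ = trans (sym (Σ-*ˡ E (ℕ→ℚ 2) _)) (Σ-cong E λ a → sym (begin
        𝟙 (on p a) * X a * (∑[ b ← E ] ν a b * 𝟙 (on p b))   ≡⟨ ℚₚ.*-assoc (𝟙 (on p a)) (X a) _ ⟩
        𝟙 (on p a) * (X a * (∑[ b ← E ] ν a b * 𝟙 (on p b))) ≡⟨ 𝟙-guard (on p a) (λ pa → cong (X a *_) (trans (Σ-ν a _)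
                                                                 (cong₂ _-ℚ_ (degree-3 p (∈Ptc⇒Roots p p∈)) (𝟙-T pa)))) ⟩
        𝟙 (on p a) * (X a * (ℕ→ℚ 3 -ℚ 1ℚ))                   ≡⟨ solve 2 (λ o x → o :* (x :* (con (ℕ→ℚ 3) :- con 1ℚ)) := con (ℕ→ℚ 2) :* (o :* x)) refl (𝟙 (on p a)) (X a) ⟩
        ℕ→ℚ 2 * (𝟙 (on p a) * X a)                           ∎))
      distribute : ∀ p → tc p * (∑[ a ← E ] 𝟙 (on p a) * X a * (∑[ b ← E ] ν a b * 𝟙 (on p b))) ≡
                   ∑[ a ← E ] ∑[ b ← E ] X a * (ν a b * (tc p * (𝟙 (on p a) * 𝟙 (on p b))))
      distribute p = trans (sym (Σ-*ˡ E (tc p) _)) (Σ-cong E λ a → trans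
        (sym (ℚₚ.*-assoc (tc p) (𝟙 (on p a) * X a) _)) (trans (sym (Σ-*ˡ E (tc p * (𝟙 (on p a) * X a)) _)) (Σ-cong E λ b →
        solve 5 (λ t i x n j → t :* (i :* x) :* (n :* j) := x :* (n :* (t :* (i :* j)))) refl (tc p) (𝟙 (on p a)) (X a) (ν a b) (𝟙 (on p b)))))

    -- Each point has three roots and hence six ordered pairs of distinct roots, so the sum of
    -- `pairs` counts every point six times.
    size-formula : ℕ→ℚ 6 * (∑[ p ← allPoints ] tc p) ≡ (qℚ -ℚ 1ℚ) * (qℚ -ℚ 1ℚ) * (qℚ -ℚ ℕ→ℚ 2)
    size-formula = begin
      ℕ→ℚ 6 * (∑[ p ← allPoints ] tc p)
        ≡⟨ trans (sym (Σ-*ˡ allPoints (ℕ→ℚ 6) _)) (Σ-cong allPoints (λ p → trans (ℚₚ.*-comm (ℕ→ℚ 6) (tc p))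
             (𝟙-guard (Ptc p) (λ p∈ → sym (cong (ℕ→ℚ 2 *_) (trans (Σ-cong E (λ t → *-identityʳ _)) (degree-3 p (∈Ptc⇒Roots p p∈)))))))) ⟩
      (∑[ p ← allPoints ] tc p * (ℕ→ℚ 2 * (∑[ t ← E ] 𝟙 (on p t) * 1ℚ)))
        ≡⟨ Σ-double (λ _ → 1ℚ) ⟩
      (∑[ a ← E ] 1ℚ * (∑[ b ← E ] ν a b * pairs a b))
        ≡⟨ trans (Σ-cong E (λ a → *-identityˡ _)) Σ-pairs-tc ⟩
      (qℚ -ℚ 1ℚ) * (qℚ -ℚ 1ℚ) * (qℚ -ℚ ℕ→ℚ 2) ∎

open CountTheory

-- Incidences and `σ` as sums over parameters.

module SphereTheory where

  open Q using (_*_; _≤_) renaming (_+_ to _+ℚ_; _-_ to _-ℚ_)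
  open ℚₚ using (*-identityˡ; *-identityʳ; *-zeroˡ)
  open ℚSolver.+-*-Solver using (solve; _:*_; _:-_; _:=_)
  open ≡-Reasoning
  open Listing

  -- Division of integers in ℚ reduces to lowest terms, so the cancellation is verified on
  -- unnormalised fractions.
  /-* : ∀ n d .{{_ : ℕ.NonZero d}} → ((ℤ.+ n) Q./ d) * ℕ→ℚ d ≡ ℕ→ℚ n
  /-* n d@(suc d-1) = ℚₚ.toℚᵘ-injective (begin≃
    Q.toℚᵘ (((ℤ.+ n) Q./ d) * ℕ→ℚ d)               ≈⟨ ℚₚ.toℚᵘ-homo-* ((ℤ.+ n) Q./ d) (ℕ→ℚ d) ⟩
    Q.toℚᵘ ((ℤ.+ n) Q./ d) ℚᵘ.* Q.toℚᵘ (ℕ→ℚ d)     ≈⟨ ℚᵘₚ.*-cong (ℚₚ.toℚᵘ-fromℚᵘ (ℚᵘ.mkℚᵘ (ℤ.+ n) d-1)) (ℚₚ.toℚᵘ-fromℚᵘ (ℚᵘ.mkℚᵘ (ℤ.+ d) 0)) ⟩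
    ℚᵘ.mkℚᵘ (ℤ.+ n) d-1 ℚᵘ.* ℚᵘ.mkℚᵘ (ℤ.+ d) 0     ≈⟨ ℚᵘ.*≡* cross ⟩
    ℚᵘ.mkℚᵘ (ℤ.+ n) 0                              ≈⟨ ℚₚ.toℚᵘ-fromℚᵘ (ℚᵘ.mkℚᵘ (ℤ.+ n) 0) ⟨
    Q.toℚᵘ (ℕ→ℚ n)                                 ∎≃)
    where
    open ℚᵘₚ.≃-Reasoning using (step-≈-⟩; step-≈-⟨) renaming (begin_ to begin≃_; _∎ to _∎≃)
    cross : ((ℤ.+ n) ℤ.* (ℤ.+ d)) ℤ.* (ℤ.+ 1) ≡ (ℤ.+ n) ℤ.* (ℤ.+ (d ℕ.* 1))
    cross = trans (ℤₚ.*-identityʳ _) (cong (λ m → (ℤ.+ n) ℤ.* (ℤ.+ m)) (sym (ℕₚ.*-identityʳ d)))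

  ℕ→ℚ-≢0 : ∀ n .{{_ : ℕ.NonZero n}} → ℕ→ℚ n ≢ 0ℚ
  ℕ→ℚ-≢0 n e = ℚₚ.<-irrefl (sym e) (Rational.ℕ→ℚ-pos n)

  /-recip₀ : ∀ n d .{{_ : ℕ.NonZero d}} → (ℤ.+ n) Q./ d ≡ ℕ→ℚ n * recip₀ (ℕ→ℚ d)
  /-recip₀ n d = *-cancelˡ (ℕ→ℚ d) (ℕ→ℚ-≢0 d) (begin
    ℕ→ℚ d * ((ℤ.+ n) Q./ d)             ≡⟨ ℚₚ.*-comm (ℕ→ℚ d) _ ⟩
    ((ℤ.+ n) Q./ d) * ℕ→ℚ d             ≡⟨ /-* n d ⟩
    ℕ→ℚ n                               ≡⟨ *-identityʳ _ ⟨
    ℕ→ℚ n * 1ℚ                          ≡⟨ cong (ℕ→ℚ n *_) (Rational.recip₀-inverse (Rational.ℕ→ℚ-pos d)) ⟨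
    ℕ→ℚ n * (ℕ→ℚ d * recip₀ (ℕ→ℚ d))    ≡⟨ solve 3 (λ n d r → n :* (d :* r) := d :* (n :* r)) refl (ℕ→ℚ n) (ℕ→ℚ d) (recip₀ (ℕ→ℚ d)) ⟩
    ℕ→ℚ d * (ℕ→ℚ n * recip₀ (ℕ→ℚ d))    ∎)

  module Spheres {q : ℕ} (F : FiniteField q) (R : FiniteField.Carrier F)
                 (2≢0 : FieldAlgebra.2# F ≢ FiniteField.0# F)
                 (3≢0 : FiniteField._+_ F (FieldAlgebra.2# F) (FiniteField.1# F) ≢ FiniteField.0# F) where

    open FiniteField F hiding (_*_; _-_)
    open FieldAlgebra F using (elements-listing)
    open Geometry F
    open TwistedCubic F R
    open Points F R 2≢0
    open Counts F R 2≢0 3≢0 using (tc; pairs; points-listing; Σ-1)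

    private
      E = elements
      qℚ = ℕ→ℚ q

    1/q : ℚ
    1/q = recip₀ qℚ

    q*1/q : qℚ * 1/q ≡ 1ℚ
    q*1/q = Rational.recip₀-inverse (Rational.ℕ→ℚ-pos q)

    0≤1/q : 0ℚ ≤ 1/q
    0≤1/q = ℚₚ.<⇒≤ (Rational.recip₀-pos (Rational.ℕ→ℚ-pos q))

    S-injective : ∀ {t u} → S t ≡ S u → t ≡ u
    S-injective e = cong (λ T → Vec.lookup (centre T) (suc (suc zero))) e

    S∈𝒮tc : ∀ t → S t ∈ 𝒮tc
    S∈𝒮tc t = Anyₚ.any⁺ (λ u → does (S t ≟ˢ S u)) (Any.map (λ { refl → T-does (S t ≟ˢ S t) refl }) (elements-listing .complete t))

    ∈𝒮tc⇒S : ∀ T → T ∈ 𝒮tc → ∃[ t ] T ≡ S t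
    ∈𝒮tc⇒S T h with t , e ← Any.satisfied (Anyₚ.any⁻ (λ u → does (T ≟ˢ S u)) elements h) = t , does-T (T ≟ˢ S t) e

    spheres-listing : Listing allSpheres
    spheres-listing .unique = Uniqueₚ.cartesianProduct⁺ (points-listing .unique) (elements-listing .unique)
    spheres-listing .complete (c , r) = Membershipₚ.∈-cartesianProduct⁺ (points-listing .complete c) (elements-listing .complete r)

    -- The indicator of a subfamily of `𝒮tc` vanishes off the image of the injective map t ↦ S t.
    Σ-spheres : ∀ (𝒮 : Sub Sphere) → 𝒮 ⊆ 𝒮tc → (f : Sphere → ℚ) →
                ∑[ T ← allSpheres ] 𝟙 (𝒮 T) * f T ≡ ∑[ t ← E ] 𝟙 (𝒮 (S t)) * f (S t)
    Σ-spheres 𝒮 𝒮⊆ f = Finite.Σ-reindex spheres-listing elements-listing _≟ˢ_ _≟_ S S-injective (λ T → 𝟙 (𝒮 T) * f T)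
      λ T miss → trans (cong (_* f T) (𝟙-¬T {𝒮 T} λ h → let t , e = ∈𝒮tc⇒S T (𝒮⊆ T h) in miss t (sym e))) (*-zeroˡ (f T))

    size-spheres : ∀ 𝒮 → 𝒮 ⊆ 𝒮tc → ℕ→ℚ ∣ 𝒮 ∣ₛ ≡ ∑[ t ← E ] 𝟙 (𝒮 (S t))
    size-spheres 𝒮 𝒮⊆ = begin
      ℕ→ℚ ∣ 𝒮 ∣ₛ                                 ≡⟨ count≡Σ allSpheres 𝒮 ⟩
      (∑[ T ← allSpheres ] 𝟙 (𝒮 T))              ≡⟨ Σ-cong allSpheres (λ T → *-identityʳ (𝟙 (𝒮 T))) ⟨
      (∑[ T ← allSpheres ] 𝟙 (𝒮 T) * 1ℚ)         ≡⟨ Σ-spheres 𝒮 𝒮⊆ (λ _ → 1ℚ) ⟩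
      (∑[ t ← E ] 𝟙 (𝒮 (S t)) * 1ℚ)              ≡⟨ Σ-cong E (λ t → *-identityʳ (𝟙 (𝒮 (S t)))) ⟩
      (∑[ t ← E ] 𝟙 (𝒮 (S t)))                   ∎

    incidences : Sub Sphere → Point → ℚ
    incidences 𝒮 p = ∑[ t ← E ] 𝟙 (on p t) * 𝟙 (𝒮 (S t))

    I-formula : ∀ P 𝒮 → 𝒮 ⊆ 𝒮tc → ℕ→ℚ (I Q₀ P 𝒮) ≡ ∑[ p ← allPoints ] 𝟙 (P p) * incidences 𝒮 p
    I-formula P 𝒮 𝒮⊆ = begin
      ℕ→ℚ (I Q₀ P 𝒮)
        ≡⟨ count≡Σ (List.cartesianProduct allPoints allSpheres) _ ⟩
      Σ (List.cartesianProduct allPoints allSpheres) (λ (p , T) → 𝟙 (P p ∧ 𝒮 T ∧ pointsOf Q₀ T p))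
        ≡⟨ Σ-cartesianProduct allPoints allSpheres _ ⟩
      (∑[ p ← allPoints ] ∑[ T ← allSpheres ] 𝟙 (P p ∧ 𝒮 T ∧ pointsOf Q₀ T p))
        ≡⟨ Σ-cong allPoints (λ p → trans (Σ-cong allSpheres (λ T → trans (𝟙-∧ (P p) _) (cong (𝟙 (P p) *_) (𝟙-∧ (𝒮 T) _)))) (Σ-*ˡ allSpheres (𝟙 (P p)) _)) ⟩
      (∑[ p ← allPoints ] 𝟙 (P p) * (∑[ T ← allSpheres ] 𝟙 (𝒮 T) * 𝟙 (pointsOf Q₀ T p)))
        ≡⟨ Σ-cong allPoints (λ p → cong (𝟙 (P p) *_) (trans (Σ-spheres 𝒮 𝒮⊆ (λ T → 𝟙 (pointsOf Q₀ T p)))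
             (Σ-cong E (λ t → ℚₚ.*-comm (𝟙 (𝒮 (S t))) (𝟙 (on p t)))))) ⟩
      (∑[ p ← allPoints ] 𝟙 (P p) * incidences 𝒮 p) ∎

    degree-formula : ∀ p → ℕ→ℚ (degree Q₀ 𝒮tc p) ≡ ∑[ t ← E ] 𝟙 (on p t)
    degree-formula p = begin
      ℕ→ℚ (degree Q₀ 𝒮tc p)                                           ≡⟨ count≡Σ allSpheres _ ⟩
      (∑[ T ← allSpheres ] 𝟙 (𝒮tc T ∧ pointsOf Q₀ T p))               ≡⟨ Σ-cong allSpheres (λ T → 𝟙-∧ (𝒮tc T) _) ⟩
      (∑[ T ← allSpheres ] 𝟙 (𝒮tc T) * 𝟙 (pointsOf Q₀ T p))           ≡⟨ Σ-spheres 𝒮tc (λ _ h → h) (λ T → 𝟙 (pointsOf Q₀ T p)) ⟩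
      (∑[ t ← E ] 𝟙 (𝒮tc (S t)) * 𝟙 (on p t))                         ≡⟨ Σ-cong E (λ t → trans (cong (_* 𝟙 (on p t)) (𝟙-T (S∈𝒮tc t))) (*-identityˡ _)) ⟩
      (∑[ t ← E ] 𝟙 (on p t))                                         ∎

    -- The contribution of a single point to `σ`, which becomes additive in the points and in
    -- disjoint families of spheres.
    excess : Sub Sphere → Point → ℚ
    excess 𝒮 p = incidences 𝒮 p -ℚ (∑[ t ← E ] 𝟙 (𝒮 (S t))) * 1/q

    σ-formula : ∀ P 𝒮 → 𝒮 ⊆ 𝒮tc → σ Q₀ P 𝒮 ≡ ∑[ p ← allPoints ] 𝟙 (P p) * excess 𝒮 p
    σ-formula P 𝒮 𝒮⊆ = begin
      ℕ→ℚ (I Q₀ P 𝒮) -ℚ (ℤ.+ (∣ P ∣ₚ ℕ.* ∣ 𝒮 ∣ₛ)) Q./ q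
        ≡⟨ cong₂ _-ℚ_ (I-formula P 𝒮 𝒮⊆) (begin
             (ℤ.+ (∣ P ∣ₚ ℕ.* ∣ 𝒮 ∣ₛ)) Q./ q           ≡⟨ /-recip₀ (∣ P ∣ₚ ℕ.* ∣ 𝒮 ∣ₛ) q ⟩
             ℕ→ℚ (∣ P ∣ₚ ℕ.* ∣ 𝒮 ∣ₛ) * 1/q             ≡⟨ cong (_* 1/q) (Rational.ℕ→ℚ-* ∣ P ∣ₚ ∣ 𝒮 ∣ₛ) ⟩
             ℕ→ℚ ∣ P ∣ₚ * ℕ→ℚ ∣ 𝒮 ∣ₛ * 1/q             ≡⟨ cong₂ (λ x y → x * y * 1/q) (count≡Σ allPoints P) (size-spheres 𝒮 𝒮⊆) ⟩
             Σ allPoints (λ p → 𝟙 (P p)) * s * 1/q     ≡⟨ ℚₚ.*-assoc (Σ allPoints (λ p → 𝟙 (P p))) s 1/q ⟩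
             Σ allPoints (λ p → 𝟙 (P p)) * (s * 1/q)   ≡⟨ Σ-*ʳ allPoints (λ p → 𝟙 (P p)) (s * 1/q) ⟨
             Σ allPoints (λ p → 𝟙 (P p) * (s * 1/q))   ∎) ⟩
      (∑[ p ← allPoints ] 𝟙 (P p) * incidences 𝒮 p) -ℚ (∑[ p ← allPoints ] 𝟙 (P p) * (s * 1/q))
        ≡⟨ Σ-- allPoints _ _ ⟨
      (∑[ p ← allPoints ] (𝟙 (P p) * incidences 𝒮 p -ℚ 𝟙 (P p) * (s * 1/q)))
        ≡⟨ Σ-cong allPoints (λ p → solve 3 (λ x i s → x :* i :- x :* s := x :* (i :- s)) refl (𝟙 (P p)) (incidences 𝒮 p) (s * 1/q)) ⟩
      (∑[ p ← allPoints ] 𝟙 (P p) * excess 𝒮 p) ∎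
      where s = ∑[ t ← E ] 𝟙 (𝒮 (S t))

    incidences-tc : ∀ p → p ∈ Ptc → incidences 𝒮tc p ≡ ℕ→ℚ 3
    incidences-tc p p∈ = trans (Σ-cong E (λ t → trans (cong (𝟙 (on p t) *_) (𝟙-T (S∈𝒮tc t))) (*-identityʳ _))) (degree-3 p (∈Ptc⇒Roots p p∈))

    Σ-𝒮tc : ∑[ t ← E ] 𝟙 (𝒮tc (S t)) ≡ qℚ
    Σ-𝒮tc = trans (Σ-cong E (λ t → 𝟙-T (S∈𝒮tc t))) Σ-1

    ∣𝒮tc∣ : ∣ 𝒮tc ∣ₛ ≡ q
    ∣𝒮tc∣ = ℕ→ℚ-injective (trans (size-spheres 𝒮tc (λ _ h → h)) Σ-𝒮tc)

    I-subset : ∀ B → B ⊆ Ptc → I Q₀ B 𝒮tc ≡ 3 ℕ.* ∣ B ∣ₚ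
    I-subset B B⊆ = ℕ→ℚ-injective (begin
      ℕ→ℚ (I Q₀ B 𝒮tc)                                   ≡⟨ I-formula B 𝒮tc (λ _ h → h) ⟩
      (∑[ p ← allPoints ] 𝟙 (B p) * incidences 𝒮tc p)     ≡⟨ Σ-cong allPoints (λ p → 𝟙-guard (B p) (λ h → incidences-tc p (B⊆ p h))) ⟩
      (∑[ p ← allPoints ] 𝟙 (B p) * ℕ→ℚ 3)                ≡⟨ Σ-*ʳ allPoints _ (ℕ→ℚ 3) ⟩
      (∑[ p ← allPoints ] 𝟙 (B p)) * ℕ→ℚ 3                ≡⟨ cong (_* ℕ→ℚ 3) (count≡Σ allPoints B) ⟨
      ℕ→ℚ ∣ B ∣ₚ * ℕ→ℚ 3                                  ≡⟨ ℚₚ.*-comm (ℕ→ℚ ∣ B ∣ₚ) (ℕ→ℚ 3) ⟩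
      ℕ→ℚ 3 * ℕ→ℚ ∣ B ∣ₚ                                  ≡⟨ Rational.ℕ→ℚ-* 3 ∣ B ∣ₚ ⟨
      ℕ→ℚ (3 ℕ.* ∣ B ∣ₚ)                                  ∎)

    -- Each point has degree 3 and the average term is q / q, so each point contributes exactly 2.
    σ-subset : ∀ B → B ⊆ Ptc → σ Q₀ B 𝒮tc ≡ ℕ→ℚ (2 ℕ.* ∣ B ∣ₚ)
    σ-subset B B⊆ = begin
      σ Q₀ B 𝒮tc                                 ≡⟨ σ-formula B 𝒮tc (λ _ h → h) ⟩
      (∑[ p ← allPoints ] 𝟙 (B p) * excess 𝒮tc p) ≡⟨ Σ-cong allPoints (λ p → 𝟙-guard (B p) (λ h →
                                                      cong₂ _-ℚ_ (incidences-tc p (B⊆ p h)) (trans (cong (_* 1/q) Σ-𝒮tc) q*1/q))) ⟩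
      (∑[ p ← allPoints ] 𝟙 (B p) * (ℕ→ℚ 3 -ℚ 1ℚ)) ≡⟨ Σ-*ʳ allPoints _ (ℕ→ℚ 3 -ℚ 1ℚ) ⟩
      (∑[ p ← allPoints ] 𝟙 (B p)) * ℕ→ℚ 2        ≡⟨ cong (_* ℕ→ℚ 2) (count≡Σ allPoints B) ⟨
      ℕ→ℚ ∣ B ∣ₚ * ℕ→ℚ 2                          ≡⟨ ℚₚ.*-comm (ℕ→ℚ ∣ B ∣ₚ) (ℕ→ℚ 2) ⟩
      ℕ→ℚ 2 * ℕ→ℚ ∣ B ∣ₚ                          ≡⟨ Rational.ℕ→ℚ-* 2 ∣ B ∣ₚ ⟨
      ℕ→ℚ (2 ℕ.* ∣ B ∣ₚ)                          ∎

    pairs-count : ∀ a b → ℕ→ℚ ∣ Ptc ∩ pointsOf Q₀ (S a) ∩ pointsOf Q₀ (S b) ∣ₚ ≡ pairs a b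
    pairs-count a b = trans (count≡Σ allPoints _) (Σ-cong allPoints λ p → trans (𝟙-∧ (Ptc p) _) (cong (tc p *_) (𝟙-∧ (on p a) (on p b))))

open SphereTheory

-- The cubic cost and its sum over all points.

module MixedTriples where

  open Q using (_*_; _≤_; -_) renaming (_+_ to _+ℚ_; _-_ to _-ℚ_)
  open ℚₚ using (≤-trans; ≤-reflexive; *-identityʳ; *-zeroʳ)
  open ℚSolver.+-*-Solver using (solve; _:+_; _:*_; _:-_; :-_; _:=_; con; Polynomial)
  open ≡-Reasoning

  *-mono : ∀ {a b c d} → 0ℚ ≤ c → 0ℚ ≤ b → a ≤ b → c ≤ d → a * c ≤ b * d
  *-mono = Rational.mono-*

  *-monoʳ : ∀ {a b c} → 0ℚ ≤ a → b ≤ c → a * b ≤ a * c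
  *-monoʳ {a} 0≤a = ℚₚ.*-monoˡ-≤-nonNeg a {{Q.nonNegative 0≤a}}

  -- When a triple has x elements in one class and 3 - x in the other, a proportion p of the objects lying in
  -- the first class, the excess of the triple over the opposite class is 3 - x - (1 - p) or x - p.  The cubic
  -- cost x p is a common lower bound at x = 0, 1, 2, 3, and its terms count triples of a given type.

  cost : ℚ → ℚ → ℚ
  cost x p = - ((1ℚ -ℚ p) * 1/6) * (x * (x -ℚ 1ℚ) * (x -ℚ ℕ→ℚ 2)) +ℚ p * ½ * ((x * x -ℚ x) * y)
    +ℚ (1ℚ -ℚ p) * ½ * ((y * y -ℚ y) * x) +ℚ - (p * 1/6) * (y * (y -ℚ 1ℚ) * (y -ℚ ℕ→ℚ 2))
    where
    1/6 = (ℤ.+ 1) Q./ 6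
    y = ℕ→ℚ 3 -ℚ x

  -- With U the parameters of the first block, `other` serves the points of that block, `own` the
  -- points of the remaining blocks, and `one` the remainder.
  record Cost≤ (x p : ℚ) : Set where
    constructor cost≤
    field
      other : cost x p ≤ ℕ→ℚ 3 -ℚ x -ℚ (1ℚ -ℚ p)
      own   : cost x p ≤ x -ℚ p
      one   : cost x p ≤ 1ℚ

  -- At x = 0, 1, 2, 3 the cubic equals - p, 1 - p, p and p - 1. Each value is the smaller of the
  -- two excesses, which is why one slack vanishes in every case.
  cost-bounds : ∀ a b c p → 0ℚ ≤ p → p ≤ 1ℚ → Cost≤ (𝟙 a +ℚ 𝟙 b +ℚ 𝟙 c) p
  cost-bounds a b c p 0≤p p≤1 = go a b c
    where
    0≤1-p : 0ℚ ≤ 1ℚ -ℚ p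
    0≤1-p = ≤⇒0≤- p≤1
    0≤2 : 0ℚ ≤ ℕ→ℚ 2
    0≤2 = Rational.ℕ→ℚ-nonNeg 2
    bounds : ∀ {x} v d e f → cost x p ≡ v → 0ℚ ≤ d → 0ℚ ≤ e → 0ℚ ≤ f →
             ℕ→ℚ 3 -ℚ x -ℚ (1ℚ -ℚ p) ≡ v +ℚ d → x -ℚ p ≡ v +ℚ e → 1ℚ ≡ v +ℚ f → Cost≤ x p
    bounds v d e f refl 0≤d 0≤e 0≤f h₁ h₂ h₃ = cost≤ (≤-by 0≤d h₁) (≤-by 0≤e h₂) (≤-by 0≤f h₃)
    :cost : ∀ {n} → Polynomial n → Polynomial n → Polynomial n
    :cost x p = let y = con (ℕ→ℚ 3) :- x ; k = con ((ℤ.+ 1) Q./ 6) in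
      (:- ((con 1ℚ :- p) :* k)) :* (x :* (x :- con 1ℚ) :* (x :- con (ℕ→ℚ 2))) :+ p :* con ½ :* ((x :* x :- x) :* y)
      :+ (con 1ℚ :- p) :* con ½ :* ((y :* y :- y) :* x) :+ (:- (p :* k)) :* (y :* (y :- con 1ℚ) :* (y :- con (ℕ→ℚ 2)))
    zero′ : Cost≤ 0ℚ p
    zero′ = bounds (- p) (ℕ→ℚ 2 +ℚ ℕ→ℚ 2 * p) 0ℚ (1ℚ +ℚ p)
      (solve 1 (λ p → :cost (con 0ℚ) p := :- p) refl p)
      (0≤+ 0≤2 (0≤* 0≤2 0≤p)) ℚₚ.≤-refl (0≤+ 0≤1 0≤p)
      (solve 1 (λ p → con (ℕ→ℚ 3) :- con 0ℚ :- (con 1ℚ :- p) := :- p :+ (con (ℕ→ℚ 2) :+ con (ℕ→ℚ 2) :* p)) refl p)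
      (solve 1 (λ p → con 0ℚ :- p := :- p :+ con 0ℚ) refl p)
      (solve 1 (λ p → con 1ℚ := :- p :+ (con 1ℚ :+ p)) refl p)
    one′ : Cost≤ 1ℚ p
    one′ = bounds (1ℚ -ℚ p) (ℕ→ℚ 2 * p) 0ℚ p
      (solve 1 (λ p → :cost (con 1ℚ) p := con 1ℚ :- p) refl p)
      (0≤* 0≤2 0≤p) ℚₚ.≤-refl 0≤p
      (solve 1 (λ p → con (ℕ→ℚ 3) :- con 1ℚ :- (con 1ℚ :- p) := con 1ℚ :- p :+ con (ℕ→ℚ 2) :* p) refl p)
      (solve 1 (λ p → con 1ℚ :- p := con 1ℚ :- p :+ con 0ℚ) refl p)
      (solve 1 (λ p → con 1ℚ := con 1ℚ :- p :+ p) refl p)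
    two′ : Cost≤ (ℕ→ℚ 2) p
    two′ = bounds p 0ℚ (ℕ→ℚ 2 * (1ℚ -ℚ p)) (1ℚ -ℚ p)
      (solve 1 (λ p → :cost (con (ℕ→ℚ 2)) p := p) refl p)
      ℚₚ.≤-refl (0≤* 0≤2 0≤1-p) 0≤1-p
      (solve 1 (λ p → con (ℕ→ℚ 3) :- con (ℕ→ℚ 2) :- (con 1ℚ :- p) := p :+ con 0ℚ) refl p)
      (solve 1 (λ p → con (ℕ→ℚ 2) :- p := p :+ con (ℕ→ℚ 2) :* (con 1ℚ :- p)) refl p)
      (solve 1 (λ p → con 1ℚ := p :+ (con 1ℚ :- p)) refl p)
    three′ : Cost≤ (ℕ→ℚ 3) p
    three′ = bounds (- (1ℚ -ℚ p)) 0ℚ (ℕ→ℚ 2 +ℚ ℕ→ℚ 2 * (1ℚ -ℚ p)) (1ℚ +ℚ (1ℚ -ℚ p))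
      (solve 1 (λ p → :cost (con (ℕ→ℚ 3)) p := :- (con 1ℚ :- p)) refl p)
      ℚₚ.≤-refl (0≤+ 0≤2 (0≤* 0≤2 0≤1-p)) (0≤+ 0≤1 0≤1-p)
      (solve 1 (λ p → con (ℕ→ℚ 3) :- con (ℕ→ℚ 3) :- (con 1ℚ :- p) := :- (con 1ℚ :- p) :+ con 0ℚ) refl p)
      (solve 1 (λ p → con (ℕ→ℚ 3) :- p := :- (con 1ℚ :- p) :+ (con (ℕ→ℚ 2) :+ con (ℕ→ℚ 2) :* (con 1ℚ :- p))) refl p)
      (solve 1 (λ p → con 1ℚ := :- (con 1ℚ :- p) :+ (con 1ℚ :+ (con 1ℚ :- p))) refl p)
    go : ∀ a b c → Cost≤ (𝟙 a +ℚ 𝟙 b +ℚ 𝟙 c) p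
    go false false false = zero′
    go false false true  = one′
    go false true  false = one′
    go true  false false = one′
    go false true  true  = two′
    go true  false true  = two′
    go true  true  false = two′
    go true  true  true  = three′

  module Mixed {q : ℕ} (F : FiniteField q) (R : FiniteField.Carrier F)
               (2≢0 : FieldAlgebra.2# F ≢ FiniteField.0# F)
               (3≢0 : FiniteField._+_ F (FieldAlgebra.2# F) (FiniteField.1# F) ≢ FiniteField.0# F) where

    open FiniteField F hiding (_*_; _-_; -_)
    open FieldAlgebra F using (elements-listing)
    open Geometry F hiding (Polynomial)
    open TwistedCubic F R
    open Points F R 2≢0
    open Counts F R 2≢0 3≢0
    open Spheres F R 2≢0 3≢0
    open Weights elements-listing _≟_

    meets : (Carrier → Bool) → Point → ℚ
    meets U p = ∑[ t ← E ] 𝟙 (on p t) * 𝟙 (U t)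

    size : (Carrier → Bool) → ℚ
    size U = ∑[ t ← E ] 𝟙 (U t)

    0≤Σ : ∀ {A : Set} (xs : List A) {f : A → ℚ} → (∀ x → 0ℚ ≤ f x) → 0ℚ ≤ Σ xs f
    0≤Σ xs {f} h = subst (_≤ Σ xs f) (Σ-zero xs) (Σ-mono xs h)

    0≤size : ∀ U → 0ℚ ≤ size U
    0≤size U = 0≤Σ E (λ t → 0≤𝟙 (U t))

    private
      on∧ : (Carrier → Bool) → Point → Carrier → ℚ
      on∧ U p t = 𝟙 (on p t) * 𝟙 (U t)

      on∧-idem : ∀ U p t → on∧ U p t * on∧ U p t ≡ on∧ U p t
      on∧-idem U p t = trans (solve 2 (λ x y → x :* y :* (x :* y) := (x :* x) :* (y :* y)) refl (𝟙 (on p t)) (𝟙 (U t)))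
        (cong₂ _*_ (𝟙-idem (on p t)) (𝟙-idem (U t)))

      Δν : Carrier → Carrier → Carrier → ℚ
      Δν a b c = Δ a b c * ν (third a b) c

      0≤Δ : ∀ a b c → 0ℚ ≤ Δ a b c
      0≤Δ a b c = 0≤* (0≤ν a b) (0≤* (0≤ν a c) (0≤ν b c))

      Δ≤ν : ∀ a b c → Δ a b c ≤ ν a b
      Δ≤ν a b c = ≤-trans (*-monoʳ (0≤ν a b) (≤-trans (*-monoʳ (0≤ν a c) (ν≤1 b c)) (≤-trans (≤-reflexive (*-identityʳ _)) (ν≤1 a c))))
        (≤-reflexive (*-identityʳ _))

      Δν≤1 : ∀ a b c → Δν a b c ≤ 1ℚ
      Δν≤1 a b c = ≤-trans (*-monoʳ (0≤Δ a b c) (ν≤1 (third a b) c))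
        (≤-trans (≤-reflexive (*-identityʳ _)) (≤-trans (Δ≤ν a b c) (ν≤1 a b)))

    -- Triples inside one class enter the cost with a negative coefficient, so an upper bound is
    -- wanted, and bounding `Δν` by 1 is accurate enough.
    pure-triples : ∀ U → ∑[ p ← allPoints ] tc p * (meets U p * (meets U p -ℚ 1ℚ) * (meets U p -ℚ ℕ→ℚ 2)) ≤ size U * size U * size U
    pure-triples U = ≤-trans (≤-reflexive (trans
        (Σ-cong allPoints (λ p → cong (tc p *_) (sym (Σ-triples (on∧ U p) (on∧-idem U p)))))
        (triple-count u u u)))
      (≤-trans (Σ₃-mono (λ a b c → ≤-trans (*-monoʳ (0≤* (0≤* (0≤𝟙 (U a)) (0≤𝟙 (U b))) (0≤𝟙 (U c))) (Δν≤1 a b c)) (≤-reflexive (*-identityʳ _))))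
        (≤-reflexive (Σ₃-product u u u)))
      where
      u : Carrier → ℚ
      u t = 𝟙 (U t)

    -- For a ≠ b in U the vanishing of the sum excludes at most one third element, namely
    -- `third a b`. This loss accounts for the factor `size V - 1`.
    mixed-triples : ∀ U V → (∀ t → 𝟙 (U t) * 𝟙 (V t) ≡ 0ℚ) → (size U * size U -ℚ size U) * (size V -ℚ 1ℚ) ≤
                    ∑[ p ← allPoints ] tc p * ((meets U p * meets U p -ℚ meets U p) * meets V p)
    mixed-triples U V disjoint = ≤-trans bound (≤-reflexive (sym (trans
        (Σ-cong allPoints (λ p → cong (tc p *_) (sym (Σ-mixed (on∧ U p) (on∧-idem U p) (on∧ V p) (on-disjoint p)))))
        (triple-count u u v))))
      where
      u v : Carrier → ℚ
      u t = 𝟙 (U t)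
      v t = 𝟙 (V t)
      s = size U
      on-disjoint : ∀ p t → on∧ U p t * on∧ V p t ≡ 0ℚ
      on-disjoint p t = trans (solve 3 (λ o x y → o :* x :* (o :* y) := o :* o :* (x :* y)) refl (𝟙 (on p t)) (u t) (v t))
        (trans (cong (𝟙 (on p t) * 𝟙 (on p t) *_) (disjoint t)) (*-zeroʳ (𝟙 (on p t) * 𝟙 (on p t))))
      zero-sum : Carrier → Carrier → Carrier → ℚ
      zero-sum a b c = Δ a b c * (u a * u b * v c) * δ (third a b) c
      zero-sum≤ : ∀ a b c → zero-sum a b c ≤ u a * (ν a b * u b) * (δ (third a b) c * 1ℚ)
      zero-sum≤ a b c = ≤-trans (ℚₚ.*-monoʳ-≤-nonNeg (δ (third a b) c) {{Q.nonNegative (0≤𝟙 (does (third a b ≟ c)))}}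
          (*-mono (0≤* (0≤* (0≤𝟙 (U a)) (0≤𝟙 (U b))) (0≤𝟙 (V c))) (0≤ν a b) (Δ≤ν a b c)
            (*-monoʳ (0≤* (0≤𝟙 (U a)) (0≤𝟙 (U b))) (𝟙≤1 (V c)))))
        (≤-reflexive (solve 4 (λ n a b d → n :* (a :* b :* con 1ℚ) :* d := a :* (n :* b) :* (d :* con 1ℚ)) refl (ν a b) (u a) (u b) (δ (third a b) c)))
      total-zero-sum : ∑[ a ← E ] ∑[ b ← E ] ∑[ c ← E ] zero-sum a b c ≤ s * s -ℚ s
      total-zero-sum = ≤-trans (Σ₃-mono zero-sum≤) (≤-reflexive (begin
        (∑[ a ← E ] ∑[ b ← E ] ∑[ c ← E ] u a * (ν a b * u b) * (δ (third a b) c * 1ℚ))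
          ≡⟨ Σ-cong E (λ a → Σ-cong E (λ b → trans (Σ-*ˡ E (u a * (ν a b * u b)) _) (trans (cong (u a * (ν a b * u b) *_)
               (Σ-δ elements-listing _≟_ (third a b) (λ _ → 1ℚ))) (*-identityʳ (u a * (ν a b * u b)))))) ⟩
        (∑[ a ← E ] ∑[ b ← E ] u a * (ν a b * u b))      ≡⟨ Σ-cong E (λ a → Σ-*ˡ E (u a) _) ⟩
        (∑[ a ← E ] u a * (∑[ b ← E ] ν a b * u b))      ≡⟨ Σ-pairs u (λ t → 𝟙-idem (U t)) ⟩
        s * s -ℚ s                                       ∎))
      split : ∑[ a ← E ] ∑[ b ← E ] ∑[ c ← E ] u a * u b * v c * Δν a b c ≡
              (s * s -ℚ s) * size V -ℚ (∑[ a ← E ] ∑[ b ← E ] ∑[ c ← E ] zero-sum a b c)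
      split = begin
        (∑[ a ← E ] ∑[ b ← E ] ∑[ c ← E ] u a * u b * v c * Δν a b c)
          ≡⟨ Σ₃-cong (λ a b c → solve 3 (λ w d k → w :* (d :* (con 1ℚ :- k)) := d :* w :- d :* w :* k) refl (u a * u b * v c) (Δ a b c) (δ (third a b) c)) ⟩
        (∑[ a ← E ] ∑[ b ← E ] ∑[ c ← E ] (Δ a b c * (u a * u b * v c) -ℚ zero-sum a b c))
          ≡⟨ trans (Σ-cong E (λ a → trans (Σ-cong E (λ b → Σ-- E _ _)) (Σ-- E _ _))) (Σ-- E _ _) ⟩
        (∑[ a ← E ] ∑[ b ← E ] ∑[ c ← E ] Δ a b c * (u a * u b * v c)) -ℚ (∑[ a ← E ] ∑[ b ← E ] ∑[ c ← E ] zero-sum a b c)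
          ≡⟨ cong (λ z → z -ℚ (∑[ a ← E ] ∑[ b ← E ] ∑[ c ← E ] zero-sum a b c)) (Σ-mixed u (λ t → 𝟙-idem (U t)) v disjoint) ⟩
        (s * s -ℚ s) * size V -ℚ (∑[ a ← E ] ∑[ b ← E ] ∑[ c ← E ] zero-sum a b c) ∎
      bound : (s * s -ℚ s) * (size V -ℚ 1ℚ) ≤ ∑[ a ← E ] ∑[ b ← E ] ∑[ c ← E ] u a * u b * v c * Δν a b c
      bound = ≤-by (≤⇒0≤- total-zero-sum) (trans split
        (solve 3 (λ k v z → k :* v :- z := k :* (v :- con 1ℚ) :+ (k :- z)) refl (s * s -ℚ s) (size V) _))

    module _ (U V : Carrier → Bool) (complement : ∀ t → V t ≡ not (U t)) where

      private
        u = size U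
        v = size V
        r = 1/q

      fraction : ℚ
      fraction = u * r

      total-size : u +ℚ v ≡ qℚ
      total-size = trans (sym (Σ-+ E _ _)) (trans (Σ-cong E (λ t → trans (cong (λ b → 𝟙 (U t) +ℚ 𝟙 b) (complement t)) (sum (U t)))) Σ-1)
        where
        sum : ∀ b → 𝟙 b +ℚ 𝟙 (not b) ≡ 1ℚ
        sum true  = refl
        sum false = refl

      1-fraction : 1ℚ -ℚ fraction ≡ v * r
      1-fraction = begin
        1ℚ -ℚ u * r             ≡⟨ cong (_-ℚ u * r) (trans (sym q*1/q) (cong (_* r) (sym total-size))) ⟩
        (u +ℚ v) * r -ℚ u * r   ≡⟨ solve 3 (λ u v r → (u :+ v) :* r :- u :* r := v :* r) refl u v r ⟩
        v * r                   ∎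

      0≤fraction : 0ℚ ≤ fraction
      0≤fraction = 0≤* (0≤size U) 0≤1/q

      0≤1-fraction : 0ℚ ≤ 1ℚ -ℚ fraction
      0≤1-fraction = subst (0ℚ ≤_) (sym 1-fraction) (0≤* (0≤size V) 0≤1/q)

      fraction≤1 : fraction ≤ 1ℚ
      fraction≤1 = ≤-by 0≤1-fraction (solve 1 (λ f → con 1ℚ := f :+ (con 1ℚ :- f)) refl fraction)

      meets-complement : ∀ p → p ∈ Ptc → meets V p ≡ ℕ→ℚ 3 -ℚ meets U p
      meets-complement p p∈ = begin
        meets V p                                                   ≡⟨ Σ-cong E (λ t → trans (cong (𝟙 (on p t) *_) (trans (cong 𝟙 (complement t)) (𝟙-not (U t))))
                                                                         (solve 2 (λ o u → o :* (con 1ℚ :- u) := o :- o :* u) refl (𝟙 (on p t)) (𝟙 (U t)))) ⟩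
        (∑[ t ← E ] (𝟙 (on p t) -ℚ 𝟙 (on p t) * 𝟙 (U t)))           ≡⟨ Σ-- E _ _ ⟩
        (∑[ t ← E ] 𝟙 (on p t)) -ℚ meets U p                        ≡⟨ cong (_-ℚ meets U p) (degree-3 p (∈Ptc⇒Roots p p∈)) ⟩
        ℕ→ℚ 3 -ℚ meets U p                                          ∎

      cost≤-at : ∀ p → p ∈ Ptc → Cost≤ (meets U p) fraction
      cost≤-at p p∈ = subst (λ x → Cost≤ x fraction) (sym (Σ-on p r′ (λ t → 𝟙 (U t))))
        (cost-bounds (U (Roots.a r′)) (U (Roots.b r′)) (U (Roots.c r′)) fraction 0≤fraction fraction≤1)
        where r′ = ∈Ptc⇒Roots p p∈

      private
        disjoint : ∀ t → 𝟙 (U t) * 𝟙 (V t) ≡ 0ℚ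
        disjoint t = trans (cong (λ b → 𝟙 (U t) * 𝟙 b) (complement t)) (product (U t))
          where
          product : ∀ b → 𝟙 b * 𝟙 (not b) ≡ 0ℚ
          product true  = refl
          product false = refl

        disjoint′ : ∀ t → 𝟙 (V t) * 𝟙 (U t) ≡ 0ℚ
        disjoint′ t = trans (ℚₚ.*-comm (𝟙 (V t)) (𝟙 (U t))) (disjoint t)

        1/6 : ℚ
        1/6 = (ℤ.+ 1) Q./ 6

        Σtc : (Point → ℚ) → ℚ
        Σtc f = ∑[ p ← allPoints ] tc p * f p

        Σtc-+ : ∀ f g → Σtc (λ p → f p +ℚ g p) ≡ Σtc f +ℚ Σtc g
        Σtc-+ f g = trans (Σ-cong allPoints (λ p → ℚₚ.*-distribˡ-+ (tc p) (f p) (g p))) (Σ-+ allPoints _ _)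

        Σtc-* : ∀ k f → Σtc (λ p → k * f p) ≡ k * Σtc f
        Σtc-* k f = trans (Σ-cong allPoints (λ p → solve 3 (λ t k f → t :* (k :* f) := k :* (t :* f)) refl (tc p) k (f p))) (Σ-*ˡ allPoints k _)

      -- Up to the factor r/6 the four bounds add up to 3(u² + v²)(u - 1)(v - 1) - uv(u² + v²). The
      -- common factor comes out, and u + v = q gives the stated form.
      total-cost : r * 1/6 * ((u * u +ℚ v * v) * (ℕ→ℚ 2 * (u * v) -ℚ ℕ→ℚ 3 * qℚ +ℚ ℕ→ℚ 3)) ≤
                   ∑[ p ← allPoints ] tc p * cost (meets U p) fraction
      total-cost = ≤-trans (≤-reflexive rearrange) (≤-trans
          (ℚₚ.+-mono-≤ (ℚₚ.+-mono-≤ (ℚₚ.+-mono-≤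
            (negate 0≤k₁ (pure-triples U))
            (*-monoʳ (0≤* 0≤fraction 0≤½) (mixed-triples U V disjoint)))
            (*-monoʳ (0≤* 0≤1-fraction 0≤½) (mixed-triples V U disjoint′)))
            (negate 0≤k₂ (pure-triples V)))
          (≤-reflexive (sym expand)))
        where
        f = fraction
        0≤½ = ℚₚ.nonNegative⁻¹ ½
        0≤k₁ = 0≤* 0≤1-fraction (ℚₚ.nonNegative⁻¹ 1/6)
        0≤k₂ = 0≤* 0≤fraction (ℚₚ.nonNegative⁻¹ 1/6)
        negate : ∀ {k x y} → 0ℚ ≤ k → x ≤ y → - k * y ≤ - k * x
        negate {k} {x} {y} 0≤k x≤y = ≤-by (0≤* 0≤k (≤⇒0≤- x≤y))
          (solve 3 (λ k x y → (:- k) :* x := (:- k) :* y :+ k :* (y :- x)) refl k x y)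
        pure mixed : (Point → ℚ) → (Point → ℚ) → Point → ℚ
        pure x y p = x p * (x p -ℚ 1ℚ) * (x p -ℚ ℕ→ℚ 2)
        mixed x y p = (x p * x p -ℚ x p) * y p
        x y : Point → ℚ
        x = meets U
        y = meets V
        k₁ = - ((1ℚ -ℚ f) * 1/6)
        k₂ = f * ½
        k₃ = (1ℚ -ℚ f) * ½
        k₄ = - (f * 1/6)
        expand : Σtc (λ p → cost (x p) f) ≡ k₁ * Σtc (pure x y) +ℚ k₂ * Σtc (mixed x y) +ℚ k₃ * Σtc (mixed y x) +ℚ k₄ * Σtc (pure y x)
        expand = begin
          Σtc (λ p → cost (x p) f)
            ≡⟨ Σ-cong allPoints (λ p → 𝟙-guard (Ptc p) (λ p∈ → cong (λ z → k₁ * pure x y p +ℚ k₂ * ((x p * x p -ℚ x p) * z)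
                 +ℚ k₃ * ((z * z -ℚ z) * x p) +ℚ k₄ * (z * (z -ℚ 1ℚ) * (z -ℚ ℕ→ℚ 2))) (sym (meets-complement p p∈)))) ⟩
          Σtc (λ p → k₁ * pure x y p +ℚ k₂ * mixed x y p +ℚ k₃ * mixed y x p +ℚ k₄ * pure y x p)
            ≡⟨ trans (Σtc-+ _ _) (cong₂ _+ℚ_ (trans (Σtc-+ _ _) (cong₂ _+ℚ_ (trans (Σtc-+ _ _)
                 (cong₂ _+ℚ_ (Σtc-* k₁ _) (Σtc-* k₂ _))) (Σtc-* k₃ _))) (Σtc-* k₄ _)) ⟩
          k₁ * Σtc (pure x y) +ℚ k₂ * Σtc (mixed x y) +ℚ k₃ * Σtc (mixed y x) +ℚ k₄ * Σtc (pure y x) ∎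
        rearrange : r * 1/6 * ((u * u +ℚ v * v) * (ℕ→ℚ 2 * (u * v) -ℚ ℕ→ℚ 3 * qℚ +ℚ ℕ→ℚ 3)) ≡
          k₁ * (u * u * u) +ℚ k₂ * ((u * u -ℚ u) * (v -ℚ 1ℚ)) +ℚ k₃ * ((v * v -ℚ v) * (u -ℚ 1ℚ)) +ℚ k₄ * (v * v * v)
        rearrange = trans (cong (λ z → r * 1/6 * ((u * u +ℚ v * v) * (ℕ→ℚ 2 * (u * v) -ℚ ℕ→ℚ 3 * z +ℚ ℕ→ℚ 3))) (sym total-size))
          (trans (solve 3 (λ u v r → let k = con ((ℤ.+ 1) Q./ 6) in
              r :* k :* ((u :* u :+ v :* v) :* (con (ℕ→ℚ 2) :* (u :* v) :- con (ℕ→ℚ 3) :* (u :+ v) :+ con (ℕ→ℚ 3)))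
              := (:- ((v :* r) :* k)) :* (u :* u :* u) :+ u :* r :* con ½ :* ((u :* u :- u) :* (v :- con 1ℚ))
                 :+ (v :* r) :* con ½ :* ((v :* v :- v) :* (u :- con 1ℚ)) :+ (:- (u :* r :* k)) :* (v :* v :* v)) refl u v r)
            (cong (λ z → - (z * 1/6) * (u * u * u) +ℚ k₂ * ((u * u -ℚ u) * (v -ℚ 1ℚ)) +ℚ z * ½ * ((v * v -ℚ v) * (u -ℚ 1ℚ)) +ℚ k₄ * (v * v * v)) (sym 1-fraction)))

open MixedTriples

-- Nonexistence of block decompositions, over the rationals.

module BlockTheory where

  open Q using (_*_; _≤_; _<_; -_; _⊔_) renaming (_+_ to _+ℚ_; _-_ to _-ℚ_)
  open ℚₚ using (≤-trans; ≤-reflexive; *-identityˡ; *-identityʳ; *-zeroˡ)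
  open ℚSolver.+-*-Solver using (solve; _:+_; _:*_; _:-_; :-_; _:=_; con)
  open ≡-Reasoning

  -- Here u and v are the numbers of spheres inside and outside one block, D is a lower bound for the
  -- diagonal excesses and X an upper bound for the sum of the off-diagonal ones and |R′|.

  block-arithmetic : ∀ {q u v D X N : ℚ} → u +ℚ v ≡ q → 0ℚ ≤ u → 0ℚ ≤ v → ℕ→ℚ 5 ≤ q →
    ℕ→ℚ 6 * N ≡ (q -ℚ 1ℚ) * (q -ℚ 1ℚ) * (q -ℚ ℕ→ℚ 2) →
    ℕ→ℚ 2 * D ≤ u * ((q -ℚ 1ℚ) * (q -ℚ ℕ→ℚ 2)) → ℕ→ℚ 2 * D ≤ v * ((q -ℚ 1ℚ) * (q -ℚ ℕ→ℚ 2)) →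
    ℕ→ℚ 192 * N ≤ D * q → ℕ→ℚ 192 * N * X ≤ D * D →
    (u * u +ℚ v * v) * (ℕ→ℚ 2 * (u * v) -ℚ ℕ→ℚ 3 * q +ℚ ℕ→ℚ 3) ≤ ℕ→ℚ 6 * q * X → ⊥
  block-arithmetic {q} {u} {v} {D} {X} {N} refl 0≤u 0≤v 5≤q 6N≡ 2D≤u 2D≤v 192N≤ 192NX≤ cost =
    ℚₚ.<-irrefl refl (ℚₚ.<-≤-trans 0<q² q²≤0)
    where
    n : ℕ → ℚ
    n = ℕ→ℚ
    0≤n : ∀ k → 0ℚ ≤ n k
    0≤n = Rational.ℕ→ℚ-nonNeg
    s = q -ℚ n 5
    0≤s : 0ℚ ≤ s
    0≤s = ≤⇒0≤- 5≤q
    0<q : 0ℚ < q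
    0<q = ℚₚ.<-≤-trans (Rational.ℕ→ℚ-pos 5) 5≤q
    0≤q = ℚₚ.<⇒≤ 0<q
    0<q² = Rational.*-pos 0<q 0<q
    0<q³ = Rational.*-pos 0<q² 0<q
    0≤q² = ℚₚ.<⇒≤ 0<q²
    cancel : ∀ {k x y} → 0ℚ < k → x * k ≤ y * k → x ≤ y
    cancel {k} 0<k = ℚₚ.*-cancelʳ-≤-pos k {{Q.positive 0<k}}
    -- The slack 32(q - 1)²(q - 2) - 12q³ has nonnegative coefficients in s = q - 5; its constant
    -- term is 36.
    12q³≤192N : n 12 * (q * q * q) ≤ n 192 * N
    12q³≤192N = ≤-by (0≤+ (0≤+ (0≤+ (0≤n 36) (0≤* (0≤n 380) 0≤s)) (0≤* (0≤n 172) (0≤* 0≤s 0≤s))) (0≤* (0≤n 20) (0≤* 0≤s (0≤* 0≤s 0≤s))))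
      (trans (solve 1 (λ N → con (n 192) :* N := con (n 32) :* (con (n 6) :* N)) refl N) (trans (cong (n 32 *_) 6N≡)
        (solve 1 (λ q → let s = q :- con (n 5) in con (n 32) :* ((q :- con 1ℚ) :* (q :- con 1ℚ) :* (q :- con (n 2))) :=
          con (n 12) :* (q :* q :* q) :+ (con (n 36) :+ con (n 380) :* s :+ con (n 172) :* (s :* s) :+ con (n 20) :* (s :* (s :* s)))) refl q)))
    12q²≤D : n 12 * (q * q) ≤ D
    12q²≤D = cancel 0<q (≤-trans (≤-reflexive (solve 1 (λ q → con (n 12) :* (q :* q) :* q := con (n 12) :* (q :* q :* q)) refl q)) (≤-trans 12q³≤192N 192N≤))
    0≤D : 0ℚ ≤ D
    0≤D = ≤-trans (0≤* (0≤n 12) 0≤q²) 12q²≤D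
    weaken : ∀ {w} → 0ℚ ≤ w → n 2 * D ≤ w * ((q -ℚ 1ℚ) * (q -ℚ n 2)) → n 2 * D ≤ q * q * w
    weaken {w} 0≤w h = ≤-trans h (≤-by (0≤* 0≤w (0≤+ (0≤* (0≤n 3) 0≤s) (0≤n 13)))
      (solve 2 (λ q w → q :* q :* w := w :* ((q :- con 1ℚ) :* (q :- con (n 2))) :+ w :* (con (n 3) :* (q :- con (n 5)) :+ con (n 13))) refl q w))
    du = ≤⇒0≤- (weaken 0≤u 2D≤u)
    dv = ≤⇒0≤- (weaken 0≤v 2D≤v)
    4D≤q³ : n 4 * D ≤ q * q * q
    4D≤q³ = ≤-by (0≤+ du dv) (solve 3 (λ u v D → let q = u :+ v in q :* q :* q :=
      con (n 4) :* D :+ ((q :* q :* u :- con (n 2) :* D) :+ (q :* q :* v :- con (n 2) :* D))) refl u v D)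
    -- Both slacks q² u - 2D and q² v - 2D are nonnegative; their product, together with u + v = q
    -- and 4D ≤ q³, bounds uv from below.
    D≤quv : D ≤ q * (u * v)
    D≤quv = cancel 0<q³ (≤-by (0≤+ (0≤* du dv) (0≤* 0≤D (≤⇒0≤- 4D≤q³)))
      (solve 3 (λ u v D → let q = u :+ v in q :* (u :* v) :* (q :* q :* q) :=
        D :* (q :* q :* q) :+ ((q :* q :* u :- con (n 2) :* D) :* (q :* q :* v :- con (n 2) :* D) :+ D :* (q :* q :* q :- con (n 4) :* D))) refl u v D))
    Z = n 2 * (u * v) -ℚ n 3 * q
    qZ : n 2 * D -ℚ n 3 * (q * q) ≤ q * Z
    qZ = ≤-by (0≤* (0≤n 2) (≤⇒0≤- D≤quv))
      (solve 4 (λ q u v D → q :* (con (n 2) :* (u :* v) :- con (n 3) :* q) := con (n 2) :* D :- con (n 3) :* (q :* q) :+ con (n 2) :* (q :* (u :* v) :- D)) refl q u v D)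
    0≤qZ : 0ℚ ≤ q * Z
    0≤qZ = ≤-trans (≤-by (0≤+ (0≤* (0≤n 2) (≤⇒0≤- 12q²≤D)) (0≤* (0≤n 21) 0≤q²))
      (solve 2 (λ q D → con (n 2) :* D :- con (n 3) :* (q :* q) := con 0ℚ :+ (con (n 2) :* (D :- con (n 12) :* (q :* q)) :+ con (n 21) :* (q :* q))) refl q D)) qZ
    0≤Z : 0ℚ ≤ Z
    0≤Z = cancel 0<q (subst₂ _≤_ (sym (*-zeroˡ q)) (ℚₚ.*-comm q Z) 0≤qZ)
    0≤sq : ∀ x → 0ℚ ≤ x * x
    0≤sq x with ℚₚ.≤-total 0ℚ x
    ... | inj₁ 0≤x = 0≤* 0≤x 0≤x
    ... | inj₂ x≤0 = subst (0ℚ ≤_) (solve 1 (λ x → (:- x) :* (:- x) := x :* x) refl x) (0≤* 0≤-x 0≤-x)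
      where 0≤-x = ℚₚ.neg-antimono-≤ x≤0
    -- As 2(u² + v²) = q² + (u - v)² and Z is nonnegative, u² + v² may be replaced by q²/2.
    qZ≤12X : q * Z ≤ n 12 * X
    qZ≤12X = cancel 0<q (≤-trans (≤-by (0≤+ (0≤* (0≤sq (u -ℚ v)) 0≤Z) (0≤* (0≤n 6) (0≤+ (0≤sq u) (0≤sq v))))
        (solve 2 (λ u v → let q = u :+ v ; Z = con (n 2) :* (u :* v) :- con (n 3) :* q in
          con (n 2) :* ((u :* u :+ v :* v) :* (Z :+ con (n 3))) := q :* Z :* q :+ ((u :- v) :* (u :- v) :* Z :+ con (n 6) :* (u :* u :+ v :* v))) refl u v))
      (≤-trans (*-monoʳ (0≤n 2) cost) (≤-reflexive (solve 2 (λ q X → con (n 2) :* (con (n 6) :* q :* X) := con (n 12) :* X :* q) refl q X))))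
    0≤X : 0ℚ ≤ X
    0≤X = cancel (Rational.ℕ→ℚ-pos 12) (subst₂ _≤_ (sym (*-zeroˡ (n 12))) (ℚₚ.*-comm (n 12) X) (≤-trans 0≤qZ qZ≤12X))
    -- From 12q³ X ≤ 192 N X ≤ D² and 4D ≤ q³, after cancelling q³.
    48X≤D : n 48 * X ≤ D
    48X≤D = cancel 0<q³ (≤-trans
      (≤-by (0≤* (0≤n 4) (0≤+ (0≤* 0≤X (≤⇒0≤- 12q³≤192N)) (≤⇒0≤- 192NX≤)))
        (solve 4 (λ q X N D → con (n 4) :* (D :* D) := con (n 48) :* X :* (q :* q :* q) :+ con (n 4) :*
          (X :* (con (n 192) :* N :- con (n 12) :* (q :* q :* q)) :+ (D :* D :- con (n 192) :* N :* X))) refl q X N D))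
      (≤-by (0≤* 0≤D (≤⇒0≤- 4D≤q³))
        (solve 2 (λ q D → D :* (q :* q :* q) := con (n 4) :* (D :* D) :+ D :* (q :* q :* q :- con (n 4) :* D)) refl q D)))
    -- The chain 8D - 12q² ≤ 4qZ ≤ 48X ≤ D gives 7D ≤ 12q², whereas 12q² ≤ D gives 84q² ≤ 7D; the
    -- difference is 72q².
    q²≤0 : q * q ≤ 0ℚ
    q²≤0 = cancel (Rational.ℕ→ℚ-pos 72) (≤-by
      (0≤+ (0≤+ (0≤+ (≤⇒0≤- 48X≤D) (0≤* (0≤n 4) (≤⇒0≤- qZ≤12X))) (0≤* (0≤n 4) (≤⇒0≤- qZ))) (0≤* (0≤n 7) (≤⇒0≤- 12q²≤D)))
      (solve 4 (λ q X Z D → con 0ℚ :* con (n 72) := q :* q :* con (n 72) :+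
        ((D :- con (n 48) :* X) :+ con (n 4) :* (con (n 12) :* X :- q :* Z) :+ con (n 4) :* (q :* Z :- (con (n 2) :* D :- con (n 3) :* (q :* q)))
         :+ con (n 7) :* (D :- con (n 12) :* (q :* q)))) refl q X Z D))

  private variable A : Set

  foldr-filter≡Σ : ∀ (f : A → ℚ) (g : A → Bool) xs →
    List.foldr Q._+_ 0ℚ (List.map f (List.filterᵇ g xs)) ≡ ∑[ x ← xs ] 𝟙 (g x) * f x
  foldr-filter≡Σ f g []       = refl
  foldr-filter≡Σ f g (x ∷ xs) with g x
  ... | true  = cong₂ _+ℚ_ (sym (*-identityˡ (f x))) (foldr-filter≡Σ f g xs)
  ... | false = trans (foldr-filter≡Σ f g xs) (trans (sym (ℚₚ.+-identityˡ _)) (cong (_+ℚ (∑[ x ← xs ] 𝟙 (g x) * f x)) (sym (*-zeroˡ (f x)))))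

  Σ-allFin-suc : ∀ n (f : Fin (suc n) → ℚ) → Σ (List.allFin (suc n)) f ≡ f zero +ℚ (∑[ i ← List.allFin n ] f (suc i))
  Σ-allFin-suc n f = cong (f zero +ℚ_) (trans (cong (λ l → Σ l f) (sym (Listₚ.map-tabulate id suc))) (Σ-map suc (List.allFin n) f))

  allFin-listing : ∀ n → Listing (List.allFin n)
  allFin-listing n = record { unique = Uniqueₚ.allFin⁺ n ; complete = Membershipₚ.∈-allFin }

  term≤Σ : ∀ {xs : List A} → Listing xs → (_≟_ : (x y : A) → Dec (x ≡ y)) → (f : A → ℚ) → (∀ x → 0ℚ ≤ f x) → ∀ a → f a ≤ Σ xs f
  term≤Σ {xs = xs} l _≟_ f 0≤f a = ≤-trans (≤-reflexive (sym (Σ-δ l _≟_ a f))) (Σ-mono xs (λ x →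
    ≤-trans (ℚₚ.*-monoʳ-≤-nonNeg (f x) {{Q.nonNegative (0≤f x)}} (𝟙≤1 (does (a ≟ x)))) (≤-reflexive (*-identityˡ (f x)))))

  Σ-partition : ∀ {n} {X : Sub A} {Xs : Fin n → Sub A} → IsPartition X Xs → ∀ x → ∑[ i ← List.allFin n ] 𝟙 (Xs i x) ≡ 𝟙 (X x)
  Σ-partition {n = n} {X} {Xs} (sub , part) x = go (X x) refl
    where
    go : ∀ b → X x ≡ b → ∑[ i ← List.allFin n ] 𝟙 (Xs i x) ≡ 𝟙 b
    go true eq with i , x∈ , unique ← part x (subst T (sym eq) tt) = trans
      (Σ-single (allFin-listing n) Finₚ._≟_ i _ (λ j j≢i → 𝟙-¬T (λ h → j≢i (sym (unique h))))) (𝟙-T x∈)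
    go false eq = trans (Σ-cong (List.allFin n) (λ i → 𝟙-¬T (λ h → subst T eq (sub i x h)))) (Σ-zero (List.allFin n))

  -- The expression from `CenteredBlockDecomposition` for an arbitrary matrix, so that the field
  -- `cross` applies to it by conversion.
  offDiagonal : ∀ {m} → (Fin m → Fin m → ℚ) → ℚ
  offDiagonal {m} f = List.foldr Q._+_ 0ℚ
    (List.map (λ (i , j) → f i j ⊔ 0ℚ)
      (List.filterᵇ (λ (i , j) → not (does (i Finₚ.≟ j))) (List.cartesianProduct (List.allFin m) (List.allFin m))))

  -- The entries of the full sum are truncated at 0, so restricting it to the row and the column of
  -- the first block does not increase it.
  cross≤offDiagonal : ∀ {k} (f : Fin (suc k) → Fin (suc k) → ℚ) →
    (∑[ j ← List.allFin k ] f zero (suc j)) +ℚ (∑[ i ← List.allFin k ] f (suc i) zero) ≤ offDiagonal f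
  cross≤offDiagonal {k} f = ≤-trans (ℚₚ.+-mono-≤
      (Σ-mono ks (λ j → positive zero (suc j) refl))
      (Σ-mono ks (λ i → ≤-trans (positive (suc i) zero refl) (≤-trans (≤-reflexive (sym (ℚₚ.+-identityʳ _)))
        (ℚₚ.+-monoʳ-≤ (g (suc i) zero) (0≤Σ ks (λ j → 0≤g (suc i) (suc j))))))))
    (≤-trans (≤-by (0≤g zero zero) (trans
        (cong₂ _+ℚ_ (Σ-allFin-suc k (g zero)) (Σ-cong ks (λ i → Σ-allFin-suc k (g (suc i)))))
        (solve 3 (λ d x y → d :+ x :+ y := x :+ y :+ d) refl (g zero zero) (∑[ j ← ks ] g zero (suc j)) (∑[ i ← ks ] (g (suc i) zero +ℚ (∑[ j ← ks ] g (suc i) (suc j)))))))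
      (≤-reflexive (sym (begin
        offDiagonal f                                                        ≡⟨ foldr-filter≡Σ (λ (i , j) → f i j ⊔ 0ℚ) (λ (i , j) → not (does (i Finₚ.≟ j))) (List.cartesianProduct all all) ⟩
        Σ (List.cartesianProduct all all) (λ (i , j) → g i j)                ≡⟨ Σ-cartesianProduct all all (λ (i , j) → g i j) ⟩
        (∑[ i ← all ] ∑[ j ← all ] g i j)                                    ≡⟨ Σ-allFin-suc k (λ i → ∑[ j ← all ] g i j) ⟩
        (∑[ j ← all ] g zero j) +ℚ (∑[ i ← ks ] ∑[ j ← all ] g (suc i) j)    ∎))))
    where
    ks = List.allFin k
    all = List.allFin (suc k)
    g : Fin (suc k) → Fin (suc k) → ℚ
    g i j = 𝟙 (not (does (i Finₚ.≟ j))) * (f i j ⊔ 0ℚ)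
    0≤g : ∀ i j → 0ℚ ≤ g i j
    0≤g i j = 0≤* (0≤𝟙 (not (does (i Finₚ.≟ j)))) (ℚₚ.p≤q⊔p (f i j) 0ℚ)
    0≤Σ : ∀ {A : Set} (xs : List A) {f : A → ℚ} → (∀ x → 0ℚ ≤ f x) → 0ℚ ≤ Σ xs f
    0≤Σ xs {f} h = subst (_≤ Σ xs f) (Σ-zero xs) (Σ-mono xs h)
    positive : ∀ i j → not (does (i Finₚ.≟ j)) ≡ true → f i j ≤ g i j
    positive i j eq = ≤-trans (ℚₚ.p≤p⊔q (f i j) 0ℚ) (≤-reflexive (sym (trans (cong (λ b → 𝟙 b * (f i j ⊔ 0ℚ)) eq) (*-identityˡ _))))

  module Blocks {q : ℕ} (F : FiniteField q) (R : FiniteField.Carrier F)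
                (2≢0 : FieldAlgebra.2# F ≢ FiniteField.0# F)
                (3≢0 : FiniteField._+_ F (FieldAlgebra.2# F) (FiniteField.1# F) ≢ FiniteField.0# F)
                (5≤q : 5 ℕ.≤ q) where

    open FiniteField F hiding (_*_; _-_; -_)
    open Geometry F
    open TwistedCubic F R
    open Points F R 2≢0
    open Counts F R 2≢0 3≢0
    open Spheres F R 2≢0 3≢0
    open Mixed F R 2≢0 3≢0
    module W = Weights (FieldAlgebra.elements-listing F) _≟_

    trace : Sub Sphere → Carrier → Bool
    trace 𝒮 t = 𝒮 (S t)

    -- A sphere S_a contains at most (q - 1)(q - 2)/2 points: each of them lies on two further
    -- spheres, and each of the q - 1 other spheres shares at most q - 2 points with S_a.
    σ-bound : ∀ A 𝒮 → A ⊆ Ptc → 𝒮 ⊆ 𝒮tc →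
              ℕ→ℚ 2 * σ Q₀ A 𝒮 ≤ size (trace 𝒮) * ((qℚ -ℚ 1ℚ) * (qℚ -ℚ ℕ→ℚ 2))
    σ-bound A 𝒮 A⊆ 𝒮⊆ = ≤-trans (*-monoʳ 0≤2 (≤-trans (≤-reflexive (σ-formula A 𝒮 𝒮⊆)) (Σ-mono allPoints per-point)))
      (≤-trans (≤-reflexive double) (≤-trans (Σ-mono E per-element) (≤-reflexive (Σ-*ʳ E _ _))))
      where
      0≤2 = Rational.ℕ→ℚ-nonNeg 2
      per-point : ∀ p → 𝟙 (A p) * excess 𝒮 p ≤ tc p * incidences 𝒮 p
      per-point p = ≤-trans
        (*-monoʳ (0≤𝟙 (A p)) (≤-by (0≤* (0≤size (trace 𝒮)) 0≤1/q) (solve 2 (λ i s → i := i :- s :+ s) refl (incidences 𝒮 p) (size (trace 𝒮) * 1/q))))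
        (ℚₚ.*-monoʳ-≤-nonNeg (incidences 𝒮 p) {{Q.nonNegative (0≤Σ E (λ t → 0≤* (0≤𝟙 (on p t)) (0≤𝟙 (𝒮 (S t)))))}} (sub (A p) (A⊆ p)))
        where
        sub : ∀ b → (T b → p ∈ Ptc) → 𝟙 b ≤ tc p
        sub true  h = ≤-reflexive (sym (𝟙-T (h tt)))
        sub false h = 0≤𝟙 (Ptc p)
      double : ℕ→ℚ 2 * (∑[ p ← allPoints ] tc p * incidences 𝒮 p) ≡ ∑[ a ← E ] 𝟙 (𝒮 (S a)) * (∑[ b ← E ] W.ν a b * pairs a b)
      double = trans (sym (Σ-*ˡ allPoints (ℕ→ℚ 2) _)) (trans
        (Σ-cong allPoints (λ p → solve 3 (λ k t i → k :* (t :* i) := t :* (k :* i)) refl (ℕ→ℚ 2) (tc p) (incidences 𝒮 p)))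
        (Σ-double (λ t → 𝟙 (𝒮 (S t)))))
      per-element : ∀ a → 𝟙 (𝒮 (S a)) * (∑[ b ← E ] W.ν a b * pairs a b) ≤ 𝟙 (𝒮 (S a)) * ((qℚ -ℚ 1ℚ) * (qℚ -ℚ ℕ→ℚ 2))
      per-element a = *-monoʳ (0≤𝟙 (𝒮 (S a))) (≤-trans (Σ-mono E (λ b → W.ν-guard-≤ a b pairs≤q-2))
        (≤-reflexive (trans (W.Σ-ν a (λ _ → qℚ -ℚ ℕ→ℚ 2)) (trans
          (cong (_-ℚ (qℚ -ℚ ℕ→ℚ 2)) (trans (Σ-cong E (λ _ → sym (*-identityˡ (qℚ -ℚ ℕ→ℚ 2)))) (trans (Σ-*ʳ E (λ _ → 1ℚ) (qℚ -ℚ ℕ→ℚ 2)) (cong (_* (qℚ -ℚ ℕ→ℚ 2)) Σ-1))))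
          (solve 1 (λ q → q :* (q :- con (ℕ→ℚ 2)) :- (q :- con (ℕ→ℚ 2)) := (q :- con 1ℚ) :* (q :- con (ℕ→ℚ 2))) refl qℚ)))))

    module _ {k} (𝒮s : Fin (suc k) → Sub Sphere) (As : Fin (suc k) → Sub Point) (R′ : Sub Point)
             (𝒮-part : IsPartition 𝒮tc 𝒮s) (P-part : IsPartition Ptc (R′ Vector.∷ As)) where

      private
        ks = List.allFin k
        U V : Carrier → Bool
        U = trace (𝒮s zero)
        V t = not (U t)

        𝒮⊆ : ∀ i → 𝒮s i ⊆ 𝒮tc
        𝒮⊆ = proj₁ 𝒮-part

        A⊆ : ∀ i → As i ⊆ Ptc
        A⊆ i = proj₁ P-part (suc i)

        f = fraction U V (λ _ → refl)

        other-spheres : ∀ t → (∑[ j ← ks ] 𝟙 (𝒮s (suc j) (S t))) ≡ 𝟙 (V t)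
        other-spheres t = begin
          (∑[ j ← ks ] 𝟙 (𝒮s (suc j) (S t)))                              ≡⟨ solve 2 (λ u s → s := u :+ s :- u) refl (𝟙 (U t)) (∑[ j ← ks ] 𝟙 (𝒮s (suc j) (S t))) ⟩
          𝟙 (U t) +ℚ (∑[ j ← ks ] 𝟙 (𝒮s (suc j) (S t))) -ℚ 𝟙 (U t)        ≡⟨ cong (_-ℚ 𝟙 (U t)) (Σ-allFin-suc k (λ j → 𝟙 (𝒮s j (S t)))) ⟨
          (∑[ j ← List.allFin (suc k) ] 𝟙 (𝒮s j (S t))) -ℚ 𝟙 (U t)  ≡⟨ cong (_-ℚ 𝟙 (U t)) (trans (Σ-partition 𝒮-part (S t)) (𝟙-T (S∈𝒮tc t))) ⟩
          1ℚ -ℚ 𝟙 (U t)                                                   ≡⟨ 𝟙-not (U t) ⟨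
          𝟙 (V t)                                                         ∎

        other-points : Point → ℚ
        other-points p = ∑[ i ← ks ] 𝟙 (As (suc i) p)

        0≤other : ∀ p → 0ℚ ≤ other-points p
        0≤other p = 0≤Σ ks (λ i → 0≤𝟙 (As (suc i) p))

        all-points : ∀ p → 𝟙 (R′ p) +ℚ (𝟙 (As zero p) +ℚ other-points p) ≡ tc p
        all-points p = trans (sym (trans (Σ-allFin-suc (suc k) (λ i → 𝟙 ((R′ Vector.∷ As) i p)))
          (cong (𝟙 (R′ p) +ℚ_) (Σ-allFin-suc k (λ i → 𝟙 (As i p)))))) (Σ-partition P-part p)

        exV exU : Point → ℚ
        exV p = meets V p -ℚ size V * 1/q
        exU p = meets U p -ℚ size U * 1/q

        -- The excess is additive over disjoint families, so the spheres of all later blocks act as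
        -- the single class V.
        Σ-excess : ∀ p → (∑[ j ← ks ] excess (𝒮s (suc j)) p) ≡ exV p
        Σ-excess p = begin
          (∑[ j ← ks ] excess (𝒮s (suc j)) p)
            ≡⟨ Σ-- ks _ _ ⟩
          (∑[ j ← ks ] incidences (𝒮s (suc j)) p) -ℚ (∑[ j ← ks ] size (trace (𝒮s (suc j))) * 1/q)
            ≡⟨ cong₂ _-ℚ_ (trans (Σ-swap ks E _) (Σ-cong E (λ t → trans (Σ-*ˡ ks (𝟙 (on p t)) _) (cong (𝟙 (on p t) *_) (other-spheres t)))))
                 (trans (Σ-*ʳ ks _ 1/q) (cong (_* 1/q) (trans (Σ-swap ks E _) (Σ-cong E other-spheres)))) ⟩
          exV p ∎

        row : (∑[ j ← ks ] σ Q₀ (As zero) (𝒮s (suc j))) ≡ ∑[ p ← allPoints ] 𝟙 (As zero p) * exV p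
        row = trans (Σ-cong ks (λ j → σ-formula (As zero) (𝒮s (suc j)) (𝒮⊆ (suc j)))) (trans (Σ-swap ks allPoints _)
          (Σ-cong allPoints (λ p → trans (Σ-*ˡ ks (𝟙 (As zero p)) _) (cong (𝟙 (As zero p) *_) (Σ-excess p)))))

        column : (∑[ i ← ks ] σ Q₀ (As (suc i)) (𝒮s zero)) ≡ ∑[ p ← allPoints ] other-points p * exU p
        column = trans (Σ-cong ks (λ i → σ-formula (As (suc i)) (𝒮s zero) (𝒮⊆ zero))) (trans (Σ-swap ks allPoints _)
          (Σ-cong allPoints (λ p → Σ-*ʳ ks _ (exU p))))

        -- A point of the system lies in exactly one of the first block, the later blocks and the
        -- remainder. It is charged to V, to U, or with the constant 1 accordingly, and `Cost≤`
        -- covers all three cases.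
        point-cost≤ : ∀ p → tc p * cost (meets U p) f ≤ 𝟙 (As zero p) * exV p +ℚ other-points p * exU p +ℚ 𝟙 (R′ p)
        point-cost≤ p = go (Ptc p) refl
          where
          r = 𝟙 (R′ p)
          a = 𝟙 (As zero p)
          o = other-points p
          c = cost (meets U p) f
          go : ∀ b → Ptc p ≡ b → 𝟙 b * c ≤ a * exV p +ℚ o * exU p +ℚ r
          go true eq = ≤-trans (≤-reflexive split) (≤-trans
              (ℚₚ.+-mono-≤ (ℚₚ.+-mono-≤ (*-monoʳ (0≤𝟙 (As zero p)) other′) (*-monoʳ (0≤other p) own)) (*-monoʳ (0≤𝟙 (R′ p)) one))
              (≤-reflexive (cong (a * exV p +ℚ o * exU p +ℚ_) (*-identityʳ r))))
            where
            p∈ : p ∈ Ptc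
            p∈ = subst T (sym eq) tt
            open Cost≤ (cost≤-at U V (λ _ → refl) p p∈)
            other′ : c ≤ exV p
            other′ = ≤-trans other (≤-reflexive (cong₂ _-ℚ_ (sym (meets-complement U V (λ _ → refl) p p∈)) (1-fraction U V (λ _ → refl))))
            split : 1ℚ * c ≡ a * c +ℚ o * c +ℚ r * c
            split = trans (cong (_* c) (trans (cong 𝟙 (sym eq)) (sym (all-points p))))
              (solve 4 (λ r a o c → (r :+ (a :+ o)) :* c := a :* c :+ o :* c :+ r :* c) refl r a o c)
          go false eq = ≤-reflexive (begin
            0ℚ * c                            ≡⟨ *-zeroˡ c ⟩
            0ℚ                                ≡⟨ solve 2 (λ x y → con 0ℚ := con 0ℚ :* x :+ con 0ℚ :* y :+ con 0ℚ) refl (exV p) (exU p) ⟩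
            0ℚ * exV p +ℚ 0ℚ * exU p +ℚ 0ℚ    ≡⟨ cong₂ (λ x z → x * exV p +ℚ 0ℚ * exU p +ℚ z) (sym a≡0) (sym r≡0) ⟩
            a * exV p +ℚ 0ℚ * exU p +ℚ r      ≡⟨ cong (λ y → a * exV p +ℚ y * exU p +ℚ r) (sym o≡0) ⟩
            a * exV p +ℚ o * exU p +ℚ r       ∎)
            where
            p∉ : ¬ p ∈ Ptc
            p∉ = subst T eq
            a≡0 : a ≡ 0ℚ
            a≡0 = 𝟙-¬T (p∉ ∘ A⊆ zero p)
            r≡0 : r ≡ 0ℚ
            r≡0 = 𝟙-¬T (p∉ ∘ proj₁ P-part zero p)
            o≡0 : o ≡ 0ℚ
            o≡0 = trans (Σ-cong ks (λ i → 𝟙-¬T (p∉ ∘ A⊆ (suc i) p))) (Σ-zero ks)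

        ρ = ∑[ p ← allPoints ] 𝟙 (R′ p)

      crossing = offDiagonal (λ i j → σ Q₀ (As i) (𝒮s j))

      cost≤crossing : ∑[ p ← allPoints ] tc p * cost (meets U p) f ≤ crossing +ℚ ρ
      cost≤crossing = ≤-trans (Σ-mono allPoints point-cost≤) (≤-trans
        (≤-reflexive (trans (Σ-+ allPoints _ _) (cong (_+ℚ ρ) (trans (Σ-+ allPoints _ _) (cong₂ _+ℚ_ (sym row) (sym column))))))
        (ℚₚ.+-monoˡ-≤ ρ (cross≤offDiagonal (λ i j → σ Q₀ (As i) (𝒮s j)))))

      -- The diagonal excess of the first block forces `size U` to be large; that of block `suc j`,
      -- whose spheres all belong to V, does the same for `size V`.
      no-blocks : ∀ D j → D ≤ σ Q₀ (As zero) (𝒮s zero) → D ≤ σ Q₀ (As (suc j)) (𝒮s (suc j)) →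
        ℕ→ℚ 96 * σ Q₀ Ptc 𝒮tc ≤ D * qℚ →
        ℕ→ℚ 144 * crossing * σ Q₀ Ptc 𝒮tc ≤ D * D →
        ℕ→ℚ 144 * σ Q₀ R′ 𝒮tc * σ Q₀ Ptc 𝒮tc ≤ D * D → ⊥
      no-blocks D j D≤₀ D≤₁ large cross rest = block-arithmetic {qℚ} {size U} {size V} {D} {crossing +ℚ ρ} {N}
        (total-size U V (λ _ → refl)) (0≤size U) (0≤size V) (ℕ→ℚ-mono 5≤q) size-formula
        (≤-trans (*-monoʳ (Rational.ℕ→ℚ-nonNeg 2) D≤₀) (σ-bound (As zero) (𝒮s zero) (A⊆ zero) (𝒮⊆ zero)))
        (≤-trans (*-monoʳ (Rational.ℕ→ℚ-nonNeg 2) D≤₁) (≤-trans (σ-bound (As (suc j)) (𝒮s (suc j)) (A⊆ (suc j)) (𝒮⊆ (suc j)))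
          (ℚₚ.*-monoʳ-≤-nonNeg _ {{Q.nonNegative 0≤qq}} (Σ-mono E second≤V))))
        (≤-trans (≤-reflexive (trans (solve 1 (λ N → con (ℕ→ℚ 192) :* N := con (ℕ→ℚ 96) :* (con (ℕ→ℚ 2) :* N)) refl N) (cong (ℕ→ℚ 96 *_) (sym σ≡)))) large)
        combined
        (≤-trans (≤-by ℚₚ.≤-refl (begin
            ℕ→ℚ 6 * qℚ * (1/q * 1/6 * G)   ≡⟨ solve 3 (λ q r G → con (ℕ→ℚ 6) :* q :* (r :* con ((ℤ.+ 1) Q./ 6) :* G) := (q :* r) :* G) refl qℚ 1/q G ⟩
            (qℚ * 1/q) * G                 ≡⟨ cong (_* G) q*1/q ⟩
            1ℚ * G                         ≡⟨ solve 1 (λ G → con 1ℚ :* G := G :+ con 0ℚ) refl G ⟩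
            G +ℚ 0ℚ                        ∎))
          (*-monoʳ (0≤* (Rational.ℕ→ℚ-nonNeg 6) (Rational.ℕ→ℚ-nonNeg q)) (≤-trans (total-cost U V (λ _ → refl)) cost≤crossing)))
        where
        N = ∑[ p ← allPoints ] tc p
        1/6 = (ℤ.+ 1) Q./ 6
        u = size U
        v = size V
        G = (u * u +ℚ v * v) * (ℕ→ℚ 2 * (u * v) -ℚ ℕ→ℚ 3 * qℚ +ℚ ℕ→ℚ 3)
        0≤qq : 0ℚ ≤ (qℚ -ℚ 1ℚ) * (qℚ -ℚ ℕ→ℚ 2)
        0≤qq = 0≤* (≤⇒0≤- (ℕ→ℚ-mono (ℕₚ.≤-trans (ℕ.s≤s ℕ.z≤n) 5≤q))) (≤⇒0≤- (ℕ→ℚ-mono (ℕₚ.≤-trans (ℕ.s≤s (ℕ.s≤s ℕ.z≤n)) 5≤q)))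
        second≤V : ∀ t → 𝟙 (𝒮s (suc j) (S t)) ≤ 𝟙 (V t)
        second≤V t = ≤-trans (term≤Σ (allFin-listing k) Finₚ._≟_ (λ i → 𝟙 (𝒮s (suc i) (S t))) (λ i → 0≤𝟙 (𝒮s (suc i) (S t))) j)
          (≤-reflexive (other-spheres t))
        twice : ∀ B → B ⊆ Ptc → σ Q₀ B 𝒮tc ≡ ℕ→ℚ 2 * (∑[ p ← allPoints ] 𝟙 (B p))
        twice B B⊆ = trans (σ-subset B B⊆) (trans (Rational.ℕ→ℚ-* 2 ∣ B ∣ₚ) (cong (ℕ→ℚ 2 *_) (count≡Σ allPoints B)))
        σ≡ : σ Q₀ Ptc 𝒮tc ≡ ℕ→ℚ 2 * N
        σ≡ = twice Ptc (λ _ h → h)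
        -- Since σ(R′) = 2ρ and Σ = 2N, the hypotheses read 288 N C ≤ D² and 576 N ρ ≤ D². Two
        -- thirds of the first and one third of the second add up to the constant 192.
        combined : ℕ→ℚ 192 * N * (crossing +ℚ ρ) ≤ D * D
        combined = ≤-by (0≤* (ℚₚ.nonNegative⁻¹ ((ℤ.+ 1) Q./ 3)) (0≤+ (0≤* (Rational.ℕ→ℚ-nonNeg 2) dc) dr))
          (solve 4 (λ D N C ρ → D :* D := con (ℕ→ℚ 192) :* N :* (C :+ ρ) :+ con ((ℤ.+ 1) Q./ 3) :*
              (con (ℕ→ℚ 2) :* (D :* D :- con (ℕ→ℚ 144) :* C :* (con (ℕ→ℚ 2) :* N)) :+
               (D :* D :- con (ℕ→ℚ 144) :* (con (ℕ→ℚ 2) :* ρ) :* (con (ℕ→ℚ 2) :* N)))) refl D N crossing ρ)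
          where
          dc = ≤⇒0≤- (subst (λ z → ℕ→ℚ 144 * crossing * z ≤ D * D) σ≡ cross)
          dr = ≤⇒0≤- (subst₂ (λ y z → ℕ→ℚ 144 * y * z ≤ D * D) (twice R′ (proj₁ P-part zero)) σ≡ rest)

open BlockTheory

-- Ternary quadratic forms and their isotropic vectors.

module FormTheory where

  open Listing

  length-cartesianProductWith : ∀ {A B C : Set} (f : A → B → C) xs ys →
    List.length (List.cartesianProductWith f xs ys) ≡ List.length xs ℕ.* List.length ys
  length-cartesianProductWith f []       ys = refl
  length-cartesianProductWith f (x ∷ xs) ys = trans (Listₚ.length-++ (List.map (f x) ys))
    (cong₂ ℕ._+_ (Listₚ.length-map (f x) ys) (length-cartesianProductWith f xs ys))

  length-vectors : ∀ {q} (F : FiniteField q) n → List.length (Geometry.vectors F n) ≡ q ℕ.^ n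
  length-vectors F zero    = refl
  length-vectors F (suc n) = trans (length-cartesianProductWith _∷_ (FiniteField.elements F) (Geometry.vectors F n))
    (cong₂ ℕ._*_ (FieldAlgebra.length-elements F) (length-vectors F n))

  𝟙-does≤ : ∀ {P : Set} (P? : Dec P) {x} → 0ℚ Q.≤ x → (P → 1ℚ Q.≤ x) → 𝟙 (does P?) Q.≤ x
  𝟙-does≤ (yes p) _   h = h p
  𝟙-does≤ (no _)  0≤x _ = 0≤x

  module Forms {q : ℕ} (F : FiniteField q) (2≢0 : FieldAlgebra.2# F ≢ FiniteField.0# F) where

    open FiniteField F
    open FieldAlgebra F
    open Geometry F

    -- Every nonzero value of x ↦ a x² has at most two preimages and 0 has one, so the values of a x² and of
    -- - c - b y² cannot be disjoint: otherwise 2 q ≤ 2 (q - 1) + 1.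

    module Conic (a b c : Carrier) (a≢0 : a ≢ 0#) (b≢0 : b ≢ 0#) where

      open Q using () renaming (_+_ to _+ℚ_; _*_ to _*ℚ_; _-_ to _-ℚ_; _≤_ to _≤ℚ_)
      open Finite elements-listing elements-listing _≟_ _≟_

      f g : Carrier → Carrier
      f x = a * (x * x)
      g y = - (c + b * (y * y))

      square-roots : ∀ {x y} → x * x ≡ y * y → x ≡ y ⊎ x ≡ - y
      square-roots {x} {y} h with x ≟ y
      ... | yes e  = inj₁ e
      ... | no x≢y = inj₂ (-‿≡0 (*-cancel-- x≢y (combine₁ 1# h
        (solve 2 (λ x y → (x :- y) :* (x :- (:- y)) :- :0 := :1 :* (x :* x :- y :* y)) refl x y))))

      f-roots : ∀ {x y} → f x ≡ f y → x ≡ y ⊎ x ≡ - y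
      f-roots h = square-roots (*-cancelˡ-≡ a≢0 h)

      g-roots : ∀ {x y} → g x ≡ g y → x ≡ y ⊎ x ≡ - y
      g-roots {x} {y} h = square-roots (*-cancelˡ-≡ b≢0 (combine₁ (- 1#) h
        (solve 4 (λ b c x y → b :* x :- b :* y := (:- :1) :* ((:- (c :+ b :* x)) :- (:- (c :+ b :* y)))) refl b c (x * x) (y * y))))

      δ : Carrier → Carrier → ℚ
      δ x y = 𝟙 (does (x ≟ y)) *ℚ 1ℚ

      Σ-δ₁ : ∀ x → Σ elements (δ x) ≡ 1ℚ
      Σ-δ₁ x = Σ-δ elements-listing _≟_ x (λ _ → 1ℚ)

      0≤δ : ∀ x y → 0ℚ ≤ℚ δ x y
      0≤δ x y = 0≤* (0≤𝟙 (does (x ≟ y))) 0≤1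

      δ-hit : ∀ {x y} → x ≡ y → 1ℚ ≤ℚ δ x y
      δ-hit {x} {y} e = ℚₚ.≤-reflexive (sym (cong (λ b → 𝟙 b *ℚ 1ℚ) (dec-true (x ≟ y) e)))

      two-roots : (h : Carrier → Carrier) → (∀ {x y} → h x ≡ h y → x ≡ y ⊎ x ≡ - y) → ∀ x₀ → fibre h (h x₀) ≤ℚ ℕ→ℚ 2
      two-roots h roots x₀ = ℚₚ.≤-trans (Σ-mono elements bound) (ℚₚ.≤-reflexive
        (trans (Σ-+ elements (δ x₀) (δ (- x₀))) (cong₂ _+ℚ_ (Σ-δ₁ x₀) (Σ-δ₁ (- x₀)))))
        where
        bound : ∀ x → 𝟙 (does (h x ≟ h x₀)) ≤ℚ δ x₀ x +ℚ δ (- x₀) x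
        bound x = 𝟙-does≤ (h x ≟ h x₀) (0≤+ (0≤δ x₀ x) (0≤δ (- x₀) x)) (hit ∘ roots)
          where
          hit : x ≡ x₀ ⊎ x ≡ - x₀ → 1ℚ ≤ℚ δ x₀ x +ℚ δ (- x₀) x
          hit (inj₁ e) = ℚₚ.≤-trans (δ-hit (sym e)) (≤-by (0≤δ (- x₀) x) refl)
          hit (inj₂ e) = ℚₚ.≤-trans (δ-hit (sym e)) (≤-by (0≤δ x₀ x) (ℚₚ.+-comm (δ x₀ x) (δ (- x₀) x)))

      one-root : fibre f 0# ≤ℚ 1ℚ
      one-root = ℚₚ.≤-trans (Σ-mono elements bound) (ℚₚ.≤-reflexive (Σ-δ₁ 0#))
        where
        bound : ∀ x → 𝟙 (does (f x ≟ 0#)) ≤ℚ δ 0# x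
        bound x = 𝟙-does≤ (f x ≟ 0#) (0≤δ 0# x) (δ-hit ∘ root (x ≟ 0#))
          where
          root : Dec (x ≡ 0#) → f x ≡ 0# → 0# ≡ x
          root (yes x≡0) e = sym x≡0
          root (no x≢0)  e = ⊥-elim (*-≢0 a≢0 (*-≢0 x≢0 x≢0) e)

      f≢g⇒⊥ : (∀ x y → f x ≢ g y) → ⊥
      f≢g⇒⊥ disjoint = ℚₚ.<-irrefl refl (ℚₚ.<-≤-trans (Rational.+-posʳ (Q₂ +ℚ Q₂) (ℚₚ.positive⁻¹ 1ℚ)) (ℚₚ.≤-trans
          (ℚₚ.+-monoˡ-≤ 1ℚ (ℚₚ.≤-trans (ℚₚ.≤-reflexive (sym (trans (Σ-+ elements (fibre f) (fibre g)) (cong₂ _+ℚ_ (Σ-fibre f) (Σ-fibre g)))))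
            (Σ-mono elements bound)))
          (ℚₚ.≤-reflexive total)))
        where
        Q₂ = ℕ→ℚ (List.length elements)
        total : Σ elements (λ w → ℕ→ℚ 2 -ℚ δ 0# w) +ℚ 1ℚ ≡ Q₂ +ℚ Q₂
        total = trans (cong (_+ℚ 1ℚ) (trans (Σ-- elements (λ _ → ℕ→ℚ 2) (δ 0#)) (cong₂ _-ℚ_ (Σ-const elements (ℕ→ℚ 2)) (Σ-δ₁ 0#))))
          (ℚSolver.+-*-Solver.solve 1 (λ n → n ℚ:* ℚcon (ℕ→ℚ 2) ℚ:- ℚcon 1ℚ ℚ:+ ℚcon 1ℚ ℚ:= n ℚ:+ n) refl Q₂)
          where open ℚSolver.+-*-Solver using () renaming (_:*_ to _ℚ:*_; _:+_ to _ℚ:+_; _:-_ to _ℚ:-_; _:=_ to _ℚ:=_; con to ℚcon)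
        no-g : ∀ {w} → (∃[ x ] f x ≡ w) → fibre g w ≡ 0ℚ
        no-g (x , refl) = fibre-empty g (f x) (λ y e → disjoint x y (sym e))
        f0 : f 0# ≡ 0#
        f0 = solve 1 (λ a → a :* (:0 :* :0) := :0) refl a
        at-zero : fibre f 0# +ℚ fibre g 0# ≤ℚ ℕ→ℚ 2 -ℚ δ 0# 0#
        at-zero = ℚₚ.≤-trans (ℚₚ.≤-reflexive (trans (cong (fibre f 0# +ℚ_) (no-g (0# , f0))) (ℚₚ.+-identityʳ (fibre f 0#))))
          (ℚₚ.≤-trans one-root (ℚₚ.≤-reflexive (cong (λ b → ℕ→ℚ 2 -ℚ 𝟙 b *ℚ 1ℚ) (sym (dec-true (0# ≟ 0#) refl)))))
        at-most-two : ∀ w → Dec (Any.Any (λ x → f x ≡ w) elements) → Dec (Any.Any (λ y → g y ≡ w) elements) →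
                      fibre f w +ℚ fibre g w ≤ℚ ℕ→ℚ 2
        at-most-two w (yes p) _ with x , refl ← Any.satisfied p =
          ℚₚ.≤-trans (ℚₚ.≤-reflexive (trans (cong (fibre f (f x) +ℚ_) (no-g (x , refl))) (ℚₚ.+-identityʳ (fibre f (f x))))) (two-roots f f-roots x)
        at-most-two w (no ¬p) (yes r) with y , refl ← Any.satisfied r =
          ℚₚ.≤-trans (ℚₚ.≤-reflexive (trans (cong (_+ℚ fibre g (g y)) (fibre-empty f (g y) (λ x e → ¬p (Membership.lose (elements-listing .complete x) e))))
            (ℚₚ.+-identityˡ (fibre g (g y))))) (two-roots g g-roots y)
        at-most-two w (no ¬p) (no ¬r) = ℚₚ.≤-trans (ℚₚ.≤-reflexive (cong₂ _+ℚ_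
          (fibre-empty f w (λ x e → ¬p (Membership.lose (elements-listing .complete x) e)))
          (fibre-empty g w (λ y e → ¬r (Membership.lose (elements-listing .complete y) e))))) (Rational.ℕ→ℚ-nonNeg 2)
        bound : ∀ w → fibre f w +ℚ fibre g w ≤ℚ ℕ→ℚ 2 -ℚ δ 0# w
        bound w = go (0# ≟ w)
          where
          go : Dec (0# ≡ w) → fibre f w +ℚ fibre g w ≤ℚ ℕ→ℚ 2 -ℚ δ 0# w
          go (yes refl) = at-zero
          go (no 0≢w)   = ℚₚ.≤-trans (at-most-two w (Any.any? (λ x → f x ≟ w) elements) (Any.any? (λ y → g y ≟ w) elements))
            (ℚₚ.≤-reflexive (cong (λ b → ℕ→ℚ 2 -ℚ 𝟙 b *ℚ 1ℚ) (sym (dec-false (0# ≟ w) 0≢w))))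

      solution : ∃[ x ] ∃[ y ] a * (x * x) + b * (y * y) + c ≡ 0#
      solution with Any.any? (λ x → Any.any? (λ y → f x ≟ g y) elements) elements
      ... | no none = ⊥-elim (f≢g⇒⊥ λ x y e → none (Membership.lose (elements-listing .complete x) (Membership.lose (elements-listing .complete y) e)))
      ... | yes p with x , p′ ← Any.satisfied p with y , e ← Any.satisfied p′ = x , y , combine₁ 1# e
        (solve 3 (λ u v c → u :+ v :+ c :- :0 := :1 :* (u :- (:- (c :+ v)))) refl (f x) (b * (y * y)) c)

    infix 4 _≟ᵛ_
    _≟ᵛ_ : ∀ {n} (u v : Space n) → Dec (u ≡ v)
    _≟ᵛ_ = Vecₚ.≡-dec _≟_

    ⊕-comm : ∀ {n} (u v : Space n) → u ⊕ v ≡ v ⊕ u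
    ⊕-comm = Vecₚ.zipWith-comm +-comm

    module Form (Q : QuadraticForm) where

      open QuadraticForm Q

      B : Point → Point → Carrier
      B (x ∷ y ∷ z ∷ []) (x′ ∷ y′ ∷ z′ ∷ []) =
          2# * xx * (x * x′) + 2# * yy * (y * y′) + 2# * zz * (z * z′)
        + xy * (x * y′ + y * x′) + xz * (x * z′ + z * x′) + yz * (y * z′ + z * y′)

      polar≡B : ∀ u v → polar Q u v ≡ B u v
      polar≡B (x ∷ y ∷ z ∷ []) (x′ ∷ y′ ∷ z′ ∷ []) = solve 12 (λ A B C D E G x y z x′ y′ z′ →
        let q = λ x y z → A :* (x :* x) :+ B :* (y :* y) :+ C :* (z :* z) :+ D :* (x :* y) :+ E :* (x :* z) :+ G :* (y :* z) in
        q (x :+ x′) (y :+ y′) (z :+ z′) :- q x y z :- q x′ y′ z′ :=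
          :2 :* A :* (x :* x′) :+ :2 :* B :* (y :* y′) :+ :2 :* C :* (z :* z′)
          :+ D :* (x :* y′ :+ y :* x′) :+ E :* (x :* z′ :+ z :* x′) :+ G :* (y :* z′ :+ z :* y′))
        refl xx yy zz xy xz yz x y z x′ y′ z′

      eval-⊕ : ∀ u v → eval Q (u ⊕ v) ≡ eval Q u + eval Q v + B u v
      eval-⊕ u v = trans (solve 3 (λ s a b → s := a :+ b :+ (s :- a :- b)) refl (eval Q (u ⊕ v)) (eval Q u) (eval Q v))
        (cong (eval Q u + eval Q v +_) (polar≡B u v))

      eval-• : ∀ a u → eval Q (a • u) ≡ a * a * eval Q u
      eval-• a (x ∷ y ∷ z ∷ []) = solve 10 (λ A B C D E G a x y z →
        let q = λ x y z → A :* (x :* x) :+ B :* (y :* y) :+ C :* (z :* z) :+ D :* (x :* y) :+ E :* (x :* z) :+ G :* (y :* z) in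
        q (a :* x) (a :* y) (a :* z) := a :* a :* q x y z) refl xx yy zz xy xz yz a x y z

      B-sym : ∀ u v → B u v ≡ B v u
      B-sym u v = trans (sym (polar≡B u v)) (trans
        (trans (cong (λ w → eval Q w - eval Q u - eval Q v) (⊕-comm u v))
          (solve 3 (λ s a b → s :- a :- b := s :- b :- a) refl (eval Q (v ⊕ u)) (eval Q u) (eval Q v))) (polar≡B v u))

      B-diagonal : ∀ u → B u u ≡ 2# * eval Q u
      B-diagonal (x ∷ y ∷ z ∷ []) = solve 9 (λ A B C D E G x y z →
        :2 :* A :* (x :* x) :+ :2 :* B :* (y :* y) :+ :2 :* C :* (z :* z)
          :+ D :* (x :* y :+ y :* x) :+ E :* (x :* z :+ z :* x) :+ G :* (y :* z :+ z :* y) :=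
        :2 :* (A :* (x :* x) :+ B :* (y :* y) :+ C :* (z :* z) :+ D :* (x :* y) :+ E :* (x :* z) :+ G :* (y :* z)))
        refl xx yy zz xy xz yz x y z

      -- B u is the linear form with coefficients B u eᵢ, so linearity only involves nine variables.

      gradient : Point → Carrier × Carrier × Carrier
      gradient (x ∷ y ∷ z ∷ []) = 2# * xx * x + xy * y + xz * z , xy * x + 2# * yy * y + yz * z , xz * x + yz * y + 2# * zz * z

      pairing : Carrier × Carrier × Carrier → Point → Carrier
      pairing (α , β , γ) (x ∷ y ∷ z ∷ []) = α * x + β * y + γ * z

      B≡pairing : ∀ u v → B u v ≡ pairing (gradient u) v
      B≡pairing (x ∷ y ∷ z ∷ []) (x′ ∷ y′ ∷ z′ ∷ []) = solve 12 (λ A B C D E G x y z x′ y′ z′ →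
          :2 :* A :* (x :* x′) :+ :2 :* B :* (y :* y′) :+ :2 :* C :* (z :* z′)
          :+ D :* (x :* y′ :+ y :* x′) :+ E :* (x :* z′ :+ z :* x′) :+ G :* (y :* z′ :+ z :* y′) :=
          (:2 :* A :* x :+ D :* y :+ E :* z) :* x′ :+ (D :* x :+ :2 :* B :* y :+ G :* z) :* y′ :+ (E :* x :+ G :* y :+ :2 :* C :* z) :* z′)
        refl xx yy zz xy xz yz x y z x′ y′ z′

      B-⊕ʳ : ∀ w u v → B w (u ⊕ v) ≡ B w u + B w v
      B-⊕ʳ w u v = trans (B≡pairing w (u ⊕ v)) (trans (go (gradient w) u v) (sym (cong₂ _+_ (B≡pairing w u) (B≡pairing w v))))
        where
        go : ∀ l u v → pairing l (u ⊕ v) ≡ pairing l u + pairing l v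
        go (α , β , γ) (x ∷ y ∷ z ∷ []) (x′ ∷ y′ ∷ z′ ∷ []) = solve 9 (λ α β γ x y z x′ y′ z′ →
          α :* (x :+ x′) :+ β :* (y :+ y′) :+ γ :* (z :+ z′) := α :* x :+ β :* y :+ γ :* z :+ (α :* x′ :+ β :* y′ :+ γ :* z′))
          refl α β γ x y z x′ y′ z′

      B-•ʳ : ∀ w a u → B w (a • u) ≡ a * B w u
      B-•ʳ w a u = trans (B≡pairing w (a • u)) (trans (go (gradient w) u) (cong (a *_) (sym (B≡pairing w u))))
        where
        go : ∀ l u → pairing l (a • u) ≡ a * pairing l u
        go (α , β , γ) (x ∷ y ∷ z ∷ []) = solve 7 (λ a α β γ x y z →
          α :* (a :* x) :+ β :* (a :* y) :+ γ :* (a :* z) := a :* (α :* x :+ β :* y :+ γ :* z)) refl a α β γ x y z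

      combination : Carrier → Carrier → Carrier → Point → Point → Point → Point
      combination α β γ u v w = (α • u ⊕ β • v) ⊕ γ • w

      B-combination : ∀ p α β γ u v w → B p (combination α β γ u v w) ≡ α * B p u + β * B p v + γ * B p w
      B-combination p α β γ u v w = trans (B-⊕ʳ p (α • u ⊕ β • v) (γ • w)) (cong₂ _+_
        (trans (B-⊕ʳ p (α • u) (β • v)) (cong₂ _+_ (B-•ʳ p α u) (B-•ʳ p β v))) (B-•ʳ p γ w))

      eval-combination : ∀ α β γ u v w → eval Q (combination α β γ u v w) ≡
        α * α * eval Q u + β * β * eval Q v + γ * γ * eval Q w + α * β * B u v + α * γ * B u w + β * γ * B v w
      eval-combination α β γ u v w = trans (eval-⊕ (α • u ⊕ β • v) (γ • w)) (trans
        (cong₂ (λ s t → s + eval Q (γ • w) + t) (eval-⊕ (α • u) (β • v))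
          (trans (B-sym (α • u ⊕ β • v) (γ • w)) (B-⊕ʳ (γ • w) (α • u) (β • v))))
        (trans (cong₂ (λ s t → s + t + (B (γ • w) (α • u) + B (γ • w) (β • v)))
            (cong₂ (λ s t → s + t + B (α • u) (β • v)) (eval-• α u) (eval-• β v)) (eval-• γ w))
          (trans (cong₂ (λ s t → α * α * eval Q u + β * β * eval Q v + s + γ * γ * eval Q w + t) (B-•• α u β v)
              (cong₂ _+_ (B-•• γ w α u) (B-•• γ w β v)))
            (trans (cong₂ (λ s t → α * α * eval Q u + β * β * eval Q v + α * β * B u v + γ * γ * eval Q w + (γ * α * s + γ * β * t)) (B-sym w u) (B-sym w v))
            (solve 9 (λ α β γ a b c d e f → α :* α :* a :+ β :* β :* b :+ α :* β :* d :+ γ :* γ :* c :+ (γ :* α :* e :+ γ :* β :* f)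
              := α :* α :* a :+ β :* β :* b :+ γ :* γ :* c :+ α :* β :* d :+ α :* γ :* e :+ β :* γ :* f)
              refl α β γ (eval Q u) (eval Q v) (eval Q w) (B u v) (B u w) (B v w))))))
        where
        B-•• : ∀ a u b v → B (a • u) (b • v) ≡ a * b * B u v
        B-•• a u b v = trans (B-•ʳ (a • u) b v) (trans (cong (b *_) (trans (B-sym (a • u) v) (trans (B-•ʳ v a u) (cong (a *_) (B-sym v u)))))
          (solve 3 (λ a b c → b :* (a :* c) := a :* b :* c) refl a b (B u v)))

      -- Orthogonalisation without division yields e₁, e₂, e₃. Either e₁ or e₂ is isotropic, or the
      -- form on x e₁ + y e₂ + e₃ is diagonal with nonzero leading coefficients, to which
      -- `Conic.solution` applies.
      isotropic : ∃[ v ] v ≢ 0ᵛ × eval Q v ≡ 0#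
      isotropic = go (eval Q e₁ ≟ 0#) (eval Q e₂ ≟ 0#)
        where
        e₁ e₂ g e₃ : Point
        e₁ = 1# ∷ 0# ∷ 0# ∷ []
        g = 0# ∷ 0# ∷ 1# ∷ []
        D₁ = B e₁ e₁
        e₂ = - xy ∷ D₁ ∷ 0# ∷ []
        D₂ = B e₂ e₂
        -- The Gram-Schmidt vector of g, multiplied by D₁ D₂ to clear denominators.
        e₃ = combination (D₁ * D₂) (- (B g e₁ * D₂)) (- (B g e₂ * D₁)) g e₁ e₂
        third : Point → Carrier
        third v = Vec.lookup v (suc (suc zero))
        e₁⊥e₂ : B e₁ e₂ ≡ 0#
        e₁⊥e₂ = solve 6 (λ A B C D E G →
          let D₁ = :2 :* A :* (:1 :* :1) :+ :2 :* B :* (:0 :* :0) :+ :2 :* C :* (:0 :* :0)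
                   :+ D :* (:1 :* :0 :+ :0 :* :1) :+ E :* (:1 :* :0 :+ :0 :* :1) :+ G :* (:0 :* :0 :+ :0 :* :0) in
          :2 :* A :* (:1 :* (:- D)) :+ :2 :* B :* (:0 :* D₁) :+ :2 :* C :* (:0 :* :0)
          :+ D :* (:1 :* D₁ :+ :0 :* (:- D)) :+ E :* (:1 :* :0 :+ :0 :* (:- D)) :+ G :* (:0 :* :0 :+ :0 :* D₁) := :0) refl xx yy zz xy xz yz
        e₁⊥e₃ : B e₁ e₃ ≡ 0#
        e₁⊥e₃ = trans (B-combination e₁ (D₁ * D₂) (- (B g e₁ * D₂)) (- (B g e₂ * D₁)) g e₁ e₂) (trans
          (cong₂ (λ s t → D₁ * D₂ * s + - (B g e₁ * D₂) * D₁ + - (B g e₂ * D₁) * t) (B-sym e₁ g) e₁⊥e₂)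
          (solve 4 (λ d₁ d₂ b c → d₁ :* d₂ :* b :+ (:- (b :* d₂)) :* d₁ :+ (:- (c :* d₁)) :* :0 := :0) refl D₁ D₂ (B g e₁) (B g e₂)))
        e₂⊥e₃ : B e₂ e₃ ≡ 0#
        e₂⊥e₃ = trans (B-combination e₂ (D₁ * D₂) (- (B g e₁ * D₂)) (- (B g e₂ * D₁)) g e₁ e₂) (trans
          (cong₂ (λ s t → D₁ * D₂ * s + - (B g e₁ * D₂) * t + - (B g e₂ * D₁) * D₂) (B-sym e₂ g) (trans (B-sym e₂ e₁) e₁⊥e₂))
          (solve 4 (λ d₁ d₂ b c → d₁ :* d₂ :* c :+ (:- (b :* d₂)) :* :0 :+ (:- (c :* d₁)) :* d₂ := :0) refl D₁ D₂ (B g e₁) (B g e₂)))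
        diagonal≢0 : ∀ {v} → eval Q v ≢ 0# → B v v ≢ 0#
        diagonal≢0 {v} h e = *-≢0 2≢0 h (trans (sym (B-diagonal v)) e)
        go : Dec (eval Q e₁ ≡ 0#) → Dec (eval Q e₂ ≡ 0#) → ∃[ v ] v ≢ 0ᵛ × eval Q v ≡ 0#
        go (yes e) _ = e₁ , (λ h → 0≢1 (sym (cong Vec.head h))) , e
        go (no n) (yes e) = e₂ , (λ h → diagonal≢0 n (cong (λ v → Vec.lookup v (suc zero)) h)) , e
        go (no n₁) (no n₂) with x , y , e ← Conic.solution (eval Q e₁) (eval Q e₂) (eval Q e₃) n₁ n₂ =
          combination x y 1# e₁ e₂ e₃ , nonzero , trans (eval-combination x y 1# e₁ e₂ e₃) (trans
            (cong₂ (λ s t → x * x * eval Q e₁ + y * y * eval Q e₂ + 1# * 1# * eval Q e₃ + x * y * s + x * 1# * t + y * 1# * B e₂ e₃) e₁⊥e₂ e₁⊥e₃)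
            (trans (cong (λ s → x * x * eval Q e₁ + y * y * eval Q e₂ + 1# * 1# * eval Q e₃ + x * y * 0# + x * 1# * 0# + y * 1# * s) e₂⊥e₃)
            (trans (solve 5 (λ x y a b c → x :* x :* a :+ y :* y :* b :+ :1 :* :1 :* c :+ x :* y :* :0 :+ x :* :1 :* :0 :+ y :* :1 :* :0
              := a :* (x :* x) :+ b :* (y :* y) :+ c) refl x y (eval Q e₁) (eval Q e₂) (eval Q e₃)) e)))
          where
          -- Both e₁ and e₂ have third coordinate 0, so the combination has third coordinate D₁ D₂.
          nonzero : combination x y 1# e₁ e₂ e₃ ≢ 0ᵛ
          nonzero h = *-≢0 (diagonal≢0 n₁) (diagonal≢0 n₂) (trans
            (solve 6 (λ x y d₁ d₂ b c → d₁ :* d₂ := x :* :0 :+ y :* :0 :+ :1 :* (d₁ :* d₂ :* :1 :+ (:- (b :* d₂)) :* :0 :+ (:- (c :* d₁)) :* :0))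
              refl x y D₁ D₂ (B g e₁) (B g e₂))
            (cong third h))

open FormTheory

-- Similarity of every nondegenerate ternary form to Q₀, and transport of the system.

module NormalForm where

  open Listing

  module NormalForms {q : ℕ} (F : FiniteField q) (2≢0 : FieldAlgebra.2# F ≢ FiniteField.0# F) (1<q : 1 ℕ.< q) where

    open FiniteField F
    open FieldAlgebra F
    open Geometry F
    open Forms F 2≢0

    private
      listing : ∀ n → Listing (vectors n)
      listing = vectors-listing F

    -- Exhaustive search in a finite space turns a refutation of nonexistence into a witness.
    search : ∀ {n} (P : Space n → Set) → (∀ v → Dec (P v)) → ¬ (∀ v → ¬ P v) → ∃[ v ] P v
    search {n} P P? h with Any.any? P? (vectors n)
    ... | yes p   = Any.satisfied p
    ... | no none = ⊥-elim (h λ v p → none (Membership.lose (listing n .complete v) p))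

    stable : ∀ {x} → ¬ x ≢ 0# → x ≡ 0#
    stable {x} h with x ≟ 0#
    ... | yes e = e
    ... | no n  = ⊥-elim (h n)

    module Normal (Q : QuadraticForm) (nondegenerate : Nondegenerate Q) where

      open Form Q

      v : Point
      v = proj₁ isotropic

      Qv : eval Q v ≡ 0#
      Qv = proj₂ (proj₂ isotropic)

      Bvv : B v v ≡ 0#
      Bvv = trans (B-diagonal v) (trans (cong (2# *_) Qv) (zeroʳ 2#))

      radical : ∀ {u} → (∀ p → B u p ≡ 0#) → u ≡ 0ᵛ
      radical {u} h = nondegenerate u (λ p → trans (polar≡B u p) (h p))

      partner : ∃[ w ] B v w ≢ 0#
      partner = search (λ w → B v w ≢ 0#) (λ w → ¬? (B v w ≟ 0#))
        (λ none → proj₁ (proj₂ isotropic) (radical (λ p → stable (none p))))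

      -- The vector `w₁` is scaled so that B v w₁ = 1. Then Q(w₁ + a v) = Q(w₁) + a, and a = - Q(w₁)
      -- makes `w` isotropic, so that v and w form a hyperbolic pair.
      w₁ w : Point
      w₁ = B v (proj₁ partner) ⁻¹ • proj₁ partner
      w = w₁ ⊕ (- eval Q w₁) • v

      Bvw₁ : B v w₁ ≡ 1#
      Bvw₁ = trans (B-•ʳ v _ (proj₁ partner)) (trans (*-comm _ _) (*-inverseʳ _ (proj₂ partner)))

      Bvw : B v w ≡ 1#
      Bvw = trans (B-⊕ʳ v w₁ _) (trans (cong₂ _+_ Bvw₁ (trans (B-•ʳ v (- eval Q w₁) v) (trans (cong (- eval Q w₁ *_) Bvv) (zeroʳ _)))) (+-identityʳ 1#))

      Qw : eval Q w ≡ 0#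
      Qw = trans (eval-⊕ w₁ _) (trans
        (cong₂ (λ s t → eval Q w₁ + s + t) (trans (eval-• (- eval Q w₁) v) (cong (- eval Q w₁ * - eval Q w₁ *_) Qv))
          (trans (B-•ʳ w₁ (- eval Q w₁) v) (cong (- eval Q w₁ *_) (trans (B-sym w₁ v) Bvw₁))))
        (solve 1 (λ a → a :+ (:- a) :* (:- a) :* :0 :+ (:- a) :* :1 := :0) refl (eval Q w₁)))

      Bww : B w w ≡ 0#
      Bww = trans (B-diagonal w) (trans (cong (2# *_) Qw) (zeroʳ 2#))

      -- Projection onto the orthogonal complement of the plane of v and w. The coefficients appear
      -- crossed because v and w are isotropic with B v w = 1.
      project : Point → Point
      project g = combination 1# (- B g w) (- B g v) g v w

      B-project : ∀ p g → B p (project g) ≡ 1# * B p g + - B g w * B p v + - B g v * B p w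
      B-project p g = B-combination p 1# (- B g w) (- B g v) g v w

      v⊥project : ∀ g → B v (project g) ≡ 0#
      v⊥project g = trans (B-project v g) (trans
        (cong (λ s → 1# * B v g + - B g w * s + - B g v * B v w) Bvv) (trans
        (cong₂ (λ s t → 1# * B v g + - B g w * 0# + - s * t) (B-sym g v) Bvw)
        (solve 2 (λ a b → :1 :* a :+ (:- b) :* :0 :+ (:- a) :* :1 := :0) refl (B v g) (B g w))))

      w⊥project : ∀ g → B w (project g) ≡ 0#
      w⊥project g = trans (B-project w g) (trans
        (cong (λ s → 1# * B w g + - B g w * s + - B g v * B w w) (trans (B-sym w v) Bvw)) (trans
        (cong₂ (λ s t → 1# * B w g + - s * 1# + - B g v * t) (B-sym g w) Bww)
        (solve 2 (λ a b → :1 :* a :+ (:- a) :* :1 :+ (:- b) :* :0 := :0) refl (B w g) (B g v))))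

      B-additiveˡ : ∀ g h p → B (g ⊕ h) p ≡ B g p + B h p
      B-additiveˡ g h p = trans (B-sym (g ⊕ h) p) (trans (B-⊕ʳ p g h) (cong₂ _+_ (B-sym p g) (B-sym p h)))

      project-⊕ : ∀ g h → project g ⊕ project h ≡ project (g ⊕ h)
      project-⊕ g h = trans (go g h v w) (cong₂ (λ s t → combination 1# (- s) (- t) (g ⊕ h) v w) (sym (B-additiveˡ g h w)) (sym (B-additiveˡ g h v)))
        where
        a = B g w
        a′ = B h w
        b = B g v
        b′ = B h v
        coordinate : ∀ x x′ y z → 1# * x + - a * y + - b * z + (1# * x′ + - a′ * y + - b′ * z) ≡ 1# * (x + x′) + - (a + a′) * y + - (b + b′) * z
        coordinate x x′ y z = solve 8 (λ a a′ b b′ x x′ y z → :1 :* x :+ (:- a) :* y :+ (:- b) :* z :+ (:1 :* x′ :+ (:- a′) :* y :+ (:- b′) :* z)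
          := :1 :* (x :+ x′) :+ (:- (a :+ a′)) :* y :+ (:- (b :+ b′)) :* z) refl a a′ b b′ x x′ y z
        go : ∀ g h v w → combination 1# (- a) (- b) g v w ⊕ combination 1# (- a′) (- b′) h v w ≡ combination 1# (- (a + a′)) (- (b + b′)) (g ⊕ h) v w
        go (x₁ ∷ x₂ ∷ x₃ ∷ []) (y₁ ∷ y₂ ∷ y₃ ∷ []) (v₁ ∷ v₂ ∷ v₃ ∷ []) (w₁ ∷ w₂ ∷ w₃ ∷ []) =
          cong₂ _∷_ (coordinate x₁ y₁ v₁ w₁) (cong₂ _∷_ (coordinate x₂ y₂ v₂ w₂) (cong (_∷ []) (coordinate x₃ y₃ v₃ w₃)))

      -- If Q vanished on the orthogonal complement of v and w, this complement would lie in the radical, so a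
      -- vector g would be determined by B g v and B g w, contradicting q³ > q².

      anisotropic : ∃[ g ] eval Q (project g) ≢ 0#
      anisotropic = search (λ g → eval Q (project g) ≢ 0#) (λ g → ¬? (eval Q (project g) ≟ 0#)) impossible
        where
        module _ (none : ∀ g → ¬ eval Q (project g) ≢ 0#) where
          flat : ∀ g → eval Q (project g) ≡ 0#
          flat g = stable (none g)
          orthogonal : ∀ g h → B (project g) (project h) ≡ 0#
          orthogonal g h = combine₁ 1# (trans (sym (eval-⊕ (project g) (project h))) (trans (cong (eval Q) (project-⊕ g h)) (flat (g ⊕ h))))
            (trans (solve 1 (λ b → b :- :0 := :1 :* ((:0 :+ :0 :+ b) :- :0)) refl (B (project g) (project h)))
              (cong₂ (λ s t → 1# * ((s + t + B (project g) (project h)) - 0#)) (sym (flat g)) (sym (flat h))))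
          -- Being orthogonal to v and w, `project g` pairs with h as it does with `project h`, that
          -- is, to 0.
          project≡0 : ∀ g → project g ≡ 0ᵛ
          project≡0 g = radical λ h → combine₁ 1# (trans (sym (B-project (project g) h)) (orthogonal g h))
            (trans (solve 3 (λ x s t → x :- :0 := :1 :* ((:1 :* x :+ s :* :0 :+ t :* :0) :- :0)) refl (B (project g) h) (- B h w) (- B h v))
              (cong₂ (λ s t → 1# * ((1# * B (project g) h + - B h w * s + - B h v * t) - 0#))
                (sym (trans (B-sym (project g) v) (v⊥project g))) (sym (trans (B-sym (project g) w) (w⊥project g)))))
          coefficients : Point → Space 2
          coefficients g = B g w ∷ B g v ∷ []
          cancel : ∀ {a b} g h v w → combination 1# (- a) (- b) g v w ≡ 0ᵛ → combination 1# (- a) (- b) h v w ≡ 0ᵛ → g ≡ h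
          cancel {a} {b} (x₁ ∷ x₂ ∷ x₃ ∷ []) (y₁ ∷ y₂ ∷ y₃ ∷ []) (v₁ ∷ v₂ ∷ v₃ ∷ []) (w₁ ∷ w₂ ∷ w₃ ∷ []) e f =
            cong₂ _∷_ (coordinate v₁ w₁ (cong (λ p → Vec.lookup p zero) e) (cong (λ p → Vec.lookup p zero) f))
              (cong₂ _∷_ (coordinate v₂ w₂ (cong (λ p → Vec.lookup p (suc zero)) e) (cong (λ p → Vec.lookup p (suc zero)) f))
              (cong (_∷ []) (coordinate v₃ w₃ (cong (λ p → Vec.lookup p (suc (suc zero))) e) (cong (λ p → Vec.lookup p (suc (suc zero))) f))))
            where
            coordinate : ∀ {x x′} y z → 1# * x + - a * y + - b * z ≡ 0# → 1# * x′ + - a * y + - b * z ≡ 0# → x ≡ x′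
            coordinate {x} {x′} y z h k = combine₂ 1# (- 1#) h k (solve 6 (λ a b x x′ y z → x :- x′ :=
              :1 :* (:1 :* x :+ (:- a) :* y :+ (:- b) :* z :- :0) :+ (:- :1) :* (:1 :* x′ :+ (:- a) :* y :+ (:- b) :* z :- :0)) refl a b x x′ y z)
          coefficients-injective : ∀ {g h} → coefficients g ≡ coefficients h → g ≡ h
          coefficients-injective {g} {h} e = cancel g h v w (project≡0 g)
            (trans (cong₂ (λ s t → combination 1# (- s) (- t) h v w) (cong Vec.head e) (cong (λ p → Vec.lookup p (suc zero)) e)) (project≡0 h))
          impossible : ⊥
          impossible = ℕₚ.<⇒≱ (ℕₚ.^-monoʳ-< q 1<q {2} {3} ℕₚ.≤-refl) (subst₂ ℕ._≤_ (length-vectors F 3) (length-vectors F 2)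
            (Finite.injective⇒length≤ (listing 3) (listing 2) _≟ᵛ_ _≟ᵛ_ coefficients coefficients-injective))

      u : Point
      u = project (proj₁ anisotropic)

      κ : Carrier
      κ = eval Q u

      κ≢0 : κ ≢ 0#
      κ≢0 = proj₂ anisotropic

      -- The factor κ on x makes the hyperbolic part equal to κ x y. It then matches Q(z u) = κ z²,
      -- and the form becomes κ Q₀.
      embed : Point → Point
      embed (x ∷ y ∷ z ∷ []) = combination (κ * x) y z v w u

      module _ (R : Carrier) where

        open TwistedCubic F R using (Q₀)

        eval-embed : ∀ p → eval Q (embed p) ≡ κ * eval Q₀ p
        eval-embed (x ∷ y ∷ z ∷ []) = trans (eval-combination (κ * x) y z v w u) (trans
          (cong₂ (λ s t → (κ * x) * (κ * x) * s + y * y * t + z * z * κ + (κ * x) * y * B v w + (κ * x) * z * B v u + y * z * B w u) Qv Qw) (trans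
          (cong₂ (λ s t → (κ * x) * (κ * x) * 0# + y * y * 0# + z * z * κ + (κ * x) * y * s + (κ * x) * z * t + y * z * B w u) Bvw (v⊥project (proj₁ anisotropic))) (trans
          (cong (λ s → (κ * x) * (κ * x) * 0# + y * y * 0# + z * z * κ + (κ * x) * y * 1# + (κ * x) * z * 0# + y * z * s) (w⊥project (proj₁ anisotropic)))
          (solve 4 (λ k x y z → (k :* x) :* (k :* x) :* :0 :+ y :* y :* :0 :+ z :* z :* k :+ (k :* x) :* y :* :1 :+ (k :* x) :* z :* :0 :+ y :* z :* :0 :=
            k :* (:0 :* (x :* x) :+ :0 :* (y :* y) :+ :1 :* (z :* z) :+ :1 :* (x :* y) :+ :0 :* (x :* z) :+ :0 :* (y :* z))) refl κ x y z))))

      embed-⊖ : ∀ p c → embed p ⊖ embed c ≡ embed (p ⊖ c)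
      embed-⊖ (x ∷ y ∷ z ∷ []) (x′ ∷ y′ ∷ z′ ∷ []) = go v w u
        where
        coordinate : ∀ a b c → (κ * x) * a + y * b + z * c - ((κ * x′) * a + y′ * b + z′ * c) ≡ (κ * (x - x′)) * a + (y - y′) * b + (z - z′) * c
        coordinate = solve 10 (λ k x y z x′ y′ z′ a b c → (k :* x) :* a :+ y :* b :+ z :* c :- ((k :* x′) :* a :+ y′ :* b :+ z′ :* c)
          := (k :* (x :- x′)) :* a :+ (y :- y′) :* b :+ (z :- z′) :* c) refl κ x y z x′ y′ z′
        go : ∀ v w u → combination (κ * x) y z v w u ⊖ combination (κ * x′) y′ z′ v w u ≡ combination (κ * (x - x′)) (y - y′) (z - z′) v w u
        go (v₁ ∷ v₂ ∷ v₃ ∷ []) (w₁ ∷ w₂ ∷ w₃ ∷ []) (u₁ ∷ u₂ ∷ u₃ ∷ []) =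
          cong₂ _∷_ (coordinate v₁ w₁ u₁) (cong₂ _∷_ (coordinate v₂ w₂ u₂) (cong (_∷ []) (coordinate v₃ w₃ u₃)))

      -- Pairing the image with w, v and u recovers κ x, y and 2 κ z.
      embed-injective : ∀ {p p′} → embed p ≡ embed p′ → p ≡ p′
      embed-injective {x ∷ y ∷ z ∷ []} {x′ ∷ y′ ∷ z′ ∷ []} e = cong₂ _∷_
        (*-cancelˡ-≡ κ≢0 (trans (sym (Bw x y z)) (trans (cong (B w) e) (Bw x′ y′ z′)))) (cong₂ _∷_
        (trans (sym (Bv x y z)) (trans (cong (B v) e) (Bv x′ y′ z′))) (cong (_∷ [])
        (*-cancelˡ-≡ (*-≢0 2≢0 κ≢0) (trans (sym (Bu x y z)) (trans (cong (B u) e) (Bu x′ y′ z′))))))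
        where
        u⊥v = trans (B-sym u v) (v⊥project (proj₁ anisotropic))
        u⊥w = trans (B-sym u w) (w⊥project (proj₁ anisotropic))
        Bw : ∀ x y z → B w (embed (x ∷ y ∷ z ∷ [])) ≡ κ * x
        Bw x y z = trans (B-combination w (κ * x) y z v w u) (trans
          (cong₂ (λ s t → (κ * x) * s + y * t + z * B w u) (trans (B-sym w v) Bvw) Bww) (trans
          (cong (λ s → (κ * x) * 1# + y * 0# + z * s) (w⊥project (proj₁ anisotropic)))
          (solve 3 (λ a y z → a :* :1 :+ y :* :0 :+ z :* :0 := a) refl (κ * x) y z)))
        Bv : ∀ x y z → B v (embed (x ∷ y ∷ z ∷ [])) ≡ y
        Bv x y z = trans (B-combination v (κ * x) y z v w u) (trans
          (cong₂ (λ s t → (κ * x) * s + y * t + z * B v u) Bvv Bvw) (trans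
          (cong (λ s → (κ * x) * 0# + y * 1# + z * s) (v⊥project (proj₁ anisotropic)))
          (solve 3 (λ a y z → a :* :0 :+ y :* :1 :+ z :* :0 := y) refl (κ * x) y z)))
        Bu : ∀ x y z → B u (embed (x ∷ y ∷ z ∷ [])) ≡ 2# * κ * z
        Bu x y z = trans (B-combination u (κ * x) y z v w u) (trans
          (cong₂ (λ s t → (κ * x) * s + y * t + z * B u u) u⊥v u⊥w) (trans
          (cong (λ s → (κ * x) * 0# + y * 0# + z * s) (B-diagonal u))
          (solve 4 (λ a y z k → a :* :0 :+ y :* :0 :+ z :* (:2 :* k) := :2 :* k :* z) refl (κ * x) y z κ)))

      embed-surjective : ∀ p → ∃[ p′ ] embed p′ ≡ p
      embed-surjective = Finite.injective⇒surjective (listing 3) (listing 3) _≟ᵛ_ _≟ᵛ_ embed embed-injective ℕₚ.≤-refl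

      pull : Point → Point
      pull p = proj₁ (embed-surjective p)

      embed-pull : ∀ p → embed (pull p) ≡ p
      embed-pull p = proj₂ (embed-surjective p)

      pull-embed : ∀ p → pull (embed p) ≡ p
      pull-embed p = embed-injective (embed-pull (embed p))

      -- Transport along the similitude embed of a system of spheres of radius R for Q₀.

      module Transport (R : Carrier) (R≢0 : R ≢ 0#) (P₀ : Sub Point) (𝒮₀ : Sub Sphere)
                       (radius-R : ∀ T → T ∈ 𝒮₀ → radius T ≡ R) where

        open TwistedCubic F R using (Q₀)

        P : Sub Point
        P p = P₀ (pull p)

        pullˢ pushˢ : Sphere → Sphere
        pullˢ T = pull (centre T) , R
        pushˢ T = embed (centre T) , κ * R

        -- As `pullˢ` overwrites the radius with R, the first condition alone would accept spheres
        -- of every radius; the second selects κ R.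
        𝒮 : Sub Sphere
        𝒮 T = 𝒮₀ (pullˢ T) ∧ does (radius T ≟ (κ * R))

        radius-𝒮 : ∀ T → T ∈ 𝒮 → radius T ≡ κ * R
        radius-𝒮 T h = does-T (radius T ≟ (κ * R)) (T-∧₂ {𝒮₀ (pullˢ T)} h)

        pull-push : ∀ T → T ∈ 𝒮₀ → pullˢ (pushˢ T) ≡ T
        pull-push (c , r) h = cong₂ _,_ (pull-embed c) (sym (radius-R (c , r) h))

        push-pull : ∀ T → T ∈ 𝒮 → pushˢ (pullˢ T) ≡ T
        push-pull (c , r) h = cong₂ _,_ (embed-pull c) (sym (radius-𝒮 (c , r) h))

        push∈ : ∀ T → T ∈ 𝒮₀ → pushˢ T ∈ 𝒮
        push∈ T h = ∧-T (subst (_∈ 𝒮₀) (sym (pull-push T h)) h) (T-does ((κ * R) ≟ (κ * R)) refl)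

        eval-pull : ∀ p c → eval Q (p ⊖ c) ≡ κ * eval Q₀ (pull p ⊖ pull c)
        eval-pull p c = trans (cong (eval Q) (trans (cong₂ _⊖_ (sym (embed-pull p)) (sym (embed-pull c))) (embed-⊖ (pull p) (pull c))))
          (eval-embed R (pull p ⊖ pull c))

        -- The membership proof in a refinement is irrelevant; decidability supplies one that may be
        -- used in computations.
        relevant : ∀ {A : Set} {X : Sub A} → (x : Refinement A (_∈ X)) → value x ∈ X
        relevant {X = X} (x , [ h ]) = recompute (Boolₚ.T? (X x)) h

        isomorphism : system Q P 𝒮 ≅ system Q₀ P₀ 𝒮₀
        isomorphism = record
          { points = mk↔ₛ′ (λ (p , h) → pull p , h)
              (λ (p , [ h ]) → embed p , [ subst (_∈ P₀) (sym (pull-embed p)) h ])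
              (λ (p , _) → value-injective (pull-embed p)) (λ (p , _) → value-injective (embed-pull p))
          ; objects = mk↔ₛ′ (λ (T , [ h ]) → pullˢ T , [ T-∧₁ h ]) (λ (T , [ h ]) → pushˢ T , [ push∈ T h ])
              (λ T → value-injective (pull-push (value T) (relevant T))) (λ T → value-injective (push-pull (value T) (relevant T)))
          ; incident = λ p T → mk⇔
              (λ l → *-cancelˡ-≡ κ≢0 (trans (sym (eval-pull (value p) (centre (value T)))) (trans l (radius-𝒮 (value T) (relevant T)))))
              (λ l → trans (eval-pull (value p) (centre (value T))) (trans (cong (κ *_) l) (sym (radius-𝒮 (value T) (relevant T)))))
          }

        transported : ∃[ P ] ∃[ 𝒮 ] ∃[ r ] r ≢ 0# × (∀ T → T ∈ 𝒮 → radius T ≡ r) × system Q P 𝒮 ≅ system Q₀ P₀ 𝒮₀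
        transported = P , 𝒮 , κ * R , *-≢0 κ≢0 R≢0 , radius-𝒮 , isomorphism

open NormalForm

-- Order, products, reciprocals and square roots of Cauchy reals.

module RealTheory where

  open Q using (_<_)
  open ℚₚ using (<⇒≤; ≤-<-trans; <-≤-trans; <-trans)
  open ℚSolver.+-*-Solver using (solve; _:+_; _:*_; _:-_; :-_; _:=_; con)
  open ℝ using (seq; cauchy; _≃_; _≤_; _+_; _*_; _-_; _⁻¹; _/_; 1ℝ; Positive; eventually; eventually⁻¹; ≤⊔ˡ; ≤⊔ʳ)

  private variable x y z w : ℝ

  Eventually : (ℕ → Set) → Set
  Eventually P = ∃[ N ] ∀ n → N ℕ.≤ n → P n

  both : ∀ {P P′} → Eventually P → Eventually P′ → Eventually (λ n → P n × P′ n)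
  both (M , h) (N , k) = M ℕ.⊔ N , λ n p → h n (≤⊔ˡ M N p) , k n (≤⊔ʳ M N p)

  map-eventually : ∀ {P P′ : ℕ → Set} → (∀ n → P n → P′ n) → Eventually P → Eventually P′
  map-eventually f (N , h) = N , λ n p → f n (h n p)

  module Half {ε : ℚ} (0<ε : 0ℚ < ε) where
    η = ε Q.* ½
    0<η : 0ℚ < η
    0<η = Rational.half-pos 0<ε

  ≤-seq : Eventually (λ n → seq x n Q.≤ seq y n) → x ≤ y
  ≤-seq {x} {y} h ε 0<ε = map-eventually (λ n p → ≤-<-trans p (Rational.+-posʳ (seq y n) 0<ε)) h

  ≃-seq : Eventually (λ n → seq x n ≡ seq y n) → x ≃ y
  ≃-seq {x} {y} h = ≤-seq {x} {y} (map-eventually (λ _ e → ℚₚ.≤-reflexive e) h)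
                  , ≤-seq {y} {x} (map-eventually (λ _ e → ℚₚ.≤-reflexive (sym e)) h)

  ≃-pointwise : (∀ n → seq x n ≡ seq y n) → x ≃ y
  ≃-pointwise {x} {y} h = ≃-seq {x} {y} (0 , λ n _ → h n)

  fromℚ-mono : ∀ {p q} → p Q.≤ q → fromℚ p ≤ fromℚ q
  fromℚ-mono {p} {q} h = ≤-seq {fromℚ p} {fromℚ q} (0 , λ _ _ → h)

  ≤-refl : x ≤ x
  ≤-refl {x} = ≤-seq {x} {x} (0 , λ _ _ → ℚₚ.≤-refl)

  ≤-trans : x ≤ y → y ≤ z → x ≤ z
  ≤-trans {x} {y} {z} h k ε 0<ε = map-eventually (λ n (a , b) → <-≤-trans a (ℚₚ.≤-trans (ℚₚ.+-monoˡ-≤ η (<⇒≤ b))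
      (ℚₚ.≤-reflexive (trans (ℚₚ.+-assoc (seq z n) η η) (cong (λ e → seq z n Q.+ e) (Rational.halves ε))))))
    (both (h η 0<η) (k η 0<η))
    where open Half 0<ε

  ≃-sym : x ≃ y → y ≃ x
  ≃-sym (a , b) = b , a

  ≃-trans : x ≃ y → y ≃ z → x ≃ z
  ≃-trans {x} {y} {z} (a , b) (c , d) = ≤-trans {x} {y} {z} a c , ≤-trans {z} {y} {x} d b

  0<- : ∀ {p q} → p < q → 0ℚ < q Q.- p
  0<- {p} {q} p<q = subst (_< q Q.- p) (ℚₚ.+-inverseʳ p) (ℚₚ.+-monoˡ-< (Q.- p) p<q)

  fromℚ-cancel-≤ : ∀ {p q} → fromℚ p ≤ fromℚ q → p Q.≤ q
  fromℚ-cancel-≤ {p} {q} h = ℚₚ.≮⇒≥ λ q<p → let N , k = h (p Q.- q) (0<- q<p) in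
    ℚₚ.<-irrefl refl (subst (p <_) (Rational.add-back p q) (k N ℕₚ.≤-refl))

  +-mono-≤ : x ≤ y → z ≤ w → x + z ≤ y + w
  +-mono-≤ {x} {y} {z} {w} h k ε 0<ε = map-eventually (λ n (a , b) → <-≤-trans (ℚₚ.+-mono-< a b) (ℚₚ.≤-reflexive (trans
      (solve 3 (λ a b e → a :+ e :+ (b :+ e) := a :+ b :+ (e :+ e)) refl (seq y n) (seq w n) η)
      (cong (λ e → seq y n Q.+ seq w n Q.+ e) (Rational.halves ε)))))
    (both (h η 0<η) (k η 0<η))
    where open Half 0<ε

  bounded : ∀ x → ∃[ B ] 0ℚ < B × Eventually (λ n → seq x n < B)
  bounded x with N , h ← cauchy x 1ℚ (ℚₚ.positive⁻¹ 1ℚ) = Q.∣ seq x N ∣ Q.+ 1ℚ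
    , ≤-<-trans (ℚₚ.0≤∣p∣ (seq x N)) (Rational.+-posʳ Q.∣ seq x N ∣ (ℚₚ.positive⁻¹ 1ℚ))
    , N , λ n p → ≤-<-trans (Rational.p≤∣p∣ (seq x n)) (Rational.bound (seq x n) (seq x N) (h n N p ℕₚ.≤-refl))

  NonNegative : ℝ → Set
  NonNegative x = Eventually (λ n → 0ℚ Q.≤ seq x n)

  positive⇒nonNegative : Positive x → NonNegative x
  positive⇒nonNegative p with δ , 0<δ , h ← eventually p = map-eventually (λ n k → <⇒≤ (<-trans 0<δ k)) h

  -- The factor c < B enlarges the error (ε/2)/B to at most ε/2, and the other half of ε makes the
  -- inequality strict.
  scaled-< : ∀ {a b c B ε} → 0ℚ Q.≤ c → c < B → 0ℚ < B → 0ℚ < ε → a < b Q.+ ε Q.* ½ Q.* recip₀ B → c Q.* a < c Q.* b Q.+ ε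
  scaled-< {a} {b} {c} {B} {ε} 0≤c c<B 0<B 0<ε a<b = ≤-<-trans
      (≤-by (0≤+ (0≤* 0≤c (≤⇒0≤- (<⇒≤ a<b))) (0≤* (≤⇒0≤- (<⇒≤ c<B)) (<⇒≤ 0<η)))
        (solve 5 (λ a b c B h → c :* b :+ B :* h := c :* a :+ (c :* (b :+ h :- a) :+ (B :- c) :* h)) refl a b c B η))
      (ℚₚ.+-monoʳ-< (c Q.* b) (subst (_< ε) (sym Bη≡) ε½<ε))
    where
    η = ε Q.* ½ Q.* recip₀ B
    0<η : 0ℚ < η
    0<η = Rational.*-pos (Rational.half-pos 0<ε) (Rational.recip₀-pos 0<B)
    Bη≡ : B Q.* η ≡ ε Q.* ½
    Bη≡ = trans (solve 3 (λ e b r → b :* (e :* r) := e :* (b :* r)) refl (ε Q.* ½) B (recip₀ B))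
      (trans (cong (ε Q.* ½ Q.*_) (Rational.recip₀-inverse 0<B)) (ℚₚ.*-identityʳ (ε Q.* ½)))
    ε½<ε : ε Q.* ½ < ε
    ε½<ε = subst (ε Q.* ½ <_) (Rational.halves ε) (Rational.+-posʳ (ε Q.* ½) (Rational.half-pos 0<ε))

  *-monoˡ-≤ : NonNegative z → x ≤ y → z * x ≤ z * y
  *-monoˡ-≤ {z} {x} {y} 0≤z h ε 0<ε = go (bounded z)
    where
    go : (∃[ B ] 0ℚ < B × Eventually (λ n → seq z n < B)) → Eventually (λ n → seq z n Q.* seq x n < seq z n Q.* seq y n Q.+ ε)
    go (B , 0<B , bound) = map-eventually
      (λ n (0≤c , c<B , a<b) → scaled-< {seq x n} {seq y n} {seq z n} {B} {ε} 0≤c c<B 0<B 0<ε a<b)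
      (both 0≤z (both bound (h (ε Q.* ½ Q.* recip₀ B) (Rational.*-pos (Rational.half-pos 0<ε) (Rational.recip₀-pos 0<B)))))

  *-comm : ∀ x y → x * y ≃ y * x
  *-comm x y = ≃-pointwise {x * y} {y * x} (λ n → ℚₚ.*-comm (seq x n) (seq y n))

  neg-*-≤ : ∀ {B} → 0ℚ Q.≤ B → y ≤ x → fromℚ (Q.- B) * x ≤ fromℚ (Q.- B) * y
  neg-*-≤ {y} {x} {B} 0≤B h ε 0<ε = map-eventually (λ n → step (seq x n) (seq y n))
    (*-monoˡ-≤ {fromℚ B} {y} {x} (0 , λ _ _ → 0≤B) h ε 0<ε)
    where
    step : ∀ a b → B Q.* b < B Q.* a Q.+ ε → (Q.- B) Q.* a < (Q.- B) Q.* b Q.+ ε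
    step a b k = subst₂ _<_
      (solve 3 (λ B a b → :- (B :* b) :- B :* a :+ B :* b := (:- B) :* a) refl B a b)
      (solve 4 (λ B a b e → :- (B :* b) :- B :* a :+ (B :* a :+ e) := (:- B) :* b :+ e) refl B a b ε)
      (ℚₚ.+-monoʳ-< (Q.- (B Q.* b) Q.- B Q.* a) k)

  shifted-≤ : ∀ {B} → 0ℚ Q.≤ B → NonNegative (z + fromℚ B) → x ≃ y → z * x ≤ z * y
  shifted-≤ {z} {x} {y} {B} 0≤B 0≤z′ (h , k) =
    ≤-trans {z * x} {z′ * x + fromℚ (Q.- B) * x} {z * y} (proj₁ (≃-pointwise {z * x} {z′ * x + fromℚ (Q.- B) * x} (split x)))
      (≤-trans {z′ * x + fromℚ (Q.- B) * x} {z′ * y + fromℚ (Q.- B) * y} {z * y}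
        (+-mono-≤ {z′ * x} {z′ * y} {fromℚ (Q.- B) * x} {fromℚ (Q.- B) * y} (*-monoˡ-≤ {z′} {x} {y} 0≤z′ h) (neg-*-≤ {y} {x} {B} 0≤B k))
        (proj₂ (≃-pointwise {z * y} {z′ * y + fromℚ (Q.- B) * y} (split y))))
    where
    z′ = z + fromℚ B
    split : ∀ x n → seq (z * x) n ≡ seq (z′ * x + fromℚ (Q.- B) * x) n
    split x n = solve 3 (λ z B x → z :* x := (z :+ B) :* x :+ (:- B) :* x) refl (seq z n) B (seq x n)

  -- For z of arbitrary sign: split z as (z + B) - B with B a bound for - z.

  *-congˡ : x ≃ y → z * x ≃ z * y
  *-congˡ {x} {y} {z} (h , k) = one {x} {y} (h , k) , one {y} {x} (k , h)
    where
    one : ∀ {x y} → x ≃ y → z * x ≤ z * y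
    one {x} {y} h = go (bounded (ℝ.- z))
      where
      go : (∃[ B ] 0ℚ < B × Eventually (λ n → seq (ℝ.- z) n < B)) → z * x ≤ z * y
      go (B , 0<B , bound) = shifted-≤ {z} {x} {y} {B} (<⇒≤ 0<B) 0≤z′ h
        where
        0≤z′ : NonNegative (z + fromℚ B)
        0≤z′ = map-eventually (λ n b → ≤-by (≤⇒0≤- (<⇒≤ b)) (solve 2 (λ z B → z :+ B := con 0ℚ :+ (B :- (:- z))) refl (seq z n) B)) bound

  *-congʳ : x ≃ y → x * z ≃ y * z
  *-congʳ {x} {y} {z} h = ≃-trans {x * z} {z * x} {y * z} (*-comm x z)
    (≃-trans {z * x} {z * y} {y * z} (*-congˡ {x} {y} {z} h) (*-comm z y))

  *-cong : x ≃ y → z ≃ w → x * z ≃ y * w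
  *-cong {x} {y} {z} {w} h k = ≃-trans {x * z} {y * z} {y * w} (*-congʳ {x} {y} {z} h) (*-congˡ {z} {w} {y} k)

  *-inverse : ∀ x {{_ : Positive x}} → x * x ⁻¹ ≃ 1ℝ
  *-inverse x {{p}} with δ , 0<δ , h ← eventually p = ≃-seq {x * x ⁻¹} {1ℝ}
    (map-eventually (λ n k → Rational.recip₀-inverse (<-trans 0<δ k)) h)

  /-cancel : ∀ x y {{_ : Positive y}} → x * y / y ≃ x
  /-cancel x y = ≃-trans {x * y / y} {x * (y * y ⁻¹)} {x} (≃-pointwise {x * y / y} {x * (y * y ⁻¹)} (λ n → ℚₚ.*-assoc (seq x n) (seq y n) (seq (y ⁻¹) n)))
    (≃-trans {x * (y * y ⁻¹)} {x * 1ℝ} {x} (*-congˡ {y * y ⁻¹} {1ℝ} {x} (*-inverse y)) (≃-pointwise {x * 1ℝ} {x} (λ n → ℚₚ.*-identityʳ (seq x n))))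

  *-cancelʳ-≃ : ∀ {x y} z {{_ : Positive z}} → x * z ≃ y * z → x ≃ y
  *-cancelʳ-≃ {x} {y} z h = ≃-trans {x} {x * z / z} {y} (≃-sym {x * z / z} {x} (/-cancel x z))
    (≃-trans {x * z / z} {y * z / z} {y} (*-congʳ {x * z} {y * z} {z ⁻¹} h) (/-cancel y z))

  -- The difference of the two reciprocals is (B - a)/(a B).
  recip₀-anti : ∀ {a B} → 0ℚ < a → a Q.≤ B → recip₀ B Q.≤ recip₀ a
  recip₀-anti {a} {B} 0<a a≤B = ≤-by (0≤* (0≤* (≤⇒0≤- a≤B) (<⇒≤ (Rational.recip₀-pos 0<B))) (<⇒≤ (Rational.recip₀-pos 0<a)))
    (trans (sym lhs) (solve 4 (λ a B r s → s :* (B :* r) :+ r :* (con 1ℚ :- a :* s) := r :+ (B :- a) :* r :* s) refl a B r s))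
    where
    0<B = <-≤-trans 0<a a≤B
    r = recip₀ B
    s = recip₀ a
    lhs : s Q.* (B Q.* r) Q.+ r Q.* (1ℚ Q.- a Q.* s) ≡ s
    lhs = trans (cong₂ (λ e f → s Q.* e Q.+ r Q.* (1ℚ Q.- f)) (Rational.recip₀-inverse 0<B) (Rational.recip₀-inverse 0<a))
      (solve 2 (λ s r → s :* con 1ℚ :+ r :* (con 1ℚ :- con 1ℚ) := s) refl s r)

  -- A Cauchy sequence is eventually below some B, which keeps its reciprocals above 1/(2B).
  ⁻¹-positive : ∀ x {{_ : Positive x}} → Positive (x ⁻¹)
  ⁻¹-positive x {{p}} = go (eventually p) (bounded x)
    where
    go : (∃[ δ ] 0ℚ < δ × Eventually (λ n → δ < seq x n)) → (∃[ B ] 0ℚ < B × Eventually (λ n → seq x n < B)) → Positive (x ⁻¹)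
    go (δ , 0<δ , h) (B , 0<B , k) = eventually⁻¹ {x ⁻¹} (recip₀ B Q.* ½ , Rational.half-pos (Rational.recip₀-pos 0<B) ,
      map-eventually (λ n (δ<x , x<B) → <-≤-trans half<r (recip₀-anti (<-trans 0<δ δ<x) (<⇒≤ x<B))) (both h k))
      where
      half<r : recip₀ B Q.* ½ < recip₀ B
      half<r = subst (recip₀ B Q.* ½ <_) (Rational.halves (recip₀ B)) (Rational.+-posʳ (recip₀ B Q.* ½) (Rational.half-pos (Rational.recip₀-pos 0<B)))

  positive-resp-≃ : x ≃ y → Positive x → Positive y
  positive-resp-≃ {x} {y} (x≤y , _) p with δ , 0<δ , h ← eventually p = eventually⁻¹ (δ Q.* ½ , Rational.half-pos 0<δ ,
    map-eventually (λ n (δ<x , x<y) → ℚₚ.≰⇒> λ y≤ → ℚₚ.<-irrefl refl (<-trans δ<x (<-≤-trans x<y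
      (ℚₚ.≤-trans (ℚₚ.+-monoˡ-≤ (δ Q.* ½) y≤) (ℚₚ.≤-reflexive (Rational.halves δ))))))
    (both h (x≤y (δ Q.* ½) (Rational.half-pos 0<δ))))

  -- If x ≥ y + ε with y ≥ 0 then x² ≥ y² + ε².

  square-cancel-≤ : NonNegative y → x * x ≤ y * y → x ≤ y
  square-cancel-≤ {y} {x} 0≤y h ε 0<ε = map-eventually (λ n (0≤yn , k) → ℚₚ.≰⇒> λ far →
      ℚₚ.<-irrefl refl (<-≤-trans k (≤-by (0≤+ (0≤+ (0≤* (≤⇒0≤- far) (≤⇒0≤- far)) (0≤* (0≤* (ℚₚ.nonNegative⁻¹ (ℕ→ℚ 2)) (0≤+ 0≤yn (<⇒≤ 0<ε))) (≤⇒0≤- far)))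
        (0≤* (0≤* (ℚₚ.nonNegative⁻¹ (ℕ→ℚ 2)) 0≤yn) (<⇒≤ 0<ε)))
        (solve 3 (λ x y e → x :* x := y :* y :+ e :* e :+ ((x :- (y :+ e)) :* (x :- (y :+ e)) :+ con (ℕ→ℚ 2) :* (y :+ e) :* (x :- (y :+ e)) :+ con (ℕ→ℚ 2) :* y :* e))
          refl (seq x n) (seq y n) ε))))
    (both 0≤y (h (ε Q.* ε) (Rational.*-pos 0<ε 0<ε)))

  √-nonNegative : ∀ x → NonNegative (√ x)
  √-nonNegative x = 0 , λ n _ → Rational.√↓-nonNeg n (seq x n Q.⊔ 0ℚ)

  -- The excess of (s + u)² over s² is u(2s + u) ≤ u(2s + 1) ≤ u B < ε.
  √-step : ∀ {a s u ε B} → 0ℚ < B → 0ℚ Q.≤ u → u < 1ℚ → ℕ→ℚ 2 Q.* s Q.+ 1ℚ Q.≤ B → u < ε Q.* recip₀ B →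
           a < (s Q.+ u) Q.* (s Q.+ u) → a < s Q.* s Q.+ ε
  √-step {a} {s} {u} {ε} {B} 0<B 0≤u u<1 s≤B u<η a< = <-≤-trans a< (≤-by
      (0≤+ (0≤* 0≤u (≤⇒0≤- (<⇒≤ u<1))) (0≤+ (0≤* 0≤u (≤⇒0≤- s≤B)) (0≤* (<⇒≤ 0<B) (≤⇒0≤- (<⇒≤ u<η)))))
      (trans (cong (s Q.* s Q.+_) (sym Bη≡))
        (solve 4 (λ s h u B → s :* s :+ B :* h := (s :+ u) :* (s :+ u) :+
          (u :* (con 1ℚ :- u) :+ (u :* (B :- (con (ℕ→ℚ 2) :* s :+ con 1ℚ)) :+ B :* (h :- u)))) refl s η u B)))
    where
    η = ε Q.* recip₀ B
    Bη≡ : B Q.* η ≡ ε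
    Bη≡ = trans (solve 3 (λ e b r → b :* (e :* r) := e :* (b :* r)) refl ε B (recip₀ B))
      (trans (cong (ε Q.*_) (Rational.recip₀-inverse 0<B)) (ℚₚ.*-identityʳ ε))

  square≤⇒≤+1 : ∀ {a s} → 0ℚ Q.≤ a → 0ℚ Q.≤ s → s Q.* s Q.≤ a → s Q.≤ a Q.+ 1ℚ
  square≤⇒≤+1 {a} {s} 0≤a 0≤s s²≤a with ℚₚ.≤-total s 1ℚ
  ... | inj₁ s≤1 = ℚₚ.≤-trans s≤1 (≤-by 0≤a (ℚₚ.+-comm a 1ℚ))
  ... | inj₂ 1≤s = ℚₚ.≤-trans (≤-by (0≤+ (0≤* 0≤s (≤⇒0≤- 1≤s)) (≤⇒0≤- s²≤a))
      (solve 2 (λ a s → a := s :+ (s :* (s :- con 1ℚ) :+ (a :- s :* s))) refl a s)) (≤-by 0≤1 refl)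

  -- Only for constant sequences; s ≤ a + 1 follows from s² ≤ a.

  √-square : ∀ {a} → 0ℚ Q.≤ a → (∀ n → seq x n ≡ a) → √ x * √ x ≃ x
  √-square {x} {a} 0≤a const = ≤-seq {√ x * √ x} {x} (0 , λ n _ → subst (seq (√ x * √ x) n Q.≤_) (sym (const n)) (below n)) , above
    where
    s : ℕ → ℚ
    s n = seq (√ x) n
    x⊔0 : ∀ n → seq x n Q.⊔ 0ℚ ≡ a
    x⊔0 n = trans (cong (Q._⊔ 0ℚ) (const n)) (ℚₚ.p≥q⇒p⊔q≡p 0≤a)
    below : ∀ n → s n Q.* s n Q.≤ a
    below n = subst (s n Q.* s n Q.≤_) (x⊔0 n) (Rational.√↓-lower n (seq x n Q.⊔ 0ℚ) (ℚₚ.p≤q⊔p (seq x n) 0ℚ))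
    B = ℕ→ℚ 2 Q.* (a Q.+ 1ℚ) Q.+ 1ℚ
    0<B : 0ℚ < B
    0<B = ≤-<-trans (0≤* (ℚₚ.nonNegative⁻¹ (ℕ→ℚ 2)) (0≤+ 0≤a 0≤1)) (Rational.+-posʳ (ℕ→ℚ 2 Q.* (a Q.+ 1ℚ)) (ℚₚ.positive⁻¹ 1ℚ))
    s≤B : ∀ n → ℕ→ℚ 2 Q.* s n Q.+ 1ℚ Q.≤ B
    s≤B n = ℚₚ.+-monoˡ-≤ 1ℚ (ℚₚ.*-monoˡ-≤-nonNeg (ℕ→ℚ 2)
      (square≤⇒≤+1 0≤a (Rational.√↓-nonNeg n (seq x n Q.⊔ 0ℚ)) (below n)))
    above : x ≤ √ x * √ x
    above ε 0<ε = map-eventually (λ n (u<1 , u<η) → subst (_< s n Q.* s n Q.+ ε) (sym (const n))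
        (√-step {a} {s n} {Rational.unit n} {ε} {B} 0<B (<⇒≤ (Rational.unit-pos n)) u<1 (s≤B n) u<η
          (subst (_< (s n Q.+ Rational.unit n) Q.* (s n Q.+ Rational.unit n)) (x⊔0 n) (Rational.√↓-upper n (seq x n Q.⊔ 0ℚ)))))
      (both (Rational.archimedes 1ℚ (ℚₚ.positive⁻¹ 1ℚ)) (Rational.archimedes (ε Q.* recip₀ B) (Rational.*-pos 0<ε (Rational.recip₀-pos 0<B))))

open RealTheory

-- The density constant K, its bounds, and its distance from √(2/3).

module DensityTheory where

  open ℚSolver.+-*-Solver using (solve; _:+_; _:*_; _:-_; :-_; _:=_; con)
  open ℝ using (seq; _≃_; _≤_; _<_; _+_; _*_; _-_; _⁻¹; _/_; 1ℝ; Positive)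

  -- _≃_ unfolds to an arithmetical statement, from which Agda cannot infer the two numbers.

  infix 4 _≈_

  record _≈_ (x y : ℝ) : Set where
    constructor equal
    field equality : x ≃ y

  open _≈_ public

  ≈-setoid : Setoid _ _
  ≈-setoid = record
    { Carrier = ℝ ; _≈_ = _≈_
    ; isEquivalence = record
      { refl  = λ {x} → equal (≤-refl {x} , ≤-refl {x})
      ; sym   = λ {x} {y} (equal h) → equal (≃-sym {x} {y} h)
      ; trans = λ {x} {y} {z} (equal h) (equal k) → equal (≃-trans {x} {y} {z} h k) } }

  open Setoid ≈-setoid public using () renaming (refl to ≈-refl; sym to ≈-sym; trans to ≈-trans)
  open SetoidReasoning ≈-setoid

  pointwise : ∀ {x y} → (∀ n → seq x n ≡ seq y n) → x ≈ y
  pointwise {x} {y} h = equal (≃-pointwise {x} {y} h)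

  *-cong-≈ : ∀ {x y z w} → x ≈ y → z ≈ w → x * z ≈ y * w
  *-cong-≈ {x} {y} {z} {w} (equal h) (equal k) = equal (*-cong {x} {y} {z} {w} h k)

  /-cancel-≈ : ∀ x y {{_ : Positive y}} → x * y / y ≈ x
  /-cancel-≈ x y = equal (/-cancel x y)

  *-cancelʳ-≈ : ∀ {x y} z {{_ : Positive z}} → x * z ≈ y * z → x ≈ y
  *-cancelʳ-≈ {x} {y} z (equal h) = equal (*-cancelʳ-≃ {x} {y} z h)

  square-unique : ∀ {x y} → NonNegative x → NonNegative y → x * x ≈ y * y → x ≈ y
  square-unique {x} {y} 0≤x 0≤y (equal (h , k)) = equal (square-cancel-≤ {y} {x} 0≤y h , square-cancel-≤ {x} {y} 0≤x k)

  √ℕ-square : ∀ n → √ (fromℕ n) * √ (fromℕ n) ≈ fromℕ n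
  √ℕ-square n = equal (√-square {fromℕ n} (Rational.ℕ→ℚ-nonNeg n) (λ _ → refl))

  *-nonNegative : ∀ {x y} → NonNegative x → NonNegative y → NonNegative (x * y)
  *-nonNegative h k = map-eventually (λ n (a , b) → 0≤* a b) (both h k)

  *-interchange : ∀ x y → (x * x) * (y * y) ≈ (x * y) * (x * y)
  *-interchange x y = pointwise (λ n → solve 2 (λ x y → (x :* x) :* (y :* y) := (x :* y) :* (x :* y)) refl (seq x n) (seq y n))

  fromℕ-* : ∀ m n → fromℕ (m ℕ.* n) ≈ fromℕ m * fromℕ n
  fromℕ-* m n = pointwise (λ _ → Rational.ℕ→ℚ-* m n)

  fromℕ≈fromℚ : ∀ n → fromℕ n ≈ fromℚ (ℕ→ℚ n)
  fromℕ≈fromℚ n = pointwise (λ _ → refl)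

  √-* : ∀ m n → √ (fromℕ (m ℕ.* n)) ≈ √ (fromℕ m) * √ (fromℕ n)
  √-* m n = square-unique {√ (fromℕ (m ℕ.* n))} {√ (fromℕ m) * √ (fromℕ n)} (√-nonNegative (fromℕ (m ℕ.* n)))
    (*-nonNegative {√ (fromℕ m)} {√ (fromℕ n)} (√-nonNegative (fromℕ m)) (√-nonNegative (fromℕ n)))
    (≈-trans (√ℕ-square (m ℕ.* n)) (≈-trans (fromℕ-* m n) (≈-trans (≈-sym (*-cong-≈ (√ℕ-square m) (√ℕ-square n)))
      (*-interchange (√ (fromℕ m)) (√ (fromℕ n))))))

  -- Here `a` and `n` are q and N, `κ` = 4N/q³ is the value of K², and `η` = 3/q bounds its distance
  -- from 2/3. The inequalities are cleared of q³ and expanded in `b` = q - 5 with nonnegative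
  -- coefficients.
  module DensityArithmetic (a n : ℚ) (5≤a : ℕ→ℚ 5 Q.≤ a)
    (6n≡ : ℕ→ℚ 6 Q.* n ≡ (a Q.- 1ℚ) Q.* (a Q.- 1ℚ) Q.* (a Q.- ℕ→ℚ 2)) where

    0<a : 0ℚ Q.< a
    0<a = ℚₚ.<-≤-trans (Rational.ℕ→ℚ-pos 5) 5≤a

    0≤a = ℚₚ.<⇒≤ 0<a

    r b ⅔ κ η : ℚ
    r = recip₀ a
    b = a Q.- ℕ→ℚ 5
    ⅔ = (ℤ.+ 2) Q./ 3
    κ = ℕ→ℚ 4 Q.* n Q.* (r Q.* (r Q.* r))
    η = ℕ→ℚ 3 Q.* r

    private
      a*r : a Q.* r ≡ 1ℚ
      a*r = Rational.recip₀-inverse 0<a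
      0≤b : 0ℚ Q.≤ b
      0≤b = ≤⇒0≤- 5≤a
      0≤r : 0ℚ Q.≤ r
      0≤r = ℚₚ.<⇒≤ (Rational.recip₀-pos 0<a)
      0≤r³ = 0≤* 0≤r (0≤* 0≤r 0≤r)
      0≤ℕ : ∀ k → 0ℚ Q.≤ ℕ→ℚ k
      0≤ℕ = Rational.ℕ→ℚ-nonNeg
      a³ = a Q.* a Q.* a
      r³ = r Q.* (r Q.* r)
      M = (a Q.- 1ℚ) Q.* (a Q.- 1ℚ) Q.* (a Q.- ℕ→ℚ 2)

    0≤η : 0ℚ Q.≤ η
    0≤η = 0≤* (0≤ℕ 3) 0≤r

    a³r³ : a³ Q.* r³ ≡ 1ℚ
    a³r³ = trans (solve 2 (λ a r → a :* a :* a :* (r :* (r :* r)) := (a :* r) :* ((a :* r) :* (a :* r))) refl a r)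
      (cong (λ z → z Q.* (z Q.* z)) a*r)

    scale : ∀ x → x ≡ x Q.* a³ Q.* r³
    scale x = trans (sym (ℚₚ.*-identityʳ x)) (trans (cong (x Q.*_) (sym a³r³)) (sym (ℚₚ.*-assoc x a³ r³)))

    η-scale : η ≡ ℕ→ℚ 3 Q.* (a Q.* a) Q.* r³
    η-scale = trans (scale η) (trans (solve 3 (λ a r s → con (ℕ→ℚ 3) :* r :* (a :* a :* a) :* s := con (ℕ→ℚ 3) :* (a :* a) :* s :* (a :* r)) refl a r r³)
      (trans (cong (ℕ→ℚ 3 Q.* (a Q.* a) Q.* r³ Q.*_) a*r) (ℚₚ.*-identityʳ (ℕ→ℚ 3 Q.* (a Q.* a) Q.* r³))))

    κ≡ : κ ≡ ⅔ Q.* M Q.* r³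
    κ≡ = cong (Q._* r³) (trans (solve 1 (λ n → con (ℕ→ℚ 4) :* n := con ((ℤ.+ 2) Q./ 3) :* (con (ℕ→ℚ 6) :* n)) refl n) (cong (⅔ Q.*_) 6n≡))

    private
      compare : ∀ {x y} → x Q.≤ y → x Q.* r³ Q.≤ y Q.* r³
      compare = ℚₚ.*-monoʳ-≤-nonNeg r³ {{Q.nonNegative 0≤r³}}

    -- At q = 5 the value is 32/125, just above 1/4. The resulting K ≥ 1/2 is what makes C₁ = 2
    -- sufficient for the upper end of the window.
    ¼≤κ : ½ Q.* ½ Q.≤ κ
    ¼≤κ = subst₂ Q._≤_ (sym (scale (½ Q.* ½))) (sym κ≡) (compare {½ Q.* ½ Q.* a³} {⅔ Q.* M} (≤-by
      (0≤+ (0≤+ (0≤+ (ℚₚ.nonNegative⁻¹ ((ℤ.+ 9) Q./ 12)) (0≤* (ℚₚ.nonNegative⁻¹ ((ℤ.+ 95) Q./ 12)) 0≤b))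
        (0≤* (ℚₚ.nonNegative⁻¹ ((ℤ.+ 43) Q./ 12)) (0≤* 0≤b 0≤b))) (0≤* (ℚₚ.nonNegative⁻¹ ((ℤ.+ 5) Q./ 12)) (0≤* 0≤b (0≤* 0≤b 0≤b))))
      (solve 1 (λ a → let b = a :- con (ℕ→ℚ 5) in
        con ((ℤ.+ 2) Q./ 3) :* ((a :- con 1ℚ) :* (a :- con 1ℚ) :* (a :- con (ℕ→ℚ 2))) := con (½ Q.* ½) :* (a :* a :* a) :+
          (con ((ℤ.+ 9) Q./ 12) :+ con ((ℤ.+ 95) Q./ 12) :* b :+ con ((ℤ.+ 43) Q./ 12) :* (b :* b) :+ con ((ℤ.+ 5) Q./ 12) :* (b :* (b :* b)))) refl a)))

    κ≤⅔ : κ Q.≤ ⅔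
    κ≤⅔ = subst₂ Q._≤_ (sym κ≡) (sym (scale ⅔)) (compare {⅔ Q.* M} {⅔ Q.* a³} (≤-by
      (0≤* (ℚₚ.nonNegative⁻¹ ⅔) (0≤+ (0≤+ (0≤* (0≤ℕ 4) (0≤* 0≤b 0≤b)) (0≤* (0≤ℕ 35) 0≤b)) (0≤ℕ 77)))
      (solve 1 (λ a → let b = a :- con (ℕ→ℚ 5) in con ((ℤ.+ 2) Q./ 3) :* (a :* a :* a) :=
        con ((ℤ.+ 2) Q./ 3) :* ((a :- con 1ℚ) :* (a :- con 1ℚ) :* (a :- con (ℕ→ℚ 2))) :+
        con ((ℤ.+ 2) Q./ 3) :* (con (ℕ→ℚ 4) :* (b :* b) :+ con (ℕ→ℚ 35) :* b :+ con (ℕ→ℚ 77))) refl a)))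

    -- Since (q - 1)²(q - 2) = q³ - 4q² + 5q - 2, the gap 2/3 - κ has leading term 8/(3q), which 3/q
    -- exceeds.
    ⅔≤κ+η : ⅔ Q.≤ κ Q.+ η
    ⅔≤κ+η = subst₂ Q._≤_ (sym (scale ⅔)) (trans (ℚₚ.*-distribʳ-+ r³ (⅔ Q.* M) (ℕ→ℚ 3 Q.* (a Q.* a))) (cong₂ Q._+_ (sym κ≡) (sym η-scale)))
      (compare {⅔ Q.* a³} {⅔ Q.* M Q.+ ℕ→ℚ 3 Q.* (a Q.* a)} (≤-by (0≤* (ℚₚ.nonNegative⁻¹ ((ℤ.+ 1) Q./ 3)) (0≤+ (0≤+ (0≤* 0≤b 0≤b) (0≤* (0≤ℕ 20) 0≤b)) (0≤ℕ 71)))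
      (solve 1 (λ a → let b = a :- con (ℕ→ℚ 5) in
        con ((ℤ.+ 2) Q./ 3) :* ((a :- con 1ℚ) :* (a :- con 1ℚ) :* (a :- con (ℕ→ℚ 2))) :+ con (ℕ→ℚ 3) :* (a :* a) :=
        con ((ℤ.+ 2) Q./ 3) :* (a :* a :* a) :+ con ((ℤ.+ 1) Q./ 3) :* (b :* b :+ con (ℕ→ℚ 20) :* b :+ con (ℕ→ℚ 71))) refl a)))

  -- The numbers are q, N, √q, √N and √(N q).

  module Density (q N w s t : ℝ) {{_ : Positive q}} {{_ : Positive N}} {{_ : Positive w}} {{_ : Positive s}} {{_ : Positive t}}
    (w²≈q : w * w ≈ q) (s²≈N : s * s ≈ N) (t≈sw : t ≈ s * w) where

    private
      2N = fromℕ 2 * N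

    -- The reciprocal takes its positivity witness as an argument. Allowing any `c` equal to w³ with
    -- any witness makes the result applicable to whichever witness occurs in a statement.
    density-solution : ∀ c {{_ : Positive c}} → c ≈ w * w * w → 2N ≈ fromℕ 2 * s / c * q * t
    density-solution c c≈w³ = ≈-sym (begin
      fromℕ 2 * s / c * q * t                  ≈⟨ *-cong-≈ (≈-refl {fromℕ 2 * s / c * q}) t≈sw ⟩
      fromℕ 2 * s / c * q * (s * w)            ≈⟨ pointwise (λ n → solve 5 (λ k s i q w → k :* s :* i :* q :* (s :* w) := k :* (s :* s) :* (q :* w) :* i)
                                                    refl (ℕ→ℚ 2) (seq s n) (seq (c ⁻¹) n) (seq q n) (seq w n)) ⟩
      fromℕ 2 * (s * s) * (q * w) * c ⁻¹       ≈⟨ *-cong-≈ (*-cong-≈ (*-cong-≈ (≈-refl {fromℕ 2}) s²≈N) (*-cong-≈ (≈-sym w²≈q) (≈-refl {w}))) (≈-refl {c ⁻¹}) ⟩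
      fromℕ 2 * N * (w * w * w) * c ⁻¹         ≈⟨ *-cong-≈ (*-cong-≈ (≈-refl {fromℕ 2 * N}) (≈-sym c≈w³)) (≈-refl {c ⁻¹}) ⟩
      fromℕ 2 * N * c / c                      ≈⟨ /-cancel-≈ (fromℕ 2 * N) c ⟩
      2N                                       ∎)

    K₀ : ℝ
    K₀ = fromℕ 2 * s / (w * w * w)

    K₀-positive : Positive K₀
    K₀-positive = ℝ.*-positive {{ℝ.*-positive {fromℕ 2} {s}}} {{⁻¹-positive (w * w * w)}}

    solution : ∃[ K ] Positive K × 2N ≈ K * q * t
    solution = K₀ , K₀-positive , density-solution (w * w * w) ≈-refl

    t²≈Nq : t * t ≈ N * q
    t²≈Nq = ≈-trans (*-cong-≈ t≈sw t≈sw) (≈-trans (≈-sym (*-interchange s w)) (*-cong-≈ s²≈N w²≈q))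

    module _ (K : ℝ) (isK : 2N ≈ K * q * t) where

      density-unique : ∀ c {{_ : Positive c}} → c ≈ w * w * w → K ≈ fromℕ 2 * s / c
      density-unique c c≈w³ = *-cancelʳ-≈ q (*-cancelʳ-≈ t (≈-trans (≈-sym isK) (density-solution c c≈w³)))

      K-positive : Positive K
      K-positive = positive-resp-≃ {K₀} {K} (≃-sym {K} {K₀} (equality (density-unique (w * w * w) ≈-refl))) K₀-positive

      density-square : K * K * (q * q) * q ≈ fromℕ 4 * N
      density-square = *-cancelʳ-≈ N (begin
        K * K * (q * q) * q * N      ≈⟨ pointwise (λ n → solve 3 (λ k q N → k :* k :* (q :* q) :* q :* N := k :* k :* (q :* q) :* (N :* q)) refl (seq K n) (seq q n) (seq N n)) ⟩
        K * K * (q * q) * (N * q)    ≈⟨ *-cong-≈ (≈-refl {K * K * (q * q)}) (≈-sym t²≈Nq) ⟩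
        K * K * (q * q) * (t * t)    ≈⟨ pointwise (λ n → solve 3 (λ k q t → k :* k :* (q :* q) :* (t :* t) := k :* q :* t :* (k :* q :* t)) refl (seq K n) (seq q n) (seq t n)) ⟩
        K * q * t * (K * q * t)      ≈⟨ *-cong-≈ (≈-sym isK) (≈-sym isK) ⟩
        2N * 2N                      ≈⟨ pointwise (λ n → solve 1 (λ N → con (ℕ→ℚ 2) :* N :* (con (ℕ→ℚ 2) :* N) := con (ℕ→ℚ 4) :* N :* N) refl (seq N n)) ⟩
        fromℕ 4 * N * N              ∎)

      -- By the formula for K² both sides are in fact equal.
      window-lower : ∀ c {{_ : Positive c}} → c ≈ K * K * (q * q) → fromℕ 4 * N / c ≤ q
      window-lower c c≈ = proj₁ (equality (begin
        fromℕ 4 * N / c                  ≈⟨ *-cong-≈ (≈-sym density-square) (≈-refl {c ⁻¹}) ⟩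
        K * K * (q * q) * q * c ⁻¹       ≈⟨ *-cong-≈ (*-cong-≈ (≈-sym c≈) (≈-refl {q})) (≈-refl {c ⁻¹}) ⟩
        c * q / c                        ≈⟨ *-cong-≈ (pointwise (λ m → ℚₚ.*-comm (seq c m) (seq q m))) (≈-refl {c ⁻¹}) ⟩
        q * c / c                        ≈⟨ /-cancel-≈ q c ⟩
        q                                ∎))

      module Bounds (a n : ℚ) (q≈a : q ≈ fromℚ a) (N≈n : N ≈ fromℚ n) (5≤a : ℕ→ℚ 5 Q.≤ a)
        (6n≡ : ℕ→ℚ 6 Q.* n ≡ (a Q.- 1ℚ) Q.* (a Q.- 1ℚ) Q.* (a Q.- ℕ→ℚ 2)) where

        open DensityArithmetic a n 5≤a 6n≡

        K²≈κ : K * K ≈ fromℚ κ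
        K²≈κ = begin
          K * K                                                         ≈⟨ pointwise (λ m → cube (seq K m)) ⟩
          K * K * (fromℚ a * fromℚ a) * fromℚ a * fromℚ (r Q.* (r Q.* r)) ≈⟨ *-cong-≈ (*-cong-≈ (*-cong-≈ (≈-refl {K * K}) (*-cong-≈ (≈-sym q≈a) (≈-sym q≈a))) (≈-sym q≈a)) (≈-refl {fromℚ (r Q.* (r Q.* r))}) ⟩
          K * K * (q * q) * q * fromℚ (r Q.* (r Q.* r))                 ≈⟨ *-cong-≈ (≈-trans density-square (*-cong-≈ (≈-refl {fromℕ 4}) N≈n)) (≈-refl {fromℚ (r Q.* (r Q.* r))}) ⟩
          fromℕ 4 * fromℚ n * fromℚ (r Q.* (r Q.* r))                   ≈⟨ pointwise (λ _ → refl) ⟩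
          fromℚ κ                                                       ∎
          where
          cube : ∀ k → k Q.* k ≡ k Q.* k Q.* (a Q.* a) Q.* a Q.* (r Q.* (r Q.* r))
          cube k = trans (scale (k Q.* k)) (solve 3 (λ k a s → k :* k :* (a :* a :* a) :* s := k :* k :* (a :* a) :* a :* s) refl k a (r Q.* (r Q.* r)))

        ½≤K : fromℚ ½ ≤ K
        ½≤K = square-cancel-≤ {K} {fromℚ ½} (positive⇒nonNegative K-positive)
          (≤-trans {fromℚ ½ * fromℚ ½} {fromℚ κ} {K * K} (≤-seq {fromℚ ½ * fromℚ ½} {fromℚ κ} (0 , λ _ _ → ¼≤κ)) (proj₂ (equality K²≈κ)))

        K≤1 : K ≤ 1ℝ
        K≤1 = square-cancel-≤ {1ℝ} {K} (0 , λ _ _ → 0≤1) (≤-trans {K * K} {fromℚ κ} {1ℝ * 1ℝ} (proj₁ (equality K²≈κ))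
          (≤-seq {fromℚ κ} {1ℝ * 1ℝ} (0 , λ _ _ → ℚₚ.≤-trans κ≤⅔ (≤-by {⅔} {1ℚ Q.* 1ℚ} {(ℤ.+ 1) Q./ 3} (ℚₚ.nonNegative⁻¹ ((ℤ.+ 1) Q./ 3)) refl))))

        window-upper : q ≤ fromℕ 2 * K * q
        window-upper = ≤-trans {q} {z * fromℚ ½} {fromℕ 2 * K * q}
          (proj₁ (equality (≈-trans q≈a (pointwise {fromℚ a} {z * fromℚ ½} (λ _ → solve 1 (λ a → a := con (ℕ→ℚ 2) :* a :* con ½) refl a)))))
          (≤-trans {z * fromℚ ½} {z * K} {fromℕ 2 * K * q} (*-monoˡ-≤ {z} {fromℚ ½} {K} (0 , λ _ _ → 0≤* (Rational.ℕ→ℚ-nonNeg 2) 0≤a) ½≤K)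
            (proj₁ (equality (≈-trans (pointwise {z * K} {fromℕ 2 * K * fromℚ a} (λ m → solve 2 (λ a k → con (ℕ→ℚ 2) :* a :* k := con (ℕ→ℚ 2) :* k :* a) refl a (seq K m)))
              (*-cong-≈ (≈-refl {fromℕ 2 * K}) (≈-sym q≈a))))))
          where z = fromℕ 2 * fromℚ a

        -- As K ≤ 1, the left side is at most q/8, and 7q/8 ≥ 3 holds for q ≥ 5.
        rich-pairs : ∀ c {{_ : Positive c}} → c ≈ fromℚ (ℕ→ℚ 8) → ∀ p → a Q.- ℕ→ℚ 3 Q.≤ ℕ→ℚ p → K * q / c ≤ fromℕ p
        rich-pairs c c≈8 p a-3≤p = ≤-trans {K * q / c} {z * K} {fromℕ p} (proj₁ (equality (begin
            K * q / c                               ≈⟨ *-cong-≈ (*-cong-≈ (≈-refl {K}) q≈a) (≈-refl {c ⁻¹}) ⟩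
            K * fromℚ a * c ⁻¹                      ≈⟨ *-cong-≈ (pointwise (λ m → eighth (seq K m))) (≈-refl {c ⁻¹}) ⟩
            z * K * fromℚ (ℕ→ℚ 8) * c ⁻¹            ≈⟨ *-cong-≈ (*-cong-≈ (≈-refl {z * K}) (≈-sym c≈8)) (≈-refl {c ⁻¹}) ⟩
            z * K * c / c                           ≈⟨ /-cancel-≈ (z * K) c ⟩
            z * K                                   ∎)))
          (≤-trans {z * K} {z * 1ℝ} {fromℕ p} (*-monoˡ-≤ {z} {K} {1ℝ} (0 , λ _ _ → 0≤* 0≤a (ℚₚ.nonNegative⁻¹ ((ℤ.+ 1) Q./ 8))) K≤1)
            (≤-seq {z * 1ℝ} {fromℕ p} (0 , λ _ _ → ℚₚ.≤-trans bound a-3≤p)))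
          where
          z = fromℚ (a Q.* ((ℤ.+ 1) Q./ 8))
          eighth : ∀ k → k Q.* a ≡ a Q.* ((ℤ.+ 1) Q./ 8) Q.* k Q.* ℕ→ℚ 8
          eighth k = solve 2 (λ k a → k :* a := a :* con ((ℤ.+ 1) Q./ 8) :* k :* con (ℕ→ℚ 8)) refl k a
          bound : a Q.* ((ℤ.+ 1) Q./ 8) Q.* 1ℚ Q.≤ a Q.- ℕ→ℚ 3
          bound = ≤-by (0≤+ (0≤* (ℚₚ.nonNegative⁻¹ ((ℤ.+ 7) Q./ 8)) (≤⇒0≤- 5≤a)) (ℚₚ.nonNegative⁻¹ ((ℤ.+ 11) Q./ 8)))
            (solve 1 (λ a → a :- con (ℕ→ℚ 3) := a :* con ((ℤ.+ 1) Q./ 8) :* con 1ℚ :+ (con ((ℤ.+ 7) Q./ 8) :* (a :- con (ℕ→ℚ 5)) :+ con ((ℤ.+ 11) Q./ 8))) refl a)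

        module _ (ρ : ℝ) (0≤ρ : NonNegative ρ) (ρ²≈⅔ : ρ * ρ ≈ fromℚ ⅔) where

          K≤ρ : K ≤ ρ
          K≤ρ = square-cancel-≤ {ρ} {K} 0≤ρ (≤-trans {K * K} {fromℚ κ} {ρ * ρ} (proj₁ (equality K²≈κ))
            (≤-trans {fromℚ κ} {fromℚ ⅔} {ρ * ρ} (fromℚ-mono κ≤⅔) (proj₂ (equality ρ²≈⅔))))

          -- (K + η)² ≥ K² + 2 η K ≥ K² + η ≥ 2/3.

          ρ≤K+η : ρ ≤ K + fromℚ η
          ρ≤K+η = square-cancel-≤ {K + fromℚ η} {ρ} (map-eventually (λ _ h → 0≤+ h 0≤η) (positive⇒nonNegative K-positive))
            (≤-trans {ρ * ρ} {fromℚ ⅔} {y} (proj₁ (equality ρ²≈⅔)) (≤-trans {fromℚ ⅔} {fromℚ κ + h * fromℚ ½} {y}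
              (≤-seq {fromℚ ⅔} {fromℚ κ + h * fromℚ ½} (0 , λ _ _ → ℚₚ.≤-trans ⅔≤κ+η (ℚₚ.≤-reflexive
                (cong (κ Q.+_) (solve 1 (λ h → h := con (ℕ→ℚ 2) :* h :* con ½) refl η)))))
              (≤-trans {fromℚ κ + h * fromℚ ½} {K * K + h * K} {y}
                (+-mono-≤ {fromℚ κ} {K * K} {h * fromℚ ½} {h * K} (proj₂ (equality K²≈κ))
                  (*-monoˡ-≤ {h} {fromℚ ½} {K} (0 , λ _ _ → 0≤* (Rational.ℕ→ℚ-nonNeg 2) 0≤η) ½≤K))
                (≤-seq {K * K + h * K} {y} (0 , λ m _ → ≤-by (0≤* 0≤η 0≤η)
                  (solve 2 (λ k h → (k :+ h) :* (k :+ h) := k :* k :+ con (ℕ→ℚ 2) :* h :* k :+ h :* h) refl (seq K m) η))))))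
            where
            h = fromℚ (ℕ→ℚ 2 Q.* η)
            y = (K + fromℚ η) * (K + fromℚ η)

          close : ∀ ε {δ} → 0ℚ Q.< δ → Eventually (λ n → δ Q.< seq ε n) → η Q.< δ Q.* ½ → ℝ.∣ K - ρ ∣ < ε
          close ε {δ} 0<δ δ<ε η<δ/2 = γ , 0<γ , map-eventually (λ m (d , u , l) → bound (seq K m) (seq ρ m) (seq ε m) d u l)
              (both δ<ε (both (K≤ρ γ 0<γ) (ρ≤K+η γ 0<γ)))
            where
            -- Half of δ absorbs η, a quarter absorbs the error of the two comparisons, and the last
            -- quarter is the margin of the strict inequality.
            γ = δ Q.* ½ Q.* ½
            0<γ = Rational.half-pos (Rational.half-pos 0<δ)
            bound : ∀ k p e → δ Q.< e → k Q.< p Q.+ γ → p Q.< k Q.+ η Q.+ γ → Q.∣ k Q.- p ∣ Q.+ γ Q.< e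
            bound k p e d u l = ℚₚ.<-trans (ℚₚ.+-monoˡ-< γ (Rational.<⇒∣-∣ {k} {p} {δ Q.* ½ Q.+ γ}
                (ℚₚ.<-≤-trans u (≤-by (ℚₚ.<⇒≤ (Rational.half-pos 0<δ)) (solve 3 (λ p h g → p :+ (h :+ g) := p :+ g :+ h) refl p (δ Q.* ½) γ)))
                (ℚₚ.<-trans l (subst (k Q.+ η Q.+ γ Q.<_) (ℚₚ.+-assoc k (δ Q.* ½) γ) (ℚₚ.+-monoˡ-< γ (ℚₚ.+-monoʳ-< k η<δ/2))))))
              (subst (Q._< e) (solve 1 (λ d → d := d :* con ½ :+ d :* con ½ :* con ½ :+ d :* con ½ :* con ½) refl δ) d)

open DensityTheory

-- Conversion of the hypotheses on τ and ε into rational inequalities.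

module RealBlocks where

  open ℚSolver.+-*-Solver using (solve; _:*_; _:=_)
  open ℝ using (seq; _≤_; _*_; _⁻¹; _/_; Positive)

  module _ (τ ε : ℝ) {{τ-positive : Positive τ}} (S D : ℚ) (0<S : 0ℚ Q.< S) (τS≤D : τ * fromℚ S ≤ fromℚ D) where

    private
      r d : ℚ
      r = recip₀ S
      d = D Q.* r
      0≤S = ℚₚ.<⇒≤ 0<S
      S*r : S Q.* r ≡ 1ℚ
      S*r = Rational.recip₀-inverse 0<S
      dS≡D : d Q.* S ≡ D
      dS≡D = trans (solve 3 (λ D r S → D :* r :* S := D :* (S :* r)) refl D r S) (trans (cong (D Q.*_) S*r) (ℚₚ.*-identityʳ D))

      -- The real τ is replaced by the rational D/S, after which real inequalities are needed only
      -- between constants.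
      τ≤d : τ ≤ fromℚ d
      τ≤d = ≤-trans {τ} {fromℚ r * (τ * fromℚ S)} {fromℚ d}
        (proj₁ (equality (pointwise {τ} {fromℚ r * (τ * fromℚ S)} (λ n → sym (unscale (seq τ n))))))
        (≤-trans {fromℚ r * (τ * fromℚ S)} {fromℚ r * fromℚ D} {fromℚ d}
          (*-monoˡ-≤ {fromℚ r} {τ * fromℚ S} {fromℚ D} (0 , λ _ _ → ℚₚ.<⇒≤ (Rational.recip₀-pos 0<S)) τS≤D)
          (proj₁ (equality (pointwise {fromℚ r * fromℚ D} {fromℚ d} (λ _ → ℚₚ.*-comm r D)))))
        where
        unscale : ∀ t → r Q.* (t Q.* S) ≡ t
        unscale t = trans (solve 3 (λ r t S → r :* (t :* S) := t :* (S :* r)) refl r t S) (trans (cong (t Q.*_) S*r) (ℚₚ.*-identityʳ t))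

      0≤τ : NonNegative τ
      0≤τ = positive⇒nonNegative τ-positive

      0≤d : 0ℚ Q.≤ d
      0≤d = fromℚ-cancel-≤ (≤-trans {fromℚ 0ℚ} {τ} {fromℚ d} (≤-seq {fromℚ 0ℚ} {τ} 0≤τ) τ≤d)

    -- The chain 96 ≤ τ q ≤ d q is multiplied by S, using d S = D.
    large-field : ∀ q {a} → 0ℚ Q.≤ a → q ≈ fromℚ a → fromℕ 96 / τ ≤ q → ℕ→ℚ 96 Q.* S Q.≤ D Q.* a
    large-field q {a} 0≤a q≈a h = subst (ℕ→ℚ 96 Q.* S Q.≤_)
      (trans (solve 3 (λ a d S → a :* d :* S := d :* S :* a) refl a d S) (cong (Q._* a) dS≡D))
      (ℚₚ.*-monoʳ-≤-nonNeg S {{Q.nonNegative 0≤S}} 96≤ad)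
      where
      rearrange : τ * (fromℕ 96 * τ ⁻¹) ≈ fromℕ 96 * τ / τ
      rearrange = pointwise (λ n → solve 3 (λ t i k → t :* (k :* i) := k :* t :* i) refl (seq τ n) (seq (τ ⁻¹) n) (ℕ→ℚ 96))
      96≤ad : ℕ→ℚ 96 Q.≤ a Q.* d
      96≤ad = fromℚ-cancel-≤ {ℕ→ℚ 96} (≤-trans {fromℚ (ℕ→ℚ 96)} {τ * (fromℕ 96 / τ)} {fromℚ (a Q.* d)}
        (proj₂ (equality (≈-trans rearrange (≈-trans (/-cancel-≈ (fromℕ 96) τ) (pointwise {fromℕ 96} {fromℚ (ℕ→ℚ 96)} (λ _ → refl))))))
        (≤-trans {τ * (fromℕ 96 / τ)} {τ * q} {fromℚ (a Q.* d)} (*-monoˡ-≤ {τ} {fromℕ 96 / τ} {q} 0≤τ h)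
          (≤-trans {τ * q} {fromℚ a * τ} {fromℚ (a Q.* d)}
            (proj₁ (equality (≈-trans (*-cong-≈ (≈-refl {τ}) q≈a) (pointwise {τ * fromℚ a} {fromℚ a * τ} (λ n → ℚₚ.*-comm (seq τ n) a)))))
            (≤-trans {fromℚ a * τ} {fromℚ a * fromℚ d} {fromℚ (a Q.* d)} (*-monoˡ-≤ {fromℚ a} {τ} {fromℚ d} (0 , λ _ _ → 0≤a) τ≤d)
              (≤-seq {fromℚ a * fromℚ d} {fromℚ (a Q.* d)} (0 , λ _ _ → ℚₚ.≤-refl))))))

    -- From c ε ≤ τ² ≤ d² follows c X ≤ c ε S ≤ d² S, and a further factor S turns d² S² into D².
    small-sum : ∀ c {{c-positive : Positive c}} → c ≈ fromℚ (ℕ→ℚ 144) → ε ≤ τ * τ / c →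
                ∀ {X} → fromℚ X ≤ ε * fromℚ S → ℕ→ℚ 144 Q.* X Q.* S Q.≤ D Q.* D
    small-sum c {{c-positive}} c≈144 ε≤ {X} X≤ = subst (ℕ→ℚ 144 Q.* X Q.* S Q.≤_)
      (trans (solve 2 (λ d S → S :* (d :* d) :* S := d :* S :* (d :* S)) refl d S) (cong (λ z → z Q.* z) dS≡D))
      (ℚₚ.*-monoʳ-≤-nonNeg S {{Q.nonNegative 0≤S}} 144X≤)
      where
      dd : ℝ
      dd = fromℚ (d Q.* d)
      τ²≤d² : τ * τ ≤ dd
      τ²≤d² = ≤-trans {τ * τ} {τ * fromℚ d} {dd} (*-monoˡ-≤ {τ} {τ} {fromℚ d} 0≤τ τ≤d)
        (≤-trans {τ * fromℚ d} {fromℚ d * τ} {dd} (proj₁ (equality (pointwise {τ * fromℚ d} {fromℚ d * τ} (λ n → ℚₚ.*-comm (seq τ n) d))))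
          (≤-trans {fromℚ d * τ} {fromℚ d * fromℚ d} {dd} (*-monoˡ-≤ {fromℚ d} {τ} {fromℚ d} (0 , λ _ _ → 0≤d) τ≤d)
            (≤-seq {fromℚ d * fromℚ d} {dd} (0 , λ _ _ → ℚₚ.≤-refl))))
      ε*c≤d² : c * ε ≤ dd
      ε*c≤d² = ≤-trans {c * ε} {c * (τ * τ / c)} {dd} (*-monoˡ-≤ {c} {ε} {τ * τ / c} (positive⇒nonNegative c-positive) ε≤)
        (≤-trans {c * (τ * τ / c)} {τ * τ} {dd}
          (proj₁ (equality (≈-trans (pointwise {c * (τ * τ / c)} {τ * τ * c / c}
            (λ n → solve 3 (λ c t i → c :* (t :* t :* i) := t :* t :* c :* i) refl (seq c n) (seq τ n) (seq (c ⁻¹) n))) (/-cancel-≈ (τ * τ) c))))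
          τ²≤d²)
      144X≤ : ℕ→ℚ 144 Q.* X Q.≤ S Q.* (d Q.* d)
      144X≤ = fromℚ-cancel-≤ (≤-trans {fromℚ (ℕ→ℚ 144 Q.* X)} {c * fromℚ X} {fromℚ (S Q.* (d Q.* d))}
        (proj₂ (equality (≈-trans (*-cong-≈ c≈144 (≈-refl {fromℚ X})) (pointwise {fromℚ (ℕ→ℚ 144) * fromℚ X} {fromℚ (ℕ→ℚ 144 Q.* X)} (λ _ → refl)))))
        (≤-trans {c * fromℚ X} {c * (ε * fromℚ S)} {fromℚ (S Q.* (d Q.* d))}
          (*-monoˡ-≤ {c} {fromℚ X} {ε * fromℚ S} (positive⇒nonNegative c-positive) X≤)
          (≤-trans {c * (ε * fromℚ S)} {fromℚ S * (c * ε)} {fromℚ (S Q.* (d Q.* d))}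
            (proj₁ (equality (pointwise {c * (ε * fromℚ S)} {fromℚ S * (c * ε)} (λ n → solve 3 (λ c e s → c :* (e :* s) := s :* (c :* e)) refl (seq c n) (seq ε n) S))))
            (≤-trans {fromℚ S * (c * ε)} {fromℚ S * dd} {fromℚ (S Q.* (d Q.* d))}
              (*-monoˡ-≤ {fromℚ S} {c * ε} {dd} (0 , λ _ _ → 0≤S) ε*c≤d²)
              (≤-seq {fromℚ S * dd} {fromℚ (S Q.* (d Q.* d))} (0 , λ _ _ → ℚₚ.≤-refl))))))

open RealBlocks

-- The density statements in terms of the numbers of points and spheres.

module RealSystem where

  open ℝ using (seq; _≃_; _≤_; _<_; _*_; _-_; _/_; 0ℝ; Positive)

  -- The statements about K for a system of N points and m = q spheres with σ = 2 N.

  module ScaledDensity (q N m : ℕ) {{_ : ℕ.NonZero q}} {{_ : ℕ.NonZero N}} (σ : ℚ) (σ≡2N : σ ≡ ℕ→ℚ (2 ℕ.* N)) (m≡q : m ≡ q)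
    (5≤q : 5 ℕ.≤ q) (6N≡ : ℕ→ℚ 6 Q.* ℕ→ℚ N ≡ (ℕ→ℚ q Q.- 1ℚ) Q.* (ℕ→ℚ q Q.- 1ℚ) Q.* (ℕ→ℚ q Q.- ℕ→ℚ 2)) where

    IsK : ℝ → Set
    IsK K = fromℚ σ ≃ K * fromℕ q * √ (fromℕ (N ℕ.* m))

    private
      module D = Density (fromℕ q) (fromℕ N) (√ (fromℕ q)) (√ (fromℕ N)) (√ (fromℕ (N ℕ.* q)))
        {{ℝ.fromℕ-positive}} {{ℝ.fromℕ-positive}} {{ℝ.√-positive}} {{ℝ.√-positive}} {{ℝ.√-positive {{ℝ.fromℕ-positive {{ℕₚ.m*n≢0 N q}}}}}}
        (√ℕ-square q) (√ℕ-square N) (√-* N q)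

      σ≈2N : fromℚ σ ≈ fromℕ 2 * fromℕ N
      σ≈2N = subst (λ z → fromℚ z ≈ fromℕ 2 * fromℕ N) (sym σ≡2N) (≈-trans (≈-sym (fromℕ≈fromℚ (2 ℕ.* N))) (fromℕ-* 2 N))

      m≈q : fromℕ m ≈ fromℕ q
      m≈q = subst (λ k → fromℕ k ≈ fromℕ q) (sym m≡q) ≈-refl

      scale : ∀ K → IsK K → fromℕ 2 * fromℕ N ≈ K * fromℕ q * √ (fromℕ (N ℕ.* q))
      scale K h = ≈-trans (≈-sym σ≈2N) (subst (λ k → fromℚ σ ≈ K * fromℕ q * √ (fromℕ (N ℕ.* k))) m≡q (equal h))

      unscale : ∀ K → fromℕ 2 * fromℕ N ≈ K * fromℕ q * √ (fromℕ (N ℕ.* q)) → IsK K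
      unscale K h = equality (subst (λ k → fromℚ σ ≈ K * fromℕ q * √ (fromℕ (N ℕ.* k))) (sym m≡q) (≈-trans σ≈2N h))

      module B (K : ℝ) (h : IsK K) =
        D.Bounds K (scale K h) (ℕ→ℚ q) (ℕ→ℚ N) (fromℕ≈fromℚ q) (fromℕ≈fromℚ N) (ℕ→ℚ-mono 5≤q) 6N≡

    K-exists : ∃[ K ] 0ℝ < K × IsK K
    K-exists = go D.solution
      where
      go : (∃[ K ] Positive K × fromℕ 2 * fromℕ N ≈ K * fromℕ q * √ (fromℕ (N ℕ.* q))) → ∃[ K ] 0ℝ < K × IsK K
      go (K , 0<K , h) = K , ℝ.0< 0<K , unscale K h

    K-formula : ∀ K → IsK K → K ≃ fromℕ 2 * √ (fromℕ N) / (√ (fromℕ q) * √ (fromℕ q) * √ (fromℕ q))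
    K-formula K h = equality formula
      where
      formula : {{p : Positive (√ (fromℕ q) * √ (fromℕ q) * √ (fromℕ q))}} →
                K ≈ _/_ (fromℕ 2 * √ (fromℕ N)) (√ (fromℕ q) * √ (fromℕ q) * √ (fromℕ q)) {{p}}
      formula {{p}} = D.density-unique K (scale K h) (√ (fromℕ q) * √ (fromℕ q) * √ (fromℕ q)) {{p}} ≈-refl

    K-square : ∀ K → IsK K → K * K * (fromℕ q * fromℕ q) * fromℕ m ≃ fromℕ 4 * fromℕ N
    K-square K h = equality (≈-trans (*-cong-≈ (≈-refl {K * K * (fromℕ q * fromℕ q)}) m≈q) (D.density-square K (scale K h)))

    window-lower : ∀ K → IsK K → {{p : Positive (K * K * (fromℕ q * fromℕ q))}} →
                   _/_ (fromℕ 4 * fromℕ N) (K * K * (fromℕ q * fromℕ q)) {{p}} ≤ fromℕ m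
    window-lower K h {{p}} = go (K * K * (fromℕ q * fromℕ q)) p ≈-refl
      where
      go : ∀ c (p : Positive c) → c ≈ K * K * (fromℕ q * fromℕ q) → _/_ (fromℕ 4 * fromℕ N) c {{p}} ≤ fromℕ m
      go c p c≈ = ≤-trans {_/_ (fromℕ 4 * fromℕ N) c {{p}}} {fromℕ q} {fromℕ m} (D.window-lower K (scale K h) c {{p}} c≈) (proj₂ (equality m≈q))

    window-upper : ∀ K → IsK K → fromℕ m ≤ fromℕ 2 * K * fromℕ q
    window-upper K h = ≤-trans {fromℕ m} {fromℕ q} {fromℕ 2 * K * fromℕ q} (proj₁ (equality m≈q)) (B.window-upper K h)

    rich-pairs : ∀ K → IsK K → {{pos : Positive (fromℕ 4 * fromℕ 2)}} → ∀ p → ℕ→ℚ q Q.- ℕ→ℚ 3 Q.≤ ℕ→ℚ p →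
                 _/_ (K * fromℕ q) (fromℕ 4 * fromℕ 2) {{pos}} ≤ fromℕ p
    rich-pairs K h {{pos}} = B.rich-pairs K h (fromℕ 4 * fromℕ 2) {{pos}} (pointwise (λ _ → refl))

    near-√⅔ : ∀ K → IsK K → ∀ ε {δ} → 0ℚ Q.< δ → Eventually (λ n → δ Q.< seq ε n) → ℕ→ℚ 3 Q.* recip₀ (ℕ→ℚ q) Q.< δ Q.* ½ →
              ℝ.∣ K - √ (fromℚ ((ℤ.+ 2) Q./ 3)) ∣ < ε
    near-√⅔ K h ε 0<δ δ<ε small = B.close K h (√ (fromℚ ((ℤ.+ 2) Q./ 3))) (√-nonNegative (fromℚ ((ℤ.+ 2) Q./ 3)))
      (equal (√-square {fromℚ ((ℤ.+ 2) Q./ 3)} (ℚₚ.nonNegative⁻¹ ((ℤ.+ 2) Q./ 3)) (λ _ → refl))) ε 0<δ δ<ε small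

open RealSystem

-- Assembly for the twisted cubic system.

module MainTheory where

  open Q using () renaming (_*_ to _*ℚ_; _≤_ to _≤ℚ_; _+_ to _+ℚ_; _-_ to _-ℚ_)
  open ℚSolver.+-*-Solver using (solve; _:+_; _:*_; _:-_; :-_; _:=_; con)
  open ≡-Reasoning

  ÷₀-mono : ∀ {x y k c} → 0ℚ Q.< y → 0ℚ Q.< c → x *ℚ c ≤ℚ k *ℚ y → x ÷₀ y ≤ℚ k ÷₀ c
  ÷₀-mono {x} {y} {k} {c} 0<y 0<c h = subst₂ _≤ℚ_
    (trans (solve 4 (λ x c r s → x :* c :* (r :* s) := x :* r :* (c :* s)) refl x c (recip₀ y) (recip₀ c))
      (trans (cong (x *ℚ recip₀ y *ℚ_) (Rational.recip₀-inverse 0<c)) (ℚₚ.*-identityʳ (x *ℚ recip₀ y))))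
    (trans (solve 4 (λ k y r s → k :* y :* (r :* s) := k :* s :* (y :* r)) refl k y (recip₀ y) (recip₀ c))
      (trans (cong (k *ℚ recip₀ c *ℚ_) (Rational.recip₀-inverse 0<y)) (ℚₚ.*-identityʳ (k *ℚ recip₀ c))))
    (ℚₚ.*-monoʳ-≤-nonNeg (recip₀ y *ℚ recip₀ c)
      {{Q.nonNegative (0≤* (ℚₚ.<⇒≤ (Rational.recip₀-pos 0<y)) (ℚₚ.<⇒≤ (Rational.recip₀-pos 0<c)))}} h)

  module Main {q : ℕ} (F : FiniteField q) (5≤q : 5 ℕ.≤ q)
              (¬2 : ¬ FiniteField.HasCharacteristic F 2) (¬3 : ¬ FiniteField.HasCharacteristic F 3)
              (R : FiniteField.Carrier F) (R≢0 : R ≢ FiniteField.0# F) where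

    open FiniteField F
    open Geometry F
    open TwistedCubic F R

    2≢0 : FieldAlgebra.2# F ≢ 0#
    2≢0 = FieldAlgebra.two≢0 F ¬2

    3≢0 : FieldAlgebra.2# F + 1# ≢ 0#
    3≢0 = FieldAlgebra.three≢0 F ¬3

    open CubicAlgebra F R using (lifts-distinct; no-three-on-line) public
    open Points F R 2≢0 public
    open Counts F R 2≢0 3≢0 public using (size-formula; q-3≤pairs; pairs≤q-2; qℚ)
    open Spheres F R 2≢0 3≢0 public

    N : ℕ
    N = ∣ Ptc ∣ₚ

    radius-tc : ∀ T → T ∈ 𝒮tc → radius T ≡ R
    radius-tc T h with t , refl ← ∈𝒮tc⇒S T h = refl

    no-coaxal : ∀ 𝒫 → IsCoaxalPencil Q₀ 𝒫 → ∀ T U V → T ∈ 𝒮tc → U ∈ 𝒮tc → V ∈ 𝒮tc →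
                T ≢ U → T ≢ V → U ≢ V → ¬ (T ∈ 𝒫 × U ∈ 𝒫 × V ∈ 𝒫)
    no-coaxal 𝒫 pencil T U V hT hU hV T≢U T≢V U≢V (T∈ , U∈ , V∈)
      with t , refl ← ∈𝒮tc⇒S T hT | u , refl ← ∈𝒮tc⇒S U hU | v , refl ← ∈𝒮tc⇒S V hV =
      no-three-on-line 2≢0 line t u v (T≢U ∘ cong S) (T≢V ∘ cong S) (U≢V ∘ cong S) (into (S t) T∈ , into (S u) U∈ , into (S v) V∈)
      where open IsCoaxalPencil pencil

    6N≡ : ℕ→ℚ 6 *ℚ ℕ→ℚ N ≡ (qℚ -ℚ 1ℚ) *ℚ (qℚ -ℚ 1ℚ) *ℚ (qℚ -ℚ ℕ→ℚ 2)
    6N≡ = trans (cong (ℕ→ℚ 6 *ℚ_) (count≡Σ allPoints Ptc)) size-formula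

    square : ℕ→ℚ ((q ℕ.∸ 1) ℕ.^ 2) ≡ (qℚ -ℚ 1ℚ) *ℚ (qℚ -ℚ 1ℚ)
    square = trans (cong (λ k → ℕ→ℚ ((q ℕ.∸ 1) ℕ.* k)) (ℕₚ.*-identityʳ (q ℕ.∸ 1))) (trans (Rational.ℕ→ℚ-* (q ℕ.∸ 1) (q ℕ.∸ 1))
      (cong (λ z → z *ℚ z) (ℕ→ℚ-∸ (ℕₚ.≤-trans (ℕ.s≤s ℕ.z≤n) 5≤q))))

    q∸2 : ℕ→ℚ (q ℕ.∸ 2) ≡ qℚ -ℚ ℕ→ℚ 2
    q∸2 = ℕ→ℚ-∸ (ℕₚ.≤-trans (ℕ.s≤s (ℕ.s≤s ℕ.z≤n)) 5≤q)

    N-value : ℕ→ℚ N ≡ (ℤ.+ ((q ℕ.∸ 1) ℕ.^ 2 ℕ.* (q ℕ.∸ 2))) Q./ 6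
    N-value = *-cancelˡ (ℕ→ℚ 6) (ℕ→ℚ-≢0 6) (trans 6N≡ (sym (trans (ℚₚ.*-comm (ℕ→ℚ 6) ((ℤ.+ ((q ℕ.∸ 1) ℕ.^ 2 ℕ.* (q ℕ.∸ 2))) Q./ 6)) (trans (/-* ((q ℕ.∸ 1) ℕ.^ 2 ℕ.* (q ℕ.∸ 2)) 6)
      (trans (Rational.ℕ→ℚ-* ((q ℕ.∸ 1) ℕ.^ 2) (q ℕ.∸ 2)) (cong₂ _*ℚ_ square q∸2))))))

    0<q-1 : 0ℚ Q.< qℚ -ℚ 1ℚ
    0<q-1 = subst (0ℚ Q.<_) (ℕ→ℚ-∸ (ℕₚ.≤-trans (ℕ.s≤s ℕ.z≤n) 5≤q)) (Rational.ℕ→ℚ-pos (q ℕ.∸ 1) {{ℕ.>-nonZero (ℕₚ.m<n⇒0<n∸m (ℕₚ.≤-trans (ℕ.s≤s (ℕ.s≤s ℕ.z≤n)) 5≤q))}})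

    0<q-2 : 0ℚ Q.< qℚ -ℚ ℕ→ℚ 2
    0<q-2 = subst (0ℚ Q.<_) q∸2 (Rational.ℕ→ℚ-pos (q ℕ.∸ 2) {{ℕ.>-nonZero (ℕₚ.m<n⇒0<n∸m (ℕₚ.≤-trans (ℕ.s≤s (ℕ.s≤s (ℕ.s≤s ℕ.z≤n))) 5≤q))}})

    N≢0 : N ≢ 0
    N≢0 e = ℚₚ.<-irrefl refl (subst (0ℚ Q.<_) (trans (sym 6N≡) (trans (cong (λ n → ℕ→ℚ 6 *ℚ ℕ→ℚ n) e) (ℚₚ.*-zeroʳ (ℕ→ℚ 6))))
      (Rational.*-pos (Rational.*-pos 0<q-1 0<q-1) 0<q-2))

    instance
      N-nonZero : ℕ.NonZero N
      N-nonZero = ℕ.≢-nonZero N≢0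

    degree≡3 : ∀ p → p ∈ Ptc → degree Q₀ 𝒮tc p ≡ 3
    degree≡3 p p∈ = ℕ→ℚ-injective (trans (degree-formula p) (degree-3 p (∈Ptc⇒Roots p p∈)))

    Σ≡2N : σ Q₀ Ptc 𝒮tc ≡ ℕ→ℚ (2 ℕ.* N)
    Σ≡2N = σ-subset Ptc (λ _ h → h)

    0<Σ : 0ℚ Q.< σ Q₀ Ptc 𝒮tc
    0<Σ = subst (0ℚ Q.<_) (sym Σ≡2N) (Rational.ℕ→ℚ-pos (2 ℕ.* N) {{ℕₚ.m*n≢0 2 N}})

    meet : Sphere → Sphere → Sub Point
    meet T U = Ptc ∩ pointsOf Q₀ T ∩ pointsOf Q₀ U

    q-3≤meet : ∀ {a b} → a ≢ b → qℚ -ℚ ℕ→ℚ 3 ≤ℚ ℕ→ℚ ∣ meet (S a) (S b) ∣ₚ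
    q-3≤meet {a} {b} a≢b = subst (qℚ -ℚ ℕ→ℚ 3 ≤ℚ_) (sym (pairs-count a b)) (q-3≤pairs a≢b)

    meet≤q-2 : ∀ {a b} → a ≢ b → ℕ→ℚ ∣ meet (S a) (S b) ∣ₚ ≤ℚ qℚ -ℚ ℕ→ℚ 2
    meet≤q-2 {a} {b} a≢b = subst (_≤ℚ qℚ -ℚ ℕ→ℚ 2) (sym (pairs-count a b)) (pairs≤q-2 a≢b)

    pair-bounds : ∀ a b → a ≢ b → q ℕ.∸ 3 ℕ.≤ ∣ meet (S a) (S b) ∣ₚ × ∣ meet (S a) (S b) ∣ₚ ℕ.≤ q ℕ.∸ 2
    pair-bounds a b a≢b =
        ℕ→ℚ-cancel-≤ (subst (_≤ℚ ℕ→ℚ ∣ meet (S a) (S b) ∣ₚ) (sym (ℕ→ℚ-∸ (ℕₚ.≤-trans (ℕ.s≤s (ℕ.s≤s (ℕ.s≤s ℕ.z≤n))) 5≤q))) (q-3≤meet a≢b))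
      , ℕ→ℚ-cancel-≤ (subst (ℕ→ℚ ∣ meet (S a) (S b) ∣ₚ ≤ℚ_) (sym q∸2) (meet≤q-2 a≢b))

    -- The factors 2 cancel from the ratio, leaving p/N with p ≤ q - 2 and 6N = (q - 1)²(q - 2).
    pair-ratio : ∀ a b → a ≢ b → σ Q₀ (meet (S a) (S b)) 𝒮tc ÷₀ σ Q₀ Ptc 𝒮tc ≤ℚ ℕ→ℚ 6 ÷₀ ℕ→ℚ ((q ℕ.∸ 1) ℕ.^ 2)
    pair-ratio a b a≢b = ÷₀-mono {σ Q₀ (meet (S a) (S b)) 𝒮tc} {σ Q₀ Ptc 𝒮tc} {ℕ→ℚ 6} {ℕ→ℚ ((q ℕ.∸ 1) ℕ.^ 2)} 0<Σ (subst (0ℚ Q.<_) (sym square) (Rational.*-pos 0<q-1 0<q-1))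
      (subst₂ _≤ℚ_ (cong₂ _*ℚ_ (sym (twice (meet (S a) (S b)) (λ _ → T-∧₁))) (sym square)) (cong (ℕ→ℚ 6 *ℚ_) (sym (twice Ptc (λ _ h → h))))
        (≤-by (0≤* (0≤* (Rational.ℕ→ℚ-nonNeg 2) (0≤* (ℚₚ.<⇒≤ 0<q-1) (ℚₚ.<⇒≤ 0<q-1))) (≤⇒0≤- (meet≤q-2 a≢b)))
          (trans (solve 1 (λ n → con (ℕ→ℚ 6) :* (con (ℕ→ℚ 2) :* n) := con (ℕ→ℚ 2) :* (con (ℕ→ℚ 6) :* n)) refl (ℕ→ℚ N)) (trans (cong (ℕ→ℚ 2 *ℚ_) 6N≡)
            (rearrange qℚ (ℕ→ℚ ∣ meet (S a) (S b) ∣ₚ))))))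
      where
      twice : ∀ B → B ⊆ Ptc → σ Q₀ B 𝒮tc ≡ ℕ→ℚ 2 *ℚ ℕ→ℚ ∣ B ∣ₚ
      twice B B⊆ = trans (σ-subset B B⊆) (Rational.ℕ→ℚ-* 2 ∣ B ∣ₚ)
      rearrange : ∀ q p → ℕ→ℚ 2 *ℚ ((q -ℚ 1ℚ) *ℚ (q -ℚ 1ℚ) *ℚ (q -ℚ ℕ→ℚ 2)) ≡
        ℕ→ℚ 2 *ℚ p *ℚ ((q -ℚ 1ℚ) *ℚ (q -ℚ 1ℚ)) +ℚ ℕ→ℚ 2 *ℚ ((q -ℚ 1ℚ) *ℚ (q -ℚ 1ℚ)) *ℚ (q -ℚ ℕ→ℚ 2 -ℚ p)
      rearrange = solve 2 (λ q p → let s = (q :- con 1ℚ) :* (q :- con 1ℚ) in con (ℕ→ℚ 2) :* (s :* (q :- con (ℕ→ℚ 2))) :=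
        con (ℕ→ℚ 2) :* p :* s :+ con (ℕ→ℚ 2) :* s :* (q :- con (ℕ→ℚ 2) :- p)) refl

    -- The incidence isomorphism sends a triple A to p_A and a point p to {t : p ∈ S_t}.

    pointAt : ∀ A → Dec (A ∈𝔗) → Point
    pointAt A (yes h) = proj₁ (proj₁ (point-of A h))
    pointAt A (no _)  = 0ᵛ

    pointAt-correct : ∀ A (d : Dec (A ∈𝔗)) → A ∈𝔗 → IsPointOf A (pointAt A d)
    pointAt-correct A (yes h) _ = proj₁ (proj₂ (proj₁ (point-of A h)))
    pointAt-correct A (no n)  h = ⊥-elim (n h)

    pointAt-unique : ∀ A (d : Dec (A ∈𝔗)) → A ∈𝔗 → ∀ {p} → IsPointOf A p → pointAt A d ≡ p
    pointAt-unique A (yes h) _ k = proj₂ (proj₂ (proj₁ (point-of A h))) k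
    pointAt-unique A (no n)  h _ = ⊥-elim (n h)

    -- Total on subsets, because the membership proof stored in a refinement is irrelevant and
    -- cannot determine the point. It is computed from the decision instead, with `0ᵛ` as default.
    p_ : Subset q → Point
    p_ A = pointAt A (∈𝔗? A)

    incidence : ∀ A → A ∈𝔗 → ∀ t → Lies Q₀ (p_ A) (S t) ⇔ t ∈ᶠ A
    incidence A h = proj₂ (point-of A h) (p_ A) (pointAt-correct A (∈𝔗? A) h)

    p∈Ptc : ∀ A → A ∈𝔗 → p_ A ∈ Ptc
    p∈Ptc A h = A⇒∈Ptc (p_ A) A h (pointAt-correct A (∈𝔗? A) h)

    p-rootSet : ∀ p → p ∈ Ptc → p_ (rootSet p) ≡ p
    p-rootSet p p∈ = pointAt-unique (rootSet p) (∈𝔗? (rootSet p)) (proj₁ c) (proj₂ c)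
      where c = rootSet-correct p (∈Ptc⇒Roots p p∈)

    rootSet-p : ∀ A → A ∈𝔗 → rootSet (p_ A) ≡ A
    rootSet-p A h = trans (Vecₚ.tabulate-cong (λ i → T-ext
        (λ on-i → subst (λ j → T (Vec.lookup A j)) (index-element i) (∈ᶠ⇒T (Equivalence.to (incidence A h (element i)) (on⇒Lies (p_ A) (element i) on-i))))
        (λ in-i → Lies⇒on (p_ A) (element i) (Equivalence.from (incidence A h (element i)) (T⇒∈ᶠ (subst (λ j → T (Vec.lookup A j)) (sym (index-element i)) in-i))))))
      (Vecₚ.tabulate∘lookup A)

    Triple : Subset q → Set
    Triple A = Subset.∣ A ∣ ≡ 3 × - sumOf A ≢ 0#

    Triple⇒∈𝔗 : ∀ A → Triple A → A ∈𝔗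
    Triple⇒∈𝔗 A (size , n) = size , λ e → n (trans (cong -_ e) (FieldAlgebra.-0#≈0# F))

    ∈𝔗⇒Triple : ∀ A → A ∈𝔗 → Triple A
    ∈𝔗⇒Triple A (size , n) = size , λ e → n (trans (sym (FieldAlgebra.-‿involutive F (sumOf A))) (trans (cong -_ e) (FieldAlgebra.-0#≈0# F)))

    relevant : (A : Refinement (Subset q) Triple) → value A ∈𝔗
    relevant (A , [ h ]) = recompute (∈𝔗? A) (Triple⇒∈𝔗 A h)

    ∈-relevant : ∀ {A : Set} {X : Sub A} (x : Refinement A (_∈ X)) → value x ∈ X
    ∈-relevant {X = X} (x , [ h ]) = recompute (Boolₚ.T? (X x)) h

    third-coordinate : Sphere → Carrier
    third-coordinate T = Vec.lookup (centre T) (suc (suc zero))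

    isomorphism : 𝒟₃₀ ≅ system Q₀ Ptc 𝒮tc
    isomorphism = record
      { points = mk↔ₛ′ (λ (A , [ h ]) → p_ A , [ p∈Ptc A (Triple⇒∈𝔗 A h) ])
          (λ (p , [ h ]) → rootSet p , [ ∈𝔗⇒Triple (rootSet p) (proj₁ (rootSet-correct p (∈Ptc⇒Roots p h))) ])
          (λ p → value-injective (p-rootSet (value p) (∈-relevant p))) (λ A → value-injective (rootSet-p (value A) (relevant A)))
      ; objects = mk↔ₛ′ (λ t → S t , [ S∈𝒮tc t ]) (λ T → third-coordinate (value T))
          (λ T → value-injective (back (value T) (∈𝒮tc⇒S (value T) (∈-relevant T)))) (λ _ → refl)
      ; incident = λ A t → mk⇔ (Equivalence.from (incidence (value A) (relevant A) t)) (Equivalence.to (incidence (value A) (relevant A) t)) }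
      where
      back : ∀ T → ∃[ t ] T ≡ S t → S (third-coordinate T) ≡ T
      back T (t , refl) = refl

    module K = ScaledDensity q (Geometry.∣_∣ₚ F (TwistedCubic.Ptc F R)) ∣ 𝒮tc ∣ₛ {{FiniteField.order-nonZero F}} (σ Q₀ Ptc 𝒮tc) Σ≡2N ∣𝒮tc∣ 5≤q 6N≡

    rich-pairs : ∀ K → K.IsK K → {{pos : ℝ.Positive (fromℕ 4 ℝ.* fromℕ 2)}} → ∀ T U → T ∈ 𝒮tc → U ∈ 𝒮tc → T ≢ U →
                 ℝ._/_ (K ℝ.* fromℕ q) (fromℕ 4 ℝ.* fromℕ 2) {{pos}} ℝ.≤ fromℕ ∣ meet T U ∣ₚ
    rich-pairs K h {{pos}} T U hT hU T≢U = K.rich-pairs K h {{pos}} ∣ meet T U ∣ₚ (go (∈𝒮tc⇒S T hT) (∈𝒮tc⇒S U hU))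
      where
      go : ∃[ a ] T ≡ S a → ∃[ b ] U ≡ S b → qℚ -ℚ ℕ→ℚ 3 ≤ℚ ℕ→ℚ ∣ meet T U ∣ₚ
      go (a , T≡) (b , U≡) = subst₂ (λ T U → qℚ -ℚ ℕ→ℚ 3 ≤ℚ ℕ→ℚ ∣ meet T U ∣ₚ) (sym T≡) (sym U≡)
        (q-3≤meet (λ a≡b → T≢U (trans T≡ (trans (cong S a≡b) (sym U≡)))))

    no-decomposition : ∀ τ {{_ : ℝ.Positive τ}} → τ ℝ.≤ ℝ.1ℝ → fromℕ 96 ℝ./ τ ℝ.≤ fromℕ q →
      ∀ ε → ℝ.0ℝ ℝ.≤ ε → ε ℝ.≤ τ ℝ.* τ ℝ./ fromℕ 144 → ¬ CenteredBlockDecomposition Q₀ Ptc 𝒮tc τ ε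
    no-decomposition τ _ large ε _ ε≤ record { m = 0 ; 2≤m = () }
    no-decomposition τ _ large ε _ ε≤ record { m = 1 ; 2≤m = ℕ.s≤s () }
    no-decomposition τ {{τ-positive}} _ large ε _ ε≤ record
      { m = suc (suc k) ; 𝒮s = 𝒮s ; As = As ; R′ = R′ ; sphere-partition = sp ; point-partition = pp
      ; diagonal = diagonal ; remainder = remainder ; cross = cross } = go (ℚₚ.≤-total σ₀ σ₁)
      where
      Σtc = σ Q₀ Ptc 𝒮tc
      σ₀ = σ Q₀ (As zero) (𝒮s zero)
      σ₁ = σ Q₀ (As (suc zero)) (𝒮s (suc zero))
      -- The smaller of the two diagonal excesses is taken for D: it bounds both from below and is
      -- one of them, so the condition `diagonal` holds for it.
      finish : ∀ D → D ≤ℚ σ₀ → D ≤ℚ σ₁ → τ ℝ.* fromℚ Σtc ℝ.≤ fromℚ D → ⊥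
      finish D D≤₀ D≤₁ τΣ≤D = Blocks.no-blocks F R 2≢0 3≢0 5≤q 𝒮s As R′ sp pp D zero D≤₀ D≤₁
        (large-field τ ε Σtc D 0<Σ τΣ≤D (fromℕ q) (Rational.ℕ→ℚ-nonNeg q) (fromℕ≈fromℚ q) large)
        (small-sum τ ε Σtc D 0<Σ τΣ≤D (fromℕ 144) (fromℕ≈fromℚ 144) ε≤ cross)
        (small-sum τ ε Σtc D 0<Σ τΣ≤D (fromℕ 144) (fromℕ≈fromℚ 144) ε≤ remainder)
      go : σ₀ ≤ℚ σ₁ ⊎ σ₁ ≤ℚ σ₀ → ⊥
      go (inj₁ h) = finish σ₀ ℚₚ.≤-refl h (diagonal zero)
      go (inj₂ h) = finish σ₁ h ℚₚ.≤-refl (diagonal (suc zero))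

    every-form : ∀ Q → Nondegenerate Q →
      ∃[ P ] ∃[ 𝒮 ] ∃[ r ] r ≢ 0# × (∀ T → T ∈ 𝒮 → radius T ≡ r) × system Q P 𝒮 ≅ system Q₀ Ptc 𝒮tc
    every-form Q nondegenerate = NormalForms.Normal.Transport.transported F 2≢0 (ℕₚ.≤-trans (ℕ.s≤s (ℕ.s≤s ℕ.z≤n)) 5≤q) Q nondegenerate
      R R≢0 Ptc 𝒮tc radius-tc

  unit≡recip₀ : ∀ n → Rational.unit n ≡ recip₀ (ℕ→ℚ (suc n))
  unit≡recip₀ n = trans (/-recip₀ 1 (suc n)) (ℚₚ.*-identityˡ (recip₀ (ℕ→ℚ (suc n))))

  -- Beyond q₀ the error 3 / q is smaller than δ / 2.

  threshold : ∀ {δ} → 0ℚ Q.< δ → ∃[ q₀ ] ∀ q → q₀ ℕ.≤ q → ℕ→ℚ 3 *ℚ recip₀ (ℕ→ℚ q) Q.< δ *ℚ ½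
  threshold {δ} 0<δ = go (Rational.archimedes η (Rational.*-pos (Rational.half-pos 0<δ) (ℚₚ.positive⁻¹ ((ℤ.+ 1) Q./ 3))))
    where
    η = δ *ℚ ½ *ℚ ((ℤ.+ 1) Q./ 3)
    go : (∃[ N ] ∀ n → N ℕ.≤ n → Rational.unit n Q.< η) → ∃[ q₀ ] ∀ q → q₀ ℕ.≤ q → ℕ→ℚ 3 *ℚ recip₀ (ℕ→ℚ q) Q.< δ *ℚ ½
    go (N , h) = suc N , λ { (suc n) (ℕ.s≤s N≤n) → subst₂ Q._<_ (cong (ℕ→ℚ 3 *ℚ_) (unit≡recip₀ n)) (thrice δ)
      (ℚₚ.*-monoʳ-<-pos (ℕ→ℚ 3) (h n N≤n)) }
      where
      thrice : ∀ δ → ℕ→ℚ 3 *ℚ (δ *ℚ ½ *ℚ ((ℤ.+ 1) Q./ 3)) ≡ δ *ℚ ½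
      thrice = solve 1 (λ d → con (ℕ→ℚ 3) :* (d :* con ½ :* con ((ℤ.+ 1) Q./ 3)) := d :* con ½) refl

open MainTheory

open import Data.Integer.Base using (+_)

theorem4p14 :
  ( ∀ (q : ℕ) (F : FiniteField q) →
    let open FiniteField F hiding (order-nonZero)
        instance nz = FiniteField.order-nonZero F
        open Geometry F
    in
    5 ℕ.≤ q → ¬ HasCharacteristic 2 → ¬ HasCharacteristic 3 →
    ∀ (R : Carrier) → R ≢ 0# →
    let open TwistedCubic F R
        N     = Geometry.∣_∣ₚ F (TwistedCubic.Ptc F R)
        Σtc   = σ Q₀ Ptc 𝒮tc
        pairs = λ S₁ S₂ → Ptc ∩ pointsOf Q₀ S₁ ∩ pointsOf Q₀ S₂
        IsK   = Geometry.IsDensity F (TwistedCubic.Q₀ F R) (TwistedCubic.Ptc F R) (TwistedCubic.𝒮tc F R)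
        q′    = fromℕ q
        q³ᐟ²  = √ q′ ℝ.* √ q′ ℝ.* √ q′
        C₁    = 2
    in
    -- (1)
    ( (∀ T → T ∈ 𝒮tc → radius T ≡ R)
    × (∀ t u → t ≢ u → Φ Q₀ (S t) ≢ Φ Q₀ (S u))
    × (∀ (L : AffineLine 4) t u v → t ≢ u → t ≢ v → u ≢ v →
         ¬ (Φ Q₀ (S t) onLine L × Φ Q₀ (S u) onLine L × Φ Q₀ (S v) onLine L))
    × (∀ 𝒫 → IsCoaxalPencil Q₀ 𝒫 → ∀ T U V → T ∈ 𝒮tc → U ∈ 𝒮tc → V ∈ 𝒮tc →
         T ≢ U → T ≢ V → U ≢ V → ¬ (T ∈ 𝒫 × U ∈ 𝒫 × V ∈ 𝒫))
    )
    ×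
    -- (2), apart from the limit
    ( ℕ→ℚ N ≡ (+ ((q ℕ.∸ 1) ℕ.^ 2 ℕ.* (q ℕ.∸ 2))) Q./ 6
    × (∀ A → A ∈𝔗 →
         ∃! _≡_ (IsPointOf A)
       × (∀ p → IsPointOf A p → ∀ t → Lies Q₀ p (S t) ⇔ t ∈ᶠ A))
    × (∀ p → p ∈ Ptc → degree Q₀ 𝒮tc p ≡ 3)
    × I Q₀ Ptc 𝒮tc ≡ 3 ℕ.* N
    × Σtc ≡ ℕ→ℚ (2 ℕ.* N)
    × Q.0ℚ Q.< Σtc
    × (∃[ K ] ℝ.0ℝ ℝ.< K × IsK K)
    × (∀ K → IsK K →
         K ℝ.≃ fromℕ 2 ℝ.* √ (fromℕ N) ℝ./ q³ᐟ²
       × K ℝ.* K ℝ.* (q′ ℝ.* q′) ℝ.* fromℕ ∣ 𝒮tc ∣ₛ ℝ.≃ fromℕ 4 ℝ.* fromℕ N)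
    )
    ×
    -- (3)
    ( (∀ a b → a ≢ b →
         q ℕ.∸ 3 ℕ.≤ ∣ pairs (S a) (S b) ∣ₚ
       × ∣ pairs (S a) (S b) ∣ₚ ℕ.≤ q ℕ.∸ 2)
    × (∀ K {{_ : ℝ.Positive K}} → IsK K →
         fromℕ 4 ℝ.* fromℕ N ℝ./ (K ℝ.* K ℝ.* (q′ ℝ.* q′)) ℝ.≤ fromℕ ∣ 𝒮tc ∣ₛ
       × fromℕ ∣ 𝒮tc ∣ₛ ℝ.≤ fromℕ C₁ ℝ.* K ℝ.* q′
       × (∀ T U → T ∈ 𝒮tc → U ∈ 𝒮tc → T ≢ U →
            K ℝ.* q′ ℝ./ (fromℕ 4 ℝ.* fromℕ C₁) ℝ.≤ fromℕ ∣ pairs T U ∣ₚ))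
    )
    ×
    -- (4)
    ( (∀ B → B ⊆ Ptc → σ Q₀ B 𝒮tc ≡ ℕ→ℚ (2 ℕ.* ∣ B ∣ₚ))
    × (∀ a b → a ≢ b →
         σ Q₀ (pairs (S a) (S b)) 𝒮tc ÷₀ Σtc Q.≤ ℕ→ℚ 6 ÷₀ ℕ→ℚ ((q ℕ.∸ 1) ℕ.^ 2))
    )
    ×
    -- (5)
    ( (Σ[ f ∈ 𝒟₃₀ ≅ system Q₀ Ptc 𝒮tc ]
         (∀ A → IsPointOf (value A) (value (Inverse.to (_≅_.points f) A)))
       × (∀ t → value (Inverse.to (_≅_.objects f) t) ≡ S t))
    × (∀ τ {{_ : ℝ.Positive τ}} → τ ℝ.≤ ℝ.1ℝ → fromℕ 96 ℝ./ τ ℝ.≤ q′ →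
       ∀ ε → ℝ.0ℝ ℝ.≤ ε → ε ℝ.≤ τ ℝ.* τ ℝ./ fromℕ 144 →
       ¬ CenteredBlockDecomposition Q₀ Ptc 𝒮tc τ ε)
    )
    ×
    -- every nondegenerate ternary form
    ( ∀ Q → Nondegenerate Q →
      ∃[ P ] ∃[ 𝒮 ] ∃[ r ]
        r ≢ 0#
      × (∀ T → T ∈ 𝒮 → radius T ≡ r)
      × system Q P 𝒮 ≅ system Q₀ Ptc 𝒮tc )
  )
  ×
  -- the limit in (2)
  ( ∀ ε → ℝ.0ℝ ℝ.< ε →
    ∃[ q₀ ] ∀ (q : ℕ) (F : FiniteField q) →
    let open FiniteField F
        open Geometry F
    in
    q₀ ℕ.≤ q → 5 ℕ.≤ q → ¬ HasCharacteristic 2 → ¬ HasCharacteristic 3 →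
    ∀ (R : Carrier) → R ≢ 0# →
    let open TwistedCubic F R in
    ∀ K → Geometry.IsDensity F (TwistedCubic.Q₀ F R) (TwistedCubic.Ptc F R) (TwistedCubic.𝒮tc F R) K → ℝ.∣ K ℝ.- √ (fromℚ ((+ 2) Q./ 3)) ∣ ℝ.< ε )
theorem4p14 = (λ q F 5≤q ¬2 ¬3 R R≢0 → let
      module M = Main F 5≤q ¬2 ¬3 R R≢0
      open FiniteField F using (order-nonZero)
    in
    ( M.radius-tc , M.lifts-distinct M.2≢0 , M.no-three-on-line M.2≢0 , M.no-coaxal )
  , ( M.N-value , M.point-of , M.degree≡3 , M.I-subset _ (λ _ h → h) , M.Σ≡2N , M.0<Σ , M.K.K-exists
    , λ K h → M.K.K-formula K h , M.K.K-square K h )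
  , ( M.pair-bounds , λ K {{0<K}} h → M.K.window-lower K h , M.K.window-upper K h , M.rich-pairs K h )
  , ( M.σ-subset , M.pair-ratio )
  , ( (M.isomorphism , (λ A → M.pointAt-correct (value A) (TwistedCubic.∈𝔗? F R (value A)) (M.relevant A)) , (λ _ → refl)) , M.no-decomposition )
  , M.every-form )
  , λ ε 0<ε → let δ , 0<δ , δ<ε = ℝ.eventually {ε} (ℝ.positive 0<ε) ; q₀ , small = threshold 0<δ in
      q₀ , λ q F q₀≤q 5≤q ¬2 ¬3 R R≢0 K isK → Main.K.near-√⅔ F 5≤q ¬2 ¬3 R R≢0 K isK ε {δ} 0<δ δ<ε (small q q₀≤q)
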